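{- Let $\Lambda$ be a composition of $n$, let $\lambda=\mathrm{sort}(\Lambda)$, and let $\mu$ be a partition of $n$. Then $\mathrm{F}_{\mu\Lambda}(q)\neq0$ if and only if $\lambda\trianglelefteq\mu'$. When $\lambda\trianglelefteq\mu'$: (1) $\mathrm{F}_{\mu\Lambda}(q)=\mathrm{F}_{\mu\lambda}(q)=(q-1)^{n-\ell(\mu)}q^{\binom{n}{2}-\mathsf{n}(\mu)-(n-\ell(\mu))}\,b_{\mu'\lambda}(1/q)$; (2) $\mathrm{F}_{\mu\lambda}(q)$ is a polynomial in $q$ with integer coefficients, of degree $\binom{n}{2}-\mathsf{n}(\mu)$, whose leading coefficient is the Kostka number $K_{\mu'\lambda}$; (3) there is a polynomial $\mathrm{R}_{\mu\lambda}(q)\in\mathbb{Z}[q]$ with $\mathrm{R}_{\mu\lambda}(0)=1$ and $\mathrm{R}_{\mu\lambda}(1)>0$ such that \[ \mathrm{F}_{\mu\lambda}(q)=(q-1)^{n-\ell(\mu)}q^{\binom{n}{2}-\binom{\ell(\mu)}{2}-\sum_{j\ge1}\mu'_j\mu'_{j+1}}\,\mathrm{R}_{\mu\lambda}(q). \]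
   Context: A composition $\Lambda=(\Lambda_1,\dots,\Lambda_s)$ of $n$ is a tuple of positive integers summing to $n$; $\mathrm{sort}(\Lambda)$ is the partition obtained by sorting its parts decreasingly. For a prime power $q$, $\mathfrak{u}_\Lambda(\mathbb{F}_q)$ is the nilradical of the standard parabolic subalgebra of $\mathfrak{gl}_n(\mathbb{F}_q)$ with diagonal blocks of sizes $\Lambda_1,\dots,\Lambda_s$ (block strictly upper triangular matrices: entries below or in the diagonal blocks are zero). $J_\mu$ is the nilpotent Jordan matrix with upper triangular Jordan blocks of sizes $\mu_1,\mu_2,\dots$, $\mathcal{C}_\mu$ its $\mathrm{GL}_n(\mathbb{F}_q)$-conjugacy class, $\mathrm{F}_{\mu\Lambda}(q)=|\mathcal{C}_\mu\cap\mathfrak{u}_\Lambda(\mathbb{F}_q)|$ (a partition is a special composition). $\mu'$ is the conjugate partition, $\ell(\mu)$ the number of parts, $\mathsf{n}(\mu)=\sum_i(i-1)\mu_i$, $\trianglelefteq$ the dominance order, $K_{\mu'\lambda}$ the number of semistandard Young tableaux of shape $\mu'$ and content $\lambda$. $[m]_q=(q^m-1)/(q-1)$, $[m]_q!=[1]_q\cdots[m]_q$, ${m\brack k}_q=[m]_q!/([k]_q![m-k]_q!)$. For partitions $\rho\subseteq\eta$ with $\eta/\rho$ a horizontal strip (no two boxes in the same column), $\theta_{\eta/\rho}(q)=\frac{[|\eta|-|\rho|]_q!}{[\eta_1-\rho_1]_q!}\prod_{i\ge1}{\rho_i-\rho_{i+1}\brack\eta_{i+1}-\rho_{i+1}}_q$.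 For partitions $\nu,\lambda$ of $n$ with $\ell(\lambda)=s$, $b_{\nu\lambda}(q)=\sum\prod_{j=1}^s\theta_{\nu^j/\nu^{j-1}}(q)$, the sum over all chains $\emptyset=\nu^0\subseteq\nu^1\subseteq\dots\subseteq\nu^s=\nu$ with each $\nu^j/\nu^{j-1}$ a horizontal strip of size $\lambda_j$ ($b_{\nu\lambda}=0$ if there is no such chain). Statements about $\mathrm{F}$ being a polynomial mean it agrees at all prime powers $q$ with that polynomial. -}

module Defs where

open import Level using (0ℓ)
open import Data.Bool.Base using (Bool; true; false; if_then_else_; _∧_; _∨_; not)
import Data.Nat.Base as ℕ
open import Data.Nat.Base using (ℕ; zero; suc; _∸_; _≤_; _<_; _≤ᵇ_; _<ᵇ_; _≡ᵇ_)
open import Data.Nat.Combinatorics using (_C_)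
open import Data.Fin.Base using (Fin; toℕ)
import Data.Fin.Base as Fin
import Data.Fin.Properties as FinP
open import Data.List.Base
  using (List; []; _∷_; [_]; map; foldr; length; upTo; allFin; concatMap; filterᵇ;
         zipWith; drop; take; concat; reverse)
open import Data.Nat.ListAction using (sum)
open import Data.Bool.ListAction using (all; any)
open import Data.List.Relation.Unary.All using (All)
open import Data.List.Relation.Unary.Linked using (Linked)
open import Data.Vec.Functional using (Vector) renaming (_∷_ to _∷ᶠ_)
open import Data.Product.Base using (Σ; _×_; _,_; proj₁; proj₂)
open import Function.Bundles using (_↔_; Inverse)
open import Relation.Binary.PropositionalEquality using (_≡_; _≢_)
open import Relation.Binary.Definitions using (DecidableEquality)
open import Relation.Nullary.Decidable.Core using (yes; no; isYes)
open import Algebra.Structures using (IsCommutativeRing)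
import Data.Integer.Base as ℤ
open import Data.Integer.Base using (ℤ)
import Data.Rational.Base as ℚ
open import Data.Rational.Base using (ℚ; 0ℚ; 1ℚ)
import Data.Rational.Properties as ℚP

-- Lists of naturals: indexing with default 0 (partitions padded by 0s)

_‼_ : List ℕ → ℕ → ℕ
[]       ‼ _     = 0
(x ∷ xs) ‼ zero  = x
(x ∷ xs) ‼ suc i = xs ‼ i

IsComposition : ℕ → List ℕ → Set
IsComposition n Λ = All (λ x → 0 < x) Λ × sum Λ ≡ n

IsPartition : ℕ → List ℕ → Set
IsPartition n μ = All (λ x → 0 < x) μ × Linked (λ x y → y ≤ x) μ × sum μ ≡ n

insertDesc : ℕ → List ℕ → List ℕ
insertDesc x []       = [ x ]
insertDesc x (y ∷ ys) = if y ≤ᵇ x then x ∷ y ∷ ys else y ∷ insertDesc x ys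

sortDesc : List ℕ → List ℕ
sortDesc = foldr insertDesc []

conj : List ℕ → List ℕ
conj μ = map (λ j → length (filterᵇ (λ m → suc j ≤ᵇ m) μ)) (upTo (μ ‼ 0))

-- dominance order  λ ⊴ ν  (for partitions of the same n)
_⊴_ : List ℕ → List ℕ → Set
la ⊴ nu = ∀ k → sum (take k la) ≤ sum (take k nu)

nstat : List ℕ → ℕ
nstat μ = sum (zipWith ℕ._*_ (upTo (length μ)) μ)

adjProdSum : List ℕ → ℕ
adjProdSum ν = sum (zipWith ℕ._*_ ν (drop 1 ν))

-- Kostka numbers: number of semistandard Young tableaux of shape ν
-- and content λ (entries 1..ℓ(λ)); a tableau is the list of its rows.

listsOfLen : ℕ → List ℕ → List (List ℕ)
listsOfLen zero    vs = [ [] ]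
listsOfLen (suc r) vs = concatMap (λ v → map (v ∷_) (listsOfLen r vs)) vs

fillings : List ℕ → ℕ → List (List (List ℕ))
fillings ν s = foldr (λ r acc → concatMap (λ row → map (row ∷_) acc)
                                   (listsOfLen r (map suc (upTo s))))
                     [ [] ] ν

weaklyIncr : List ℕ → Bool
weaklyIncr []           = true
weaklyIncr (x ∷ [])     = true
weaklyIncr (x ∷ y ∷ ys) = (x ≤ᵇ y) ∧ weaklyIncr (y ∷ ys)

colsStrict : List (List ℕ) → Bool
colsStrict T = all (λ p → rowBelow (proj₁ p) (proj₂ p)) (zipWith _,_ T (drop 1 T))
  where
    rowBelow : List ℕ → List ℕ → Bool
    rowBelow upper lower = all (λ j → (upper ‼ j) <ᵇ (lower ‼ j)) (upTo (length lower))

isSSYT : List ℕ → List (List ℕ) → Bool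
isSSYT la T = all weaklyIncr T ∧ colsStrict T
  ∧ all (λ k → length (filterᵇ (λ e → e ≡ᵇ suc k) (concat T)) ≡ᵇ (la ‼ k)) (upTo (length la))

kostka : List ℕ → List ℕ → ℕ
kostka ν la = length (filterᵇ (isSSYT la) (fillings ν (length la)))

-- total division on ℚ (only ever used with nonzero denominators)
divQ : ℚ → ℚ → ℚ
divQ p r with r ℚP.≟ 0ℚ
... | yes _  = 0ℚ
... | no r≢0 = ℚ._÷_ p r {{ℚ.≢-nonZero r≢0}}

powQ : ℚ → ℕ → ℚ
powQ t zero    = 1ℚ
powQ t (suc m) = t ℚ.* powQ t m

sumQ : List ℚ → ℚ
sumQ = foldr ℚ._+_ 0ℚ

prodQ : List ℚ → ℚ
prodQ = foldr ℚ._*_ 1ℚ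

qInt : ℚ → ℕ → ℚ
qInt t m = sumQ (map (powQ t) (upTo m))

qFact : ℚ → ℕ → ℚ
qFact t m = prodQ (map (λ i → qInt t (suc i)) (upTo m))

qBinom : ℚ → ℕ → ℕ → ℚ
qBinom t m k = if k ≤ᵇ m then divQ (qFact t m) (qFact t k ℚ.* qFact t (m ∸ k)) else 0ℚ

-- partitions are represented by lists padded with zeros to a fixed length
isDecr : List ℕ → Bool
isDecr []           = true
isDecr (x ∷ [])     = true
isDecr (x ∷ y ∷ ys) = (y ≤ᵇ x) ∧ isDecr (y ∷ ys)

subLists : List ℕ → List (List ℕ)
subLists []       = [ [] ]
subLists (x ∷ xs) = concatMap (λ r → map (r ∷_) (subLists xs)) (upTo (suc x))

isHorizontalStrip : List ℕ → List ℕ → Bool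
isHorizontalStrip η ρ =
  all (λ c → length (filterᵇ (λ i → ((ρ ‼ i) <ᵇ suc c) ∧ (suc c ≤ᵇ (η ‼ i)))
                             (upTo (length η))) ≤ᵇ 1)
      (upTo (η ‼ 0))

strips : List ℕ → ℕ → List (List ℕ)
strips η k = filterᵇ (λ ρ → isDecr ρ ∧ isHorizontalStrip η ρ ∧ ((sum η ∸ sum ρ) ≡ᵇ k))
                     (subLists η)

theta : ℚ → List ℕ → List ℕ → ℚ
theta t η ρ =
  divQ (qFact t (sum η ∸ sum ρ)) (qFact t ((η ‼ 0) ∸ (ρ ‼ 0)))
  ℚ.* prodQ (map (λ i → qBinom t ((ρ ‼ i) ∸ (ρ ‼ suc i)) ((η ‼ suc i) ∸ (ρ ‼ suc i)))
                 (upTo (length η)))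

-- sum over chains ∅ = ν⁰ ⊆ … ⊆ νʲ = η with strips of sizes given
-- (sizes listed from the top: λ_j, λ_{j-1}, …, λ_1)
bChain : ℚ → List ℕ → List ℕ → ℚ
bChain t η []       = if sum η ≡ᵇ 0 then 1ℚ else 0ℚ
bChain t η (k ∷ ks) = sumQ (map (λ ρ → theta t η ρ ℚ.* bChain t ρ ks) (strips η k))

bPoly : List ℕ → List ℕ → ℚ → ℚ
bPoly ν la t = bChain t ν (reverse la)

-- Finite fields (of order q = size; q ranges over all prime powers)

record FiniteField : Set₁ where
  field
    Carrier    : Set
    _+_ _*_    : Carrier → Carrier → Carrier
    -_         : Carrier → Carrier
    0# 1#      : Carrier
    isCommutativeRing : IsCommutativeRing _≡_ _+_ _*_ -_ 0# 1#
    0≢1        : 0# ≢ 1#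
    inverse    : ∀ x → x ≢ 0# → Σ Carrier (λ y → x * y ≡ 1#)
    decEq      : DecidableEquality Carrier
    size       : ℕ
    enum       : Fin size ↔ Carrier

module _ (F : FiniteField) where
  open FiniteField F

  Mat : ℕ → Set
  Mat n = Fin n → Fin n → Carrier

  elems : List Carrier
  elems = map (Inverse.to enum) (allFin size)

  allFuns : {A : Set} (m : ℕ) → List A → List (Vector A m)
  allFuns zero    xs = [ (λ ()) ]
  allFuns (suc m) xs = concatMap (λ a → map (a ∷ᶠ_) (allFuns m xs)) xs

  -- every n×n matrix over F exactly once
  allMats : (n : ℕ) → List (Mat n)
  allMats n = allFuns n (allFuns n elems)

  sumF : {n : ℕ} → (Fin n → Carrier) → Carrier
  sumF {zero}  f = 0#
  sumF {suc n} f = f Fin.zero + sumF (λ i → f (Fin.suc i))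

  _·_ : {n : ℕ} → Mat n → Mat n → Mat n
  (X · Y) i k = sumF (λ j → X i j * Y j k)

  idMat : {n : ℕ} → Mat n
  idMat i j = if isYes (i FinP.≟ j) then 1# else 0#

  eqᵇ : Carrier → Carrier → Bool
  eqᵇ x y = isYes (decEq x y)

  matEqᵇ : {n : ℕ} → Mat n → Mat n → Bool
  matEqᵇ {n} X Y = all (λ i → all (λ j → eqᵇ (X i j) (Y i j)) (allFin n)) (allFin n)

  blk : List ℕ → ℕ → ℕ
  blk []      i = 0
  blk (a ∷ Λ) i = if i <ᵇ a then 0 else suc (blk Λ (i ∸ a))

  jordan : (n : ℕ) → List ℕ → Mat n
  jordan n μ i j =
    if (toℕ j ≡ᵇ suc (toℕ i)) ∧ (blk μ (toℕ i) ≡ᵇ blk μ (toℕ j)) then 1# else 0#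

  inNilradical : {n : ℕ} → List ℕ → Mat n → Bool
  inNilradical {n} Λ X =
    all (λ i → all (λ j → not (blk Λ (toℕ j) ≤ᵇ blk Λ (toℕ i)) ∨ eqᵇ (X i j) 0#)
                   (allFin n)) (allFin n)

  conjugateᵇ : {n : ℕ} → Mat n → Mat n → Bool
  conjugateᵇ {n} X Y =
    any (λ g → any (λ h → matEqᵇ (g · h) idMat ∧ matEqᵇ (h · g) idMat
                           ∧ matEqᵇ X ((g · Y) · h))
                   (allMats n))
        (allMats n)

  Fcount : (n : ℕ) → List ℕ → List ℕ → ℕ
  Fcount n μ Λ =
    length (filterᵇ (λ X → inNilradical Λ X ∧ conjugateᵇ X (jordan n μ)) (allMats n))

evalZ : List ℤ → ℤ → ℤ
evalZ []       x = ℤ.0ℤ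
evalZ (c ∷ cs) x = c ℤ.+ x ℤ.* evalZ cs x

ℕtoℚ : ℕ → ℚ
ℕtoℚ m = ℚ._/_ (ℤ.+ m) 1

{-# OPTIONS --safe #-}

-- Write η for the conjugate of the Jordan type. By induction on the columns every strictly upper
-- triangular matrix has a Jordan form, so its conjugacy class is determined by the numbers |ker Xⁱ|.
-- A matrix in the nilradical of (Λ, k) has the form [[X, Y], [0, 0]] with X in the nilradical of Λ.
-- After bringing X to Jordan form, |ker| of the powers of this matrix depends only on the rows of Y at
-- the ends of the Jordan blocks, through the dimensions of the common kernels of the rows of the blocks
-- of size ≥ i. Adding these rows one at a time, the number of Y raising the type from ρ to η is computed:
-- η / ρ is a horizontal strip of size k, and the number is Wt η ρ, which is a power of q − 1 times a power
-- of q times a product of q-integers and Gaussian binomials. Hence the count is a sum over chains of strips.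
--
-- Reflection in the antidiagonal reverses Λ and preserves |ker Xⁱ|. Together with the recursion on the last
-- block this allows the last two blocks to be exchanged, so the count depends only on the sorted composition.
--
-- For (1), θ(1/q) is θ(q) up to a power of q. For (2), each chain contributes a monic polynomial of degree
-- Σ_{i<j} η_i η_j, and chains of strips are semistandard tableaux. For (3), the power of q in Wt η ρ exceeds the
-- expected one by Σ_j f_j (η_{j+1} − Σ_{i>j} f_i) with f = η − ρ. This is nonnegative and vanishes for exactly one
-- strip of each size k ≤ η₁, obtained by merging two rows; it preserves dominance when k is the least part.
module Submission where

-- Vectors and matrices are functions compared pointwise, so all counts run over finite setoids and
-- dimension is never defined. A subspace is measured by its cardinality; `card-∩` and `card-perp`
-- take the place of rank and duality. For the same reason the Jordan type is read from the sizes of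
-- kernels.
--
-- The polynomials in (2) and (3) have to serve all fields at once. Hence the weights are functions
-- of an integer variable x. Fields enter through x = q only, in `count≡B`; degrees, leading
-- coefficients and factors are then properties of `B x η ks` for every x, and (3) evaluates its
-- cofactor at x = 0 and x = 1. The symmetry in the parts is different: it comes from the matrices,
-- not from the weights, and is available at x = q only.
--
-- Blocks are removed from the end, so `ks` lists the parts backwards. For a composition sorted
-- decreasingly the part removed first is the least one. This order matters: the strip of least
-- excess keeps the remaining partition dominant only if its size does not exceed any remaining
-- part.

open import Defs using (FiniteField)

-- Sums over finite setoids.

module Counting where

  open import Defs
  open import Data.Nat.Base using (ℕ; zero; suc; _+_; _*_; _^_)
  import Data.Nat.Properties as ℕP
  open import Data.Bool.Base using (Bool; true; false)
  open import Data.Fin.Base as Fin using (Fin)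
  import Data.Fin.Properties as FinP
  open import Data.List.Base using (List; []; _∷_; map; concatMap; filterᵇ; length; _++_; allFin; tabulate)
  open import Data.List.Properties using (map-tabulate)
  open import Data.Product.Base using (∃; _×_; _,_)
  open import Data.Sum.Base using (_⊎_; inj₁; inj₂)
  open import Data.Empty using (⊥-elim)
  open import Data.Vec.Functional using (Vector; head; tail) renaming (_∷_ to _∷ᶠ_)
  open import Function.Base using (_∘_; id)
  open import Function.Bundles using (Inverse)
  open import Relation.Nullary using (Dec; yes; no; ¬_)
  open import Relation.Nullary.Decidable using (_×-dec_; ¬?)
  open import Relation.Binary.PropositionalEquality

  ∑ : {A : Set} → List A → (A → ℕ) → ℕ
  ∑ []       φ = 0
  ∑ (x ∷ xs) φ = φ x + ∑ xs φ

  χ : {P : Set} → Dec P → ℕ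
  χ (yes _) = 1
  χ (no _)  = 0

  𝟙 : Bool → ℕ
  𝟙 true  = 1
  𝟙 false = 0

  module _ {A : Set} where

    ∑-cong : (xs : List A) {φ ψ : A → ℕ} → (∀ x → φ x ≡ ψ x) → ∑ xs φ ≡ ∑ xs ψ
    ∑-cong []       h = refl
    ∑-cong (x ∷ xs) h = cong₂ _+_ (h x) (∑-cong xs h)

    ∑-0 : (xs : List A) → ∑ xs (λ _ → 0) ≡ 0
    ∑-0 []       = refl
    ∑-0 (x ∷ xs) = ∑-0 xs

    ∑-+ : (xs : List A) (φ ψ : A → ℕ) → ∑ xs (λ x → φ x + ψ x) ≡ ∑ xs φ + ∑ xs ψ
    ∑-+ []       φ ψ = refl
    ∑-+ (x ∷ xs) φ ψ = begin
      φ x + ψ x + ∑ xs (λ y → φ y + ψ y) ≡⟨ cong (φ x + ψ x +_) (∑-+ xs φ ψ) ⟩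
      φ x + ψ x + (∑ xs φ + ∑ xs ψ)      ≡⟨ ℕP.+-assoc (φ x) (ψ x) _ ⟩
      φ x + (ψ x + (∑ xs φ + ∑ xs ψ))    ≡⟨ cong (φ x +_) (sym (ℕP.+-assoc (ψ x) _ _)) ⟩
      φ x + (ψ x + ∑ xs φ + ∑ xs ψ)      ≡⟨ cong (λ t → φ x + (t + ∑ xs ψ)) (ℕP.+-comm (ψ x) _) ⟩
      φ x + (∑ xs φ + ψ x + ∑ xs ψ)      ≡⟨ cong (φ x +_) (ℕP.+-assoc (∑ xs φ) _ _) ⟩
      φ x + (∑ xs φ + (ψ x + ∑ xs ψ))    ≡⟨ sym (ℕP.+-assoc (φ x) _ _) ⟩
      φ x + ∑ xs φ + (ψ x + ∑ xs ψ)      ∎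
      where open ≡-Reasoning

    ∑-*ˡ : (xs : List A) (c : ℕ) (φ : A → ℕ) → ∑ xs (λ x → c * φ x) ≡ c * ∑ xs φ
    ∑-*ˡ []       c φ = sym (ℕP.*-zeroʳ c)
    ∑-*ˡ (x ∷ xs) c φ = trans (cong (c * φ x +_) (∑-*ˡ xs c φ)) (sym (ℕP.*-distribˡ-+ c (φ x) _))

    ∑-*ʳ : (xs : List A) (c : ℕ) (φ : A → ℕ) → ∑ xs (λ x → φ x * c) ≡ ∑ xs φ * c
    ∑-*ʳ xs c φ = trans (∑-cong xs (λ x → ℕP.*-comm (φ x) c)) (trans (∑-*ˡ xs c φ) (ℕP.*-comm c _))

    ∑-++ : (xs ys : List A) (φ : A → ℕ) → ∑ (xs ++ ys) φ ≡ ∑ xs φ + ∑ ys φ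
    ∑-++ []       ys φ = refl
    ∑-++ (x ∷ xs) ys φ = trans (cong (φ x +_) (∑-++ xs ys φ)) (sym (ℕP.+-assoc (φ x) _ _))

    ∑-const : (xs : List A) (c : ℕ) → ∑ xs (λ _ → c) ≡ length xs * c
    ∑-const []       c = refl
    ∑-const (x ∷ xs) c = cong (c +_) (∑-const xs c)

    length-filterᵇ : (p : A → Bool) (xs : List A) → length (filterᵇ p xs) ≡ ∑ xs (𝟙 ∘ p)
    length-filterᵇ p []       = refl
    length-filterᵇ p (x ∷ xs) with p x
    ... | true  = cong suc (length-filterᵇ p xs)
    ... | false = length-filterᵇ p xs

    ∑-filterᵇ : (p : A → Bool) (xs : List A) (φ : A → ℕ) → ∑ (filterᵇ p xs) φ ≡ ∑ xs (λ x → 𝟙 (p x) * φ x)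
    ∑-filterᵇ p []       φ = refl
    ∑-filterᵇ p (x ∷ xs) φ with p x
    ... | true  = cong₂ _+_ (sym (ℕP.+-identityʳ (φ x))) (∑-filterᵇ p xs φ)
    ... | false = ∑-filterᵇ p xs φ

  module _ {A B : Set} where

    ∑-map : (g : A → B) (xs : List A) (φ : B → ℕ) → ∑ (map g xs) φ ≡ ∑ xs (φ ∘ g)
    ∑-map g []       φ = refl
    ∑-map g (x ∷ xs) φ = cong (φ (g x) +_) (∑-map g xs φ)

    ∑-concatMap : (g : A → List B) (xs : List A) (φ : B → ℕ) →
                  ∑ (concatMap g xs) φ ≡ ∑ xs (λ x → ∑ (g x) φ)
    ∑-concatMap g []       φ = refl
    ∑-concatMap g (x ∷ xs) φ = trans (∑-++ (g x) _ φ) (cong (∑ (g x) φ +_) (∑-concatMap g xs φ))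

    ∑-swap : (xs : List A) (ys : List B) (φ : A → B → ℕ) →
             ∑ xs (λ x → ∑ ys (φ x)) ≡ ∑ ys (λ y → ∑ xs (λ x → φ x y))
    ∑-swap []       ys φ = sym (∑-0 ys)
    ∑-swap (x ∷ xs) ys φ = trans (cong (∑ ys (φ x) +_) (∑-swap xs ys φ)) (sym (∑-+ ys (φ x) _))

  χ-yes : {P : Set} (d : Dec P) → P → χ d ≡ 1
  χ-yes (yes _) p = refl
  χ-yes (no ¬p) p = ⊥-elim (¬p p)

  χ-no : {P : Set} (d : Dec P) → ¬ P → χ d ≡ 0
  χ-no (yes p) ¬p = ⊥-elim (¬p p)
  χ-no (no _)  ¬p = refl

  χ-cong : {P Q : Set} (d : Dec P) (e : Dec Q) → (P → Q) → (Q → P) → χ d ≡ χ e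
  χ-cong (yes p) e f g = sym (χ-yes e (f p))
  χ-cong (no ¬p) e f g = sym (χ-no e (¬p ∘ g))

  χ-× : {P Q : Set} (d : Dec P) (e : Dec Q) → χ (d ×-dec e) ≡ χ d * χ e
  χ-× (yes p) (yes q) = refl
  χ-× (yes p) (no q)  = refl
  χ-× (no p)  (yes q) = refl
  χ-× (no p)  (no q)  = refl

  χ-¬ : {P : Set} (d : Dec P) → χ d + χ (¬? d) ≡ 1
  χ-¬ (yes _) = refl
  χ-¬ (no _)  = refl

  -- A finite type up to an equivalence, with an enumeration hitting each class exactly once.
  record FinSetoid : Set₁ where
    field
      Carrier  : Set
      _≈_      : Carrier → Carrier → Set
      ≈-refl   : ∀ {x} → x ≈ x
      ≈-sym    : ∀ {x y} → x ≈ y → y ≈ x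
      ≈-trans  : ∀ {x y z} → x ≈ y → y ≈ z → x ≈ z
      _≈?_     : ∀ x y → Dec (x ≈ y)
      elements : List Carrier
      once     : ∀ y → ∑ elements (λ x → χ (x ≈? y)) ≡ 1

  open FinSetoid using (Carrier; elements)

  ∑[_] : (A : FinSetoid) → (Carrier A → ℕ) → ℕ
  ∑[ A ] φ = ∑ (elements A) φ

  ∣_∣ : FinSetoid → ℕ
  ∣ A ∣ = length (elements A)

  private
    χ-*-cong : {P : Set} (d : Dec P) {m n : ℕ} → (P → m ≡ n) → χ d * m ≡ χ d * n
    χ-*-cong (yes p) h = cong (1 *_) (h p)
    χ-*-cong (no _)  h = refl

  module _ (A : FinSetoid) where
    open FinSetoid A hiding (Carrier; elements)

    ∑-select : (φ : Carrier A → ℕ) → (∀ {x y} → x ≈ y → φ x ≡ φ y) → ∀ y →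
               ∑[ A ] (λ x → χ (x ≈? y) * φ x) ≡ φ y
    ∑-select φ φ-cong y = begin
      ∑[ A ] (λ x → χ (x ≈? y) * φ x) ≡⟨ ∑-cong (elements A) (λ x → χ-*-cong (x ≈? y) φ-cong) ⟩
      ∑[ A ] (λ x → χ (x ≈? y) * φ y) ≡⟨ ∑-*ʳ (elements A) (φ y) _ ⟩
      ∑[ A ] (λ x → χ (x ≈? y)) * φ y ≡⟨ cong (_* φ y) (once y) ⟩
      1 * φ y                         ≡⟨ ℕP.*-identityˡ _ ⟩
      φ y                             ∎
      where open ≡-Reasoning

    module _ {P : Carrier A → Set} (P? : ∀ x → Dec (P x)) (P-cong : ∀ {x y} → x ≈ y → P x → P y) where

      private
        scan : (xs : List (Carrier A)) →
               ∃ P ⊎ (∀ y → ∑ xs (λ x → χ (x ≈? y)) ≢ 0 → ¬ P y)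
        scan []       = inj₂ (λ y h _ → h refl)
        scan (x ∷ xs) with P? x | scan xs
        ... | yes p | _       = inj₁ (x , p)
        ... | no _  | inj₁ e  = inj₁ e
        ... | no ¬p | inj₂ h  = inj₂ λ y ne py → h y (λ z → ne (cong₂ _+_ (χ-no (x ≈? y) (λ e → ¬p (P-cong (≈-sym e) py))) z)) py

      -- Running through the enumeration decides an invariant predicate, because `once` guarantees
      -- that every element is met up to ≈.
      search : ∃ P ⊎ (∀ x → ¬ P x)
      search with scan (elements A)
      ... | inj₁ e = inj₁ e
      ... | inj₂ h = inj₂ (λ y → h y (λ z → ℕP.1+n≢0 (trans (sym (once y)) z)))

  -- φ ∘ f and φ have the same total if f is injective up to ≈ (with retraction r)
  -- and φ vanishes off the image of f.
  module _ (A B : FinSetoid) where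
    private
      module A = FinSetoid A
      module B = FinSetoid B

    ∑-reindex : (f : A.Carrier → B.Carrier) (r : B.Carrier → A.Carrier) (φ : B.Carrier → ℕ) →
                (∀ {x y} → x A.≈ y → f x B.≈ f y) → (∀ {x y} → x B.≈ y → r x A.≈ r y) →
                (∀ a → r (f a) A.≈ a) → (∀ b → φ b ≡ 0 ⊎ f (r b) B.≈ b) →
                (∀ {x y} → x B.≈ y → φ x ≡ φ y) →
                ∑[ A ] (φ ∘ f) ≡ ∑[ B ] φ
    ∑-reindex f r φ f-cong r-cong rf fr φ-cong = begin
      ∑[ A ] (φ ∘ f)
        -- Each φ (f a) is spread over B by the delta function at f a. After the sums are exchanged,
        -- the fibre over b is the class of r b, unless φ b = 0.
        ≡⟨ ∑-cong A.elements (λ a → sym (∑-select B φ φ-cong (f a))) ⟩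
      ∑[ A ] (λ a → ∑[ B ] (λ b → χ (b B.≈? f a) * φ b))
        ≡⟨ ∑-swap A.elements B.elements _ ⟩
      ∑[ B ] (λ b → ∑[ A ] (λ a → χ (b B.≈? f a) * φ b))
        ≡⟨ ∑-cong B.elements fibre ⟩
      ∑[ B ] φ ∎
      where
      open ≡-Reasoning
      fibre : ∀ b → ∑[ A ] (λ a → χ (b B.≈? f a) * φ b) ≡ φ b
      fibre b with fr b
      ... | inj₁ z = trans (∑-cong A.elements (λ a → trans (cong (χ (b B.≈? f a) *_) z) (ℕP.*-zeroʳ (χ (b B.≈? f a)))))
                       (trans (∑-0 A.elements) (sym z))
      ... | inj₂ e = begin
        ∑[ A ] (λ a → χ (b B.≈? f a) * φ b) ≡⟨ ∑-*ʳ A.elements (φ b) _ ⟩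
        ∑[ A ] (λ a → χ (b B.≈? f a)) * φ b ≡⟨ cong (_* φ b) (∑-cong A.elements (λ a → χ-cong (b B.≈? f a) (a A.≈? r b)
              (λ b≈fa → A.≈-sym (A.≈-trans (r-cong b≈fa) (rf a)))
              (λ a≈rb → B.≈-sym (B.≈-trans (f-cong a≈rb) e)))) ⟩
        ∑[ A ] (λ a → χ (a A.≈? r b)) * φ b ≡⟨ cong (_* φ b) (A.once (r b)) ⟩
        1 * φ b                             ≡⟨ ℕP.*-identityˡ _ ⟩
        φ b                                 ∎

  _⊗_ : FinSetoid → FinSetoid → FinSetoid
  A ⊗ B = record
    { Carrier  = A.Carrier × B.Carrier
    ; _≈_      = λ (a , b) (a′ , b′) → a A.≈ a′ × b B.≈ b′
    ; ≈-refl   = A.≈-refl , B.≈-refl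
    ; ≈-sym    = λ (p , q) → A.≈-sym p , B.≈-sym q
    ; ≈-trans  = λ (p , q) (p′ , q′) → A.≈-trans p p′ , B.≈-trans q q′
    ; _≈?_     = λ (a , b) (a′ , b′) → (a A.≈? a′) ×-dec (b B.≈? b′)
    ; elements = concatMap (λ a → map (a ,_) B.elements) A.elements
    ; once     = λ (a , b) → begin
        ∑ (concatMap (λ x → map (x ,_) B.elements) A.elements) (λ (x , y) → χ ((x A.≈? a) ×-dec (y B.≈? b)))
          ≡⟨ ∑-concatMap _ A.elements _ ⟩
        ∑ A.elements (λ x → ∑ (map (x ,_) B.elements) (λ (x , y) → χ ((x A.≈? a) ×-dec (y B.≈? b))))
          ≡⟨ ∑-cong A.elements (λ x → ∑-map (x ,_) B.elements _) ⟩
        ∑ A.elements (λ x → ∑ B.elements (λ y → χ ((x A.≈? a) ×-dec (y B.≈? b))))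
          ≡⟨ ∑-cong A.elements (λ x → trans (∑-cong B.elements (λ y → χ-× (x A.≈? a) (y B.≈? b)))
               (trans (∑-*ˡ B.elements (χ (x A.≈? a)) _)
               (trans (cong (χ (x A.≈? a) *_) (B.once b)) (ℕP.*-identityʳ _)))) ⟩
        ∑ A.elements (λ x → χ (x A.≈? a)) ≡⟨ A.once a ⟩
        1 ∎
    }
    where
    module A = FinSetoid A
    module B = FinSetoid B
    open ≡-Reasoning

  ∑-⊗ : (A B : FinSetoid) (φ : Carrier A × Carrier B → ℕ) →
        ∑[ A ⊗ B ] φ ≡ ∑[ A ] (λ a → ∑[ B ] (λ b → φ (a , b)))
  ∑-⊗ A B φ = trans (∑-concatMap _ (elements A) φ) (∑-cong (elements A) (λ a → ∑-map (a ,_) (elements B) φ))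

  ∑-allFin-once : ∀ {n} (j : Fin n) → ∑ (allFin n) (λ i → χ (i FinP.≟ j)) ≡ 1
  ∑-allFin-once {suc n} j = go j
    where
    open ≡-Reasoning
    shift : (φ : Fin (suc n) → ℕ) → ∑ (tabulate Fin.suc) φ ≡ ∑ (allFin n) (φ ∘ Fin.suc)
    shift φ = trans (cong (λ l → ∑ l φ) (sym (map-tabulate id Fin.suc))) (∑-map Fin.suc (allFin n) φ)
    go : ∀ j → ∑ (allFin (suc n)) (λ i → χ (i FinP.≟ j)) ≡ 1
    go Fin.zero = cong suc (trans (shift _) (∑-0 (allFin n)))
    go (Fin.suc j) = trans (shift _) (trans
      (∑-cong (allFin n) (λ i → χ-cong (Fin.suc i FinP.≟ Fin.suc j) (i FinP.≟ j) FinP.suc-injective (cong Fin.suc)))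
      (∑-allFin-once j))

  module _ (F : FiniteField) where
    open FiniteField F using (size; enum; decEq)

    𝔽 : FinSetoid
    𝔽 = record
      { Carrier = FiniteField.Carrier F ; _≈_ = _≡_ ; ≈-refl = refl ; ≈-sym = sym ; ≈-trans = trans
      ; _≈?_ = decEq ; elements = elems F
      ; once = λ y → trans (∑-map (Inverse.to enum) (allFin size) _)
          (trans (∑-cong (allFin size) (λ i → χ-cong (decEq (Inverse.to enum i) y) (i FinP.≟ Inverse.from enum y)
              (λ e → sym (Inverse.inverseʳ enum (sym e)))
              (λ e → Inverse.inverseˡ enum e)))
            (∑-allFin-once (Inverse.from enum y)))
      }

    ∣𝔽∣ : ∣ 𝔽 ∣ ≡ size
    ∣𝔽∣ = trans (length-map (Inverse.to enum) (allFin size)) (length-tabulate {n = size} id)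
      where open import Data.List.Properties using (length-map; length-tabulate)

    ∑-allFuns : {A : Set} (m : ℕ) (xs : List A) (φ : Vector A (suc m) → ℕ) →
                ∑ (allFuns F (suc m) xs) φ ≡ ∑ xs (λ a → ∑ (allFuns F m xs) (λ v → φ (a ∷ᶠ v)))
    ∑-allFuns m xs φ = trans (∑-concatMap _ xs φ) (∑-cong xs (λ a → ∑-map (a ∷ᶠ_) (allFuns F m xs) φ))

    -- The elements are listed by `allFuns`, so that iterating the construction gives literally the
    -- list `allMats` over which the statement counts.
    Fun : ℕ → FinSetoid → FinSetoid
    Fun m A = record
      { Carrier  = Vector A.Carrier m
      ; _≈_      = λ u v → ∀ i → u i A.≈ v i
      ; ≈-refl   = λ i → A.≈-refl
      ; ≈-sym    = λ p i → A.≈-sym (p i)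
      ; ≈-trans  = λ p q i → A.≈-trans (p i) (q i)
      ; _≈?_     = λ u v → FinP.all? (λ i → u i A.≈? v i)
      ; elements = allFuns F m A.elements
      ; once     = go m
      }
      where
      module A = FinSetoid A
      open ≡-Reasoning
      go : ∀ m (w : Vector A.Carrier m) →
           ∑ (allFuns F m A.elements) (λ v → χ (FinP.all? (λ i → v i A.≈? w i))) ≡ 1
      go zero    w = count (allFuns F 0 A.elements)
        where
        count : ∀ vs → ∑ vs (λ v → χ (FinP.all? {n = 0} (λ i → v i A.≈? w i))) ≡ length vs
        count []       = refl
        count (v ∷ vs) = cong₂ _+_ (χ-yes (FinP.all? {n = 0} (λ i → v i A.≈? w i)) (λ ())) (count vs)
      go (suc m) w = begin
        ∑ (allFuns F (suc m) A.elements) (λ v → χ (FinP.all? (λ i → v i A.≈? w i)))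
          ≡⟨ ∑-allFuns m A.elements _ ⟩
        ∑ A.elements (λ a → ∑ (allFuns F m A.elements) (λ v → χ (FinP.all? (λ i → (a ∷ᶠ v) i A.≈? w i))))
          ≡⟨ ∑-cong A.elements (λ a → ∑-cong (allFuns F m A.elements) (λ v → trans
               (χ-cong (FinP.all? (λ i → (a ∷ᶠ v) i A.≈? w i)) ((a A.≈? head w) ×-dec FinP.all? (λ i → v i A.≈? tail w i))
                 (λ p → p Fin.zero , λ i → p (Fin.suc i))
                 (λ { (p , q) Fin.zero → p ; (p , q) (Fin.suc i) → q i }))
               (χ-× (a A.≈? head w) (FinP.all? (λ i → v i A.≈? tail w i))))) ⟩
        ∑ A.elements (λ a → ∑ (allFuns F m A.elements) (λ v → χ (a A.≈? head w) * χ (FinP.all? (λ i → v i A.≈? tail w i))))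
          ≡⟨ ∑-cong A.elements (λ a → trans (∑-*ˡ (allFuns F m A.elements) (χ (a A.≈? head w)) _)
               (trans (cong (χ (a A.≈? head w) *_) (go m (tail w))) (ℕP.*-identityʳ _))) ⟩
        ∑ A.elements (λ a → χ (a A.≈? head w)) ≡⟨ A.once (head w) ⟩
        1 ∎

    ∣Fun∣ : ∀ m A → ∣ Fun m A ∣ ≡ ∣ A ∣ ^ m
    ∣Fun∣ m A = trans (one m) (go m)
      where
      one : ∀ m → length (allFuns F m (elements A)) ≡ ∑ (allFuns F m (elements A)) (λ _ → 1)
      one m = sym (trans (∑-const (allFuns F m (elements A)) 1) (ℕP.*-identityʳ _))
      go : ∀ m → ∑ (allFuns F m (elements A)) (λ _ → 1) ≡ ∣ A ∣ ^ m
      go zero    = refl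
      go (suc m) = trans (∑-allFuns m (elements A) (λ _ → 1))
        (trans (∑-const (elements A) _) (cong (∣ A ∣ *_) (go m)))

  -- An injective self-map of a finite set is onto: the fibres of f have at most one class and their
  -- sizes add up to the size of A, so no fibre is empty.
  section⇒retraction : (A : FinSetoid) (f r : Carrier A → Carrier A) →
    (∀ {x y} → FinSetoid._≈_ A x y → FinSetoid._≈_ A (f x) (f y)) →
    (∀ {x y} → FinSetoid._≈_ A x y → FinSetoid._≈_ A (r x) (r y)) →
    (∀ a → FinSetoid._≈_ A (r (f a)) a) → ∀ b → FinSetoid._≈_ A (f (r b)) b
  section⇒retraction A f r f-cong r-cong rf b
    with search A (λ b → ¬? (f (r b) A.≈? b))
           (λ x≈y ne e → ne (A.≈-trans (f-cong (r-cong x≈y)) (A.≈-trans e (A.≈-sym x≈y))))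
    where module A = FinSetoid A
  ... | inj₂ h = decidable-stable (FinSetoid._≈?_ A (f (r b)) b) (h b)
    where open import Relation.Nullary.Decidable using (decidable-stable)
  ... | inj₁ (b₀ , ne) = ⊥-elim (ℕP.1+n≢0 (trans (sym bad₀) bad-none))
    where
    module A = FinSetoid A
    open ≡-Reasoning
    good bad : A.Carrier → ℕ
    good b = χ (f (r b) A.≈? b)
    bad  b = χ (¬? (f (r b) A.≈? b))
    image : ∀ b → ∑[ A ] (λ a → χ (b A.≈? f a)) ≡ good b
    image b with f (r b) A.≈? b
    ... | yes e = trans (∑-cong A.elements (λ a → χ-cong (b A.≈? f a) (a A.≈? r b)
                    (λ p → A.≈-sym (A.≈-trans (r-cong p) (rf a)))
                    (λ p → A.≈-sym (A.≈-trans (f-cong p) e)))) (A.once (r b))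
    ... | no ne = trans (∑-cong A.elements (λ a → χ-no (b A.≈? f a)
                    (λ p → ne (A.≈-trans (f-cong (A.≈-trans (r-cong p) (rf a))) (A.≈-sym p))))) (∑-0 A.elements)
    all-good : ∑[ A ] good ≡ ∑[ A ] (λ _ → 1)
    all-good = begin
      ∑[ A ] good                                       ≡⟨ ∑-cong A.elements (λ b → sym (image b)) ⟩
      ∑[ A ] (λ b → ∑[ A ] (λ a → χ (b A.≈? f a)))      ≡⟨ ∑-swap A.elements A.elements _ ⟩
      ∑[ A ] (λ a → ∑[ A ] (λ b → χ (b A.≈? f a)))      ≡⟨ ∑-cong A.elements (λ a → A.once (f a)) ⟩
      ∑[ A ] (λ _ → 1)                                  ∎
    none-bad : ∑[ A ] bad ≡ 0
    none-bad = ℕP.+-cancelˡ-≡ (∑[ A ] good) _ _ (begin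
      ∑[ A ] good + ∑[ A ] bad       ≡⟨ sym (∑-+ A.elements good bad) ⟩
      ∑[ A ] (λ b → good b + bad b)  ≡⟨ ∑-cong A.elements (λ b → χ-¬ (f (r b) A.≈? b)) ⟩
      ∑[ A ] (λ _ → 1)               ≡⟨ sym all-good ⟩
      ∑[ A ] good                    ≡⟨ sym (ℕP.+-identityʳ _) ⟩
      ∑[ A ] good + 0                ∎)
    bad-none : ∑[ A ] (λ b → χ (b A.≈? b₀) * bad b) ≡ 0
    bad-none = ∑≡0 A.elements none-bad
      where
      ∑≡0 : ∀ xs → ∑ xs bad ≡ 0 → ∑ xs (λ b → χ (b A.≈? b₀) * bad b) ≡ 0
      ∑≡0 []       _ = refl
      ∑≡0 (x ∷ xs) h = cong₂ _+_
        (trans (cong (χ (x A.≈? b₀) *_) (ℕP.m+n≡0⇒m≡0 (bad x) h)) (ℕP.*-zeroʳ (χ (x A.≈? b₀))))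
        (∑≡0 xs (ℕP.m+n≡0⇒n≡0 (bad x) h))
    bad₀ : ∑[ A ] (λ b → χ (b A.≈? b₀) * bad b) ≡ 1
    bad₀ = trans (∑-select A bad (λ {x} {y} x≈y → χ-cong (¬? (f (r x) A.≈? x)) (¬? (f (r y) A.≈? y))
        (λ ne e → ne (A.≈-trans (f-cong (r-cong x≈y)) (A.≈-trans e (A.≈-sym x≈y))))
        (λ ne e → ne (A.≈-trans (f-cong (r-cong (A.≈-sym x≈y))) (A.≈-trans e x≈y)))) b₀)
      (χ-yes (¬? (f (r b₀) A.≈? b₀)) ne)

-- Linear algebra over a finite field by counting.

module LinearAlgebra (F : FiniteField) where

  open import Defs hiding (FiniteField)
  open Counting
  open import Algebra.Bundles using (CommutativeRing)
  import Algebra.Properties.Ring as RingP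
  open import Data.Nat.Base as ℕ using (ℕ; zero; suc; _^_)
  import Data.Nat.Properties as ℕP
  open import Data.Nat.Tactic.RingSolver using (solve-∀)
  open import Data.Fin.Base as Fin using (Fin)
  import Data.Fin.Properties as FinP
  open import Data.Maybe.Base using (nothing)
  open import Data.Product.Base using (∃; _×_; _,_; proj₁; proj₂)
  open import Data.Sum.Base using (_⊎_; inj₁; inj₂)
  open import Data.Empty using (⊥-elim)
  open import Data.Vec.Functional using (Vector) renaming (_∷_ to _∷ᶠ_)
  open import Function.Base using (_∘_)
  open import Function.Bundles using (Inverse)
  open import Relation.Nullary using (Dec; yes; no)
  open import Relation.Nullary.Decidable using (_×-dec_; ¬?; decidable-stable)
  open import Relation.Binary.PropositionalEquality hiding (resp)
  import Tactic.RingSolver.NonReflective as NR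
  open import Tactic.RingSolver.Core.AlmostCommutativeRing using (fromCommutativeRing)

  open FiniteField F public
    using (0#; 1#; 0≢1; inverse; decEq; size; isCommutativeRing)
    renaming (Carrier to K; _+_ to infixl 6 _+ᶠ_; _*_ to infixl 7 _*ᶠ_; -_ to infix 8 -ᶠ_)

  𝕂 : CommutativeRing _ _
  𝕂 = record { isCommutativeRing = isCommutativeRing }

  module 𝕂 = CommutativeRing 𝕂
  module 𝕂P = RingP 𝕂.ring
  module 𝕂S = NR (fromCommutativeRing 𝕂 (λ _ → nothing))

  V : ℕ → Set
  V n = Fin n → K

  𝕍 : ℕ → FinSetoid
  𝕍 n = Fun F n (𝔽 F)

  ∣𝕍∣ : ∀ n → ∑[ 𝕍 n ] (λ _ → 1) ≡ size ^ n
  ∣𝕍∣ n = trans (∑-const (FinSetoid.elements (𝕍 n)) 1) (trans (ℕP.*-identityʳ _)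
    (trans (∣Fun∣ F n (𝔽 F)) (cong (_^ n) (∣𝔽∣ F))))

  infix 4 _≐_
  _≐_ : ∀ {n} → V n → V n → Set
  u ≐ v = ∀ i → u i ≡ v i

  infixl 6 _+ᵥ_
  _+ᵥ_ : ∀ {n} → V n → V n → V n
  (u +ᵥ v) i = u i +ᶠ v i

  infixl 7 _*ᵥ_
  _*ᵥ_ : ∀ {n} → K → V n → V n
  (c *ᵥ v) i = c *ᶠ v i

  0ᵥ : ∀ {n} → V n
  0ᵥ _ = 0#

  δ : ∀ {n} → Fin n → V n
  δ = idMat F

  Σᶠ : ∀ {n} → V n → K
  Σᶠ = sumF F

  Σᶠ-cong : ∀ {n} {u v : V n} → u ≐ v → Σᶠ u ≡ Σᶠ v
  Σᶠ-cong {zero}  h = refl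
  Σᶠ-cong {suc n} h = cong₂ _+ᶠ_ (h Fin.zero) (Σᶠ-cong (h ∘ Fin.suc))

  Σᶠ-0 : ∀ n → Σᶠ {n} 0ᵥ ≡ 0#
  Σᶠ-0 zero    = refl
  Σᶠ-0 (suc n) = trans (𝕂.+-identityˡ _) (Σᶠ-0 n)

  +ᶠ-interchange : ∀ a b c d → (a +ᶠ b) +ᶠ (c +ᶠ d) ≡ (a +ᶠ c) +ᶠ (b +ᶠ d)
  +ᶠ-interchange = 𝕂S.solve 4 (λ a b c d → ((a ⊕ b) ⊕ (c ⊕ d)) ⊜ ((a ⊕ c) ⊕ (b ⊕ d))) refl
    where open 𝕂S using (_⊕_; _⊜_)

  Σᶠ-+ : ∀ {n} (u v : V n) → Σᶠ (u +ᵥ v) ≡ Σᶠ u +ᶠ Σᶠ v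
  Σᶠ-+ {zero}  u v = sym (𝕂.+-identityˡ _)
  Σᶠ-+ {suc n} u v = trans (cong (u Fin.zero +ᶠ v Fin.zero +ᶠ_) (Σᶠ-+ {n} (u ∘ Fin.suc) (v ∘ Fin.suc))) (+ᶠ-interchange _ _ _ _)

  Σᶠ-*ˡ : ∀ {n} c (v : V n) → Σᶠ (c *ᵥ v) ≡ c *ᶠ Σᶠ v
  Σᶠ-*ˡ {zero}  c v = sym (𝕂.zeroʳ c)
  Σᶠ-*ˡ {suc n} c v = trans (cong (c *ᶠ v Fin.zero +ᶠ_) (Σᶠ-*ˡ {n} c (v ∘ Fin.suc))) (sym (𝕂.distribˡ c _ _))

  Σᶠ-swap : ∀ {m n} (f : Fin m → Fin n → K) → Σᶠ (λ i → Σᶠ (f i)) ≡ Σᶠ (λ j → Σᶠ (λ i → f i j))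
  Σᶠ-swap {zero}  {n} f = sym (Σᶠ-0 n)
  Σᶠ-swap {suc m} {n} f = trans (cong (Σᶠ (f Fin.zero) +ᶠ_) (Σᶠ-swap (f ∘ Fin.suc)))
    (sym (Σᶠ-+ (f Fin.zero) _))

  δ-suc : ∀ {n} (i j : Fin n) → δ (Fin.suc i) (Fin.suc j) ≡ δ i j
  δ-suc i j with i FinP.≟ j
  ... | yes _ = refl
  ... | no _  = refl

  dot : ∀ {n} → V n → V n → K
  dot u v = Σᶠ (λ j → u j *ᶠ v j)

  dot-cong : ∀ {n} {u u′ v v′ : V n} → u ≐ u′ → v ≐ v′ → dot u v ≡ dot u′ v′
  dot-cong p q = Σᶠ-cong (λ i → cong₂ _*ᶠ_ (p i) (q i))

  dot-comm : ∀ {n} (u v : V n) → dot u v ≡ dot v u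
  dot-comm u v = Σᶠ-cong (λ i → 𝕂.*-comm (u i) (v i))

  dot-+ʳ : ∀ {n} (u v w : V n) → dot u (v +ᵥ w) ≡ dot u v +ᶠ dot u w
  dot-+ʳ {n} u v w = trans (Σᶠ-cong (λ i → 𝕂.distribˡ (u i) (v i) (w i))) (Σᶠ-+ {n} _ _)

  dot-*ʳ : ∀ {n} (u : V n) c (v : V n) → dot u (c *ᵥ v) ≡ c *ᶠ dot u v
  dot-*ʳ {n} u c v = trans (Σᶠ-cong (λ i → x∙yz≈y∙xz (u i) c (v i))) (Σᶠ-*ˡ {n} c _)
    where open import Algebra.Properties.CommutativeSemigroup 𝕂.*-commutativeSemigroup using (x∙yz≈y∙xz)

  dot-0ˡ : ∀ {n} (v : V n) → dot 0ᵥ v ≡ 0#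
  dot-0ˡ {n} v = trans (Σᶠ-cong (λ i → 𝕂.zeroˡ (v i))) (Σᶠ-0 n)

  dot-0ʳ : ∀ {n} (v : V n) → dot v 0ᵥ ≡ 0#
  dot-0ʳ v = trans (dot-comm v 0ᵥ) (dot-0ˡ v)

  dot-δˡ : ∀ {n} (i : Fin n) (v : V n) → dot (δ i) v ≡ v i
  dot-δˡ Fin.zero v = trans (cong₂ _+ᶠ_ (𝕂.*-identityˡ _) (dot-0ˡ (v ∘ Fin.suc))) (𝕂.+-identityʳ _)
  dot-δˡ (Fin.suc i) v = trans (cong₂ _+ᶠ_ (𝕂.zeroˡ _)
    (trans (dot-cong (δ-suc i) (λ _ → refl)) (dot-δˡ i (v ∘ Fin.suc)))) (𝕂.+-identityˡ _)

  δ-sym : ∀ {n} (i j : Fin n) → δ i j ≡ δ j i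
  δ-sym i j with i FinP.≟ j | j FinP.≟ i
  ... | yes _ | yes _ = refl
  ... | no _  | no _  = refl
  ... | yes p | no n  = ⊥-elim (n (sym p))
  ... | no n  | yes p = ⊥-elim (n (sym p))

  infixr 6 _▷_
  _▷_ : ∀ {m n} → Vector (V n) m → V n → V m
  (X ▷ v) i = dot (X i) v

  ▷-cong : ∀ {m n} {X Y : Vector (V n) m} {u v : V n} → (∀ i → X i ≐ Y i) → u ≐ v → X ▷ u ≐ Y ▷ v
  ▷-cong p q i = dot-cong (p i) q

  ▷-congʳ : ∀ {m n} (X : Vector (V n) m) {u v : V n} → u ≐ v → X ▷ u ≐ X ▷ v
  ▷-congʳ X = ▷-cong (λ _ _ → refl)

  ▷-+ : ∀ {m n} (X : Vector (V n) m) u v → X ▷ (u +ᵥ v) ≐ (X ▷ u) +ᵥ (X ▷ v)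
  ▷-+ X u v i = dot-+ʳ (X i) u v

  ▷-* : ∀ {m n} (X : Vector (V n) m) c v → X ▷ (c *ᵥ v) ≐ c *ᵥ (X ▷ v)
  ▷-* X c v i = dot-*ʳ (X i) c v

  ▷-0 : ∀ {m n} (X : Vector (V n) m) → X ▷ 0ᵥ ≐ 0ᵥ
  ▷-0 X i = dot-0ʳ (X i)

  id▷ : ∀ {n} (v : V n) → idMat F ▷ v ≐ v
  id▷ v i = dot-δˡ i v

  ▷δ : ∀ {m n} (X : Vector (V n) m) j → X ▷ δ j ≐ (λ i → X i j)
  ▷δ X j i = trans (dot-comm (X i) (δ j)) (dot-δˡ j (X i))

  mul : ∀ {m n p} → Vector (V n) m → Vector (V p) n → Vector (V p) m
  mul X Y i k = dot (X i) (λ j → Y j k)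

  -- Exchange of the order of summation. It yields both the associativity of matrix action and
  -- product and the adjointness of a matrix and its transpose.
  dot-▷ : ∀ {m n} (u : V m) (Y : Vector (V n) m) (v : V n) →
          dot u (Y ▷ v) ≡ dot (λ k → dot u (λ j → Y j k)) v
  dot-▷ {m} {n} u Y v = begin
    Σᶠ (λ j → u j *ᶠ Σᶠ (λ k → Y j k *ᶠ v k))   ≡⟨ Σᶠ-cong (λ j → sym (Σᶠ-*ˡ {n} (u j) _)) ⟩
    Σᶠ (λ j → Σᶠ (λ k → u j *ᶠ (Y j k *ᶠ v k))) ≡⟨ Σᶠ-swap {m} {n} _ ⟩
    Σᶠ (λ k → Σᶠ (λ j → u j *ᶠ (Y j k *ᶠ v k))) ≡⟨ Σᶠ-cong (λ k → Σᶠ-cong (λ j →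
                                                    trans (sym (𝕂.*-assoc (u j) (Y j k) (v k))) (𝕂.*-comm _ _))) ⟩
    Σᶠ (λ k → Σᶠ (λ j → v k *ᶠ (u j *ᶠ Y j k))) ≡⟨ Σᶠ-cong (λ k → trans (Σᶠ-*ˡ {m} (v k) _) (𝕂.*-comm _ _)) ⟩
    Σᶠ (λ k → Σᶠ (λ j → u j *ᶠ Y j k) *ᶠ v k)   ∎
    where open ≡-Reasoning

  mul-▷ : ∀ {m n p} (X : Vector (V n) m) (Y : Vector (V p) n) v → mul X Y ▷ v ≐ X ▷ Y ▷ v
  mul-▷ X Y v i = sym (dot-▷ (X i) Y v)

  ▷-ext : ∀ {m n} (X Y : Vector (V n) m) → (∀ v → X ▷ v ≐ Y ▷ v) → ∀ i → X i ≐ Y i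
  ▷-ext X Y h i j = trans (sym (▷δ X j i)) (trans (h (δ j) i) (▷δ Y j i))

  -- Membership is decidable, so the size of a subspace is a sum over all vectors and no basis is
  -- ever chosen.
  record Subspace (n : ℕ) : Set₁ where
    field
      Mem  : V n → Set
      mem? : ∀ v → Dec (Mem v)
      resp : ∀ {u v} → u ≐ v → Mem u → Mem v
      0∈   : Mem 0ᵥ
      +∈   : ∀ {u v} → Mem u → Mem v → Mem (u +ᵥ v)
      *∈   : ∀ c {v} → Mem v → Mem (c *ᵥ v)

    card : ℕ
    card = ∑[ 𝕍 n ] (λ v → χ (mem? v))

  open Subspace

  record Functional (n : ℕ) : Set where
    field
      fn   : V n → K
      cong-fn : ∀ {u v} → u ≐ v → fn u ≡ fn v
      fn-+ : ∀ u v → fn (u +ᵥ v) ≡ fn u +ᶠ fn v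
      fn-* : ∀ c v → fn (c *ᵥ v) ≡ c *ᶠ fn v

    fn-0 : fn 0ᵥ ≡ 0#
    fn-0 = trans (cong-fn (λ i → sym (𝕂.zeroˡ 0#))) (trans (fn-* 0# 0ᵥ) (𝕂.zeroˡ _))

  open Functional

  full : ∀ {n} → Subspace n
  full = record { Mem = λ _ → ⊤ ; mem? = λ _ → yes tt ; resp = λ _ _ → tt ; 0∈ = tt ; +∈ = λ _ _ → tt ; *∈ = λ _ _ → tt }
    where open import Data.Unit.Base using (⊤; tt)

  card-full : ∀ n → card (full {n}) ≡ size ^ n
  card-full n = ∣𝕍∣ n

  _∩_ : ∀ {n} → Subspace n → Functional n → Subspace n
  Z ∩ f = record
    { Mem  = λ v → Mem Z v × fn f v ≡ 0#
    ; mem? = λ v → mem? Z v ×-dec decEq (fn f v) 0#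
    ; resp = λ e (p , z) → resp Z e p , trans (cong-fn f (λ i → sym (e i))) z
    ; 0∈   = 0∈ Z , fn-0 f
    ; +∈   = λ (p , z) (p′ , z′) → +∈ Z p p′ , trans (fn-+ f _ _) (trans (cong₂ _+ᶠ_ z z′) (𝕂.+-identityʳ 0#))
    ; *∈   = λ c (p , z) → *∈ Z c p , trans (fn-* f c _) (trans (cong (c *ᶠ_) z) (𝕂.zeroʳ c))
    }

  _⊥ᶠ_ : ∀ {n} → Functional n → Subspace n → Set
  f ⊥ᶠ Z = ∀ v → Mem Z v → fn f v ≡ 0#

  private
    witness? : ∀ {n} (f : Functional n) (Z : Subspace n) →
               (∃ λ v → Mem Z v × fn f v ≢ 0#) ⊎ f ⊥ᶠ Z
    witness? {n} f Z with search (𝕍 n) (λ v → mem? Z v ×-dec ¬? (decEq (fn f v) 0#))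
                         (λ e (p , ne) → resp Z e p , λ z → ne (trans (cong-fn f e) z))
    ... | inj₁ w = inj₁ w
    ... | inj₂ h = inj₂ (λ v p → decidable-stable (decEq (fn f v) 0#) (λ ne → h v (p , ne)))

  _⊥?_ : ∀ {n} (f : Functional n) (Z : Subspace n) → Dec (f ⊥ᶠ Z)
  f ⊥? Z with witness? f Z
  ... | inj₁ (v , p , ne) = no (λ h → ne (h v p))
  ... | inj₂ h            = yes h

  -- The number q - 1 as a natural number: identities containing it can be stated with addition only
  -- and later cancelled.
  pred-size : ℕ
  pred-size = ℕ.pred size

  size≡suc : size ≡ suc pred-size
  size≡suc with size | FiniteField.enum F
  ... | zero  | e = ⊥-elim (FinP.¬Fin0 (Inverse.from e 0#))
  ... | suc _ | _ = refl

  -- If q were 1, the enumeration would identify `0#` and `1#`.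
  pred-size≢0 : pred-size ≢ 0
  pred-size≢0 e = 0≢1 (trans (sym (Inverse.inverseˡ enum refl)) (trans (cong (Inverse.to enum) (one _ _)) (Inverse.inverseˡ enum refl)))
    where
    open FiniteField F using (enum)
    unique : ∀ n → n ≡ 1 → (i j : Fin n) → i ≡ j
    unique _ refl Fin.zero Fin.zero = refl
    one : ∀ (i j : Fin size) → i ≡ j
    one = unique size (trans size≡suc (cong suc e))

  -- A functional not vanishing on Z takes every value equally often on Z.
  card-∩ : ∀ {n} (Z : Subspace n) (f : Functional n) →
           size ℕ.* card (Z ∩ f) ≡ card Z ℕ.+ pred-size ℕ.* (χ (f ⊥? Z) ℕ.* card Z)
  card-∩ {n} Z f with witness? f Z
  ... | inj₂ h = begin
      size ℕ.* card (Z ∩ f)  ≡⟨ cong₂ ℕ._*_ size≡suc (∑-cong (FinSetoid.elements (𝕍 n)) (λ v → χ-cong (mem? (Z ∩ f) v) (mem? Z v) proj₁ (λ p → p , h v p))) ⟩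
      card Z ℕ.+ pred-size ℕ.* card Z          ≡⟨ cong (λ t → card Z ℕ.+ pred-size ℕ.* t) (sym (ℕP.+-identityʳ _)) ⟩
      card Z ℕ.+ pred-size ℕ.* (1 ℕ.* card Z)  ∎
    where open ≡-Reasoning
  ... | inj₁ (w , w∈Z , fw≢0) = begin
      size ℕ.* card (Z ∩ f)
        ≡⟨ cong (ℕ._* card (Z ∩ f)) (sym (∣𝔽∣ F)) ⟩
      ∣ 𝔽 F ∣ ℕ.* card (Z ∩ f)
        ≡⟨ sym (∑-const (elements (𝔽 F)) _) ⟩
      ∑[ 𝔽 F ] (λ c → card (Z ∩ f))
        ≡⟨ ∑-cong (elements (𝔽 F)) (λ c → sym (fibre c)) ⟩
      ∑[ 𝔽 F ] (λ c → ∑[ 𝕍 n ] (λ v → at c v))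
        ≡⟨ ∑-swap (elements (𝔽 F)) (elements (𝕍 n)) _ ⟩
      ∑[ 𝕍 n ] (λ v → ∑[ 𝔽 F ] (λ c → at c v))
        ≡⟨ ∑-cong (elements (𝕍 n)) total ⟩
      card Z
        ≡⟨ sym (ℕP.+-identityʳ _) ⟩
      card Z ℕ.+ 0
        ≡⟨ cong (card Z ℕ.+_) (sym (ℕP.*-zeroʳ pred-size)) ⟩
      card Z ℕ.+ pred-size ℕ.* 0 ∎
    where
    open ≡-Reasoning
    open FinSetoid using (elements)
    at : K → V n → ℕ
    at c v = χ (mem? Z v ×-dec decEq c (fn f v))
    total : ∀ v → ∑[ 𝔽 F ] (λ c → at c v) ≡ χ (mem? Z v)
    total v = trans (∑-cong (elements (𝔽 F)) (λ c → χ-× (mem? Z v) (decEq c (fn f v))))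
      (trans (∑-*ˡ (elements (𝔽 F)) (χ (mem? Z v)) _)
      (trans (cong (χ (mem? Z v) ℕ.*_) (FinSetoid.once (𝔽 F) (fn f v))) (ℕP.*-identityʳ _)))
    -- The inverse of f w. Translation by (c s) w raises the value of f by c, hence carries the
    -- fibre of f over 0 to the fibre over c inside Z.
    s : K
    s = proj₁ (inverse (fn f w) fw≢0)
    fsw : ∀ c → fn f ((c *ᶠ s) *ᵥ w) ≡ c
    fsw c = trans (fn-* f (c *ᶠ s) w) (trans (𝕂.*-assoc c s (fn f w))
      (trans (cong (c *ᶠ_) (trans (𝕂.*-comm s _) (proj₂ (inverse (fn f w) fw≢0)))) (𝕂.*-identityʳ c)))
    shift : K → V n → V n
    shift c v = v +ᵥ ((c *ᶠ s) *ᵥ w)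
    unshift : ∀ c d → c +ᶠ d ≡ 0# → ∀ v → shift d (shift c v) ≐ v
    unshift c d e v i = trans (𝕂.+-assoc _ _ _) (trans (cong (v i +ᶠ_)
      (trans (sym (𝕂.distribʳ (w i) _ _)) (trans (cong (_*ᶠ w i) (trans (sym (𝕂.distribʳ s c d)) (trans (cong (_*ᶠ s) e) (𝕂.zeroˡ s)))) (𝕂.zeroˡ _))))
      (𝕂.+-identityʳ _))
    fn-shift : ∀ c v → fn f (shift c v) ≡ fn f v +ᶠ c
    fn-shift c v = trans (fn-+ f v _) (cong (fn f v +ᶠ_) (fsw c))
    shift∈ : ∀ c {v} → Mem Z v → Mem Z (shift c v)
    shift∈ c p = +∈ Z p (*∈ Z _ w∈Z)
    fibre : ∀ c → ∑[ 𝕍 n ] (at c) ≡ card (Z ∩ f)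
    fibre c = trans (sym (∑-reindex (𝕍 n) (𝕍 n) (shift c) (shift (-ᶠ c)) (at c)
        (λ e i → cong (_+ᶠ _) (e i)) (λ e i → cong (_+ᶠ _) (e i))
        (unshift c (-ᶠ c) (𝕂.-‿inverseʳ c))
        (λ b → inj₂ (unshift (-ᶠ c) c (𝕂.-‿inverseˡ c) b))
        (λ {x} {y} e → χ-cong (mem? Z x ×-dec decEq c (fn f x)) (mem? Z y ×-dec decEq c (fn f y))
           (λ (p , z) → resp Z e p , trans z (cong-fn f e))
           (λ (p , z) → resp Z (λ i → sym (e i)) p , trans z (sym (cong-fn f e))))))
      (∑-cong (elements (𝕍 n)) (λ v → χ-cong (mem? Z (shift c v) ×-dec decEq c (fn f (shift c v))) (mem? (Z ∩ f) v)
        (λ (p , z) → resp Z (unshift c (-ᶠ c) (𝕂.-‿inverseʳ c) v) (shift∈ (-ᶠ c) p) ,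
           𝕂P.+-cancelʳ c _ _ (trans (sym (fn-shift c v)) (trans (sym z) (sym (𝕂.+-identityˡ c)))))
        (λ (p , z) → shift∈ c p , sym (trans (fn-shift c v) (trans (cong (_+ᶠ c) z) (𝕂.+-identityˡ c))))))

  dotF : ∀ {n} → V n → Functional n
  dotF y = record { fn = dot y ; cong-fn = dot-cong (λ _ → refl) ; fn-+ = dot-+ʳ y ; fn-* = dot-*ʳ y }

  0ᵥ? : ∀ {n} (v : V n) → Dec (v ≐ 0ᵥ)
  0ᵥ? v = FinP.all? (λ i → decEq (v i) 0#)

  -- The case of `card-∩` in which Z is the whole space. The dot product is nondegenerate: `dot v`
  -- vanishes on every `δ i` only if v is zero.
  count-⊥ : ∀ {n} (v : V n) → size ℕ.* ∑[ 𝕍 n ] (λ u → χ (decEq (dot u v) 0#))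
            ≡ size ^ n ℕ.+ pred-size ℕ.* (χ (0ᵥ? v) ℕ.* size ^ n)
  count-⊥ {n} v = begin
    size ℕ.* ∑[ 𝕍 n ] (λ u → χ (decEq (dot u v) 0#))
      ≡⟨ cong (size ℕ.*_) (∑-cong (FinSetoid.elements (𝕍 n)) (λ u → χ-cong (decEq (dot u v) 0#) (mem? (full ∩ dotF v) u)
          (λ e → _ , trans (dot-comm v u) e) (λ (_ , e) → trans (dot-comm u v) e))) ⟩
    size ℕ.* card (full ∩ dotF v)
      ≡⟨ card-∩ full (dotF v) ⟩
    card (full {n}) ℕ.+ pred-size ℕ.* (χ (dotF v ⊥? full) ℕ.* card (full {n}))
      ≡⟨ cong₂ (λ a b → a ℕ.+ pred-size ℕ.* (b ℕ.* a)) (card-full n)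
          (χ-cong (dotF v ⊥? full) (0ᵥ? v)
            (λ h i → trans (sym (dot-δˡ i v)) (trans (dot-comm (δ i) v) (h (δ i) _)))
            (λ z u _ → trans (dot-cong z (λ _ → refl)) (dot-0ˡ u))) ⟩
    size ^ n ℕ.+ pred-size ℕ.* (χ (0ᵥ? v) ℕ.* size ^ n) ∎
    where open ≡-Reasoning

  private
    cancel : ∀ {a b} p → p ≢ 0 → p ℕ.* a ≡ p ℕ.* b → a ≡ b
    cancel zero    ne e = ⊥-elim (ne refl)
    cancel (suc p) ne e = ℕP.*-cancelˡ-≡ _ _ (suc p) e

  size≢0 : size ≢ 0
  size≢0 e = ℕP.1+n≢0 (trans (sym size≡suc) e)

  size^≢0 : ∀ n → size ^ n ≢ 0
  size^≢0 n e = size≢0 (ℕP.m^n≡0⇒m≡0 size n e)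

  perp? : ∀ {n} (Z : Subspace n) (y : V n) → Dec (dotF y ⊥ᶠ Z)
  perp? Z y = dotF y ⊥? Z

  -- |Z| |Z^⊥| = q^n, by counting {(y,z) : z ∈ Z, y·z = 0} in two ways.
  card-perp : ∀ {n} (Z : Subspace n) → ∑[ 𝕍 n ] (λ y → χ (perp? Z y)) ℕ.* card Z ≡ size ^ n
  card-perp {n} Z = cancel pred-size pred-size≢0 (ℕP.+-cancelˡ-≡ (Q ℕ.* card Z) _ _ (begin
    Q ℕ.* card Z ℕ.+ pred-size ℕ.* (A ℕ.* card Z)
      ≡⟨ cong₂ ℕ._+_ (trans (cong (ℕ._* card Z) (sym (∣𝕍∣ n))) (trans (sym (∑-*ʳ E (card Z) _)) (∑-cong E (λ _ → ℕP.*-identityˡ _))))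
           (trans (cong (pred-size ℕ.*_) (sym (∑-*ʳ E (card Z) _))) (sym (∑-*ˡ E pred-size _))) ⟩
    ∑ E (λ _ → card Z) ℕ.+ ∑ E (λ y → pred-size ℕ.* (χ (perp? Z y) ℕ.* card Z))
      ≡⟨ sym (∑-+ E _ _) ⟩
    ∑ E (λ y → card Z ℕ.+ pred-size ℕ.* (χ (perp? Z y) ℕ.* card Z))
      ≡⟨ ∑-cong E (λ y → sym (card-∩ Z (dotF y))) ⟩
    ∑ E (λ y → size ℕ.* card (Z ∩ dotF y))
      ≡⟨ ∑-*ˡ E size _ ⟩
    size ℕ.* ∑ E (λ y → ∑ E (λ z → χ (mem? (Z ∩ dotF y) z)))
      ≡⟨ cong (size ℕ.*_) (∑-swap E E _) ⟩
    size ℕ.* ∑ E (λ z → ∑ E (λ y → χ (mem? (Z ∩ dotF y) z)))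
      ≡⟨ sym (∑-*ˡ E size _) ⟩
    ∑ E (λ z → size ℕ.* ∑ E (λ y → χ (mem? (Z ∩ dotF y) z)))
      ≡⟨ ∑-cong E (λ z → trans (cong (size ℕ.*_) (trans (∑-cong E (λ y → χ-× (mem? Z z) (decEq (dot y z) 0#))) (∑-*ˡ E (χ (mem? Z z)) _)))
           (trans (swap-factors size (χ (mem? Z z)) _) (cong (χ (mem? Z z) ℕ.*_) (count-⊥ z)))) ⟩
    ∑ E (λ z → χ (mem? Z z) ℕ.* (Q ℕ.+ pred-size ℕ.* (χ (0ᵥ? z) ℕ.* Q)))
      ≡⟨ ∑-cong E (λ z → expand (χ (mem? Z z)) Q pred-size (χ (0ᵥ? z))) ⟩
    ∑ E (λ z → χ (mem? Z z) ℕ.* Q ℕ.+ (χ (0ᵥ? z) ℕ.* χ (mem? Z z)) ℕ.* (pred-size ℕ.* Q))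
      ≡⟨ ∑-+ E _ _ ⟩
    ∑ E (λ z → χ (mem? Z z) ℕ.* Q) ℕ.+ ∑ E (λ z → (χ (0ᵥ? z) ℕ.* χ (mem? Z z)) ℕ.* (pred-size ℕ.* Q))
      ≡⟨ cong₂ ℕ._+_ (trans (∑-*ʳ E Q _) (ℕP.*-comm (card Z) Q))
           (trans (∑-*ʳ E (pred-size ℕ.* Q) _) (trans (cong (ℕ._* (pred-size ℕ.* Q)) zero-once) (ℕP.*-identityˡ _))) ⟩
    Q ℕ.* card Z ℕ.+ pred-size ℕ.* Q ∎))
    where
    open ≡-Reasoning
    E = FinSetoid.elements (𝕍 n)
    Q = size ^ n
    A = ∑[ 𝕍 n ] (λ y → χ (perp? Z y))
    swap-factors : ∀ a b c → a ℕ.* (b ℕ.* c) ≡ b ℕ.* (a ℕ.* c)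
    swap-factors = solve-∀
    expand : ∀ a Q p b → a ℕ.* (Q ℕ.+ p ℕ.* (b ℕ.* Q)) ≡ a ℕ.* Q ℕ.+ (b ℕ.* a) ℕ.* (p ℕ.* Q)
    expand = solve-∀
    zero-once : ∑ E (λ z → χ (0ᵥ? z) ℕ.* χ (mem? Z z)) ≡ 1
    zero-once = trans (∑-select (𝕍 n) (λ z → χ (mem? Z z))
      (λ {x} {y} e → χ-cong (mem? Z x) (mem? Z y) (resp Z e) (resp Z (λ i → sym (e i)))) 0ᵥ)
      (χ-yes (mem? Z 0ᵥ) (0∈ Z))

  -- Adjoint operators have kernels of the same size: count {(u,v) : u·Lv = 0} in two ways.
  card-ker-adjoint : ∀ {n} (L L* : V n → V n) → (∀ u v → dot u (L v) ≡ dot v (L* u)) →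
    ∑[ 𝕍 n ] (λ v → χ (0ᵥ? (L v))) ≡ ∑[ 𝕍 n ] (λ v → χ (0ᵥ? (L* v)))
  card-ker-adjoint {n} L L* adj = cancel (pred-size ℕ.* Q) (λ e → [ pred-size≢0 , size^≢0 n ]′ (ℕP.m*n≡0⇒m≡0∨n≡0 pred-size e))
    (ℕP.+-cancelˡ-≡ (∑ E (λ _ → Q)) _ _ (begin
      ∑ E (λ _ → Q) ℕ.+ pred-size ℕ.* Q ℕ.* ∑ E (λ v → χ (0ᵥ? (L v)))   ≡⟨ sym (total L) ⟩
      size ℕ.* ∑ E (λ v → ∑ E (λ u → χ (decEq (dot u (L v)) 0#)))       ≡⟨ cong (size ℕ.*_) (∑-swap E E _) ⟩
      size ℕ.* ∑ E (λ u → ∑ E (λ v → χ (decEq (dot u (L v)) 0#)))       ≡⟨ cong (size ℕ.*_) (∑-cong E (λ u → ∑-cong E (λ v →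
        χ-cong (decEq (dot u (L v)) 0#) (decEq (dot v (L* u)) 0#) (trans (sym (adj u v))) (trans (adj u v))))) ⟩
      size ℕ.* ∑ E (λ u → ∑ E (λ v → χ (decEq (dot v (L* u)) 0#)))      ≡⟨ total L* ⟩
      ∑ E (λ _ → Q) ℕ.+ pred-size ℕ.* Q ℕ.* ∑ E (λ v → χ (0ᵥ? (L* v)))  ∎))
    where
    open import Data.Sum.Base using ([_,_]′)
    open ≡-Reasoning
    E = FinSetoid.elements (𝕍 n)
    Q = size ^ n
    rearrange : ∀ p b Q → p ℕ.* (b ℕ.* Q) ≡ p ℕ.* Q ℕ.* b
    rearrange = solve-∀
    total : ∀ M → size ℕ.* ∑ E (λ v → ∑ E (λ u → χ (decEq (dot u (M v)) 0#)))
                ≡ ∑ E (λ _ → Q) ℕ.+ pred-size ℕ.* Q ℕ.* ∑ E (λ v → χ (0ᵥ? (M v)))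
    total M = begin
      size ℕ.* ∑ E (λ v → ∑ E (λ u → χ (decEq (dot u (M v)) 0#))) ≡⟨ sym (∑-*ˡ E size _) ⟩
      ∑ E (λ v → size ℕ.* ∑ E (λ u → χ (decEq (dot u (M v)) 0#))) ≡⟨ ∑-cong E (λ v → count-⊥ (M v)) ⟩
      ∑ E (λ v → Q ℕ.+ pred-size ℕ.* (χ (0ᵥ? (M v)) ℕ.* Q))       ≡⟨ ∑-+ E _ _ ⟩
      ∑ E (λ _ → Q) ℕ.+ ∑ E (λ v → pred-size ℕ.* (χ (0ᵥ? (M v)) ℕ.* Q))
        ≡⟨ cong (∑ E (λ _ → Q) ℕ.+_) (trans (∑-cong E (λ v → rearrange pred-size (χ (0ᵥ? (M v))) Q)) (∑-*ˡ E (pred-size ℕ.* Q) _)) ⟩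
      ∑ E (λ _ → Q) ℕ.+ pred-size ℕ.* Q ℕ.* ∑ E (λ v → χ (0ᵥ? (M v))) ∎

-- Existence of the Jordan form.

module JordanExistence (F : FiniteField) where

  open import Defs hiding (FiniteField)
  open Counting
  open LinearAlgebra F
  open import Data.Bool.Base using (true; false; if_then_else_; T)
  open import Data.Nat.Base as ℕ using (ℕ; zero; suc; _≤_; _<_; z≤n; s≤s; _∸_; _<ᵇ_; _≡ᵇ_)
  import Data.Nat.Properties as ℕP
  open import Data.Nat.ListAction using (sum)
  open import Data.Fin.Base as Fin using (Fin; toℕ)
  import Data.Fin.Properties as FinP
  open import Data.List.Base using (List; []; _∷_; map)
  open import Data.List.Relation.Unary.All as All using (All; []; _∷_)
  import Data.List.Relation.Unary.All.Properties as AllP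
  open import Data.List.Relation.Unary.AllPairs using (AllPairs; []; _∷_)
  import Data.List.Relation.Unary.AllPairs.Properties as AllPairsP
  open import Data.List.Relation.Unary.Any using (here; there)
  open import Data.List.Membership.Propositional using (_∈_)
  open import Data.Product.Base using (∃; _×_; _,_; proj₁; proj₂)
  open import Data.Sum.Base using (_⊎_; inj₁; inj₂)
  open import Data.Empty using (⊥-elim)
  open import Data.Unit.Base using (tt)
  open import Data.Vec.Functional using (Vector)
  open import Function.Base using (_∘_; case_of_)
  open import Relation.Nullary using (yes; no)
  open import Relation.Binary.PropositionalEquality hiding (J)

  ≐-sym : ∀ {n} {u v : V n} → u ≐ v → v ≐ u
  ≐-sym p i = sym (p i)

  ≐-trans : ∀ {n} {u v w : V n} → u ≐ v → v ≐ w → u ≐ w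
  ≐-trans p q i = trans (p i) (q i)

  +ᵥ-cong : ∀ {n} {u u′ v v′ : V n} → u ≐ u′ → v ≐ v′ → u +ᵥ v ≐ u′ +ᵥ v′
  +ᵥ-cong p q i = cong₂ _+ᶠ_ (p i) (q i)

  Sq : ℕ → Set
  Sq n = Vector (V n) n

  pw : ∀ {n} → Sq n → ℕ → V n → V n
  pw X zero    v = v
  pw X (suc i) v = X ▷ pw X i v

  module _ {n : ℕ} (X : Sq n) where

    pw-cong : ∀ i {u v} → u ≐ v → pw X i u ≐ pw X i v
    pw-cong zero    e = e
    pw-cong (suc i) e = ▷-congʳ X (pw-cong i e)

    pw-+ : ∀ i u v → pw X i (u +ᵥ v) ≐ pw X i u +ᵥ pw X i v
    pw-+ zero    u v = λ _ → refl
    pw-+ (suc i) u v = ≐-trans (▷-congʳ X (pw-+ i u v)) (▷-+ X _ _)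

    pw-* : ∀ i c v → pw X i (c *ᵥ v) ≐ c *ᵥ pw X i v
    pw-* zero    c v = λ _ → refl
    pw-* (suc i) c v = ≐-trans (▷-congʳ X (pw-* i c v)) (▷-* X c _)

    pw-0 : ∀ i → pw X i 0ᵥ ≐ 0ᵥ
    pw-0 zero    = λ _ → refl
    pw-0 (suc i) = ≐-trans (▷-congʳ X (pw-0 i)) (▷-0 X)

    pw-∘ : ∀ i j v → pw X (i ℕ.+ j) v ≐ pw X i (pw X j v)
    pw-∘ zero    j v = λ _ → refl
    pw-∘ (suc i) j v = ▷-congʳ X (pw-∘ i j v)

    pw-suc : ∀ i v → pw X (suc i) v ≐ pw X i (X ▷ v)
    pw-suc i v = subst (λ k → pw X k v ≐ pw X i (X ▷ v)) (ℕP.+-comm i 1) (pw-∘ i 1 v)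

    pw-≥ : ∀ {i j} v → i ≤ j → pw X i v ≐ 0ᵥ → pw X j v ≐ 0ᵥ
    pw-≥ {i} {j} v i≤j z = subst (λ k → pw X k v ≐ 0ᵥ) (ℕP.m∸n+n≡m i≤j)
      (≐-trans (pw-∘ (j ∸ i) i v) (≐-trans (pw-cong (j ∸ i) z) (pw-0 (j ∸ i))))

  -- The relation X = g Y h with h inverse to g, phrased through the action on vectors, where
  -- compositions need no associativity law.
  record Similar {n} (X Y : Sq n) : Set where
    field
      g h : Sq n
      gh  : ∀ v → g ▷ h ▷ v ≐ v
      hg  : ∀ v → h ▷ g ▷ v ≐ v
      intertwine : ∀ v → X ▷ g ▷ v ≐ g ▷ Y ▷ v

  <⇒<ᵇ-true : ∀ {i a} → i < a → (i <ᵇ a) ≡ true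
  <⇒<ᵇ-true {i} {a} p with i <ᵇ a | ℕP.<⇒<ᵇ p
  ... | true | _ = refl

  ≥⇒<ᵇ-false : ∀ {i a} → a ≤ i → (i <ᵇ a) ≡ false
  ≥⇒<ᵇ-false {i} {a} p with i <ᵇ a in eq
  ... | false = refl
  ... | true  = ⊥-elim (ℕP.<⇒≱ (ℕP.<ᵇ⇒< i a (subst T (sym eq) tt)) p)

  blk-< : ∀ {a i} Λ → i < a → blk F (a ∷ Λ) i ≡ 0
  blk-< Λ p rewrite <⇒<ᵇ-true p = refl

  blk-+ : ∀ a i Λ → blk F (a ∷ Λ) (a ℕ.+ i) ≡ suc (blk F Λ i)
  blk-+ a i Λ rewrite ≥⇒<ᵇ-false (ℕP.m≤m+n a i) | ℕP.m+n∸m≡n a i = refl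

  data Split (a : ℕ) : ℕ → Set where
    lower : ∀ {i} → i < a → Split a i
    upper : ∀ i → Split a (a ℕ.+ i)

  split : ∀ a i → Split a i
  split a i with i ℕP.<? a
  ... | yes p = lower p
  ... | no ¬p = subst (Split a) (ℕP.m+[n∸m]≡n (ℕP.≮⇒≥ ¬p)) (upper (i ∸ a))

  ≡ᵇ-refl : ∀ m → (m ≡ᵇ m) ≡ true
  ≡ᵇ-refl zero    = refl
  ≡ᵇ-refl (suc m) = ≡ᵇ-refl m

  ≢⇒≡ᵇ-false : ∀ {m n} → m ≢ n → (m ≡ᵇ n) ≡ false
  ≢⇒≡ᵇ-false {m} {n} ne with m ≡ᵇ n in eq
  ... | false = refl
  ... | true  = ⊥-elim (ne (ℕP.≡ᵇ⇒≡ m n (subst T (sym eq) tt)))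

  -- A nilpotent operator X on the span of the first i basis vectors is described by blocks (a , v)
  -- with X^a v = 0 such that the vectors v generate that span as a module over K[X].
  module JordanForm {n : ℕ} (X : Sq n) where

    Block : Set
    Block = ℕ × V n

    -- The K[X]-submodule generated by the vectors of the blocks.
    data Gen (bs : List Block) : V n → Set where
      gen   : ∀ {a v} → (a , v) ∈ bs → Gen bs v
      zero  : Gen bs 0ᵥ
      add   : ∀ {u v} → Gen bs u → Gen bs v → Gen bs (u +ᵥ v)
      scale : ∀ c {v} → Gen bs v → Gen bs (c *ᵥ v)
      app   : ∀ {v} → Gen bs v → Gen bs (X ▷ v)
      ext   : ∀ {u v} → u ≐ v → Gen bs u → Gen bs v

    -- The K-span of the vectors of the blocks alone. One coefficient is recorded per block in list
    -- order, so that the first nonzero coefficient can be located.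
    data Lin : List Block → V n → Set where
      []   : ∀ {u} → u ≐ 0ᵥ → Lin [] u
      cons : ∀ c {a v bs u u′} → Lin bs u′ → u ≐ c *ᵥ v +ᵥ u′ → Lin ((a , v) ∷ bs) u

    Lin-0 : ∀ bs → Lin bs 0ᵥ
    Lin-0 []       = [] (λ _ → refl)
    Lin-0 (b ∷ bs) = cons 0# (Lin-0 bs) (λ i → sym (trans (𝕂.+-identityʳ _) (𝕂.zeroˡ _)))

    Lin-+ : ∀ {bs u v} → Lin bs u → Lin bs v → Lin bs (u +ᵥ v)
    Lin-+ ([] p) ([] q) = [] (λ i → trans (cong₂ _+ᶠ_ (p i) (q i)) (𝕂.+-identityʳ 0#))
    Lin-+ (cons c l p) (cons d m q) = cons (c +ᶠ d) (Lin-+ l m) (λ i → trans (cong₂ _+ᶠ_ (p i) (q i))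
      (trans (+ᶠ-interchange _ _ _ _) (cong (_+ᶠ _) (sym (𝕂.distribʳ _ c d)))))

    Lin-* : ∀ {bs u} c → Lin bs u → Lin bs (c *ᵥ u)
    Lin-* c ([] p) = [] (λ i → trans (cong (c *ᶠ_) (p i)) (𝕂.zeroʳ c))
    Lin-* c (cons d {u′ = u′} l p) = cons (c *ᶠ d) (Lin-* c l) (λ i → trans (cong (c *ᶠ_) (p i))
      (trans (𝕂.distribˡ c _ _) (cong (_+ᶠ c *ᶠ u′ i) (sym (𝕂.*-assoc c d _)))))

    Lin-ext : ∀ {bs u v} → u ≐ v → Lin bs u → Lin bs v
    Lin-ext e ([] p)       = [] (≐-trans (≐-sym e) p)
    Lin-ext e (cons c l p) = cons c l (≐-trans (≐-sym e) p)

    Lin-∈ : ∀ {bs a v} → (a , v) ∈ bs → Lin bs v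
    Lin-∈ {_ ∷ bs} (here refl) = cons 1# (Lin-0 bs) (λ i → sym (trans (𝕂.+-identityʳ _) (𝕂.*-identityˡ _)))
    Lin-∈ (there m)   = cons 0# (Lin-∈ m) (λ i → sym (trans (cong (_+ᶠ _) (𝕂.zeroˡ _)) (𝕂.+-identityˡ _)))

    Lin⇒Gen : ∀ {bs cs u} → (∀ {b} → b ∈ bs → b ∈ cs) → Lin bs u → Gen cs u
    Lin⇒Gen sub ([] p)       = ext (≐-sym p) zero
    Lin⇒Gen sub (cons c l p) = ext (≐-sym p) (add (scale c (gen (sub (here refl)))) (Lin⇒Gen (sub ∘ there) l))

    Gen-mono : ∀ {bs cs} → (∀ {a v} → (a , v) ∈ bs → Gen cs v) → ∀ {u} → Gen bs u → Gen cs u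
    Gen-mono f (gen m)     = f m
    Gen-mono f zero        = zero
    Gen-mono f (add p q)   = add (Gen-mono f p) (Gen-mono f q)
    Gen-mono f (scale c p) = scale c (Gen-mono f p)
    Gen-mono f (app p)     = app (Gen-mono f p)
    Gen-mono f (ext e p)   = ext e (Gen-mono f p)

    Gen-Σ : ∀ {bs m} (f : Fin m → V n) → (∀ j → Gen bs (f j)) → Gen bs (λ i → Σᶠ (λ j → f j i))
    Gen-Σ {m = zero}  f h = zero
    Gen-Σ {m = suc m} f h = add (h Fin.zero) (Gen-Σ (f ∘ Fin.suc) (h ∘ Fin.suc))

    Gen-coordinates : ∀ {bs} (u : V n) → (∀ j → u j ≢ 0# → Gen bs (δ j)) → Gen bs u
    Gen-coordinates u h = ext (λ i → trans (Σᶠ-cong (λ j → trans (cong (u j *ᶠ_) (δ-sym j i)) (𝕂.*-comm _ _))) (dot-δˡ i u))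
      (Gen-Σ (λ j → u j *ᵥ δ j) coordinate)
      where
      coordinate : ∀ j → Gen _ (u j *ᵥ δ j)
      coordinate j with decEq (u j) 0#
      ... | yes z = ext (λ i → sym (trans (cong (_*ᶠ δ j i) z) (𝕂.zeroˡ _))) zero
      ... | no ne = scale (u j) (h j ne)

    -- A generated module M with span L of its generators satisfies M = L + X M; the powers of X are
    -- all moved into the second summand.
    decompose : ∀ {bs u} → Gen bs u → ∃ λ u₀ → ∃ λ w → Lin bs u₀ × Gen bs w × u ≐ u₀ +ᵥ (X ▷ w)
    decompose {bs} {u} (gen m) = u , 0ᵥ , Lin-∈ m , zero ,
      λ i → sym (trans (cong (u i +ᶠ_) (▷-0 X i)) (𝕂.+-identityʳ _))
    decompose {bs} zero = 0ᵥ , 0ᵥ , Lin-0 bs , zero , λ i → sym (trans (cong (0# +ᶠ_) (▷-0 X i)) (𝕂.+-identityʳ _))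
    decompose (add p q) with decompose p | decompose q
    ... | u₀ , w , l , g , e | u₀′ , w′ , l′ , g′ , e′ = u₀ +ᵥ u₀′ , w +ᵥ w′ , Lin-+ l l′ , add g g′ ,
      λ i → trans (cong₂ _+ᶠ_ (e i) (e′ i)) (trans (+ᶠ-interchange _ _ _ _) (cong (_ +ᶠ_) (sym (▷-+ X w w′ i))))
    decompose (scale c p) with decompose p
    ... | u₀ , w , l , g , e = c *ᵥ u₀ , c *ᵥ w , Lin-* c l , scale c g ,
      λ i → trans (cong (c *ᶠ_) (e i)) (trans (𝕂.distribˡ c _ _) (cong (_ +ᶠ_) (sym (▷-* X c w i))))
    decompose {bs} (app {v} p) = 0ᵥ , v , Lin-0 bs , p , λ i → sym (𝕂.+-identityˡ _)
    decompose (ext e′ p) with decompose p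
    ... | u₀ , w , l , g , e = u₀ , w , l , g , ≐-trans (≐-sym e′) e

    Chain : Block → Set
    Chain (a , v) = 0 < a × pw X a v ≐ 0ᵥ

    Longer : Block → Block → Set
    Longer b c = proj₁ c ≤ proj₁ b

    size-sum : List Block → ℕ
    size-sum bs = sum (map proj₁ bs)

    Lin-killed : ∀ {bs u a} → All Chain bs → All (λ b → proj₁ b ≤ a) bs → Lin bs u → pw X a u ≐ 0ᵥ
    Lin-killed {a = a} [] [] ([] p) = ≐-trans (pw-cong X a p) (pw-0 X a)
    Lin-killed {a = a} ((_ , z) ∷ ch) (b≤a ∷ le) (cons c {v = v} {u′ = u′} l p) =
      ≐-trans (pw-cong X a p) (≐-trans (pw-+ X a _ _) (λ i → trans
        (cong₂ _+ᶠ_ (trans (pw-* X a c v i) (trans (cong (c *ᶠ_) (pw-≥ X v b≤a z i)) (𝕂.zeroʳ c)))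
                    (Lin-killed ch le l i)) (𝕂.+-identityʳ 0#)))

    -- u = c v + l, where (a , v) is the first block of bs occurring in u and l is supported on the others
    record Pivot (bs : List Block) (u : V n) : Set where
      field
        a      : ℕ
        v      : V n
        rest   : List Block
        c      : K
        l      : V n
        c≢0    : c ≢ 0#
        u≐     : u ≐ c *ᵥ v +ᵥ l
        l∈     : Lin rest l
        killed : pw X a u ≐ 0ᵥ
        cover  : ∀ {b} → b ∈ bs → b ≡ (a , v) ⊎ b ∈ rest
        chains : All Chain rest
        sorted : AllPairs Longer rest
        sizes  : a ℕ.+ size-sum rest ≡ size-sum bs
        bound  : ∀ m → All (λ b → proj₁ b ≤ m) bs → All (λ b → proj₁ b ≤ m) rest

    -- The blocks are sorted by decreasing length, so the first one with a nonzero coefficient is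
    -- the longest that occurs in u, and its length is a power of X that kills u.
    pivot : ∀ {bs u} → All Chain bs → AllPairs Longer bs → Lin bs u → u ≐ 0ᵥ ⊎ Pivot bs u
    pivot [] [] ([] p) = inj₁ p
    pivot {(a , v) ∷ bs} {u} ((a>0 , z) ∷ ch) (le ∷ so) (cons c {u′ = u′} l p) with decEq c 0#
    ... | no c≢0 = inj₂ record
      { a = a ; v = v ; rest = bs ; c = c ; l = u′ ; c≢0 = c≢0 ; u≐ = p ; l∈ = l
      ; killed = Lin-killed ((a>0 , z) ∷ ch) (ℕP.≤-refl ∷ le) (cons c l p)
      ; cover = λ { (here e) → inj₁ e ; (there m) → inj₂ m }
      ; chains = ch ; sorted = so ; sizes = refl ; bound = λ { m (_ ∷ al) → al } }
    ... | yes c≡0 with pivot ch so (Lin-ext u′≐u l)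
      where
      u′≐u : u′ ≐ u
      u′≐u i = sym (trans (p i) (trans (cong (_+ᶠ u′ i) (trans (cong (_*ᶠ v i) c≡0) (𝕂.zeroˡ _))) (𝕂.+-identityˡ _)))
    ...   | inj₁ e = inj₁ e
    ...   | inj₂ P = inj₂ record
      { a = P.a ; v = P.v ; rest = (a , v) ∷ P.rest ; c = P.c ; l = P.l ; c≢0 = P.c≢0 ; u≐ = P.u≐
      ; l∈ = cons 0# P.l∈ (λ i → sym (trans (cong (_+ᶠ P.l i) (𝕂.zeroˡ _)) (𝕂.+-identityˡ _)))
      ; killed = P.killed
      ; cover = λ { (here e) → inj₂ (here e) ; (there m) → case P.cover m of λ { (inj₁ e) → inj₁ e ; (inj₂ m′) → inj₂ (there m′) } }
      ; chains = (a>0 , z) ∷ P.chains ; sorted = P.bound a le ∷ P.sorted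
      ; sizes = trans (x∙yz≈y∙xz P.a a _) (cong (a ℕ.+_) P.sizes)
      ; bound = λ { m (q ∷ al) → q ∷ P.bound m al } }
      where
      module P = Pivot P
      open import Algebra.Properties.CommutativeSemigroup ℕP.+-commutativeSemigroup using (x∙yz≈y∙xz)

    insert : Block → List Block → List Block
    insert b []       = b ∷ []
    insert b (c ∷ cs) with proj₁ c ℕP.≤? proj₁ b
    ... | yes _ = b ∷ c ∷ cs
    ... | no _  = c ∷ insert b cs

    insert-∈ : ∀ b cs → b ∈ insert b cs
    insert-∈ b []       = here refl
    insert-∈ b (c ∷ cs) with proj₁ c ℕP.≤? proj₁ b
    ... | yes _ = here refl
    ... | no _  = there (insert-∈ b cs)

    insert-∈ʳ : ∀ b cs {d} → d ∈ cs → d ∈ insert b cs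
    insert-∈ʳ b (c ∷ cs) m with proj₁ c ℕP.≤? proj₁ b
    insert-∈ʳ b (c ∷ cs) m         | yes _ = there m
    insert-∈ʳ b (c ∷ cs) (here e)  | no _ = here e
    insert-∈ʳ b (c ∷ cs) (there m) | no _ = there (insert-∈ʳ b cs m)

    insert-All : ∀ {P : Block → Set} b cs → P b → All P cs → All P (insert b cs)
    insert-All b []       p []       = p ∷ []
    insert-All b (c ∷ cs) p (q ∷ qs) with proj₁ c ℕP.≤? proj₁ b
    ... | yes _ = p ∷ q ∷ qs
    ... | no _  = q ∷ insert-All b cs p qs

    insert-sorted : ∀ b cs → AllPairs Longer cs → AllPairs Longer (insert b cs)
    insert-sorted b []       []       = [] ∷ []
    insert-sorted b (c ∷ cs) (q ∷ qs) with proj₁ c ℕP.≤? proj₁ b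
    ... | yes c≤b = (c≤b ∷ All.map (λ le → ℕP.≤-trans le c≤b) q) ∷ q ∷ qs
    ... | no c≰b  = insert-All b cs (ℕP.<⇒≤ (ℕP.≰⇒> c≰b)) q ∷ insert-sorted b cs qs

    insert-size : ∀ b cs → size-sum (insert b cs) ≡ proj₁ b ℕ.+ size-sum cs
    insert-size b []       = refl
    insert-size b (c ∷ cs) with proj₁ c ℕP.≤? proj₁ b
    ... | yes _ = refl
    ... | no _  = trans (cong (proj₁ c ℕ.+_) (insert-size b cs)) (x∙yz≈y∙xz (proj₁ c) (proj₁ b) _)
      where open import Algebra.Properties.CommutativeSemigroup ℕP.+-commutativeSemigroup using (x∙yz≈y∙xz)

    record Blocks (i : ℕ) : Set where
      field
        bs     : List Block
        chains : All Chain bs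
        sorted : AllPairs Longer bs
        sizes  : size-sum bs ≡ i
        spans  : ∀ j → toℕ j < i → Gen bs (δ j)

    module _ (upper-triangular : ∀ i j → toℕ j ≤ toℕ i → X i j ≡ 0#) where

      -- X δ_j lies in the span already covered and decomposes as u + X w, so e = δ_j - w satisfies
      -- X e = u. If u = 0, then e is a new block of size 1. Otherwise u = c v + l for the pivot
      -- block (a , v), and this block is replaced by (a + 1 , e): it is killed by the power a + 1
      -- because the power a kills u, and v is recovered from X e by subtracting l and dividing by
      -- c.
      extend : ∀ {i} (j : Fin n) → toℕ j ≡ i → Blocks i → Blocks (suc i)
      extend {i} j j≡i B with decompose Xδ∈
        where
        open Blocks B
        Xδ∈ : Gen bs (X ▷ δ j)
        Xδ∈ = Gen-coordinates (X ▷ δ j) (λ l ne → spans l (ℕP.≰⇒> (λ i≤l →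
          ne (trans (▷δ X j l) (upper-triangular l j (subst (_≤ toℕ l) (sym j≡i) i≤l))))))
      ... | u , w , u∈ , w∈ , Xδ≐ with pivot (Blocks.chains B) (Blocks.sorted B) u∈
      ...   | pivoted = result pivoted
        where
        open Blocks B
        e : V n
        e = δ j +ᵥ ((-ᶠ 1#) *ᵥ w)
        e+w : e +ᵥ w ≐ δ j
        e+w l = trans (𝕂.+-assoc _ _ _) (trans (cong (δ j l +ᶠ_) (trans (cong (_+ᶠ w l) (𝕂P.-1*x≈-x (w l))) (𝕂.-‿inverseˡ _))) (𝕂.+-identityʳ _))
        Xe : X ▷ e ≐ u
        Xe l = trans (▷-+ X (δ j) _ l) (trans (cong₂ _+ᶠ_ (Xδ≐ l) (trans (▷-* X (-ᶠ 1#) w l) (𝕂P.-1*x≈-x _)))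
          (trans (𝕂.+-assoc _ _ _) (trans (cong (u l +ᶠ_) (𝕂.-‿inverseʳ _)) (𝕂.+-identityʳ _))))
        spans′ : ∀ {cs} → Gen cs e → (∀ {a v} → (a , v) ∈ bs → Gen cs v) → ∀ l → toℕ l < suc i → Gen cs (δ l)
        spans′ e∈ sub l l≤i with toℕ l ℕP.≟ i
        ... | no ne = Gen-mono sub (spans l (ℕP.≤∧≢⇒< (ℕP.≤-pred l≤i) ne))
        ... | yes eq = subst (Gen _ ∘ δ) (FinP.toℕ-injective (trans j≡i (sym eq)))
                         (ext e+w (add e∈ (Gen-mono sub w∈)))
        result : u ≐ 0ᵥ ⊎ Pivot bs u → Blocks (suc i)
        result (inj₁ u≐0) = record
          { bs = insert (1 , e) bs
          ; chains = insert-All (1 , e) bs (s≤s z≤n , ≐-trans Xe u≐0) chains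
          ; sorted = insert-sorted (1 , e) bs sorted
          ; sizes = trans (insert-size (1 , e) bs) (cong suc sizes)
          ; spans = spans′ (gen (insert-∈ (1 , e) bs)) (λ m → gen (insert-∈ʳ (1 , e) bs m))
          }
        result (inj₂ P) = record
          { bs = insert new rest
          ; chains = insert-All new rest (s≤s z≤n , ≐-trans (pw-suc X a e) (≐-trans (pw-cong X a Xe) P.killed)) P.chains
          ; sorted = insert-sorted new rest P.sorted
          ; sizes = trans (insert-size new rest) (cong suc (trans P.sizes sizes))
          ; spans = spans′ e∈ sub
          }
          where
          module P = Pivot P
          open P using (a; v; rest; c; l)
          new : Block
          new = suc a , e
          e∈ : Gen (insert new rest) e
          e∈ = gen (insert-∈ new rest)
          l∈ : Gen (insert new rest) l
          l∈ = Lin⇒Gen (insert-∈ʳ new rest) P.l∈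
          c⁻¹ : K
          c⁻¹ = proj₁ (inverse c P.c≢0)
          v≐ : c⁻¹ *ᵥ ((X ▷ e) +ᵥ ((-ᶠ 1#) *ᵥ l)) ≐ v
          v≐ i = trans (cong (c⁻¹ *ᶠ_) (trans (cong₂ _+ᶠ_ (trans (Xe i) (P.u≐ i)) (𝕂P.-1*x≈-x (l i)))
              (trans (𝕂.+-assoc _ _ _) (trans (cong (_ +ᶠ_) (𝕂.-‿inverseʳ _)) (𝕂.+-identityʳ _)))))
            (trans (sym (𝕂.*-assoc _ _ _)) (trans (cong (_*ᶠ v i) (trans (𝕂.*-comm _ _) (proj₂ (inverse c P.c≢0)))) (𝕂.*-identityˡ _)))
          sub : ∀ {b w} → (b , w) ∈ bs → Gen (insert new rest) w
          sub m with P.cover m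
          ... | inj₂ m′   = gen (insert-∈ʳ new rest m′)
          ... | inj₁ refl = ext v≐ (scale c⁻¹ (add (app e∈) (scale (-ᶠ 1#) l∈)))

      blocks : ∀ i → i ≤ n → Blocks i
      blocks zero    _   = record { bs = [] ; chains = [] ; sorted = [] ; sizes = refl ; spans = λ _ () }
      blocks (suc i) i<n = extend (Fin.fromℕ< i<n) (FinP.toℕ-fromℕ< i<n) (blocks i (ℕP.<⇒≤ i<n))

    -- The columns of the conjugating matrix. A block contributes its chain with the highest power
    -- of X first, because the Jordan matrix has its ones above the diagonal and maps each basis
    -- vector of a block to the preceding one.
    col : List Block → ℕ → V n
    col []             j = 0ᵥ
    col ((a , v) ∷ bs) j = if j <ᵇ a then pw X (a ∸ suc j) v else col bs (j ∸ a)

    col-< : ∀ {a j} v bs → j < a → col ((a , v) ∷ bs) j ≡ pw X (a ∸ suc j) v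
    col-< v bs p rewrite <⇒<ᵇ-true p = refl

    col-+ : ∀ a j v bs → col ((a , v) ∷ bs) (a ℕ.+ j) ≡ col bs j
    col-+ a j v bs rewrite ≥⇒<ᵇ-false (ℕP.m≤m+n a j) | ℕP.m+n∸m≡n a j = refl

    X▷col-0 : ∀ {bs} → All Chain bs → X ▷ col bs 0 ≐ 0ᵥ
    X▷col-0 [] = ▷-0 X
    X▷col-0 {(suc a , v) ∷ bs} ((_ , z) ∷ _) = z

    sizes : List Block → List ℕ
    sizes = map proj₁

    private
      transport : ∀ {c₀ c₀′ c c′ : V n} {b₀ b₀′ b b′} → c₀′ ≡ c′ → c₀ ≡ c → b₀ ≡ b → b₀′ ≡ b′ →
        X ▷ c′ ≐ (if b ≡ᵇ b′ then c else 0ᵥ) → X ▷ c₀′ ≐ (if b₀ ≡ᵇ b₀′ then c₀ else 0ᵥ)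
      transport refl refl refl refl h = h

    -- Inside a block X moves one column to the left; the first column of a block is the last
    -- nonzero step of its chain and is killed.
    X▷col-suc : ∀ {bs} → All Chain bs → ∀ j →
      X ▷ col bs (suc j) ≐ (if blk F (sizes bs) j ≡ᵇ blk F (sizes bs) (suc j) then col bs j else 0ᵥ)
    X▷col-suc [] j = ▷-0 X
    X▷col-suc {(a , v) ∷ bs} (ch₀ ∷ ch) j with split a j
    ... | upper i = transport (trans (cong (col ((a , v) ∷ bs)) (sym (ℕP.+-suc a i))) (col-+ a (suc i) v bs)) (col-+ a i v bs)
        (blk-+ a i (sizes bs)) (trans (cong (blk F (a ∷ sizes bs)) (sym (ℕP.+-suc a i))) (blk-+ a (suc i) (sizes bs))) (X▷col-suc ch i)
    ... | lower j<a with suc j ℕP.<? a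
    ...   | yes sj<a = transport (col-< v bs sj<a) (col-< v bs j<a) (blk-< (sizes bs) j<a) (blk-< (sizes bs) sj<a)
            (λ i → cong (λ k → pw X k v i) (sym (ℕP.+-∸-assoc 1 sj<a)))
    ...   | no sj≮a with ℕP.≤-antisym j<a (ℕP.≮⇒≥ sj≮a)
    ...     | refl = transport {c = col ((suc j , v) ∷ bs) j}
              (trans (cong (col ((suc j , v) ∷ bs)) (sym (ℕP.+-identityʳ (suc j)))) (col-+ (suc j) 0 v bs)) refl
              (blk-< (sizes bs) j<a) (trans (cong (blk F (suc j ∷ sizes bs)) (sym (ℕP.+-identityʳ (suc j)))) (blk-+ (suc j) 0 (sizes bs)))
              (X▷col-0 ch)

    end-col : ∀ {bs a v} → All Chain bs → (a , v) ∈ bs → ∃ λ j → j < size-sum bs × col bs j ≡ v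
    end-col {(suc a , v) ∷ bs} (_ ∷ _) (here refl) = a , s≤s (ℕP.m≤m+n a _) ,
      trans (col-< v bs (ℕP.n<1+n a)) (cong (λ k → pw X k v) (ℕP.n∸n≡0 a))
    end-col {(b , w) ∷ bs} (_ ∷ ch) (there m) with end-col ch m
    ... | j , j< , e = b ℕ.+ j , ℕP.+-monoʳ-< b j< , trans (col-+ b j w bs) e

    module _ (B : Blocks n) where
      open Blocks B hiding (sizes)

      private
        J G : Sq n
        J = jordan F n (sizes bs)
        G i j = col bs (toℕ j) i

        J-0 : ∀ i (j : Fin n) → toℕ j ≡ 0 → J i j ≡ 0#
        J-0 i j e rewrite e = refl

        J-suc : ∀ i (j j′ : Fin n) → toℕ j ≡ suc (toℕ j′) →
          J i j ≡ (if blk F (sizes bs) (toℕ j′) ≡ᵇ blk F (sizes bs) (suc (toℕ j′)) then 1# else 0#) *ᶠ δ j′ i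
        J-suc i j j′ e with j′ FinP.≟ i
        ... | yes refl rewrite e | ≡ᵇ-refl (toℕ j′) = sym (𝕂.*-identityʳ _)
        ... | no ne rewrite e | ≢⇒≡ᵇ-false {toℕ j′} {toℕ i} (λ z → ne (FinP.toℕ-injective z)) = sym (𝕂.zeroʳ _)

        XG≡GJ : ∀ i j k → toℕ j ≡ k → dot (X i) (col bs k) ≡ dot (G i) (λ l → J l j)
        XG≡GJ i j zero eq = trans (X▷col-0 chains i) (sym (trans (dot-cong {u = G i} (λ _ → refl) (λ l → J-0 l j eq)) (dot-0ʳ (G i))))
        XG≡GJ i j (suc k) eq = trans (X▷col-suc chains k i) (sym (trans
            (dot-cong {u = G i} (λ _ → refl) (λ l → J-suc l j j′ (trans eq (cong suc (sym toℕj′)))))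
            (trans (dot-*ʳ (G i) _ (δ j′)) (trans (cong ((if blk F (sizes bs) (toℕ j′) ≡ᵇ blk F (sizes bs) (suc (toℕ j′)) then 1# else 0#) *ᶠ_) (trans (dot-comm (G i) (δ j′)) (dot-δˡ j′ (G i))))
              (subst (λ t → (if blk F (sizes bs) t ≡ᵇ blk F (sizes bs) (suc t) then 1# else 0#) *ᶠ col bs t i ≡ (if blk F (sizes bs) k ≡ᵇ blk F (sizes bs) (suc k) then col bs k else 0ᵥ) i)
                 (sym toℕj′) (select (blk F (sizes bs) k ≡ᵇ blk F (sizes bs) (suc k))))))))
          where
          k<n : k < n
          k<n = ℕP.<-trans (ℕP.n<1+n k) (subst (_< n) eq (FinP.toℕ<n j))
          j′ : Fin n
          j′ = Fin.fromℕ< k<n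
          toℕj′ : toℕ j′ ≡ k
          toℕj′ = FinP.toℕ-fromℕ< k<n
          select : ∀ b → (if b then 1# else 0#) *ᶠ col bs k i ≡ (if b then col bs k else 0ᵥ) i
          select true  = 𝕂.*-identityˡ _
          select false = 𝕂.zeroˡ _

        XG : ∀ v → X ▷ G ▷ v ≐ G ▷ J ▷ v
        XG v = ≐-trans (≐-sym (mul-▷ X G v)) (≐-trans (▷-cong {X = mul X G} {Y = mul G J} (λ i j → XG≡GJ i j (toℕ j) refl) (λ _ → refl)) (mul-▷ G J v))

        -- The image of G contains the generators, which are the last columns of the blocks, and it
        -- is stable under X since X G = G J. Hence it contains everything generated.
        preimage : ∀ {u} → Gen bs u → ∃ λ x → G ▷ x ≐ u
        preimage (gen m) with end-col chains m
        ... | j , j< , e = δ (Fin.fromℕ< j<n) , λ i → trans (▷δ G (Fin.fromℕ< j<n) i)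
                             (cong (λ f → f i) (trans (cong (col bs) (FinP.toℕ-fromℕ< j<n)) e))
          where j<n = subst (j <_) (Blocks.sizes B) j<
        preimage zero = 0ᵥ , ▷-0 G
        preimage (add p q) with preimage p | preimage q
        ... | x , e | y , e′ = x +ᵥ y , λ i → trans (▷-+ G x y i) (cong₂ _+ᶠ_ (e i) (e′ i))
        preimage (scale c p) with preimage p
        ... | x , e = c *ᵥ x , λ i → trans (▷-* G c x i) (cong (c *ᶠ_) (e i))
        preimage (app p) with preimage p
        ... | x , e = J ▷ x , ≐-trans (≐-sym (XG x)) (▷-congʳ X e)
        preimage (ext e′ p) with preimage p
        ... | x , e = x , ≐-trans e e′

        column : ∀ i → ∃ λ x → G ▷ x ≐ δ i
        column i = preimage (spans i (FinP.toℕ<n i))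

        H : Sq n
        H j i = proj₁ (column i) j

        GH : ∀ v → G ▷ H ▷ v ≐ v
        GH v = ≐-trans (≐-sym (mul-▷ G H v)) (≐-trans (▷-cong {X = mul G H} {Y = idMat F}
          (λ i j → trans (proj₂ (column j) i) (δ-sym j i)) (λ _ → refl)) (id▷ v))

      similar-jordan : Similar X (jordan F n (sizes bs))
      similar-jordan = record
        { g = G ; h = H ; gh = GH
        -- The columns of H are chosen preimages, which gives G H = 1 only; finiteness of the space
        -- supplies the other side.
        ; hg = section⇒retraction (𝕍 n) (H ▷_) (G ▷_) (▷-congʳ H) (▷-congʳ G) GH
        ; intertwine = XG }

  jordan-form : ∀ {n} (X : Sq n) → (∀ i j → toℕ j ≤ toℕ i → X i j ≡ 0#) →
    ∃ λ ρ → All (0 <_) ρ × AllPairs (λ x y → y ≤ x) ρ × sum ρ ≡ n × Similar X (jordan F n ρ)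
  jordan-form {n} X ut = sizes B.bs , AllP.map⁺ (All.map proj₁ B.chains) , AllPairsP.map⁺ B.sorted , B.sizes , similar-jordan B
    where
    open JordanForm X
    B = blocks ut n ℕP.≤-refl
    module B = Blocks B

-- Partitions, column lengths and partial sums.

module PartitionLists where

  open import Defs
  open Counting
  open import Data.Bool.Base using (true; false)
  open import Data.Nat.Base using (ℕ; zero; suc; _≤_; _<_; z≤n; s≤s; _≤ᵇ_; _<ᵇ_; _⊓_; _+_)
  import Data.Nat.Properties as ℕP
  open import Data.Nat.Tactic.RingSolver using (solve-∀)
  open import Data.Nat.ListAction using (sum)
  open import Data.Fin.Base using (Fin; toℕ)
  import Data.Fin.Properties as FinP
  open import Data.List.Base using (List; []; _∷_; map; length; take; filterᵇ; upTo; applyUpTo)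
  open import Data.List.Properties using (length-map; length-upTo; map-upTo)
  open import Data.List.Relation.Unary.All as All using (All; []; _∷_)
  open import Data.List.Relation.Unary.AllPairs using (AllPairs; []; _∷_)
  open import Data.List.Relation.Unary.Linked using (Linked)
  open import Data.List.Relation.Unary.Linked.Properties using (Linked⇒AllPairs)
  open import Data.Empty using (⊥-elim)
  open import Function.Base using (_∘_; flip)
  open import Relation.Nullary using (yes; no)
  open import Relation.Binary.PropositionalEquality

  Sorted : List ℕ → Set
  Sorted = AllPairs (λ x y → y ≤ x)

  linked⇒sorted : ∀ {μ} → Linked (λ x y → y ≤ x) μ → Sorted μ
  linked⇒sorted = Linked⇒AllPairs (flip ℕP.≤-trans)

  psum : ℕ → List ℕ → ℕ
  psum i η = sum (take i η)

  -- The number of boxes in the first i columns of ρ, which is the dimension of ker Xⁱ for X of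
  -- Jordan type ρ.
  minsum : ℕ → List ℕ → ℕ
  minsum i ρ = sum (map (_⊓ i) ρ)

  cnt : ℕ → List ℕ → ℕ
  cnt i ρ = length (filterᵇ (λ m → suc i ≤ᵇ m) ρ)

  gt : ℕ → ℕ → ℕ
  gt i a = 𝟙 (i <ᵇ a)

  cnt-∷ : ∀ i a ρ → cnt i (a ∷ ρ) ≡ gt i a + cnt i ρ
  cnt-∷ i a ρ with i <ᵇ a
  ... | true  = refl
  ... | false = refl

  gt-yes : ∀ {i a} → i < a → gt i a ≡ 1
  gt-yes {zero}  (s≤s _) = refl
  gt-yes {suc i} (s≤s p) = gt-yes p

  gt-no : ∀ {i a} → a ≤ i → gt i a ≡ 0
  gt-no z≤n     = refl
  gt-no (s≤s p) = gt-no p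

  ⊓-suc : ∀ a i → a ⊓ suc i ≡ a ⊓ i + gt i a
  ⊓-suc zero    i       = refl
  ⊓-suc (suc a) zero    = cong suc (ℕP.⊓-zeroʳ a)
  ⊓-suc (suc a) (suc i) = cong suc (⊓-suc a i)

  minsum-suc : ∀ i ρ → minsum (suc i) ρ ≡ minsum i ρ + cnt i ρ
  minsum-suc i []      = refl
  minsum-suc i (a ∷ ρ) = trans (cong₂ _+_ (⊓-suc a i) (minsum-suc i ρ))
    (trans (interchange (a ⊓ i) (gt i a) _ _) (cong (minsum i (a ∷ ρ) +_) (sym (cnt-∷ i a ρ))))
    where
    interchange : ∀ a b c d → a + b + (c + d) ≡ a + c + (b + d)
    interchange = solve-∀

  minsum-0 : ∀ ρ → minsum 0 ρ ≡ 0
  minsum-0 []      = refl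
  minsum-0 (a ∷ ρ) = cong₂ _+_ (ℕP.⊓-zeroʳ a) (minsum-0 ρ)

  minsum-≤ : ∀ i ρ → minsum i ρ ≤ sum ρ
  minsum-≤ i []      = z≤n
  minsum-≤ i (a ∷ ρ) = ℕP.+-mono-≤ (ℕP.m⊓n≤m a i) (minsum-≤ i ρ)

  minsum-bounded : ∀ {i ρ} → All (_≤ i) ρ → minsum i ρ ≡ sum ρ
  minsum-bounded []       = refl
  minsum-bounded (p ∷ ps) = cong₂ _+_ (ℕP.m≤n⇒m⊓n≡m p) (minsum-bounded ps)

  minsum-full : ∀ i ρ → minsum i ρ ≡ sum ρ → All (_≤ i) ρ
  minsum-full i []      e = []
  minsum-full i (a ∷ ρ) e = ℕP.m⊓n≡m⇒m≤n a⊓i≡a ∷ minsum-full i ρ rest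
    where
    a⊓i≡a : a ⊓ i ≡ a
    a⊓i≡a = ℕP.≤-antisym (ℕP.m⊓n≤m a i) (ℕP.+-cancelʳ-≤ (sum ρ) a (a ⊓ i)
      (ℕP.≤-trans (ℕP.≤-reflexive (sym e)) (ℕP.+-monoʳ-≤ (a ⊓ i) (minsum-≤ i ρ))))
    rest : minsum i ρ ≡ sum ρ
    rest = ℕP.+-cancelˡ-≡ a _ _ (trans (cong (_+ minsum i ρ) (sym a⊓i≡a)) e)

  cnt-bounded : ∀ {i ρ} → All (_≤ i) ρ → cnt i ρ ≡ 0
  cnt-bounded []                   = refl
  cnt-bounded {i} {a ∷ ρ} (p ∷ ps) = trans (cnt-∷ i a ρ) (cong₂ _+_ (gt-no p) (cnt-bounded ps))

  sorted-bounded : ∀ {ρ} → Sorted ρ → All (_≤ (ρ ‼ 0)) ρ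
  sorted-bounded []       = []
  sorted-bounded (p ∷ ps) = ℕP.≤-refl ∷ p

  -- The conjugate partition cut off or padded with zeros to length L; `conj μ` is the case L = μ₁.
  -- A prescribed length is needed to compare a Jordan type row by row with a given η.
  conjL : ℕ → List ℕ → List ℕ
  conjL L μ = map (λ j → cnt j μ) (upTo L)

  length-conjL : ∀ L μ → length (conjL L μ) ≡ L
  length-conjL L μ = trans (length-map (λ j → cnt j μ) (upTo L)) (length-upTo L)

  length-conj : ∀ μ → length (conj μ) ≡ μ ‼ 0
  length-conj μ = length-conjL (μ ‼ 0) μ

  conj-bound : ∀ μ (i : Fin (length (conj μ))) → toℕ i < μ ‼ 0
  conj-bound μ i = subst (toℕ i <_) (length-conj μ) (FinP.toℕ<n i)

  psum-conjL : ∀ L μ i → i ≤ L → psum i (conjL L μ) ≡ minsum i μ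
  psum-conjL L μ i i≤L = trans (cong (psum i) (map-upTo (λ j → cnt j μ) L))
    (trans (cong (_+ psum i (applyUpTo (λ j → cnt j μ) L)) (sym (minsum-0 μ))) (go i L 0 _ (λ _ → refl) i≤L))
    where
    go : ∀ i L o f → (∀ j → f j ≡ cnt (o + j) μ) → i ≤ L → minsum o μ + psum i (applyUpTo f L) ≡ minsum (o + i) μ
    go zero    L       o f h _         = trans (ℕP.+-identityʳ _) (cong (λ t → minsum t μ) (sym (ℕP.+-identityʳ o)))
    go (suc i) (suc L) o f h (s≤s i≤L) = begin
      minsum o μ + (f 0 + psum i (applyUpTo (f ∘ suc) L))
        ≡⟨ sym (ℕP.+-assoc (minsum o μ) _ _) ⟩
      minsum o μ + f 0 + psum i (applyUpTo (f ∘ suc) L)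
        ≡⟨ cong (λ t → minsum o μ + t + psum i (applyUpTo (f ∘ suc) L)) (trans (h 0) (cong (λ t → cnt t μ) (ℕP.+-identityʳ o))) ⟩
      minsum o μ + cnt o μ + psum i (applyUpTo (f ∘ suc) L)
        ≡⟨ cong (_+ psum i (applyUpTo (f ∘ suc) L)) (sym (minsum-suc o μ)) ⟩
      minsum (suc o) μ + psum i (applyUpTo (f ∘ suc) L)
        ≡⟨ go i L (suc o) (f ∘ suc) (λ j → trans (h (suc j)) (cong (λ t → cnt t μ) (ℕP.+-suc o j))) i≤L ⟩
      minsum (suc o + i) μ
        ≡⟨ cong (λ t → minsum t μ) (sym (ℕP.+-suc o i)) ⟩
      minsum (o + suc i) μ ∎
      where open ≡-Reasoning

  psum-conj : ∀ μ i → i ≤ μ ‼ 0 → psum i (conj μ) ≡ minsum i μ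
  psum-conj μ = psum-conjL (μ ‼ 0) μ

  -- The largest part is the least i with `cnt i` zero, so the heads agree, and they can be removed
  -- from both counts.
  sorted-unique : ∀ ρ μ → All (0 <_) ρ → All (0 <_) μ → Sorted ρ → Sorted μ → (∀ i → cnt i ρ ≡ cnt i μ) → ρ ≡ μ
  sorted-unique []      []      _ _ _ _ _ = refl
  sorted-unique []      (b ∷ μ) _ (q ∷ _) _ _ e = ⊥-elim (ℕP.1+n≢0 (sym (trans (e 0) (trans (cnt-∷ 0 b μ) (cong (_+ cnt 0 μ) (gt-yes q))))))
  sorted-unique (a ∷ ρ) []      (p ∷ _) _ _ _ e = ⊥-elim (ℕP.1+n≢0 (sym (trans (sym (e 0)) (trans (cnt-∷ 0 a ρ) (cong (_+ cnt 0 ρ) (gt-yes p))))))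
  sorted-unique (a ∷ ρ) (b ∷ μ) (_ ∷ p) (_ ∷ q) (as ∷ s) (bs ∷ t) e = cong₂ _∷_ a≡b (sorted-unique ρ μ p q s t
      (λ i → ℕP.+-cancelˡ-≡ (gt i a) _ _ (trans (sym (cnt-∷ i a ρ)) (trans (e i) (trans (cnt-∷ i b μ) (cong (λ c → gt i c + cnt i μ) (sym a≡b)))))))
    where
    not-less : ∀ {a b ρ μ} → All (_≤ a) ρ → (∀ i → cnt i (a ∷ ρ) ≡ cnt i (b ∷ μ)) → b ≤ a
    not-less {a} {b} {ρ} {μ} as e = ℕP.≮⇒≥ (λ a<b → ℕP.1+n≢0 (sym (trans (sym (cnt-bounded (ℕP.≤-refl ∷ as)))
      (trans (e a) (trans (cnt-∷ a b μ) (cong (_+ cnt a μ) (gt-yes a<b)))))))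
    a≡b : a ≡ b
    a≡b = ℕP.≤-antisym (not-less bs (λ i → sym (e i))) (not-less as e)

  cnt-determined : ∀ {ρ μ} i → minsum i ρ ≡ minsum i μ → minsum (suc i) ρ ≡ minsum (suc i) μ → cnt i ρ ≡ cnt i μ
  cnt-determined {ρ} {μ} i e e′ = ℕP.+-cancelˡ-≡ (minsum i ρ) _ _ (trans (sym (minsum-suc i ρ))
    (trans e′ (trans (minsum-suc i μ) (cong (_+ cnt i μ) (sym e)))))

  -- The given equations stop at the column L = μ₁. Equality of the totals shows that ρ has no boxes
  -- beyond it, which provides the missing column lengths.
  partition-unique : ∀ ρ μ → All (0 <_) ρ → All (0 <_) μ → Sorted ρ → Sorted μ → sum ρ ≡ sum μ →
    (∀ i → i < μ ‼ 0 → minsum (suc i) ρ ≡ minsum (suc i) μ) → ρ ≡ μ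
  partition-unique ρ μ p q s t total e = sorted-unique ρ μ p q s t cnts
    where
    L = μ ‼ 0
    e′ : ∀ i → i ≤ L → minsum i ρ ≡ minsum i μ
    e′ zero    _   = trans (minsum-0 ρ) (sym (minsum-0 μ))
    e′ (suc i) i<L = e i i<L
    μ≤L : All (_≤ L) μ
    μ≤L = sorted-bounded t
    ρ≤L : All (_≤ L) ρ
    ρ≤L = minsum-full L ρ (trans (e′ L ℕP.≤-refl) (trans (minsum-bounded μ≤L) (sym total)))
    cnts : ∀ i → cnt i ρ ≡ cnt i μ
    cnts i with i ℕP.<? L
    ... | yes i<L = cnt-determined {ρ} {μ} i (e′ i (ℕP.<⇒≤ i<L)) (e i i<L)
    ... | no i≮L  = trans (cnt-bounded (All.map (λ le → ℕP.≤-trans le (ℕP.≮⇒≥ i≮L)) ρ≤L))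
                     (sym (cnt-bounded (All.map (λ le → ℕP.≤-trans le (ℕP.≮⇒≥ i≮L)) μ≤L)))

-- Kernels of Jordan matrices.

module JordanKernels (F : FiniteField) where

  open import Defs hiding (FiniteField)
  open Counting
  open LinearAlgebra F
  open JordanExistence F
  open PartitionLists using (minsum)
  open import Data.Bool.Base using (Bool; if_then_else_; _∧_)
  open import Data.Bool.Properties using (∧-zeroʳ; ∧-identityʳ)
  open import Data.Nat.Base as ℕ using (ℕ; zero; suc; _≤_; _<_; z≤n; s≤s; _≡ᵇ_; _⊓_; _^_)
  import Data.Nat.Properties as ℕP
  open import Data.Nat.Tactic.RingSolver using (solve-∀)
  open import Data.Nat.ListAction using (sum)
  open import Data.Fin.Base as Fin using (Fin; toℕ; _↑ˡ_; _↑ʳ_; splitAt)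
  import Data.Fin.Properties as FinP
  open import Data.List.Base using (List; []; _∷_; length; lookup)
  open import Data.List.Relation.Unary.All using (All; []; _∷_)
  open import Data.Product.Base using (_×_; _,_)
  open import Data.Sum.Base using (inj₁; inj₂)
  open import Data.Vec.Functional using (Vector; tail) renaming (_∷_ to _∷ᶠ_; _++_ to _++ᶠ_)
  open import Data.Vec.Functional.Properties using (lookup-++ˡ; lookup-++ʳ)
  open import Function.Base using (_∘_)
  open import Relation.Nullary using (Dec)
  open import Relation.Nullary.Decidable using (_×-dec_; _→-dec_)
  open import Relation.Binary.PropositionalEquality hiding (J)

  by-parts : ∀ {a m} {P : Fin (a ℕ.+ m) → Set} → (∀ l → P (l ↑ˡ m)) → (∀ l → P (a ↑ʳ l)) → ∀ i → P i
  by-parts {a} {m} {P} f g i with splitAt a i in eq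
  ... | inj₁ l = subst P (FinP.splitAt⁻¹-↑ˡ eq) (f l)
  ... | inj₂ l = subst P (FinP.splitAt⁻¹-↑ʳ eq) (g l)

  module _ (A : FinSetoid) where
    open FinSetoid A using (Carrier; _≈_; elements; ≈-refl)

    ∑-++ᶠ : ∀ a {m} (φ : Vector Carrier (a ℕ.+ m) → ℕ) → (∀ {x y} → (∀ i → x i ≈ y i) → φ x ≡ φ y) →
            ∑[ Fun F (a ℕ.+ m) A ] φ ≡ ∑[ Fun F a A ] (λ x → ∑[ Fun F m A ] (λ y → φ (x ++ᶠ y)))
    ∑-++ᶠ zero    {m} φ φ-cong = sym (ℕP.+-identityʳ _)
    ∑-++ᶠ (suc a) {m} φ φ-cong = begin
      ∑ (allFuns F (suc (a ℕ.+ m)) elements) φ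
        ≡⟨ ∑-allFuns F (a ℕ.+ m) elements φ ⟩
      ∑ elements (λ c → ∑ (allFuns F (a ℕ.+ m) elements) (λ v → φ (c ∷ᶠ v)))
        ≡⟨ ∑-cong elements (λ c → ∑-++ᶠ a (λ v → φ (c ∷ᶠ v)) (λ e → φ-cong (λ { Fin.zero → ≈-refl ; (Fin.suc i) → e i }))) ⟩
      ∑ elements (λ c → ∑[ Fun F a A ] (λ x → ∑[ Fun F m A ] (λ y → φ (c ∷ᶠ (x ++ᶠ y)))))
        ≡⟨ ∑-cong elements (λ c → ∑-cong (allFuns F a elements) (λ x → ∑-cong (allFuns F m elements) (λ y → φ-cong (assoc c x y)))) ⟩
      ∑ elements (λ c → ∑[ Fun F a A ] (λ x → ∑[ Fun F m A ] (λ y → φ ((c ∷ᶠ x) ++ᶠ y))))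
        ≡⟨ sym (∑-allFuns F a elements _) ⟩
      ∑[ Fun F (suc a) A ] (λ x → ∑[ Fun F m A ] (λ y → φ (x ++ᶠ y))) ∎
      where
      open ≡-Reasoning
      assoc : ∀ c (x : Vector Carrier a) (y : Vector Carrier m) i → (c ∷ᶠ (x ++ᶠ y)) i ≈ ((c ∷ᶠ x) ++ᶠ y) i
      assoc c x y Fin.zero = ≈-refl
      assoc c x y (Fin.suc i) with splitAt a i
      ... | inj₁ _ = ≈-refl
      ... | inj₂ _ = ≈-refl

  Σᶠ-++ : ∀ a {m} (f : V (a ℕ.+ m)) → Σᶠ f ≡ Σᶠ (λ i → f (i ↑ˡ m)) +ᶠ Σᶠ (λ i → f (a ↑ʳ i))
  Σᶠ-++ zero    f = sym (𝕂.+-identityˡ _)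
  Σᶠ-++ (suc a) f = trans (cong (f Fin.zero +ᶠ_) (Σᶠ-++ a (f ∘ Fin.suc))) (sym (𝕂.+-assoc _ _ _))

  dot-zeroˡ : ∀ {n} {u : V n} (v : V n) → u ≐ 0ᵥ → dot u v ≡ 0#
  dot-zeroˡ v z = trans (dot-cong z (λ _ → refl)) (dot-0ˡ v)

  snoc0 : ∀ {a} → V a → V (suc a)
  snoc0 {zero}  v _           = 0#
  snoc0 {suc a} v Fin.zero    = v Fin.zero
  snoc0 {suc a} v (Fin.suc l) = snoc0 (tail v) l

  -- The action of a single nilpotent Jordan block: the first coordinate is lost and a zero enters
  -- at the end.
  shift : ∀ {a} → V a → V a
  shift {zero}  u = u
  shift {suc a} u = snoc0 (tail u)

  snoc0-cong : ∀ {a} {u v : V a} → u ≐ v → snoc0 u ≐ snoc0 v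
  snoc0-cong {zero}  e l           = refl
  snoc0-cong {suc a} e Fin.zero    = e Fin.zero
  snoc0-cong {suc a} e (Fin.suc l) = snoc0-cong (e ∘ Fin.suc) l

  shift-cong : ∀ {a} {u v : V a} → u ≐ v → shift u ≐ shift v
  shift-cong {zero}  e = e
  shift-cong {suc a} e = snoc0-cong (e ∘ Fin.suc)

  dot-snoc0 : ∀ {a} (j : Fin (suc a)) (v : V a) → dot (λ l → if toℕ l ≡ᵇ toℕ j then 1# else 0#) v ≡ snoc0 v j
  dot-snoc0 {zero}  j           v = refl
  dot-snoc0 {suc a} Fin.zero    v = trans (cong₂ _+ᶠ_ (𝕂.*-identityˡ _) (dot-0ˡ (tail v))) (𝕂.+-identityʳ _)
  dot-snoc0 {suc a} (Fin.suc j) v = trans (cong₂ _+ᶠ_ (𝕂.zeroˡ _) (dot-snoc0 j (tail v))) (𝕂.+-identityˡ _)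

  Jor : ∀ ρ → Sq (sum ρ)
  Jor ρ = jordan F (sum ρ) ρ

  module _ (a : ℕ) (ρ : List ℕ) where
    private
      m = sum ρ
      if-cong : ∀ {b b′ : Bool} → b ≡ b′ → (if b then 1# else 0#) ≡ (if b′ then 1# else 0#)
      if-cong = cong (λ b → if b then 1# else 0#)

    blk-↑ˡ : ∀ (l : Fin a) → blk F (a ∷ ρ) (toℕ (l ↑ˡ m)) ≡ 0
    blk-↑ˡ l = blk-< ρ (subst (_< a) (sym (FinP.toℕ-↑ˡ l m)) (FinP.toℕ<n l))

    blk-↑ʳ : ∀ (l : Fin m) → blk F (a ∷ ρ) (toℕ (a ↑ʳ l)) ≡ suc (blk F ρ (toℕ l))
    blk-↑ʳ l = trans (cong (blk F (a ∷ ρ)) (FinP.toℕ-↑ʳ a l)) (blk-+ a (toℕ l) ρ)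

    private
      J = Jor (a ∷ ρ)

      same : ∀ l j → J (j ↑ˡ m) (l ↑ˡ m) ≡ (if toℕ l ≡ᵇ suc (toℕ j) then 1# else 0#)
      same l j rewrite FinP.toℕ-↑ˡ l m | FinP.toℕ-↑ˡ j m | blk-< ρ (FinP.toℕ<n l) | blk-< ρ (FinP.toℕ<n j) =
        if-cong (∧-identityʳ _)

      off : ∀ l j → J (j ↑ˡ m) (a ↑ʳ l) ≡ 0#
      off l j rewrite blk-↑ˡ j | blk-↑ʳ l = if-cong (∧-zeroʳ _)

      off′ : ∀ l j → J (a ↑ʳ j) (l ↑ˡ m) ≡ 0#
      off′ l j rewrite blk-↑ˡ l | blk-↑ʳ j = if-cong (∧-zeroʳ _)

      ≡ᵇ-+ : ∀ a x y → (a ℕ.+ x ≡ᵇ a ℕ.+ y) ≡ (x ≡ᵇ y)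
      ≡ᵇ-+ zero    x y = refl
      ≡ᵇ-+ (suc a) x y = ≡ᵇ-+ a x y

      rest : ∀ l j → J (a ↑ʳ j) (a ↑ʳ l) ≡ Jor ρ j l
      rest l j rewrite blk-↑ʳ l | blk-↑ʳ j = if-cong (cong (_∧ (blk F ρ (toℕ j) ≡ᵇ blk F ρ (toℕ l)))
        (trans (cong₂ _≡ᵇ_ (FinP.toℕ-↑ʳ a l) (trans (cong suc (FinP.toℕ-↑ʳ a j)) (sym (ℕP.+-suc a _)))) (≡ᵇ-+ a (toℕ l) (suc (toℕ j)))))

    Jor-↑ˡ : ∀ u → (λ l → (J ▷ u) (l ↑ˡ m)) ≐ shift (λ l → u (l ↑ˡ m))
    Jor-↑ˡ u j = trans (Σᶠ-++ a _) (trans (cong₂ _+ᶠ_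
        (trans (dot-cong (λ l → same l j) (λ _ → refl)) (row j (λ l → u (l ↑ˡ m))))
        (dot-zeroˡ (λ l → u (a ↑ʳ l)) (λ l → off l j)))
      (𝕂.+-identityʳ _))
      where
      row : ∀ {a} (j : Fin a) (v : V a) → dot (λ l → if toℕ l ≡ᵇ suc (toℕ j) then 1# else 0#) v ≡ shift v j
      row {suc a} j v = trans (cong₂ _+ᶠ_ (𝕂.zeroˡ _) (dot-snoc0 j (tail v))) (𝕂.+-identityˡ _)

    Jor-↑ʳ : ∀ u → (λ l → (J ▷ u) (a ↑ʳ l)) ≐ Jor ρ ▷ (λ l → u (a ↑ʳ l))
    Jor-↑ʳ u j = trans (Σᶠ-++ a _) (trans (cong₂ _+ᶠ_
        (dot-zeroˡ (λ l → u (l ↑ˡ m)) (λ l → off′ l j))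
        (dot-cong (λ l → rest l j) (λ _ → refl)))
      (𝕂.+-identityˡ _))

  -- For a single Jordan block this is the kernel of the i-th power.
  VanishFrom : ∀ {a} → ℕ → V a → Set
  VanishFrom i u = ∀ l → i ≤ toℕ l → u l ≡ 0#

  vanishFrom? : ∀ {a} i (u : V a) → Dec (VanishFrom i u)
  vanishFrom? i u = FinP.all? (λ l → (i ℕP.≤? toℕ l) →-dec decEq (u l) 0#)

  snoc0-vanish⁺ : ∀ {a i} {v : V a} → VanishFrom i v → VanishFrom i (snoc0 v)
  snoc0-vanish⁺ {zero}          h l           _       = refl
  snoc0-vanish⁺ {suc a}         h Fin.zero    z≤n     = h Fin.zero z≤n
  snoc0-vanish⁺ {suc a} {zero}  h (Fin.suc l) p       = snoc0-vanish⁺ {i = zero} (λ l _ → h (Fin.suc l) z≤n) l z≤n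
  snoc0-vanish⁺ {suc a} {suc i} h (Fin.suc l) (s≤s p) = snoc0-vanish⁺ (λ l q → h (Fin.suc l) (s≤s q)) l p

  snoc0-vanish⁻ : ∀ {a i} {v : V a} → VanishFrom i (snoc0 v) → VanishFrom i v
  snoc0-vanish⁻ {suc a}         h Fin.zero    p       = h Fin.zero p
  snoc0-vanish⁻ {suc a} {zero}  h (Fin.suc l) p       = snoc0-vanish⁻ {i = zero} (λ l _ → h (Fin.suc l) z≤n) l z≤n
  snoc0-vanish⁻ {suc a} {suc i} h (Fin.suc l) (s≤s p) = snoc0-vanish⁻ (λ l q → h (Fin.suc l) (s≤s q)) l p

  shift-vanish⁺ : ∀ {a i} {u : V a} → VanishFrom (suc i) u → VanishFrom i (shift u)
  shift-vanish⁺ {suc a} h = snoc0-vanish⁺ (λ l p → h (Fin.suc l) (s≤s p))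

  shift-vanish⁻ : ∀ {a i} {u : V a} → VanishFrom i (shift u) → VanishFrom (suc i) u
  shift-vanish⁻ {suc a} h (Fin.suc l) (s≤s p) = snoc0-vanish⁻ h l p

  module _ (a : ℕ) (ρ : List ℕ) where

    ker-split⁺ : ∀ i u → VanishFrom i (λ l → u (l ↑ˡ sum ρ)) → pw (Jor ρ) i (λ l → u (a ↑ʳ l)) ≐ 0ᵥ → pw (Jor (a ∷ ρ)) i u ≐ 0ᵥ
    ker-split⁺ zero    u p q = by-parts (λ l → p l z≤n) q
    ker-split⁺ (suc i) u p q = ≐-trans (pw-suc (Jor (a ∷ ρ)) i u) (ker-split⁺ i (Jor (a ∷ ρ) ▷ u)
      (λ l i≤l → trans (Jor-↑ˡ a ρ u l) (shift-vanish⁺ p l i≤l))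
      (≐-trans (pw-cong (Jor ρ) i (Jor-↑ʳ a ρ u)) (≐-trans (≐-sym (pw-suc (Jor ρ) i _)) q)))

    ker-split⁻ : ∀ i u → pw (Jor (a ∷ ρ)) i u ≐ 0ᵥ → VanishFrom i (λ l → u (l ↑ˡ sum ρ)) × pw (Jor ρ) i (λ l → u (a ↑ʳ l)) ≐ 0ᵥ
    ker-split⁻ zero    u h = (λ l _ → h (l ↑ˡ sum ρ)) , (λ l → h (a ↑ʳ l))
    ker-split⁻ (suc i) u h with ker-split⁻ i (Jor (a ∷ ρ) ▷ u) (≐-trans (≐-sym (pw-suc (Jor (a ∷ ρ)) i u)) h)
    ... | p , q = shift-vanish⁻ (λ l i≤l → trans (sym (Jor-↑ˡ a ρ u l)) (p l i≤l)) ,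
      ≐-trans (pw-suc (Jor ρ) i _) (≐-trans (≐-sym (pw-cong (Jor ρ) i (Jor-↑ʳ a ρ u))) q)

  -- The position of the last coordinate of a block. The image of the Jordan matrix consists of the
  -- vectors that vanish at these positions, so only they can detect a vector modulo the image.
  endIx : ∀ ρ → All (0 <_) ρ → Fin (length ρ) → Fin (sum ρ)
  endIx (suc a ∷ ρ) (_ ∷ p) Fin.zero    = Fin.fromℕ a ↑ˡ sum ρ
  endIx (a ∷ ρ)     (_ ∷ p) (Fin.suc b) = a ↑ʳ endIx ρ p b

  EndsVanish : ∀ ρ → All (0 <_) ρ → ℕ → V (sum ρ) → Set
  EndsVanish ρ p i u = ∀ b → i < lookup ρ b → u (endIx ρ p b) ≡ 0#

  endsVanish? : ∀ ρ p i u → Dec (EndsVanish ρ p i u)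
  endsVanish? ρ p i u = FinP.all? (λ b → (i ℕP.<? lookup ρ b) →-dec decEq (u (endIx ρ p b)) 0#)

  neg-unique : ∀ {c d} → c +ᶠ d ≡ 0# → c ≡ -ᶠ d
  neg-unique {c} {d} e = 𝕂P.+-cancelʳ d c (-ᶠ d) (trans e (sym (𝕂.-‿inverseˡ d)))

  private
    E : ∀ n → List (V n)
    E n = FinSetoid.elements (𝕍 n)

    last? : ∀ a i (u : V (suc a)) → Dec (i ≤ a → u (Fin.fromℕ a) ≡ 0#)
    last? a i u = (i ℕP.≤? a) →-dec decEq (u (Fin.fromℕ a)) 0#

    count-tail : ∀ a i (u : V (suc a)) →
      ∑[ 𝕍 a ] (λ w → χ (vanishFrom? i (snoc0 w +ᵥ u))) ≡ size ^ (a ⊓ i) ℕ.* χ (last? a i u)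
    count-tail zero i u = trans (ℕP.+-identityʳ _) (trans (χ-cong (vanishFrom? i (snoc0 (λ ()) +ᵥ u)) (last? 0 i u)
      (λ h p → trans (sym (𝕂.+-identityˡ _)) (h Fin.zero p))
      (λ { h Fin.zero p → trans (𝕂.+-identityˡ _) (h p) })) (sym (ℕP.+-identityʳ _)))
    count-tail (suc a) zero u = begin
      ∑[ 𝕍 (suc a) ] (λ w → χ (vanishFrom? 0 (snoc0 w +ᵥ u)))
        ≡⟨ ∑-allFuns F a (FinSetoid.elements (𝔽 F)) (λ w → χ (vanishFrom? 0 (snoc0 w +ᵥ u))) ⟩
      ∑[ 𝔽 F ] (λ c → ∑[ 𝕍 a ] (λ w → χ (vanishFrom? 0 (snoc0 (c ∷ᶠ w) +ᵥ u))))
        ≡⟨ ∑-cong (FinSetoid.elements (𝔽 F)) (λ c → ∑-cong (E a) (λ w → trans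
             (χ-cong (vanishFrom? 0 (snoc0 (c ∷ᶠ w) +ᵥ u)) (decEq c (-ᶠ (u Fin.zero)) ×-dec vanishFrom? 0 (snoc0 w +ᵥ tail u))
               (λ h → neg-unique (h Fin.zero z≤n) , λ l _ → h (Fin.suc l) z≤n)
               (λ { (e , h) Fin.zero _ → trans (cong (_+ᶠ u Fin.zero) e) (𝕂.-‿inverseˡ _) ; (e , h) (Fin.suc l) _ → h l z≤n }))
             (χ-× (decEq c (-ᶠ (u Fin.zero))) (vanishFrom? 0 (snoc0 w +ᵥ tail u))))) ⟩
      ∑[ 𝔽 F ] (λ c → ∑[ 𝕍 a ] (λ w → χ (decEq c (-ᶠ (u Fin.zero))) ℕ.* χ (vanishFrom? 0 (snoc0 w +ᵥ tail u))))
        ≡⟨ ∑-cong (FinSetoid.elements (𝔽 F)) (λ c → ∑-*ˡ (E a) (χ (decEq c (-ᶠ (u Fin.zero)))) _) ⟩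
      ∑[ 𝔽 F ] (λ c → χ (decEq c (-ᶠ (u Fin.zero))) ℕ.* ∑[ 𝕍 a ] (λ w → χ (vanishFrom? 0 (snoc0 w +ᵥ tail u))))
        ≡⟨ ∑-*ʳ (FinSetoid.elements (𝔽 F)) _ _ ⟩
      ∑[ 𝔽 F ] (λ c → χ (decEq c (-ᶠ (u Fin.zero)))) ℕ.* ∑[ 𝕍 a ] (λ w → χ (vanishFrom? 0 (snoc0 w +ᵥ tail u)))
        ≡⟨ cong₂ ℕ._*_ (FinSetoid.once (𝔽 F) (-ᶠ (u Fin.zero))) (count-tail a 0 (tail u)) ⟩
      1 ℕ.* (size ^ (a ⊓ 0) ℕ.* χ (last? a 0 (tail u)))
        ≡⟨ trans (ℕP.*-identityˡ _) (cong₂ ℕ._*_ (cong (size ^_) (ℕP.⊓-zeroʳ a))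
             (χ-cong (last? a 0 (tail u)) (last? (suc a) 0 u) (λ h _ → h z≤n) (λ h _ → h z≤n))) ⟩
      size ^ 0 ℕ.* χ (last? (suc a) 0 u) ∎
      where open ≡-Reasoning
    count-tail (suc a) (suc i) u = begin
      ∑[ 𝕍 (suc a) ] (λ w → χ (vanishFrom? (suc i) (snoc0 w +ᵥ u)))
        ≡⟨ ∑-allFuns F a (FinSetoid.elements (𝔽 F)) (λ w → χ (vanishFrom? (suc i) (snoc0 w +ᵥ u))) ⟩
      ∑[ 𝔽 F ] (λ c → ∑[ 𝕍 a ] (λ w → χ (vanishFrom? (suc i) (snoc0 (c ∷ᶠ w) +ᵥ u))))
        ≡⟨ ∑-cong (FinSetoid.elements (𝔽 F)) (λ c → ∑-cong (E a) (λ w →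
             χ-cong (vanishFrom? (suc i) (snoc0 (c ∷ᶠ w) +ᵥ u)) (vanishFrom? i (snoc0 w +ᵥ tail u))
               (λ h l p → h (Fin.suc l) (s≤s p))
               (λ { h (Fin.suc l) (s≤s p) → h l p }))) ⟩
      ∑[ 𝔽 F ] (λ c → ∑[ 𝕍 a ] (λ w → χ (vanishFrom? i (snoc0 w +ᵥ tail u))))
        ≡⟨ ∑-const (FinSetoid.elements (𝔽 F)) _ ⟩
      ∣ 𝔽 F ∣ ℕ.* ∑[ 𝕍 a ] (λ w → χ (vanishFrom? i (snoc0 w +ᵥ tail u)))
        ≡⟨ cong₂ ℕ._*_ (∣𝔽∣ F) (trans (count-tail a i (tail u)) (cong (size ^ (a ⊓ i) ℕ.*_)
             (χ-cong (last? a i (tail u)) (last? (suc a) (suc i) u) (λ { h (s≤s p) → h p }) (λ h p → h (s≤s p))))) ⟩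
      size ℕ.* (size ^ (a ⊓ i) ℕ.* χ (last? (suc a) (suc i) u))
        ≡⟨ sym (ℕP.*-assoc size _ _) ⟩
      size ^ (suc a ⊓ suc i) ℕ.* χ (last? (suc a) (suc i) u) ∎
      where open ≡-Reasoning

    -- The first coordinate of w is lost and therefore free. The others are free when they move to a
    -- place before i and forced by u otherwise. The last place receives 0, so u itself has to
    -- vanish there when i ≤ a.
    count-block : ∀ a i (u : V (suc a)) →
      ∑[ 𝕍 (suc a) ] (λ w → χ (vanishFrom? i (shift w +ᵥ u))) ≡ size ^ (suc a ⊓ suc i) ℕ.* χ (last? a i u)
    count-block a i u = begin
      ∑[ 𝕍 (suc a) ] (λ w → χ (vanishFrom? i (shift w +ᵥ u)))
        ≡⟨ ∑-allFuns F a (FinSetoid.elements (𝔽 F)) (λ w → χ (vanishFrom? i (shift w +ᵥ u))) ⟩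
      ∑[ 𝔽 F ] (λ c → ∑[ 𝕍 a ] (λ w → χ (vanishFrom? i (snoc0 w +ᵥ u))))
        ≡⟨ trans (∑-const (FinSetoid.elements (𝔽 F)) _) (cong₂ ℕ._*_ (∣𝔽∣ F) (count-tail a i u)) ⟩
      size ℕ.* (size ^ (a ⊓ i) ℕ.* χ (last? a i u))
        ≡⟨ sym (ℕP.*-assoc size _ _) ⟩
      size ^ (suc a ⊓ suc i) ℕ.* χ (last? a i u) ∎
      where open ≡-Reasoning

  -- The blocks are independent, so the counts of `count-block` multiply. A vector u enters only
  -- through its coordinates at the ends of the blocks of size greater than i; this is why few rows
  -- of an extension matter.
  count-jordan : ∀ ρ (pos : All (0 <_) ρ) i (u : V (sum ρ)) →
    ∑[ 𝕍 (sum ρ) ] (λ w → χ (0ᵥ? (pw (Jor ρ) i ((Jor ρ ▷ w) +ᵥ u)))) ≡ size ^ minsum (suc i) ρ ℕ.* χ (endsVanish? ρ pos i u)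
  count-jordan [] [] i u = trans (∑-cong (E 0) (λ w → χ-yes (0ᵥ? (pw (Jor []) i ((Jor [] ▷ w) +ᵥ u))) (λ ())))
    (sym (trans (ℕP.+-identityʳ _) (χ-yes (endsVanish? [] [] i u) (λ ()))))
  count-jordan (suc a ∷ ρ) (_ ∷ pos) i u = begin
    ∑[ 𝕍 (suc a ℕ.+ m) ] φ
      ≡⟨ ∑-++ᶠ (𝔽 F) (suc a) φ (λ {x} {y} e → χ-cong (0ᵥ? (pw J i ((J ▷ x) +ᵥ u))) (0ᵥ? (pw J i ((J ▷ y) +ᵥ u)))
           (λ h → ≐-trans (pw-cong J i (+ᵥ-cong (▷-congʳ J (≐-sym e)) (λ _ → refl))) h)
           (λ h → ≐-trans (pw-cong J i (+ᵥ-cong (▷-congʳ J e) (λ _ → refl))) h)) ⟩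
    ∑[ 𝕍 (suc a) ] (λ x → ∑[ 𝕍 m ] (λ y → φ (x ++ᶠ y)))
      ≡⟨ ∑-cong (E (suc a)) (λ x → ∑-cong (E m) (λ y → factor x y)) ⟩
    ∑[ 𝕍 (suc a) ] (λ x → ∑[ 𝕍 m ] (λ y → χ (vanishFrom? i (shift x +ᵥ u₁)) ℕ.* ψ y))
      ≡⟨ trans (∑-cong (E (suc a)) (λ x → ∑-*ˡ (E m) (χ (vanishFrom? i (shift x +ᵥ u₁))) ψ)) (∑-*ʳ (E (suc a)) _ _) ⟩
    ∑[ 𝕍 (suc a) ] (λ x → χ (vanishFrom? i (shift x +ᵥ u₁))) ℕ.* ∑[ 𝕍 m ] ψ
      ≡⟨ cong₂ ℕ._*_ (count-block a i u₁) (count-jordan ρ pos i u₂) ⟩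
    size ^ (suc a ⊓ suc i) ℕ.* χ (last? a i u₁) ℕ.* (size ^ minsum (suc i) ρ ℕ.* χ (endsVanish? ρ pos i u₂))
      ≡⟨ interchange (size ^ (suc a ⊓ suc i)) _ _ _ ⟩
    (size ^ (suc a ⊓ suc i) ℕ.* size ^ minsum (suc i) ρ) ℕ.* (χ (last? a i u₁) ℕ.* χ (endsVanish? ρ pos i u₂))
      ≡⟨ cong₂ ℕ._*_ (sym (ℕP.^-distribˡ-+-* size (suc a ⊓ suc i) _)) (trans (sym (χ-× (last? a i u₁) (endsVanish? ρ pos i u₂)))
           (χ-cong (last? a i u₁ ×-dec endsVanish? ρ pos i u₂) (endsVanish? (suc a ∷ ρ) (s≤s z≤n ∷ pos) i u)
             (λ { (p , q) Fin.zero (s≤s le) → p le ; (p , q) (Fin.suc b) le → q b le })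
             (λ h → (λ le → h Fin.zero (s≤s le)) , (λ b → h (Fin.suc b))))) ⟩
    size ^ minsum (suc i) (suc a ∷ ρ) ℕ.* χ (endsVanish? (suc a ∷ ρ) (s≤s z≤n ∷ pos) i u)
      ≡⟨ cong (size ^ minsum (suc i) (suc a ∷ ρ) ℕ.*_) (χ-cong (endsVanish? (suc a ∷ ρ) (s≤s z≤n ∷ pos) i u) (endsVanish? (suc a ∷ ρ) (_ ∷ pos) i u)
           (λ { h Fin.zero → h Fin.zero ; h (Fin.suc b) → h (Fin.suc b) })
           (λ { h Fin.zero → h Fin.zero ; h (Fin.suc b) → h (Fin.suc b) })) ⟩
    size ^ minsum (suc i) (suc a ∷ ρ) ℕ.* χ (endsVanish? (suc a ∷ ρ) (_ ∷ pos) i u) ∎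
    where
    open ≡-Reasoning
    interchange : ∀ a b c d → a ℕ.* b ℕ.* (c ℕ.* d) ≡ (a ℕ.* c) ℕ.* (b ℕ.* d)
    interchange = solve-∀
    m = sum ρ
    J = Jor (suc a ∷ ρ)
    u₁ = λ l → u (l ↑ˡ m)
    u₂ = λ l → u (suc a ↑ʳ l)
    φ : V (suc a ℕ.+ m) → ℕ
    φ w = χ (0ᵥ? (pw J i ((J ▷ w) +ᵥ u)))
    ψ : V m → ℕ
    ψ y = χ (0ᵥ? (pw (Jor ρ) i ((Jor ρ ▷ y) +ᵥ u₂)))
    head-part : ∀ x y → (λ l → ((J ▷ (x ++ᶠ y)) +ᵥ u) (l ↑ˡ m)) ≐ shift x +ᵥ u₁
    head-part x y l = cong (_+ᶠ u₁ l) (trans (Jor-↑ˡ (suc a) ρ (x ++ᶠ y) l) (shift-cong (lookup-++ˡ x y) l))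
    tail-part : ∀ x y → (λ l → ((J ▷ (x ++ᶠ y)) +ᵥ u) (suc a ↑ʳ l)) ≐ (Jor ρ ▷ y) +ᵥ u₂
    tail-part x y l = cong (_+ᶠ u₂ l) (trans (Jor-↑ʳ (suc a) ρ (x ++ᶠ y) l) (▷-congʳ (Jor ρ) (lookup-++ʳ x y) l))
    factor : ∀ x y → φ (x ++ᶠ y) ≡ χ (vanishFrom? i (shift x +ᵥ u₁)) ℕ.* ψ y
    factor x y = trans (χ-cong (0ᵥ? (pw J i ((J ▷ (x ++ᶠ y)) +ᵥ u)))
        (vanishFrom? i (shift x +ᵥ u₁) ×-dec 0ᵥ? (pw (Jor ρ) i ((Jor ρ ▷ y) +ᵥ u₂)))
        (λ h → let p , q = ker-split⁻ (suc a) ρ i _ h in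
           (λ l le → trans (sym (head-part x y l)) (p l le)) , ≐-trans (pw-cong (Jor ρ) i (≐-sym (tail-part x y))) q)
        (λ (p , q) → ker-split⁺ (suc a) ρ i _ (λ l le → trans (head-part x y l) (p l le)) (≐-trans (pw-cong (Jor ρ) i (tail-part x y)) q)))
      (χ-× (vanishFrom? i (shift x +ᵥ u₁)) (0ᵥ? (pw (Jor ρ) i ((Jor ρ ▷ y) +ᵥ u₂))))

  ker : ∀ {n} → Sq n → ℕ → ℕ
  ker {n} X i = ∑[ 𝕍 n ] (λ v → χ (0ᵥ? (pw X i v)))

  ker-cong : ∀ {n} {X Y : Sq n} → (∀ v → X ▷ v ≐ Y ▷ v) → ∀ i → ker X i ≡ ker Y i
  ker-cong {n} {X} {Y} e i = ∑-cong (E n) (λ v → χ-cong (0ᵥ? (pw X i v)) (0ᵥ? (pw Y i v)) (≐-trans (≐-sym (p i v))) (≐-trans (p i v)))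
    where
    p : ∀ i v → pw X i v ≐ pw Y i v
    p zero    v = λ _ → refl
    p (suc i) v = ≐-trans (▷-congʳ X (p i v)) (e _)

  ker-0 : ∀ {n} (X : Sq n) → ker X 0 ≡ 1
  ker-0 {n} X = FinSetoid.once (𝕍 n) 0ᵥ

  ker-jordan : ∀ ρ → All (0 <_) ρ → ∀ i → ker (Jor ρ) i ≡ size ^ minsum i ρ
  ker-jordan ρ pos zero    = trans (ker-0 (Jor ρ)) (cong (size ^_) (sym (minsum-0 ρ)))
    where
    minsum-0 : ∀ ρ → minsum 0 ρ ≡ 0
    minsum-0 []      = refl
    minsum-0 (a ∷ ρ) = cong₂ ℕ._+_ (ℕP.⊓-zeroʳ a) (minsum-0 ρ)
  ker-jordan ρ pos (suc i) = begin
    ker (Jor ρ) (suc i)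
      ≡⟨ ∑-cong (E (sum ρ)) (λ v → χ-cong (0ᵥ? (pw (Jor ρ) (suc i) v)) (0ᵥ? (pw (Jor ρ) i ((Jor ρ ▷ v) +ᵥ 0ᵥ)))
           (≐-trans (≐-sym (e v))) (≐-trans (e v))) ⟩
    ∑[ 𝕍 (sum ρ) ] (λ w → χ (0ᵥ? (pw (Jor ρ) i ((Jor ρ ▷ w) +ᵥ 0ᵥ))))
      ≡⟨ count-jordan ρ pos i 0ᵥ ⟩
    size ^ minsum (suc i) ρ ℕ.* χ (endsVanish? ρ pos i 0ᵥ)
      ≡⟨ cong (size ^ minsum (suc i) ρ ℕ.*_) (χ-yes (endsVanish? ρ pos i 0ᵥ) (λ _ _ → refl)) ⟩
    size ^ minsum (suc i) ρ ℕ.* 1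
      ≡⟨ ℕP.*-identityʳ _ ⟩
    size ^ minsum (suc i) ρ ∎
    where
    open ≡-Reasoning
    e : ∀ v → pw (Jor ρ) (suc i) v ≐ pw (Jor ρ) i ((Jor ρ ▷ v) +ᵥ 0ᵥ)
    e v = ≐-trans (pw-suc (Jor ρ) i v) (pw-cong (Jor ρ) i (λ l → sym (𝕂.+-identityʳ _)))

  module _ {n : ℕ} {X Y : Sq n} (S : Similar X Y) where
    open Similar S

    pw-intertwine : ∀ i v → pw X i (g ▷ v) ≐ g ▷ pw Y i v
    pw-intertwine zero    v = λ _ → refl
    pw-intertwine (suc i) v = ≐-trans (▷-congʳ X (pw-intertwine i v)) (intertwine _)

    g-zero⁺ : ∀ {v} → v ≐ 0ᵥ → g ▷ v ≐ 0ᵥ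
    g-zero⁺ e = ≐-trans (▷-congʳ g e) (▷-0 g)

    g-zero⁻ : ∀ {v} → g ▷ v ≐ 0ᵥ → v ≐ 0ᵥ
    g-zero⁻ {v} e = ≐-trans (≐-sym (hg v)) (≐-trans (▷-congʳ h e) (▷-0 h))

    ker-similar : ∀ i → ker X i ≡ ker Y i
    ker-similar i = begin
      ∑[ 𝕍 n ] (λ v → χ (0ᵥ? (pw X i v)))
        ≡⟨ sym (∑-reindex (𝕍 n) (𝕍 n) (g ▷_) (h ▷_) (λ v → χ (0ᵥ? (pw X i v))) (▷-congʳ g) (▷-congʳ h) hg (λ v → inj₂ (gh v))
             (λ {u} {v} e → χ-cong (0ᵥ? (pw X i u)) (0ᵥ? (pw X i v)) (≐-trans (pw-cong X i (≐-sym e))) (≐-trans (pw-cong X i e)))) ⟩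
      ∑[ 𝕍 n ] (λ v → χ (0ᵥ? (pw X i (g ▷ v))))
        ≡⟨ ∑-cong (E n) (λ v → χ-cong (0ᵥ? (pw X i (g ▷ v))) (0ᵥ? (pw Y i v))
             (λ e → g-zero⁻ (≐-trans (≐-sym (pw-intertwine i v)) e))
             (λ e → ≐-trans (pw-intertwine i v) (g-zero⁺ e))) ⟩
      ∑[ 𝕍 n ] (λ v → χ (0ᵥ? (pw Y i v))) ∎
      where open ≡-Reasoning

    count-similar : ∀ i u → ∑[ 𝕍 n ] (λ w → χ (0ᵥ? (pw X i ((X ▷ w) +ᵥ (g ▷ u)))))
                          ≡ ∑[ 𝕍 n ] (λ w → χ (0ᵥ? (pw Y i ((Y ▷ w) +ᵥ u))))
    count-similar i u = begin
      ∑[ 𝕍 n ] (λ w → χ (0ᵥ? (pw X i ((X ▷ w) +ᵥ (g ▷ u)))))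
        ≡⟨ sym (∑-reindex (𝕍 n) (𝕍 n) (g ▷_) (h ▷_) (λ w → χ (0ᵥ? (pw X i ((X ▷ w) +ᵥ (g ▷ u))))) (▷-congʳ g) (▷-congʳ h) hg (λ v → inj₂ (gh v))
             (λ {x} {y} e → χ-cong (0ᵥ? (pw X i ((X ▷ x) +ᵥ (g ▷ u)))) (0ᵥ? (pw X i ((X ▷ y) +ᵥ (g ▷ u))))
                (≐-trans (pw-cong X i (+ᵥ-cong (▷-congʳ X (≐-sym e)) (λ _ → refl))))
                (≐-trans (pw-cong X i (+ᵥ-cong (▷-congʳ X e) (λ _ → refl)))))) ⟩
      ∑[ 𝕍 n ] (λ w → χ (0ᵥ? (pw X i ((X ▷ g ▷ w) +ᵥ (g ▷ u)))))
        ≡⟨ ∑-cong (E n) (λ w → χ-cong (0ᵥ? (pw X i ((X ▷ g ▷ w) +ᵥ (g ▷ u)))) (0ᵥ? (pw Y i ((Y ▷ w) +ᵥ u)))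
             (λ e → g-zero⁻ (≐-trans (≐-sym (move w)) e))
             (λ e → ≐-trans (move w) (g-zero⁺ e))) ⟩
      ∑[ 𝕍 n ] (λ w → χ (0ᵥ? (pw Y i ((Y ▷ w) +ᵥ u)))) ∎
      where
      open ≡-Reasoning
      move : ∀ w → pw X i ((X ▷ g ▷ w) +ᵥ (g ▷ u)) ≐ g ▷ pw Y i ((Y ▷ w) +ᵥ u)
      move w = ≐-trans (pw-cong X i (≐-trans (+ᵥ-cong (intertwine w) (λ _ → refl)) (≐-sym (▷-+ g (Y ▷ w) u)))) (pw-intertwine i _)

-- Conjugacy classes through kernel sizes.

module KernelTypes (F : FiniteField) where

  open import Defs hiding (FiniteField)
  open Counting
  open LinearAlgebra F
  open JordanExistence F
  open JordanKernels F
  open PartitionLists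
  open import Data.Bool.Base using (Bool; true; false; _∧_; _∨_; not; T)
  open import Data.Bool.ListAction using (all; any)
  open import Data.Nat.Base using (ℕ; suc; _≤_; _<_; z≤n; s≤s; _≤ᵇ_; _^_)
  import Data.Nat.Properties as ℕP
  open import Data.Nat.ListAction using (sum)
  open import Data.Fin.Base as Fin using (Fin; toℕ)
  import Data.Fin.Properties as FinP
  open import Data.List.Base using (List; []; _∷_; length; allFin)
  open import Data.List.Relation.Unary.All using (All; []; _∷_)
  open import Data.List.Relation.Unary.Any using (here; there)
  open import Data.List.Membership.Propositional using (_∈_)
  open import Data.List.Membership.Propositional.Properties using (∈-allFin)
  open import Data.Product.Base using (∃; _×_; _,_; proj₁; proj₂)
  open import Data.Empty using (⊥-elim)
  open import Data.Unit.Base using (tt)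
  open import Function.Base using (case_of_)
  open import Relation.Binary.Definitions using (tri<; tri≈; tri>)
  open import Relation.Nullary using (Dec; yes; no)
  open import Relation.Nullary.Decidable using (_×-dec_; _→-dec_)
  open import Relation.Binary.PropositionalEquality hiding (J)

  module _ {A : Set} {p : A → Bool} where

    all⁺ : ∀ xs → (∀ x → p x ≡ true) → all p xs ≡ true
    all⁺ []       h = refl
    all⁺ (x ∷ xs) h rewrite h x = all⁺ xs h

    all⁻ : ∀ {xs x} → all p xs ≡ true → x ∈ xs → p x ≡ true
    all⁻ {y ∷ xs} h (here refl) with p y
    ... | true = refl
    all⁻ {y ∷ xs} h (there m) with p y
    ... | true = all⁻ h m

    any⁺ : ∀ {xs x} → x ∈ xs → p x ≡ true → any p xs ≡ true
    any⁺ {y ∷ xs} (here refl) h rewrite h = refl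
    any⁺ {y ∷ xs} (there m)   h with p y
    ... | true  = refl
    ... | false = any⁺ m h

    any⁻ : ∀ xs → any p xs ≡ true → ∃ λ x → p x ≡ true
    any⁻ (x ∷ xs) h with p x in eq
    ... | true  = x , eq
    ... | false = any⁻ xs h

  ∧-true⁻ : ∀ {a b} → a ∧ b ≡ true → a ≡ true × b ≡ true
  ∧-true⁻ {true} {true} h = refl , refl

  ∧-true⁺ : ∀ {a b} → a ≡ true → b ≡ true → a ∧ b ≡ true
  ∧-true⁺ refl refl = refl

  eqᵇ⁺ : ∀ {x y : K} → x ≡ y → eqᵇ F x y ≡ true
  eqᵇ⁺ {x} {y} e with decEq x y
  ... | yes _ = refl
  ... | no ne = ⊥-elim (ne e)

  eqᵇ⁻ : ∀ {x y : K} → eqᵇ F x y ≡ true → x ≡ y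
  eqᵇ⁻ {x} {y} h with decEq x y
  ... | yes e = e

  matEqᵇ⁺ : ∀ {n} {X Y : Sq n} → (∀ i j → X i j ≡ Y i j) → matEqᵇ F X Y ≡ true
  matEqᵇ⁺ {n} e = all⁺ (allFin n) (λ i → all⁺ (allFin n) (λ j → eqᵇ⁺ (e i j)))

  matEqᵇ⁻ : ∀ {n} {X Y : Sq n} → matEqᵇ F X Y ≡ true → ∀ i j → X i j ≡ Y i j
  matEqᵇ⁻ h i j = eqᵇ⁻ (all⁻ (all⁻ h (∈-allFin i)) (∈-allFin j))

  𝕄 : ℕ → FinSetoid
  𝕄 n = Fun F n (𝕍 n)

  -- A matrix constructed in a proof occurs in the enumeration only up to pointwise equality; the
  -- Boolean search for conjugating matrices needs a listed copy.
  representative : (A : FinSetoid) → ∀ y → ∃ λ x → x ∈ FinSetoid.elements A × FinSetoid._≈_ A x y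
  representative A y = go elements (λ z → ℕP.1+n≢0 (trans (sym (once y)) z))
    where
    open FinSetoid A
    go : ∀ xs → ∑ xs (λ x → χ (x ≈? y)) ≢ 0 → ∃ λ x → x ∈ xs × x ≈ y
    go []       h = ⊥-elim (h refl)
    go (x ∷ xs) h with x ≈? y
    ... | yes e = x , here refl , e
    ... | no ne = let z , m , e = go xs h in z , there m , e

  conjugateᵇ⁻ : ∀ {n} {X Y : Sq n} → conjugateᵇ F X Y ≡ true → Similar X Y
  conjugateᵇ⁻ {n} {X} {Y} c with any⁻ (allMats F n) c
  ... | g , c₁ with any⁻ (allMats F n) c₁
  ... | h , c₂ = record
    { g = g ; h = h ; gh = gh ; hg = hg
    ; intertwine = λ v → ≐-trans (▷-cong {X = X} {Y = mul (mul g Y) h} (λ i j → matEqᵇ⁻ e₃ i j) (λ _ → refl))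
        (≐-trans (mul-▷ (mul g Y) h _) (≐-trans (▷-congʳ (mul g Y) (hg v)) (mul-▷ g Y v))) }
    where
    e₁ = matEqᵇ⁻ (proj₁ (∧-true⁻ {matEqᵇ F (mul g h) (idMat F)} c₂))
    e₂ = matEqᵇ⁻ (proj₁ (∧-true⁻ {matEqᵇ F (mul h g) (idMat F)} (proj₂ (∧-true⁻ {matEqᵇ F (mul g h) (idMat F)} c₂))))
    e₃ = proj₂ (∧-true⁻ {matEqᵇ F (mul h g) (idMat F)} (proj₂ (∧-true⁻ {matEqᵇ F (mul g h) (idMat F)} c₂)))
    gh : ∀ v → g ▷ h ▷ v ≐ v
    gh v = ≐-trans (≐-sym (mul-▷ g h v)) (≐-trans (▷-cong {X = mul g h} {Y = idMat F} e₁ (λ _ → refl)) (id▷ v))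
    hg : ∀ v → h ▷ g ▷ v ≐ v
    hg v = ≐-trans (≐-sym (mul-▷ h g v)) (≐-trans (▷-cong {X = mul h g} {Y = idMat F} e₂ (λ _ → refl)) (id▷ v))

  conjugateᵇ⁺ : ∀ {n} {X Y : Sq n} → Similar X Y → conjugateᵇ F X Y ≡ true
  conjugateᵇ⁺ {n} {X} {Y} S with representative (𝕄 n) (Similar.g S) | representative (𝕄 n) (Similar.h S)
  ... | g′ , g′∈ , g′≈ | h′ , h′∈ , h′≈ = any⁺ g′∈ (any⁺ h′∈ (∧-true⁺ (matEqᵇ⁺ e₁) (∧-true⁺ (matEqᵇ⁺ e₂) (matEqᵇ⁺ e₃))))
    where
    open Similar S
    g▷ : ∀ v → g′ ▷ v ≐ g ▷ v
    g▷ v = ▷-cong g′≈ (λ _ → refl)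
    h▷ : ∀ v → h′ ▷ v ≐ h ▷ v
    h▷ v = ▷-cong h′≈ (λ _ → refl)
    e₁ : ∀ i → mul g′ h′ i ≐ idMat F i
    e₁ = ▷-ext (mul g′ h′) (idMat F) (λ v → ≐-trans (mul-▷ g′ h′ v) (≐-trans (g▷ (h′ ▷ v))
      (≐-trans (▷-congʳ g (h▷ v)) (≐-trans (gh v) (≐-sym (id▷ v))))))
    e₂ : ∀ i → mul h′ g′ i ≐ idMat F i
    e₂ = ▷-ext (mul h′ g′) (idMat F) (λ v → ≐-trans (mul-▷ h′ g′ v) (≐-trans (h▷ (g′ ▷ v))
      (≐-trans (▷-congʳ h (g▷ v)) (≐-trans (hg v) (≐-sym (id▷ v))))))
    e₃ : ∀ i → X i ≐ mul (mul g′ Y) h′ i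
    e₃ = ▷-ext X (mul (mul g′ Y) h′) (λ v → ≐-sym (≐-trans (mul-▷ (mul g′ Y) h′ v) (≐-trans (mul-▷ g′ Y (h′ ▷ v))
      (≐-trans (g▷ (Y ▷ h′ ▷ v)) (≐-trans (≐-sym (intertwine (h′ ▷ v)))
      (▷-congʳ X (≐-trans (▷-congʳ g (h▷ v)) (gh v))))))))

  Nil : ∀ {n} → List ℕ → Sq n → Set
  Nil Λ X = ∀ i j → blk F Λ (toℕ j) ≤ blk F Λ (toℕ i) → X i j ≡ 0#

  nil? : ∀ {n} Λ (X : Sq n) → Dec (Nil Λ X)
  nil? Λ X = FinP.all? (λ i → FinP.all? (λ j → (blk F Λ (toℕ j) ℕP.≤? blk F Λ (toℕ i)) →-dec decEq (X i j) 0#))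

  inNilradical⁻ : ∀ {n} Λ {X : Sq n} → inNilradical F Λ X ≡ true → Nil Λ X
  inNilradical⁻ Λ {X} h i j le with blk F Λ (toℕ j) ≤ᵇ blk F Λ (toℕ i) | ℕP.≤⇒≤ᵇ le | all⁻ (all⁻ h (∈-allFin i)) (∈-allFin j)
  ... | true | _ | e = eqᵇ⁻ e

  inNilradical⁺ : ∀ {n} Λ {X : Sq n} → Nil Λ X → inNilradical F Λ X ≡ true
  inNilradical⁺ {n} Λ {X} h = all⁺ (allFin n) (λ i → all⁺ (allFin n) (entry i))
    where
    entry : ∀ i j → not (blk F Λ (toℕ j) ≤ᵇ blk F Λ (toℕ i)) ∨ eqᵇ F (X i j) 0# ≡ true
    entry i j with blk F Λ (toℕ j) ≤ᵇ blk F Λ (toℕ i) in eq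
    ... | false = refl
    ... | true  = eqᵇ⁺ (h i j (ℕP.≤ᵇ⇒≤ _ _ (subst T (sym eq) tt)))

  blk-mono : ∀ Λ {i j} → i ≤ j → blk F Λ i ≤ blk F Λ j
  blk-mono []      le = z≤n
  blk-mono (a ∷ Λ) {i} {j} le with split a i
  ... | lower i<a = subst (_≤ blk F (a ∷ Λ) j) (sym (blk-< Λ i<a)) z≤n
  ... | upper i′ with split a j
  ...   | lower j<a = ⊥-elim (ℕP.<⇒≱ j<a (ℕP.≤-trans (ℕP.m≤m+n a i′) le))
  ...   | upper j′ = subst₂ _≤_ (sym (blk-+ a i′ Λ)) (sym (blk-+ a j′ Λ)) (s≤s (blk-mono Λ (ℕP.+-cancelˡ-≤ a i′ j′ le)))

  -- Here η stands for the conjugate of the Jordan type. Only the first `length η` powers are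
  -- tested; together with the size of X these determine the class when η = `conj μ`.
  Type : ∀ {n} → Sq n → List ℕ → Set
  Type X η = ∀ (i : Fin (length η)) → ker X (suc (toℕ i)) ≡ size ^ psum (suc (toℕ i)) η

  type? : ∀ {n} (X : Sq n) η → Dec (Type X η)
  type? X η = FinP.all? (λ i → ker X (suc (toℕ i)) ℕP.≟ size ^ psum (suc (toℕ i)) η)

  1<size : 1 < size
  1<size = subst (1 <_) (sym size≡suc) (s≤s (ℕP.n≢0⇒n>0 pred-size≢0))

  size^-injective : ∀ {m n} → size ^ m ≡ size ^ n → m ≡ n
  size^-injective {m} {n} e with ℕP.<-cmp m n
  ... | tri< lt _ _ = ⊥-elim (ℕP.<-irrefl e (ℕP.^-monoʳ-< size 1<size lt))
  ... | tri≈ _ eq _ = eq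
  ... | tri> _ _ gt = ⊥-elim (ℕP.<-irrefl (sym e) (ℕP.^-monoʳ-< size 1<size gt))

  record JordanType {n} (X : Sq n) : Set where
    field
      ρ       : List ℕ
      pos     : All (0 <_) ρ
      sorted  : Sorted ρ
      total   : sum ρ ≡ n
      similar : Similar X (jordan F n ρ)

  jordan-type : ∀ {n} Λ (X : Sq n) → Nil Λ X → JordanType X
  jordan-type Λ X nil with jordan-form X (λ i j le → nil i j (blk-mono Λ le))
  ... | ρ , pos , sorted , total , S = record { ρ = ρ ; pos = pos ; sorted = sorted ; total = total ; similar = S }

  module _ {n : ℕ} {X : Sq n} (τ : JordanType X) where
    open JordanType τ

    ker-type : ∀ i → ker X i ≡ size ^ minsum i ρ
    ker-type i = trans (ker-similar similar i) (go total)
      where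
      go : ∀ {n} → sum ρ ≡ n → ker (jordan F n ρ) i ≡ size ^ minsum i ρ
      go refl = ker-jordan ρ pos i

  similar⇒type : ∀ {n} {X : Sq n} μ → IsPartition n μ → Similar X (jordan F n μ) → Type X (conj μ)
  similar⇒type {n} {X} μ (pos , linked , total) S i = trans (ker-type τ _) (cong (size ^_) (sym (psum-conj μ _ (conj-bound μ i))))
    where
    τ : JordanType X
    τ = record { ρ = μ ; pos = pos ; sorted = linked⇒sorted linked ; total = total ; similar = S }

  -- Membership in a nilradical guarantees some Jordan form ρ over F. Equality of kernel sizes,
  -- compared as exponents of q, leaves only ρ = μ.
  type⇒similar : ∀ {n} {X : Sq n} Λ μ → IsPartition n μ → Nil Λ X → Type X (conj μ) → Similar X (jordan F n μ)
  type⇒similar {n} {X} Λ μ (pos , linked , total) nil ty = subst (λ μ → Similar X (jordan F n μ)) ρ≡μ τ.similar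
    where
    τ = jordan-type Λ X nil
    module τ = JordanType τ
    ρ≡μ : τ.ρ ≡ μ
    ρ≡μ = partition-unique τ.ρ μ τ.pos pos τ.sorted (linked⇒sorted linked) (trans τ.total (sym total))
      (λ i i<L → size^-injective (trans (sym (ker-type τ (suc i)))
        (trans (cong (λ t → ker X (suc t)) (sym (FinP.toℕ-fromℕ< (subst (i <_) (sym (length-conj μ)) i<L))))
        (trans (ty (Fin.fromℕ< (subst (i <_) (sym (length-conj μ)) i<L)))
        (cong (size ^_) (trans (cong (λ t → psum (suc t) (conj μ)) (FinP.toℕ-fromℕ< _)) (psum-conj μ (suc i) i<L)))))))

  -- The count of the statement in terms of types. In contrast to a Jordan type, η may contain zero
  -- rows, which appear when strips are removed at fixed length.
  FT : (n : ℕ) (η Λ : List ℕ) → ℕ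
  FT n η Λ = ∑[ 𝕄 n ] (λ X → χ (nil? Λ X ×-dec type? X η))

  Fcount≡FT : ∀ n μ Λ → IsPartition n μ → Fcount F n μ Λ ≡ FT n (conj μ) Λ
  Fcount≡FT n μ Λ part = trans (length-filterᵇ _ (allMats F n)) (∑-cong (allMats F n) indicator)
    where
    indicator : ∀ X → 𝟙 (inNilradical F Λ X ∧ conjugateᵇ F X (jordan F n μ)) ≡ χ (nil? Λ X ×-dec type? X (conj μ))
    indicator X with inNilradical F Λ X in e₁ | conjugateᵇ F X (jordan F n μ) in e₂
    ... | true  | true  = sym (χ-yes (nil? Λ X ×-dec type? X (conj μ)) (inNilradical⁻ Λ e₁ , similar⇒type μ part (conjugateᵇ⁻ e₂)))
    ... | true  | false = sym (χ-no (nil? Λ X ×-dec type? X (conj μ)) (λ (nil , ty) →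
            case trans (sym e₂) (conjugateᵇ⁺ (type⇒similar Λ μ part nil ty)) of λ ()))
    ... | false | _     = sym (χ-no (nil? Λ X ×-dec type? X (conj μ)) (λ (nil , ty) →
            case trans (sym e₁) (inNilradical⁺ Λ nil) of λ ()))

-- Extending a nilpotent matrix by a last block of columns.

module CornerMatrices (F : FiniteField) where

  open import Defs hiding (FiniteField)
  open Counting
  open LinearAlgebra F
  open JordanExistence F
  open JordanKernels F
  open PartitionLists
  open KernelTypes F
  open import Data.Nat.Base as ℕ using (ℕ; zero; suc; _≤_; _<_; z≤n; s≤s; _^_)
  import Data.Nat.Properties as ℕP
  open import Data.Nat.Tactic.RingSolver using (solve-∀)
  open import Data.Nat.ListAction using (sum)
  open import Data.Fin.Base as Fin using (Fin; toℕ; _↑ˡ_; _↑ʳ_)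
  import Data.Fin.Properties as FinP
  open import Data.List.Base using (List; []; _∷_; _∷ʳ_; map; length; lookup)
  open import Data.List.Relation.Unary.All as All using (All; []; _∷_)
  open import Data.List.Relation.Unary.AllPairs using ([]; _∷_)
  open import Data.List.Membership.Propositional.Properties using (∈-lookup)
  open import Data.Product.Base using (_×_; _,_; proj₁; proj₂)
  open import Data.Sum.Base using (inj₁; inj₂)
  open import Data.Empty using (⊥-elim)
  open import Data.Vec.Functional using (Vector) renaming (_∷_ to _∷ᶠ_; _++_ to _++ᶠ_)
  open import Data.Vec.Functional.Properties using (lookup-++ˡ; lookup-++ʳ)
  open import Function.Base using (_∘_)
  open import Relation.Nullary using (Dec; yes; no)
  open import Relation.Nullary.Decidable using (_×-dec_; _→-dec_)
  open import Relation.Binary.PropositionalEquality hiding (J; resp)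

  blk-snoc-< : ∀ Λ k {i} → i < sum Λ → blk F (Λ ∷ʳ k) i ≡ blk F Λ i
  blk-snoc-< (a ∷ Λ) k {i} p with split a i
  ... | lower i<a = trans (blk-< (Λ ∷ʳ k) i<a) (sym (blk-< Λ i<a))
  ... | upper i′  = trans (blk-+ a i′ (Λ ∷ʳ k)) (trans (cong suc (blk-snoc-< Λ k (ℕP.+-cancelˡ-< a i′ (sum Λ) p))) (sym (blk-+ a i′ Λ)))

  blk<length : ∀ Λ {i} → i < sum Λ → blk F Λ i < length Λ
  blk<length (a ∷ Λ) {i} p with split a i
  ... | lower i<a = subst (_< suc (length Λ)) (sym (blk-< Λ i<a)) (s≤s z≤n)
  ... | upper i′  = subst (_< suc (length Λ)) (sym (blk-+ a i′ Λ)) (s≤s (blk<length Λ (ℕP.+-cancelˡ-< a i′ (sum Λ) p)))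

  blk-snoc-≥ : ∀ Λ k {l} → l < k → blk F (Λ ∷ʳ k) (sum Λ ℕ.+ l) ≡ length Λ
  blk-snoc-≥ []      k p = blk-< [] p
  blk-snoc-≥ (a ∷ Λ) k {l} p = trans (cong (blk F (a ∷ (Λ ∷ʳ k))) (ℕP.+-assoc a (sum Λ) l))
    (trans (blk-+ a (sum Λ ℕ.+ l) (Λ ∷ʳ k)) (cong suc (blk-snoc-≥ Λ k p)))

  ++ᶠ-cong : ∀ {m k} {x x′ : V m} {y y′ : V k} → x ≐ x′ → y ≐ y′ → x ++ᶠ y ≐ x′ ++ᶠ y′
  ++ᶠ-cong {m} {k} {x} {x′} {y} {y′} p q = by-parts
    (λ l → trans (lookup-++ˡ x y l) (trans (p l) (sym (lookup-++ˡ x′ y′ l))))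
    (λ l → trans (lookup-++ʳ x y l) (trans (q l) (sym (lookup-++ʳ x′ y′ l))))

  dot-++ : ∀ {m k} (x x′ : V m) (y y′ : V k) → dot (x ++ᶠ y) (x′ ++ᶠ y′) ≡ dot x x′ +ᶠ dot y y′
  dot-++ {m} x x′ y y′ = trans (Σᶠ-++ m _) (cong₂ _+ᶠ_
    (dot-cong (lookup-++ˡ x y) (lookup-++ˡ x′ y′)) (dot-cong (lookup-++ʳ x y) (lookup-++ʳ x′ y′)))

  corner : ∀ {m k} → Sq m → Vector (V k) m → Sq (m ℕ.+ k)
  corner X Y = (λ i → X i ++ᶠ Y i) ++ᶠ (λ _ → 0ᵥ)

  module _ {m k : ℕ} (X : Sq m) (Y : Vector (V k) m) where

    corner-↑ˡ : ∀ i → corner X Y (i ↑ˡ k) ≡ X i ++ᶠ Y i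
    corner-↑ˡ i = lookup-++ˡ (λ i → X i ++ᶠ Y i) (λ _ → 0ᵥ) i

    corner-↑ʳ : ∀ i → corner X Y (m ↑ʳ i) ≡ 0ᵥ
    corner-↑ʳ i = lookup-++ʳ (λ i → X i ++ᶠ Y i) (λ (_ : Fin k) → 0ᵥ) i

    corner-▷ : ∀ w z → corner X Y ▷ (w ++ᶠ z) ≐ ((X ▷ w) +ᵥ (Y ▷ z)) ++ᶠ 0ᵥ
    corner-▷ w z = by-parts
      (λ l → trans (cong (λ r → dot r (w ++ᶠ z)) (corner-↑ˡ l)) (trans (dot-++ (X l) w (Y l) z) (sym (lookup-++ˡ ((X ▷ w) +ᵥ (Y ▷ z)) (0ᵥ {k}) l))))
      (λ l → trans (cong (λ r → dot r (w ++ᶠ z)) (corner-↑ʳ l)) (trans (dot-0ˡ (w ++ᶠ z)) (sym (lookup-++ʳ ((X ▷ w) +ᵥ (Y ▷ z)) (0ᵥ {k}) l))))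

    corner-pw : ∀ i u → pw (corner X Y) i (u ++ᶠ 0ᵥ) ≐ pw X i u ++ᶠ 0ᵥ
    corner-pw zero    u = λ _ → refl
    corner-pw (suc i) u = ≐-trans (▷-congʳ (corner X Y) (corner-pw i u)) (≐-trans (corner-▷ (pw X i u) 0ᵥ)
      (++ᶠ-cong {y = 0ᵥ} (λ l → trans (cong (_ +ᶠ_) (▷-0 Y l)) (𝕂.+-identityʳ _)) (λ _ → refl)))

    -- The matrix sends (w, z) to (X w + Y z, 0) and acts as X on vectors of the form (u, 0). So its
    -- power i + 1 sends (w, z) to (Xⁱ (X w + Y z), 0).
    ker-corner : ∀ i → ker (corner X Y) (suc i) ≡ ∑[ 𝕍 k ] (λ z → ∑[ 𝕍 m ] (λ w → χ (0ᵥ? (pw X i ((X ▷ w) +ᵥ (Y ▷ z))))))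
    ker-corner i = begin
      ∑[ 𝕍 (m ℕ.+ k) ] (λ v → χ (0ᵥ? (pw C (suc i) v)))
        ≡⟨ ∑-++ᶠ (𝔽 F) m (λ v → χ (0ᵥ? (pw C (suc i) v))) (λ {x} {y} e → χ-cong (0ᵥ? (pw C (suc i) x)) (0ᵥ? (pw C (suc i) y))
             (≐-trans (pw-cong C (suc i) (≐-sym e))) (≐-trans (pw-cong C (suc i) e))) ⟩
      ∑[ 𝕍 m ] (λ w → ∑[ 𝕍 k ] (λ z → χ (0ᵥ? (pw C (suc i) (w ++ᶠ z)))))
        ≡⟨ ∑-cong (FinSetoid.elements (𝕍 m)) (λ w → ∑-cong (FinSetoid.elements (𝕍 k)) (λ z →
             χ-cong (0ᵥ? (pw C (suc i) (w ++ᶠ z))) (0ᵥ? (pw X i ((X ▷ w) +ᵥ (Y ▷ z))))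
               (λ e l → trans (sym (lookup-++ˡ (pw X i ((X ▷ w) +ᵥ (Y ▷ z))) (0ᵥ {k}) l)) (trans (sym (power w z (l ↑ˡ k))) (e (l ↑ˡ k))))
               (λ e → ≐-trans (power w z) (by-parts
                 (λ l → trans (lookup-++ˡ (pw X i ((X ▷ w) +ᵥ (Y ▷ z))) (0ᵥ {k}) l) (e l))
                 (λ l → lookup-++ʳ (pw X i ((X ▷ w) +ᵥ (Y ▷ z))) (0ᵥ {k}) l))))) ⟩
      ∑[ 𝕍 m ] (λ w → ∑[ 𝕍 k ] (λ z → χ (0ᵥ? (pw X i ((X ▷ w) +ᵥ (Y ▷ z))))))
        ≡⟨ ∑-swap (FinSetoid.elements (𝕍 m)) (FinSetoid.elements (𝕍 k)) _ ⟩
      ∑[ 𝕍 k ] (λ z → ∑[ 𝕍 m ] (λ w → χ (0ᵥ? (pw X i ((X ▷ w) +ᵥ (Y ▷ z)))))) ∎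
      where
      open ≡-Reasoning
      C = corner X Y
      power : ∀ w z → pw C (suc i) (w ++ᶠ z) ≐ pw X i ((X ▷ w) +ᵥ (Y ▷ z)) ++ᶠ 0ᵥ
      power w z = ≐-trans (pw-suc C i (w ++ᶠ z)) (≐-trans (pw-cong C i (corner-▷ w z)) (corner-pw i _))

  type-ext : ∀ {m n} (X : Sq m) (Y : Sq n) → (∀ i → ker X (suc i) ≡ ker Y (suc i)) → ∀ η → Type X η → Type Y η
  type-ext X Y e η t i = trans (sym (e (toℕ i))) (t i)

  sq-ker-cong : ∀ {n} {X Y : Sq n} → (∀ i → X i ≐ Y i) → ∀ i → ker X i ≡ ker Y i
  sq-ker-cong e = ker-cong (λ v → ▷-cong e (λ _ → refl))

  module _ (Λ : List ℕ) (k : ℕ) where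
    private
      m = sum Λ

      blk-low : ∀ (i : Fin m) → blk F (Λ ∷ʳ k) (toℕ (i ↑ˡ k)) ≡ blk F Λ (toℕ i)
      blk-low i = trans (cong (blk F (Λ ∷ʳ k)) (FinP.toℕ-↑ˡ i k)) (blk-snoc-< Λ k (FinP.toℕ<n i))

      blk-high : ∀ (i : Fin k) → blk F (Λ ∷ʳ k) (toℕ (m ↑ʳ i)) ≡ length Λ
      blk-high i = trans (cong (blk F (Λ ∷ʳ k)) (FinP.toℕ-↑ʳ m i)) (blk-snoc-≥ Λ k (FinP.toℕ<n i))

      blk-≤ : ∀ (i : Fin (m ℕ.+ k)) → blk F (Λ ∷ʳ k) (toℕ i) ≤ length Λ
      blk-≤ = by-parts (λ l → subst (_≤ length Λ) (sym (blk-low l)) (ℕP.<⇒≤ (blk<length Λ (FinP.toℕ<n l))))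
                       (λ l → ℕP.≤-reflexive (blk-high l))

      A = 𝕄 m ⊗ Fun F m (𝕍 k)

      top : Sq (m ℕ.+ k) → Sq m × Vector (V k) m
      top Z = (λ i j → Z (i ↑ˡ k) (j ↑ˡ k)) , (λ i j → Z (i ↑ˡ k) (m ↑ʳ j))

      join : Sq m × Vector (V k) m → Sq (m ℕ.+ k)
      join (X , Y) = corner X Y

      join-cong : ∀ {p p′} → FinSetoid._≈_ A p p′ → ∀ i → join p i ≐ join p′ i
      join-cong {X , Y} {X′ , Y′} (e , e′) = by-parts
        (λ l j → trans (cong (λ r → r j) (corner-↑ˡ X Y l)) (trans (++ᶠ-cong (e l) (e′ l) j) (sym (cong (λ r → r j) (corner-↑ˡ X′ Y′ l)))))
        (λ l j → trans (cong (λ r → r j) (corner-↑ʳ X Y l)) (sym (cong (λ r → r j) (corner-↑ʳ X′ Y′ l))))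

      top-join : ∀ p → FinSetoid._≈_ A (top (join p)) p
      top-join (X , Y) = (λ i j → trans (cong (λ r → r (j ↑ˡ k)) (corner-↑ˡ X Y i)) (lookup-++ˡ (X i) (Y i) j))
                       , (λ i j → trans (cong (λ r → r (m ↑ʳ j)) (corner-↑ˡ X Y i)) (lookup-++ʳ (X i) (Y i) j))

      join-top : ∀ Z → Nil (Λ ∷ʳ k) Z → ∀ i → join (top Z) i ≐ Z i
      join-top Z nil = by-parts
        (λ l → by-parts
          (λ j → trans (cong (λ r → r (j ↑ˡ k)) (corner-↑ˡ X Y l)) (lookup-++ˡ (X l) (Y l) j))
          (λ j → trans (cong (λ r → r (m ↑ʳ j)) (corner-↑ˡ X Y l)) (lookup-++ʳ (X l) (Y l) j)))
        (λ l j → trans (cong (λ r → r j) (corner-↑ʳ X Y l)) (sym (nil (m ↑ʳ l) j (subst (blk F (Λ ∷ʳ k) (toℕ j) ≤_) (sym (blk-high l)) (blk-≤ j)))))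
        where
        X = proj₁ (top Z)
        Y = proj₂ (top Z)

      nil-corner⁻ : ∀ X Y → Nil (Λ ∷ʳ k) (corner X Y) → Nil Λ X
      nil-corner⁻ X Y nil i j le = trans (sym (proj₁ (top-join (X , Y)) i j))
        (nil (i ↑ˡ k) (j ↑ˡ k) (subst₂ _≤_ (sym (blk-low j)) (sym (blk-low i)) le))

      nil-corner⁺ : ∀ X Y → Nil Λ X → Nil (Λ ∷ʳ k) (corner X Y)
      nil-corner⁺ X Y nil = by-parts
        (λ l → by-parts
          (λ j le → trans (proj₁ (top-join (X , Y)) l j) (nil l j (subst₂ _≤_ (blk-low j) (blk-low l) le)))
          (λ j le → ⊥-elim (ℕP.<⇒≱ (blk<length Λ (FinP.toℕ<n l)) (subst₂ _≤_ (blk-high j) (blk-low l) le))))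
        (λ l j _ → cong (λ r → r j) (corner-↑ʳ X Y l))

    FT-snoc : ∀ η → FT (m ℕ.+ k) η (Λ ∷ʳ k) ≡
      ∑[ 𝕄 m ] (λ X → χ (nil? Λ X) ℕ.* ∑[ Fun F m (𝕍 k) ] (λ Y → χ (type? (corner X Y) η)))
    FT-snoc η = begin
      ∑[ 𝕄 (m ℕ.+ k) ] φ
        -- Matrices outside the nilradical have weight zero, so `join` has to invert `top` only on
        -- the nilradical.
        ≡⟨ sym (∑-reindex A (𝕄 (m ℕ.+ k)) join top φ join-cong (λ e → (λ i j → e (i ↑ˡ k) (j ↑ˡ k)) , (λ i j → e (i ↑ˡ k) (m ↑ʳ j))) top-join
             (λ Z → support Z)
             (λ {Z} {Z′} e → χ-cong (nil? (Λ ∷ʳ k) Z ×-dec type? Z η) (nil? (Λ ∷ʳ k) Z′ ×-dec type? Z′ η)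
                (transfer e) (transfer (λ i j → sym (e i j))))) ⟩
      ∑[ A ] (φ ∘ join)
        ≡⟨ ∑-⊗ (𝕄 m) (Fun F m (𝕍 k)) (φ ∘ join) ⟩
      ∑[ 𝕄 m ] (λ X → ∑[ Fun F m (𝕍 k) ] (λ Y → φ (corner X Y)))
        ≡⟨ ∑-cong (FinSetoid.elements (𝕄 m)) (λ X → trans (∑-cong (FinSetoid.elements (Fun F m (𝕍 k))) (λ Y →
             trans (χ-× (nil? (Λ ∷ʳ k) (corner X Y)) (type? (corner X Y) η))
               (cong (ℕ._* χ (type? (corner X Y) η)) (χ-cong (nil? (Λ ∷ʳ k) (corner X Y)) (nil? Λ X) (nil-corner⁻ X Y) (nil-corner⁺ X Y)))))
             (∑-*ˡ (FinSetoid.elements (Fun F m (𝕍 k))) (χ (nil? Λ X)) _)) ⟩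
      ∑[ 𝕄 m ] (λ X → χ (nil? Λ X) ℕ.* ∑[ Fun F m (𝕍 k) ] (λ Y → χ (type? (corner X Y) η))) ∎
      where
      open ≡-Reasoning
      open import Data.Sum.Base using (_⊎_)
      φ : Sq (m ℕ.+ k) → ℕ
      φ Z = χ (nil? (Λ ∷ʳ k) Z ×-dec type? Z η)
      support : ∀ Z → φ Z ≡ 0 ⊎ (∀ i → join (top Z) i ≐ Z i)
      support Z with nil? (Λ ∷ʳ k) Z
      ... | yes nil = inj₂ (join-top Z nil)
      ... | no ¬nil = inj₁ refl
      transfer : ∀ {Z Z′ : Sq (m ℕ.+ k)} → (∀ i → Z i ≐ Z′ i) → Nil (Λ ∷ʳ k) Z × Type Z η → Nil (Λ ∷ʳ k) Z′ × Type Z′ η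
      transfer {Z} {Z′} e (nil , ty) = (λ i j le → trans (sym (e i j)) (nil i j le)) , type-ext Z Z′ (λ i → sq-ker-cong e (suc i)) η ty

  -- The number of rows of Y that do not sit at the end of a Jordan block. Each of them is arbitrary
  -- and contributes a free factor.
  defect : List ℕ → ℕ
  defect ρ = sum (map ℕ.pred ρ)

  module _ (A : FinSetoid) where
    open FinSetoid A using (Carrier; _≈_; ≈-refl; elements)
    private
      ∑-last : ∀ a (φ : Carrier → ℕ) → (∀ {x y} → x ≈ y → φ x ≡ φ y) →
               ∑[ Fun F (suc a) A ] (λ v → φ (v (Fin.fromℕ a))) ≡ ∣ A ∣ ^ a ℕ.* ∑[ A ] φ
      ∑-last zero    φ φ-cong = trans (∑-allFuns F 0 elements (λ v → φ (v Fin.zero)))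
        (trans (∑-cong elements (λ c → ℕP.+-identityʳ (φ c))) (sym (ℕP.+-identityʳ _)))
      ∑-last (suc a) φ φ-cong = trans (∑-allFuns F (suc a) elements (λ v → φ (v (Fin.fromℕ (suc a)))))
        (trans (∑-const elements _) (trans (cong (∣ A ∣ ℕ.*_) (∑-last a φ φ-cong)) (sym (ℕP.*-assoc ∣ A ∣ _ _))))

    ∑-ends : ∀ ρ (pos : All (0 <_) ρ) (Φ : Vector Carrier (length ρ) → ℕ) → (∀ {x y} → (∀ b → x b ≈ y b) → Φ x ≡ Φ y) →
      ∑[ Fun F (sum ρ) A ] (λ Y → Φ (Y ∘ endIx ρ pos)) ≡ ∣ A ∣ ^ defect ρ ℕ.* ∑[ Fun F (length ρ) A ] Φ
    ∑-ends [] [] Φ Φ-cong = trans (∑-cong (FinSetoid.elements (Fun F 0 A)) (λ Y → Φ-cong {Y ∘ endIx [] []} {Y} (λ ()))) (sym (ℕP.+-identityʳ _))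
    ∑-ends (suc a ∷ ρ) (s≤s z≤n ∷ pos) Φ Φ-cong = begin
      ∑[ Fun F (suc a ℕ.+ m) A ] (λ Y → Φ (Y ∘ endIx (suc a ∷ ρ) (s≤s z≤n ∷ pos)))
        ≡⟨ ∑-++ᶠ A (suc a) (λ Y → Φ (Y ∘ endIx (suc a ∷ ρ) (s≤s z≤n ∷ pos))) (λ e → Φ-cong (λ b → e (endIx (suc a ∷ ρ) (s≤s z≤n ∷ pos) b))) ⟩
      ∑[ Fun F (suc a) A ] (λ x → ∑[ Fun F m A ] (λ y → Φ ((x ++ᶠ y) ∘ endIx (suc a ∷ ρ) (s≤s z≤n ∷ pos))))
        ≡⟨ ∑-cong (FinSetoid.elements (Fun F (suc a) A)) (λ x → ∑-cong (FinSetoid.elements (Fun F m A)) (λ y → Φ-cong (ends x y))) ⟩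
      ∑[ Fun F (suc a) A ] (λ x → ∑[ Fun F m A ] (λ y → Φ (x (Fin.fromℕ a) ∷ᶠ (y ∘ endIx ρ pos))))
        ≡⟨ ∑-cong (FinSetoid.elements (Fun F (suc a) A)) (λ x → ∑-ends ρ pos (λ y → Φ (x (Fin.fromℕ a) ∷ᶠ y)) (λ e → Φ-cong (∷-cong ≈-refl e))) ⟩
      ∑[ Fun F (suc a) A ] (λ x → ∣ A ∣ ^ defect ρ ℕ.* ∑[ Fun F (length ρ) A ] (λ y → Φ (x (Fin.fromℕ a) ∷ᶠ y)))
        ≡⟨ trans (∑-*ˡ (FinSetoid.elements (Fun F (suc a) A)) (∣ A ∣ ^ defect ρ) _)
            (cong (∣ A ∣ ^ defect ρ ℕ.*_) (∑-last a (λ c → ∑[ Fun F (length ρ) A ] (λ y → Φ (c ∷ᶠ y)))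
              (λ c≈ → ∑-cong (FinSetoid.elements (Fun F (length ρ) A)) (λ y → Φ-cong (∷-cong c≈ (λ _ → ≈-refl)))))) ⟩
      ∣ A ∣ ^ defect ρ ℕ.* (∣ A ∣ ^ a ℕ.* ∑[ A ] (λ c → ∑[ Fun F (length ρ) A ] (λ y → Φ (c ∷ᶠ y))))
        ≡⟨ cong (λ t → ∣ A ∣ ^ defect ρ ℕ.* (∣ A ∣ ^ a ℕ.* t)) (sym (∑-allFuns F (length ρ) elements Φ)) ⟩
      ∣ A ∣ ^ defect ρ ℕ.* (∣ A ∣ ^ a ℕ.* ∑[ Fun F (suc (length ρ)) A ] Φ)
        ≡⟨ trans (regroup (∣ A ∣ ^ defect ρ) (∣ A ∣ ^ a) _) (cong (ℕ._* ∑[ Fun F (suc (length ρ)) A ] Φ) (sym (ℕP.^-distribˡ-+-* ∣ A ∣ a (defect ρ)))) ⟩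
      ∣ A ∣ ^ (a ℕ.+ defect ρ) ℕ.* ∑[ Fun F (suc (length ρ)) A ] Φ ∎
      where
      open ≡-Reasoning
      m = sum ρ
      regroup : ∀ a b c → a ℕ.* (b ℕ.* c) ≡ b ℕ.* a ℕ.* c
      regroup = solve-∀
      ∷-cong : ∀ {n} {c d : Carrier} {x y : Vector Carrier n} → c ≈ d → (∀ i → x i ≈ y i) → ∀ i → (c ∷ᶠ x) i ≈ (d ∷ᶠ y) i
      ∷-cong p q Fin.zero    = p
      ∷-cong p q (Fin.suc i) = q i
      ends : ∀ x y b → FinSetoid._≈_ A (((x ++ᶠ y) ∘ endIx (suc a ∷ ρ) (s≤s z≤n ∷ pos)) b) ((x (Fin.fromℕ a) ∷ᶠ (y ∘ endIx ρ pos)) b)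
      ends x y Fin.zero    = subst (_≈ x (Fin.fromℕ a)) (sym (lookup-++ˡ x y (Fin.fromℕ a))) ≈-refl
      ends x y (Fin.suc b) = subst (_≈ y (endIx ρ pos b)) (sym (lookup-++ʳ x y (endIx ρ pos b))) ≈-refl

  common : ∀ {l k} → ℕ → Vector (V k) l → Subspace k
  common c y = record
    { Mem  = λ z → ∀ b → toℕ b < c → dot (y b) z ≡ 0#
    ; mem? = λ z → FinP.all? (λ b → (toℕ b ℕP.<? c) →-dec decEq (dot (y b) z) 0#)
    ; resp = λ e h b b<c → trans (dot-cong {u = y b} (λ _ → refl) (λ i → sym (e i))) (h b b<c)
    ; 0∈   = λ b _ → dot-0ʳ (y b)
    ; +∈   = λ h h′ b b<c → trans (dot-+ʳ (y b) _ _) (trans (cong₂ _+ᶠ_ (h b b<c) (h′ b b<c)) (𝕂.+-identityʳ 0#))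
    ; *∈   = λ c h b b<c → trans (dot-*ʳ (y b) c _) (trans (cong (c *ᶠ_) (h b b<c)) (𝕂.zeroʳ c))
    }

  open Subspace using (card; mem?)

  card-common-cong : ∀ {l l′ k} c c′ (y : Vector (V k) l) (y′ : Vector (V k) l′) →
    (∀ z → Subspace.Mem (common c y) z → Subspace.Mem (common c′ y′) z) →
    (∀ z → Subspace.Mem (common c′ y′) z → Subspace.Mem (common c y) z) →
    card (common c y) ≡ card (common c′ y′)
  card-common-cong {k = k} c c′ y y′ f g = ∑-cong (FinSetoid.elements (𝕍 k)) (λ z → χ-cong (mem? (common c y) z) (mem? (common c′ y′) z) (f z) (g z))

  -- Since the parts decrease, the blocks of size greater than i are the first `cnt i ρ` ones. This
  -- turns the condition on block ends into a common kernel of an initial segment of rows.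
  lookup-cnt⁺ : ∀ {ρ} → Sorted ρ → ∀ {i} b → i < lookup ρ b → toℕ b < cnt i ρ
  lookup-cnt⁺ {a ∷ ρ} (p ∷ s) {i} Fin.zero    i<a = subst (0 <_) (sym (trans (cnt-∷ i a ρ) (cong (ℕ._+ cnt i ρ) (gt-yes i<a)))) (s≤s z≤n)
  lookup-cnt⁺ {a ∷ ρ} (p ∷ s) {i} (Fin.suc b) i<  = subst (suc (toℕ b) <_) (sym (trans (cnt-∷ i a ρ)
    (cong (ℕ._+ cnt i ρ) (gt-yes (ℕP.<-≤-trans i< (All.lookup p (∈-lookup {xs = ρ} b))))))) (s≤s (lookup-cnt⁺ s b i<))

  lookup-cnt⁻ : ∀ {ρ} → Sorted ρ → ∀ {i} b → toℕ b < cnt i ρ → i < lookup ρ b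
  lookup-cnt⁻ {a ∷ ρ} (p ∷ s) {i} b b< with i ℕP.<? a
  lookup-cnt⁻ {a ∷ ρ} (p ∷ s) {i} Fin.zero    b< | yes i<a = i<a
  lookup-cnt⁻ {a ∷ ρ} (p ∷ s) {i} (Fin.suc b) b< | yes i<a = lookup-cnt⁻ s b
    (ℕP.≤-pred (subst (suc (toℕ b) <_) (trans (cnt-∷ i a ρ) (cong (ℕ._+ cnt i ρ) (gt-yes i<a))) b<))
  ... | no i≮a = ⊥-elim (ℕP.n≮0 (subst (toℕ b <_) (cnt-bounded (ℕP.≮⇒≥ i≮a ∷ All.map (λ le → ℕP.≤-trans le (ℕP.≮⇒≥ i≮a)) p)) b<))

  -- What the type condition on the extended matrix becomes for the rows y of Y at the block ends.
  RowType : ∀ (η ρ : List ℕ) {l k} → Vector (V k) l → Set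
  RowType η ρ y = ∀ (i : Fin (length η)) → size ^ minsum (suc (toℕ i)) ρ ℕ.* card (common (cnt (toℕ i) ρ) y) ≡ size ^ psum (suc (toℕ i)) η

  rowType? : ∀ (η ρ : List ℕ) {l k} (y : Vector (V k) l) → Dec (RowType η ρ y)
  rowType? η ρ y = FinP.all? (λ i → size ^ minsum (suc (toℕ i)) ρ ℕ.* card (common (cnt (toℕ i) ρ) y) ℕP.≟ size ^ psum (suc (toℕ i)) η)

  module _ {m k : ℕ} {X : Sq m} (τ : JordanType X) where
    open JordanType τ
    open Similar similar

    private
      go : ∀ {n} (e : sum ρ ≡ n) i (Y : Vector (V k) n) →
        ∑[ 𝕍 k ] (λ z → ∑[ 𝕍 n ] (λ w → χ (0ᵥ? (pw (jordan F n ρ) i ((jordan F n ρ ▷ w) +ᵥ (Y ▷ z))))))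
        ≡ size ^ minsum (suc i) ρ ℕ.* card (common (cnt i ρ) (λ b → Y (subst Fin e (endIx ρ pos b))))
      go refl i Y = trans (∑-cong (FinSetoid.elements (𝕍 k)) (λ z → trans (count-jordan ρ pos i (Y ▷ z))
          (cong (size ^ minsum (suc i) ρ ℕ.*_) (χ-cong (endsVanish? ρ pos i (Y ▷ z)) (mem? (common (cnt i ρ) (λ b → Y (endIx ρ pos b))) z)
            (λ h b b< → h b (lookup-cnt⁻ sorted b b<)) (λ h b i< → h b (lookup-cnt⁺ sorted b i<))))))
        (∑-*ˡ (FinSetoid.elements (𝕍 k)) (size ^ minsum (suc i) ρ) _)

    ends : ∀ {A : Set} → Vector A m → Vector A (length ρ)
    ends Y b = Y (subst Fin total (endIx ρ pos b))

    ker-corner-ends : ∀ i (Y : Vector (V k) m) →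
      ker (corner X (mul g Y)) (suc i) ≡ size ^ minsum (suc i) ρ ℕ.* card (common (cnt i ρ) (ends Y))
    ker-corner-ends i Y = trans (ker-corner X (mul g Y) i) (trans (∑-cong (FinSetoid.elements (𝕍 k)) (λ z →
        trans (∑-cong (FinSetoid.elements (𝕍 m)) (λ w → χ-cong (0ᵥ? (pw X i ((X ▷ w) +ᵥ (mul g Y ▷ z)))) (0ᵥ? (pw X i ((X ▷ w) +ᵥ (g ▷ (Y ▷ z)))))
            (≐-trans (pw-cong X i (+ᵥ-cong (λ _ → refl) (≐-sym (mul-▷ g Y z)))))
            (≐-trans (pw-cong X i (+ᵥ-cong (λ _ → refl) (mul-▷ g Y z))))))
          (count-similar similar i (Y ▷ z)))) (go total i Y))

    -- Replacing Y by g Y permutes the matrices Y and turns the kernel counts for X into those for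
    -- its Jordan form, which see only the end rows.
    count-extensions : ∀ η → ∑[ Fun F m (𝕍 k) ] (λ Y → χ (type? (corner X Y) η))
      ≡ (size ^ k) ^ defect ρ ℕ.* ∑[ Fun F (length ρ) (𝕍 k) ] (λ y → χ (rowType? η ρ y))
    count-extensions η = begin
      ∑[ 𝔸 ] (λ Y → χ (type? (corner X Y) η))
        ≡⟨ sym (∑-reindex 𝔸 𝔸 (mul g) (mul h) (λ Y → χ (type? (corner X Y) η))
             (λ e i j → dot-cong {u = g i} (λ _ → refl) (λ l → e l j)) (λ e i j → dot-cong {u = h i} (λ _ → refl) (λ l → e l j))
             (λ Y i j → hg (λ l → Y l j) i) (λ Y → inj₂ (λ i j → gh (λ l → Y l j) i))
             (λ {Y} {Y′} e → χ-cong (type? (corner X Y) η) (type? (corner X Y′) η)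
               (type-ext (corner X Y) (corner X Y′) (λ i → sq-ker-cong (corner-cong e) (suc i)) η)
               (type-ext (corner X Y′) (corner X Y) (λ i → sq-ker-cong (corner-cong (λ i j → sym (e i j))) (suc i)) η))) ⟩
      ∑[ 𝔸 ] (λ Y → χ (type? (corner X (mul g Y)) η))
        ≡⟨ ∑-cong (FinSetoid.elements 𝔸) (λ Y → χ-cong (type? (corner X (mul g Y)) η) (rowType? η ρ (ends Y))
             (λ t i → trans (sym (ker-corner-ends (toℕ i) Y)) (t i)) (λ t i → trans (ker-corner-ends (toℕ i) Y) (t i))) ⟩
      ∑[ 𝔸 ] (λ Y → χ (rowType? η ρ (ends Y)))
        ≡⟨ sum-ends total ⟩
      ∣ 𝕍 k ∣ ^ defect ρ ℕ.* ∑[ Fun F (length ρ) (𝕍 k) ] (λ y → χ (rowType? η ρ y))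
        ≡⟨ cong (λ t → t ^ defect ρ ℕ.* ∑[ Fun F (length ρ) (𝕍 k) ] (λ y → χ (rowType? η ρ y))) (trans (sym (trans (∑-const (FinSetoid.elements (𝕍 k)) 1) (ℕP.*-identityʳ _))) (∣𝕍∣ k)) ⟩
      (size ^ k) ^ defect ρ ℕ.* ∑[ Fun F (length ρ) (𝕍 k) ] (λ y → χ (rowType? η ρ y)) ∎
      where
      open ≡-Reasoning
      𝔸 = Fun F m (𝕍 k)
      corner-cong : ∀ {Y Y′ : Vector (V k) m} → (∀ i → Y i ≐ Y′ i) → ∀ i → corner X Y i ≐ corner X Y′ i
      corner-cong {Y} {Y′} e = by-parts
        (λ l j → trans (cong (λ r → r j) (corner-↑ˡ X Y l)) (trans (++ᶠ-cong {x = X l} (λ _ → refl) (e l) j) (sym (cong (λ r → r j) (corner-↑ˡ X Y′ l)))))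
        (λ l j → trans (cong (λ r → r j) (corner-↑ʳ X Y l)) (sym (cong (λ r → r j) (corner-↑ʳ X Y′ l))))
      row-cong : ∀ {x y : Vector (V k) (length ρ)} → (∀ b → x b ≐ y b) → RowType η ρ x → RowType η ρ y
      row-cong {x} {y} e t i = trans (cong (size ^ minsum (suc (toℕ i)) ρ ℕ.*_) (card-common-cong (cnt (toℕ i) ρ) (cnt (toℕ i) ρ) y x
        (λ z h b b< → trans (dot-cong (e b) (λ _ → refl)) (h b b<))
        (λ z h b b< → trans (dot-cong (λ i → sym (e b i)) (λ _ → refl)) (h b b<)))) (t i)
      sum-ends : ∀ {n} (e : sum ρ ≡ n) → ∑[ Fun F n (𝕍 k) ] (λ Y → χ (rowType? η ρ (λ b → Y (subst Fin e (endIx ρ pos b)))))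
        ≡ ∣ 𝕍 k ∣ ^ defect ρ ℕ.* ∑[ Fun F (length ρ) (𝕍 k) ] (λ y → χ (rowType? η ρ y))
      sum-ends refl = ∑-ends (𝕍 k) ρ pos (λ y → χ (rowType? η ρ y))
        (λ {x} {y} e → χ-cong (rowType? η ρ x) (rowType? η ρ y) (row-cong e) (row-cong (λ b i → sym (e b i))))

-- The weights of horizontal strips as polynomial functions.

module Weights where

  open import Data.Nat.Base as ℕ using (ℕ; zero; suc; _∸_; _≤_)
  import Data.Nat.Properties as ℕP
  open import Data.Nat.ListAction using (sum)
  open import Data.List.Base using (List; []; _∷_; length)
  open import Data.Integer.Base using (ℤ; +_; 0ℤ; 1ℤ; _+_; _*_; _-_; _^_)
  import Data.Integer.Properties as ℤP
  open import Data.Integer.Tactic.RingSolver using (solve-∀)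
  import Data.Nat.Tactic.RingSolver as ℕS
  open import Data.Product.Base using (_×_)
  open import Data.Unit.Base using (⊤)
  open import Relation.Binary.PropositionalEquality

  Desc : ℕ → List ℕ → Set
  Desc top []      = ⊤
  Desc top (r ∷ p) = r ≤ top × Desc r p

  qi : ℤ → ℕ → ℤ
  qi x zero    = 0ℤ
  qi x (suc m) = 1ℤ + x * qi x m

  -- The product [s+1] [s+2] ⋯ [s+e], that is, the quotient of the q-factorials of s + e and s.
  ff : ℤ → ℕ → ℕ → ℤ
  ff x s zero    = 1ℤ
  ff x s (suc e) = qi x (s ℕ.+ suc e) * ff x s e

  -- Gaussian binomial coefficient (e + g choose e)
  G : ℤ → ℕ → ℕ → ℤ
  G x zero    g       = 1ℤ
  G x (suc e) zero    = 1ℤ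
  G x (suc e) (suc g) = G x (suc e) g + x ^ suc g * G x e (suc g)

  -- The binomial coefficient of e over 2.
  tri : ℕ → ℕ
  tri zero    = 0
  tri (suc e) = e ℕ.+ tri e

  -- for x = q: the number of (e + g)-tuples of functionals on F^(d + s + e) cutting a subspace
  -- of dimension s + e down to dimension s
  Mval : ℤ → ℕ → ℕ → ℕ → ℕ → ℤ
  Mval x d s e g = x ^ (d ℕ.* (e ℕ.+ g)) * (x - 1ℤ) ^ e * x ^ tri e * ff x s e * G x e g

  ^-+ : ∀ x m n → x ^ (m ℕ.+ n) ≡ x ^ m * x ^ n
  ^-+ x m n = ℤP.^-distribˡ-+-* x m n

  qi-^ : ∀ x m → (x - 1ℤ) * qi x m ≡ x ^ m - 1ℤ
  qi-^ x zero    = ℤP.*-zeroʳ (x - 1ℤ)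
  qi-^ x (suc m) = trans (expand x (qi x m)) (trans (cong (λ t → x - 1ℤ + x * t) (qi-^ x m)) (collect x (x ^ m)))
    where
    expand : ∀ x t → (x - 1ℤ) * (1ℤ + x * t) ≡ x - 1ℤ + x * ((x - 1ℤ) * t)
    expand = solve-∀
    collect : ∀ x t → x - 1ℤ + x * (t - 1ℤ) ≡ x * t - 1ℤ
    collect = solve-∀

  Mval-00 : ∀ x d s → Mval x d s 0 0 ≡ 1ℤ
  Mval-00 x d s rewrite ℕP.*-zeroʳ d = refl

  Mval-0suc : ∀ x d s g → Mval x d s 0 (suc g) ≡ x ^ d * Mval x d s 0 g
  Mval-0suc x d s g = trans (cong (λ t → t * 1ℤ * 1ℤ * 1ℤ * 1ℤ) (trans (cong (x ^_) (ℕP.*-suc d g)) (^-+ x d _))) (regroup (x ^ d) (x ^ (d ℕ.* g)))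
    where
    regroup : ∀ a b → a * b * 1ℤ * 1ℤ * 1ℤ * 1ℤ ≡ a * (b * 1ℤ * 1ℤ * 1ℤ * 1ℤ)
    regroup = solve-∀

  Mval-suc0 : ∀ x d s e → Mval x d s (suc e) 0 ≡ x ^ d * ((x - 1ℤ) * qi x (s ℕ.+ suc e)) * Mval x (suc d) s e 0
  Mval-suc0 x d s e = begin
    x ^ (d ℕ.* (suc e ℕ.+ 0)) * ((x - 1ℤ) * (x - 1ℤ) ^ e) * x ^ (e ℕ.+ tri e) * (qi x (s ℕ.+ suc e) * ff x s e) * 1ℤ
      ≡⟨ cong₂ (λ a b → a * ((x - 1ℤ) * (x - 1ℤ) ^ e) * b * (qi x (s ℕ.+ suc e) * ff x s e) * 1ℤ)
           (trans (cong (x ^_) (ℕP.*-suc d (e ℕ.+ 0))) (^-+ x d _)) (trans (^-+ x e _) (cong (λ t → x ^ t * x ^ tri e) (sym (ℕP.+-identityʳ e)))) ⟩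
    x ^ d * x ^ (d ℕ.* (e ℕ.+ 0)) * ((x - 1ℤ) * (x - 1ℤ) ^ e) * (x ^ (e ℕ.+ 0) * x ^ tri e) * (qi x (s ℕ.+ suc e) * ff x s e) * 1ℤ
      ≡⟨ regroup (x ^ d) (x ^ (d ℕ.* (e ℕ.+ 0))) (x - 1ℤ) ((x - 1ℤ) ^ e) (x ^ (e ℕ.+ 0)) (x ^ tri e) (qi x (s ℕ.+ suc e)) (ff x s e) ⟩
    x ^ d * ((x - 1ℤ) * qi x (s ℕ.+ suc e)) * (x ^ (e ℕ.+ 0) * x ^ (d ℕ.* (e ℕ.+ 0)) * (x - 1ℤ) ^ e * x ^ tri e * ff x s e * 1ℤ)
      ≡⟨ cong₂ (λ a b → x ^ d * ((x - 1ℤ) * qi x (s ℕ.+ suc e)) * (a * (x - 1ℤ) ^ e * x ^ tri e * ff x s e * b)) (sym (^-+ x (e ℕ.+ 0) _)) (sym (G-0 x e)) ⟩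
    x ^ d * ((x - 1ℤ) * qi x (s ℕ.+ suc e)) * Mval x (suc d) s e 0 ∎
    where
    open ≡-Reasoning
    G-0 : ∀ x e → G x e 0 ≡ 1ℤ
    G-0 x zero    = refl
    G-0 x (suc e) = refl
    regroup : ∀ a b y z c t q f → a * b * (y * z) * (c * t) * (q * f) * 1ℤ ≡ a * (y * q) * (c * b * z * t * f * 1ℤ)
    regroup = solve-∀

  -- The case distinction on the first functional: x^d of them vanish on the subspace, which uses up
  -- one of g, and x^d (x^(s+e+1) - 1) of them cut it, which lowers e and raises the codimension d.
  -- The rule for the binomial factor is the q-Pascal rule.
  Mval-sucsuc : ∀ x d s e g → Mval x d s (suc e) (suc g) ≡
    x ^ d * Mval x d s (suc e) g + x ^ d * ((x - 1ℤ) * qi x (s ℕ.+ suc e)) * Mval x (suc d) s e (suc g)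
  Mval-sucsuc x d s e g = begin
    x ^ (d ℕ.* (suc e ℕ.+ suc g)) * Y * x ^ (e ℕ.+ tri e) * Q * (G x (suc e) g + x ^ suc g * G x e (suc g))
      ≡⟨ cong₂ (λ a b → a * Y * b * Q * (G x (suc e) g + x ^ suc g * G x e (suc g)))
           (trans (cong (x ^_) (ℕP.*-suc d (e ℕ.+ suc g))) (^-+ x d _)) (^-+ x e _) ⟩
    x ^ d * x ^ D * ((x - 1ℤ) * (x - 1ℤ) ^ e) * (x ^ e * x ^ tri e) * (qi x (s ℕ.+ suc e) * ff x s e) * (G x (suc e) g + x ^ suc g * G x e (suc g))
      ≡⟨ regroup (x ^ d) (x ^ D) (x - 1ℤ) ((x - 1ℤ) ^ e) (x ^ e) (x ^ tri e) (qi x (s ℕ.+ suc e)) (ff x s e) (G x (suc e) g) (x ^ suc g) (G x e (suc g)) ⟩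
    x ^ d * (x ^ D * ((x - 1ℤ) * (x - 1ℤ) ^ e) * (x ^ e * x ^ tri e) * (qi x (s ℕ.+ suc e) * ff x s e) * G x (suc e) g)
      + x ^ d * ((x - 1ℤ) * qi x (s ℕ.+ suc e)) * (x ^ e * x ^ suc g * x ^ D * (x - 1ℤ) ^ e * x ^ tri e * ff x s e * G x e (suc g))
      ≡⟨ cong₂ _+_
          (cong₂ (λ a b → x ^ d * (a * Y * b * Q * G x (suc e) g)) (cong (λ t → x ^ (d ℕ.* t)) (ℕP.+-suc e g)) (sym (^-+ x e _)))
          (cong (λ a → x ^ d * ((x - 1ℤ) * qi x (s ℕ.+ suc e)) * (a * (x - 1ℤ) ^ e * x ^ tri e * ff x s e * G x e (suc g)))
             (trans (cong (_* x ^ D) (sym (^-+ x e (suc g)))) (sym (^-+ x (e ℕ.+ suc g) D)))) ⟩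
    x ^ d * Mval x d s (suc e) g + x ^ d * ((x - 1ℤ) * qi x (s ℕ.+ suc e)) * Mval x (suc d) s e (suc g) ∎
    where
    open ≡-Reasoning
    Y = (x - 1ℤ) * (x - 1ℤ) ^ e
    Q = qi x (s ℕ.+ suc e) * ff x s e
    D = d ℕ.* (e ℕ.+ suc g)
    regroup : ∀ a b y z c t q f G₁ h G₂ → a * b * (y * z) * (c * t) * (q * f) * (G₁ + h * G₂)
      ≡ a * (b * (y * z) * (c * t) * (q * f) * G₁) + a * (y * q) * (c * h * b * z * t * f * G₂)
    regroup = solve-∀

  -- HS top η ρ: η / ρ is a horizontal strip and η₁ ≤ top
  data HS : ℕ → List ℕ → List ℕ → Set where
    stop  : ∀ {g} → HS g [] []
    cons : ∀ {η ρ} g f r → HS r η ρ → HS (r ℕ.+ (f ℕ.+ g)) (r ℕ.+ f ∷ η) (r ∷ ρ)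

  -- Counts `top` rows of vectors whose common kernel has dimension s and satisfies the conditions
  -- of the strip. The rows from number r on cut the common kernel of the first r rows from
  -- dimension s + (h - r) down to s, which is one `Mval`; the first r rows are then treated in the
  -- same way.
  WL : ℤ → ℕ → ℕ → List ℕ → List ℕ → ℤ
  WL x s top (h ∷ η) (r ∷ ρ) = WL x (s ℕ.+ (h ∸ r)) r η ρ * Mval x (sum η ∸ sum ρ) s (h ∸ r) (top ∸ h)
  WL x s top _       _       = 1ℤ

  -- The exponent of x is the number of free entries of Y: vectors of length k = |η / ρ|, one for
  -- each row not at a block end. Those rows are counted by the columns of the Jordan type after the
  -- first, hence by the tail of ρ.
  Wt : ℤ → List ℕ → List ℕ → ℤ
  Wt x (h ∷ η) (r ∷ ρ) = x ^ ((sum (h ∷ η) ∸ sum (r ∷ ρ)) ℕ.* sum ρ) * WL x (h ∸ r) r η ρ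
  Wt x _       _       = 1ℤ

  dsum : ∀ {top η ρ} → HS top η ρ → ℕ
  dsum stop            = 0
  dsum (cons g f r H) = f ℕ.+ dsum H

  sum-HS : ∀ {top η ρ} (H : HS top η ρ) → sum η ≡ sum ρ ℕ.+ dsum H
  sum-HS stop            = refl
  sum-HS (cons g f r H) = trans (cong (r ℕ.+ f ℕ.+_) (sum-HS H)) (regroup r f _ _)
    where
    regroup : ∀ r f p d → r ℕ.+ f ℕ.+ (p ℕ.+ d) ≡ r ℕ.+ p ℕ.+ (f ℕ.+ d)
    regroup = ℕS.solve-∀

  sum-∸ : ∀ {top η ρ} (H : HS top η ρ) → sum η ∸ sum ρ ≡ dsum H
  sum-∸ {ρ = ρ} H = trans (cong (_∸ sum ρ) (sum-HS H)) (ℕP.m+n∸m≡n (sum ρ) _)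

  WL-cons : ∀ {η ρ} x s g f r (H : HS r η ρ) → WL x s (r ℕ.+ (f ℕ.+ g)) (r ℕ.+ f ∷ η) (r ∷ ρ) ≡ WL x (s ℕ.+ f) r η ρ * Mval x (dsum H) s f g
  WL-cons x s g f r H rewrite ℕP.m+n∸m≡n r f | sum-∸ H | ℕP.[m+n]∸[m+o]≡n∸o r (f ℕ.+ g) f | ℕP.m+n∸m≡n f g = refl

  HS-length : ∀ {top η ρ} → HS top η ρ → length η ≡ length ρ
  HS-length stop            = refl
  HS-length (cons g f r H) = cong suc (HS-length H)

-- Counting rows whose common kernels have prescribed dimensions.

module RowCounting (F : FiniteField) where

  open import Defs hiding (FiniteField)
  open Counting
  open LinearAlgebra F
  open JordanExistence F
  open JordanKernels F
  open PartitionLists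
  open KernelTypes F
  open CornerMatrices F
  open Weights
  open import Data.Nat.Base as ℕ using (ℕ; zero; suc; _≤_; _<_; z≤n; _∸_; _^_)
  import Data.Nat.Properties as ℕP
  open import Data.Nat.Tactic.RingSolver using (solve-∀)
  open import Data.Integer.Base as ℤ using (ℤ; +_; 0ℤ; 1ℤ)
  import Data.Integer.Properties as ℤP
  import Data.Integer.Tactic.RingSolver as ℤS
  open import Data.Fin.Base as Fin using (Fin; toℕ; _↑ˡ_; _↑ʳ_)
  import Data.Fin.Properties as FinP
  open import Data.List.Base using (List; []; _∷_; length)
  open import Data.List.Relation.Unary.All as All using (All; []; _∷_)
  open import Data.Product.Base using (Σ; _×_; _,_; proj₁; proj₂)
  open import Data.Sum.Base using (inj₁; inj₂)
  open import Data.Empty using (⊥-elim)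
  open import Data.Unit.Base using (⊤; tt)
  open import Data.Vec.Functional using (Vector; head; tail) renaming (_∷_ to _∷ᶠ_; _++_ to _++ᶠ_)
  open import Data.Vec.Functional.Properties using (lookup-++ˡ; lookup-++ʳ)
  open import Function.Base using (_∘_)
  open import Relation.Nullary using (Dec; yes; no; ¬_)
  open import Relation.Nullary.Decidable using (_×-dec_; ¬?)
  open import Relation.Binary.PropositionalEquality hiding (J; resp)

  open Subspace using (card; mem?; Mem; resp; 0∈)

  x : ℤ
  x = + size

  +-^ : ∀ m n → + (m ^ n) ≡ (+ m) ℤ.^ n
  +-^ m zero    = refl
  +-^ m (suc n) = trans (ℤP.pos-* m (m ^ n)) (cong (+ m ℤ.*_) (+-^ m n))

  private
    E : ∀ n → List (V n)
    E n = FinSetoid.elements (𝕍 n)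

  ∑-mono : ∀ {A : Set} (xs : List A) {φ ψ : A → ℕ} → (∀ x → φ x ≤ ψ x) → ∑ xs φ ≤ ∑ xs ψ
  ∑-mono []       h = z≤n
  ∑-mono (x ∷ xs) h = ℕP.+-mono-≤ (h x) (∑-mono xs h)

  card-≅ : ∀ {k} (Z Z′ : Subspace k) → (∀ v → Mem Z v → Mem Z′ v) → (∀ v → Mem Z′ v → Mem Z v) → card Z ≡ card Z′
  card-≅ {k} Z Z′ f g = ∑-cong (E k) (λ v → χ-cong (mem? Z v) (mem? Z′ v) (f v) (g v))

  card-⊆ : ∀ {k} (Z Z′ : Subspace k) → (∀ v → Mem Z v → Mem Z′ v) → card Z ≤ card Z′
  card-⊆ {k} Z Z′ f = ∑-mono (E k) le
    where
    le : ∀ v → χ (mem? Z v) ≤ χ (mem? Z′ v)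
    le v with mem? Z v
    ... | no _  = z≤n
    ... | yes p = ℕP.≤-reflexive (sym (χ-yes (mem? Z′ v) (f v p)))

  card-∩-≥ : ∀ {k} (Z : Subspace k) f → card Z ≤ size ℕ.* card (Z ∩ f)
  card-∩-≥ Z f = ℕP.≤-trans (ℕP.m≤m+n (card Z) _) (ℕP.≤-reflexive (sym (card-∩ Z f)))

  card>0 : ∀ {k} (Z : Subspace k) → 1 ≤ card Z
  card>0 {k} Z = subst (_≤ card Z) (FinSetoid.once (𝕍 k) 0ᵥ) (∑-mono (E k) le)
    where
    le : ∀ v → χ (FinSetoid._≈?_ (𝕍 k) v 0ᵥ) ≤ χ (mem? Z v)
    le v with FinSetoid._≈?_ (𝕍 k) v 0ᵥ
    ... | no _  = z≤n
    ... | yes e = ℕP.≤-reflexive (sym (χ-yes (mem? Z v) (resp Z (λ i → sym (e i)) (0∈ Z))))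

  ∑-two-valued : ∀ {A : Set} (xs : List A) {P : A → Set} (P? : ∀ v → Dec (P v)) (φ : A → ℕ) k₀ k₁ →
    (∀ v → P v → + φ v ≡ k₀) → (∀ v → ¬ P v → + φ v ≡ k₁) →
    + ∑ xs φ ≡ + ∑ xs (λ v → χ (P? v)) ℤ.* k₀ ℤ.+ + ∑ xs (λ v → χ (¬? (P? v))) ℤ.* k₁
  ∑-two-valued []       P? φ k₀ k₁ h₀ h₁ = sym (ℤP.+-identityˡ _)
  ∑-two-valued (v ∷ xs) P? φ k₀ k₁ h₀ h₁ with P? v | ∑-two-valued xs P? φ k₀ k₁ h₀ h₁
  ... | yes p | ih = trans (ℤP.pos-+ (φ v) _) (trans (cong₂ ℤ._+_ (h₀ v p) ih) (move k₀ k₁ (+ ∑ xs (λ v → χ (P? v))) (+ ∑ xs (λ v → χ (¬? (P? v))))))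
    where
    move : ∀ k₀ k₁ a b → k₀ ℤ.+ (a ℤ.* k₀ ℤ.+ b ℤ.* k₁) ≡ (1ℤ ℤ.+ a) ℤ.* k₀ ℤ.+ b ℤ.* k₁
    move = ℤS.solve-∀
  ... | no ¬p | ih = trans (ℤP.pos-+ (φ v) _) (trans (cong₂ ℤ._+_ (h₁ v ¬p) ih) (move k₀ k₁ (+ ∑ xs (λ v → χ (P? v))) (+ ∑ xs (λ v → χ (¬? (P? v))))))
    where
    move : ∀ k₀ k₁ a b → k₁ ℤ.+ (a ℤ.* k₀ ℤ.+ b ℤ.* k₁) ≡ a ℤ.* k₀ ℤ.+ (1ℤ ℤ.+ b) ℤ.* k₁
    move = ℤS.solve-∀

  ∑-weighted : ∀ {A : Set} (xs : List A) {P : A → Set} (P? : ∀ v → Dec (P v)) (φ : A → ℕ) k₀ → (∀ v → P v → + φ v ≡ k₀) →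
    + ∑ xs (λ v → χ (P? v) ℕ.* φ v) ≡ + ∑ xs (λ v → χ (P? v)) ℤ.* k₀
  ∑-weighted xs P? φ k₀ h = trans (∑-two-valued xs P? _ k₀ 0ℤ
      (λ v p → trans (cong (λ t → + (t ℕ.* φ v)) (χ-yes (P? v) p)) (trans (cong +_ (ℕP.*-identityˡ _)) (h v p)))
      (λ v ¬p → cong (λ t → + (t ℕ.* φ v)) (χ-no (P? v) ¬p)))
    (trans (cong (λ t → + ∑ xs (λ v → χ (P? v)) ℤ.* k₀ ℤ.+ t) (ℤP.*-zeroʳ (+ ∑ xs (λ v → χ (¬? (P? v)))))) (ℤP.+-identityʳ _))

  meet : ∀ {k a} → Subspace k → Vector (V k) a → Subspace k
  meet {a = zero}  Z y = Z
  meet {a = suc a} Z y = meet (Z ∩ dotF (head y)) (tail y)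

  meet-⊆ : ∀ {k a} (Z : Subspace k) (y : Vector (V k) a) v → Mem (meet Z y) v → Mem Z v × (∀ b → dot (y b) v ≡ 0#)
  meet-⊆ {a = zero}  Z y v p = p , λ ()
  meet-⊆ {a = suc a} Z y v p with meet-⊆ (Z ∩ dotF (head y)) (tail y) v p
  ... | (q , e) , f = q , λ { Fin.zero → e ; (Fin.suc b) → f b }

  meet-⊇ : ∀ {k a} (Z : Subspace k) (y : Vector (V k) a) v → Mem Z v → (∀ b → dot (y b) v ≡ 0#) → Mem (meet Z y) v
  meet-⊇ {a = zero}  Z y v p f = p
  meet-⊇ {a = suc a} Z y v p f = meet-⊇ (Z ∩ dotF (head y)) (tail y) v (p , f Fin.zero) (f ∘ Fin.suc)

  card-meet-≤ : ∀ {k a} (Z : Subspace k) (y : Vector (V k) a) → card (meet Z y) ≤ card Z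
  card-meet-≤ Z y = card-⊆ (meet Z y) Z (λ v p → proj₁ (meet-⊆ Z y v p))

  card-meet-≥ : ∀ {k a} (Z : Subspace k) (y : Vector (V k) a) → card Z ≤ size ^ a ℕ.* card (meet Z y)
  card-meet-≥ {a = zero}  Z y = ℕP.≤-reflexive (sym (ℕP.*-identityˡ _))
  card-meet-≥ {a = suc a} Z y = begin
    card Z                                                ≤⟨ card-∩-≥ Z (dotF (head y)) ⟩
    size ℕ.* card (Z ∩ dotF (head y))                     ≤⟨ ℕP.*-monoʳ-≤ size (card-meet-≥ (Z ∩ dotF (head y)) (tail y)) ⟩
    size ℕ.* (size ^ a ℕ.* card (meet Z y))               ≡⟨ sym (ℕP.*-assoc size (size ^ a) _) ⟩
    size ^ suc a ℕ.* card (meet Z y)                      ∎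
    where open ℕP.≤-Reasoning

  cuts : ∀ {k} → Subspace k → ℕ → ℕ → ℕ
  cuts {k} Z a t = ∑[ Fun F a (𝕍 k) ] (λ y → χ (card (meet Z y) ℕP.≟ size ^ t))

  cuts-zero : ∀ {k} (Z : Subspace k) a t → (∀ (y : Vector (V k) a) → card (meet Z y) ≢ size ^ t) → cuts Z a t ≡ 0
  cuts-zero {k} Z a t h = trans (∑-cong (FinSetoid.elements (Fun F a (𝕍 k))) (λ y → χ-no (card (meet Z y) ℕP.≟ size ^ t) (h y)))
    (∑-0 (FinSetoid.elements (Fun F a (𝕍 k))))

  cuts-suc : ∀ {k} (Z : Subspace k) a t → cuts Z (suc a) t ≡ ∑[ 𝕍 k ] (λ v → cuts (Z ∩ dotF v) a t)
  cuts-suc {k} Z a t = ∑-allFuns F a (E k) (λ y → χ (card (meet Z y) ℕP.≟ size ^ t))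

  size^-mono : ∀ {m n} → m < n → size ^ m < size ^ n
  size^-mono = ℕP.^-monoʳ-< size 1<size

  size^-cancel-≤ : ∀ {m n} → size ^ m ≤ size ^ n → m ≤ n
  size^-cancel-≤ le = ℕP.≮⇒≥ (λ lt → ℕP.<⇒≱ (size^-mono lt) le)

  module _ {k : ℕ} (d s : ℕ) (d+s≡k : d ℕ.+ s ≡ k) (Z : Subspace k) (card-Z : card Z ≡ size ^ s) where
    private
      keep drop : ℕ
      keep = ∑[ 𝕍 k ] (λ v → χ (perp? Z v))
      drop = ∑[ 𝕍 k ] (λ v → χ (¬? (perp? Z v)))

      keep≡ : keep ≡ size ^ d
      keep≡ = ℕP.*-cancelʳ-≡ keep (size ^ d) (size ^ s) {{ℕ.≢-nonZero (size^≢0 s)}} (begin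
        keep ℕ.* size ^ s       ≡⟨ cong (keep ℕ.*_) (sym card-Z) ⟩
        keep ℕ.* card Z         ≡⟨ card-perp Z ⟩
        size ^ k                ≡⟨ cong (size ^_) (sym d+s≡k) ⟩
        size ^ (d ℕ.+ s)        ≡⟨ ℕP.^-distribˡ-+-* size d s ⟩
        size ^ d ℕ.* size ^ s   ∎)
        where open ≡-Reasoning

      drop≡ : + drop ≡ x ℤ.^ d ℤ.* ((x ℤ.- 1ℤ) ℤ.* qi x s)
      drop≡ = trans (solve-for (+ keep) (+ drop) (x ℤ.^ d) (x ℤ.^ s) (trans (cong +_ keep≡) (+-^ size d)) (begin
        + keep ℤ.+ + drop      ≡⟨ sym (ℤP.pos-+ keep drop) ⟩
        + (keep ℕ.+ drop)      ≡⟨ cong +_ (trans (sym (∑-+ (E k) _ _)) (trans (∑-cong (E k) (λ v → χ-¬ (perp? Z v))) (∣𝕍∣ k))) ⟩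
        + (size ^ k)           ≡⟨ cong (λ n → + (size ^ n)) (sym d+s≡k) ⟩
        + (size ^ (d ℕ.+ s))   ≡⟨ trans (+-^ size (d ℕ.+ s)) (^-+ x d s) ⟩
        x ℤ.^ d ℤ.* x ℤ.^ s    ∎)) (cong (x ℤ.^ d ℤ.*_) (sym (qi-^ x s)))
        where
        open ≡-Reasoning
        solve-for : ∀ A B a b → A ≡ a → A ℤ.+ B ≡ a ℤ.* b → B ≡ a ℤ.* (b ℤ.- 1ℤ)
        solve-for A B a b refl e = trans (isolate A B) (trans (cong (ℤ._- A) e) (factor A b))
          where
          isolate : ∀ A B → B ≡ A ℤ.+ B ℤ.- A
          isolate = ℤS.solve-∀
          factor : ∀ a b → a ℤ.* b ℤ.- a ≡ a ℤ.* (b ℤ.- 1ℤ)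
          factor = ℤS.solve-∀

    card-keep : ∀ v → dotF v ⊥ᶠ Z → card (Z ∩ dotF v) ≡ size ^ s
    card-keep v h = trans (card-≅ (Z ∩ dotF v) Z (λ _ → proj₁) (λ z p → p , h z p)) card-Z

    card-drop : ∀ v → ¬ (dotF v ⊥ᶠ Z) → size ℕ.* card (Z ∩ dotF v) ≡ size ^ s
    card-drop v h = trans (card-∩ Z (dotF v)) (trans (cong (λ t → card Z ℕ.+ pred-size ℕ.* (t ℕ.* card Z)) (χ-no (dotF v ⊥? Z) h))
      (trans (cong (card Z ℕ.+_) (ℕP.*-zeroʳ pred-size)) (trans (ℕP.+-identityʳ _) card-Z)))

    -- By `card-perp`, q^d vectors are orthogonal to Z. The remaining q^d (q^s - 1) cut its
    -- dimension by one, and the number of continuations depends only on which case occurs.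
    cuts-step : ∀ a t k₀ k₁ → (∀ v → dotF v ⊥ᶠ Z → + cuts (Z ∩ dotF v) a t ≡ k₀) → (∀ v → ¬ (dotF v ⊥ᶠ Z) → + cuts (Z ∩ dotF v) a t ≡ k₁) →
      + cuts Z (suc a) t ≡ x ℤ.^ d ℤ.* k₀ ℤ.+ x ℤ.^ d ℤ.* ((x ℤ.- 1ℤ) ℤ.* qi x s) ℤ.* k₁
    cuts-step a t k₀ k₁ h₀ h₁ = begin
      + cuts Z (suc a) t
        ≡⟨ trans (cong +_ (cuts-suc Z a t)) (∑-two-valued (E k) (perp? Z) _ k₀ k₁ h₀ h₁) ⟩
      + keep ℤ.* k₀ ℤ.+ + drop ℤ.* k₁
        ≡⟨ cong₂ (λ a b → a ℤ.* k₀ ℤ.+ b ℤ.* k₁) (trans (cong +_ keep≡) (+-^ size d)) drop≡ ⟩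
      x ℤ.^ d ℤ.* k₀ ℤ.+ x ℤ.^ d ℤ.* ((x ℤ.- 1ℤ) ℤ.* qi x s) ℤ.* k₁ ∎
      where open ≡-Reasoning

  private
    cancel-size : ∀ {c n} → size ℕ.* c ≡ size ^ suc n → c ≡ size ^ n
    cancel-size e = ℕP.*-cancelˡ-≡ _ _ size {{ℕ.≢-nonZero size≢0}} e

  -- A functional lowers the dimension by at most one, so a of them cannot lower it by a + 1.
  cuts-too-many : ∀ {k} (Z : Subspace k) a s → card Z ≡ size ^ (s ℕ.+ suc a) → cuts Z a s ≡ 0
  cuts-too-many Z a s cz = cuts-zero Z a s λ y e → ℕP.<⇒≱ (size^-mono (ℕP.+-monoʳ-< s (ℕP.n<1+n a)))
    (ℕP.≤-trans (ℕP.≤-reflexive (sym cz)) (ℕP.≤-trans (card-meet-≥ Z y) (ℕP.≤-reflexive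
      (trans (cong (size ^ a ℕ.*_) e) (trans (sym (ℕP.^-distribˡ-+-* size a s)) (cong (size ^_) (ℕP.+-comm a s)))))))

  -- Induction on the first functional, parallel to the recursions of `Mval`. The number a is kept
  -- apart from e + g to make the recursion structural.
  cuts-value : ∀ {k} a e g d s → a ≡ e ℕ.+ g → d ℕ.+ (s ℕ.+ e) ≡ k → (Z : Subspace k) → card Z ≡ size ^ (s ℕ.+ e) →
    + cuts Z a s ≡ Mval x d s e g
  cuts-value {k} zero zero zero d s refl dk Z cz = trans (cong +_ (∑-cong (FinSetoid.elements (Fun F 0 (𝕍 k))) (λ y →
      χ-yes (card Z ℕP.≟ size ^ s) (trans cz (cong (size ^_) (ℕP.+-identityʳ s)))))) (sym (Mval-00 x d s))
  cuts-value (suc a) zero (suc .a) d s refl dk Z cz = begin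
    + cuts Z (suc a) s
      -- No dimension may be lost, so a functional that does not vanish on Z has no continuation.
      ≡⟨ cuts-step d (s ℕ.+ 0) dk Z cz a s (Mval x d s 0 a) 0ℤ
           (λ v p → cuts-value a 0 a d s refl dk (Z ∩ dotF v) (card-keep d (s ℕ.+ 0) dk Z cz v p))
           (λ v ¬p → cong +_ (cuts-zero (Z ∩ dotF v) a s (λ y e → ℕP.<-irrefl refl (smaller v ¬p y e)))) ⟩
    x ℤ.^ d ℤ.* Mval x d s 0 a ℤ.+ x ℤ.^ d ℤ.* ((x ℤ.- 1ℤ) ℤ.* qi x (s ℕ.+ 0)) ℤ.* 0ℤ
      ≡⟨ trans (cong (λ t → x ℤ.^ d ℤ.* Mval x d s 0 a ℤ.+ t) (ℤP.*-zeroʳ (x ℤ.^ d ℤ.* ((x ℤ.- 1ℤ) ℤ.* qi x (s ℕ.+ 0))))) (ℤP.+-identityʳ _) ⟩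
    x ℤ.^ d ℤ.* Mval x d s 0 a
      ≡⟨ sym (Mval-0suc x d s a) ⟩
    Mval x d s 0 (suc a) ∎
    where
    open ≡-Reasoning
    smaller : ∀ v → ¬ (dotF v ⊥ᶠ Z) → ∀ (y : Vector (V _) a) → card (meet (Z ∩ dotF v) y) ≡ size ^ s → size ^ s < size ^ s
    smaller v ¬p y e = ℕP.<-≤-trans (ℕP.m<m*n (size ^ s) size {{ℕ.≢-nonZero (size^≢0 s)}} 1<size)
      (ℕP.≤-trans (ℕP.≤-reflexive (ℕP.*-comm (size ^ s) size)) (ℕP.≤-trans (ℕP.*-monoʳ-≤ size (ℕP.≤-trans (ℕP.≤-reflexive (sym e)) (card-meet-≤ (Z ∩ dotF v) y)))
        (ℕP.≤-reflexive (trans (card-drop d (s ℕ.+ 0) dk Z cz v ¬p) (cong (size ^_) (ℕP.+-identityʳ s))))))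
  cuts-value (suc a) (suc e) g d s eq dk Z cz = step g eq
    where
    open ≡-Reasoning
    X = x ℤ.^ d ℤ.* ((x ℤ.- 1ℤ) ℤ.* qi x (s ℕ.+ suc e))
    dk′ = trans (trans (sym (ℕP.+-suc d (s ℕ.+ e))) (cong (d ℕ.+_) (sym (ℕP.+-suc s e)))) dk
    dropped : ∀ g → suc a ≡ suc e ℕ.+ g → ∀ v → ¬ (dotF v ⊥ᶠ Z) → + cuts (Z ∩ dotF v) a s ≡ Mval x (suc d) s e g
    dropped g eq v ¬p = cuts-value a e g (suc d) s (ℕP.suc-injective eq) dk′ (Z ∩ dotF v)
      (cancel-size {n = s ℕ.+ e} (trans (card-drop d _ dk Z cz v ¬p) (cong (size ^_) (ℕP.+-suc s e))))
    step : ∀ g → suc a ≡ suc e ℕ.+ g → + cuts Z (suc a) s ≡ Mval x d s (suc e) g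
    step zero eq = begin
      + cuts Z (suc a) s
        -- There are exactly as many functionals as dimensions to be lost, so a functional that
        -- vanishes on Z cannot be made up for.
        ≡⟨ cuts-step d (s ℕ.+ suc e) dk Z cz a s 0ℤ (Mval x (suc d) s e 0)
             (λ v p → cong +_ (cuts-too-many (Z ∩ dotF v) a s (trans (card-keep d _ dk Z cz v p)
                (cong (λ t → size ^ (s ℕ.+ t)) (trans (cong suc (sym (ℕP.+-identityʳ e))) (sym eq))))))
             (dropped 0 eq) ⟩
      x ℤ.^ d ℤ.* 0ℤ ℤ.+ X ℤ.* Mval x (suc d) s e 0
        ≡⟨ trans (cong (ℤ._+ (X ℤ.* Mval x (suc d) s e 0)) (ℤP.*-zeroʳ (x ℤ.^ d))) (ℤP.+-identityˡ _) ⟩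
      X ℤ.* Mval x (suc d) s e 0
        ≡⟨ sym (Mval-suc0 x d s e) ⟩
      Mval x d s (suc e) 0 ∎
    step (suc g) eq = begin
      + cuts Z (suc a) s
        ≡⟨ cuts-step d (s ℕ.+ suc e) dk Z cz a s (Mval x d s (suc e) g) (Mval x (suc d) s e (suc g))
             (λ v p → cuts-value a (suc e) g d s (trans (ℕP.suc-injective eq) (ℕP.+-suc e g)) dk (Z ∩ dotF v) (card-keep d _ dk Z cz v p))
             (dropped (suc g) eq) ⟩
      x ℤ.^ d ℤ.* Mval x d s (suc e) g ℤ.+ X ℤ.* Mval x (suc d) s e (suc g)
        ≡⟨ sym (Mval-sucsuc x d s e g) ⟩
      Mval x d s (suc e) (suc g) ∎

  -- the conditions of RowType, read down the lists
  Cond : ∀ {l k} (A B : ℕ) (η p : List ℕ) → Vector (V k) l → Set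
  Cond A B (h ∷ η) (r ∷ p) y = size ^ (A ℕ.+ r) ℕ.* card (common r y) ≡ size ^ (B ℕ.+ h) × Cond (A ℕ.+ r) (B ℕ.+ h) η p y
  Cond A B _       _       y = ⊤

  cond? : ∀ {l k} A B η p (y : Vector (V k) l) → Dec (Cond A B η p y)
  cond? A B (h ∷ η) (r ∷ p) y = (size ^ (A ℕ.+ r) ℕ.* card (common r y) ℕP.≟ size ^ (B ℕ.+ h)) ×-dec cond? (A ℕ.+ r) (B ℕ.+ h) η p y
  cond? A B []      []      y = yes tt
  cond? A B []      (_ ∷ _) y = yes tt
  cond? A B (_ ∷ _) []      y = yes tt

  card-common-++ : ∀ {r a k} (y₁ : Vector (V k) r) (y₂ : Vector (V k) a) c → c ≤ r → card (common c (y₁ ++ᶠ y₂)) ≡ card (common c y₁)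
  card-common-++ {r} {a} y₁ y₂ c c≤r = card-common-cong c c (y₁ ++ᶠ y₂) y₁
    (λ z h b b< → trans (cong (λ w → dot w z) (sym (lookup-++ˡ y₁ y₂ b))) (h (b ↑ˡ a) (subst (_< c) (sym (FinP.toℕ-↑ˡ b a)) b<)))
    (λ z h → by-parts (λ b b< → trans (cong (λ w → dot w z) (lookup-++ˡ y₁ y₂ b)) (h b (subst (_< c) (FinP.toℕ-↑ˡ b a) b<)))
      (λ b b< → ⊥-elim (ℕP.<⇒≱ (ℕP.<-≤-trans (subst (_< c) (FinP.toℕ-↑ʳ r b) b<) c≤r) (ℕP.m≤m+n r (toℕ b)))))

  card-common-meet : ∀ {r a k} (y₁ : Vector (V k) r) (y₂ : Vector (V k) a) → card (common (r ℕ.+ a) (y₁ ++ᶠ y₂)) ≡ card (meet (common r y₁) y₂)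
  card-common-meet {r} {a} y₁ y₂ = card-≅ (common (r ℕ.+ a) (y₁ ++ᶠ y₂)) (meet (common r y₁) y₂)
    (λ z h → meet-⊇ (common r y₁) y₂ z (λ b _ → trans (cong (λ w → dot w z) (sym (lookup-++ˡ y₁ y₂ b))) (h (b ↑ˡ a) (FinP.toℕ<n (b ↑ˡ a))))
      (λ b → trans (cong (λ w → dot w z) (sym (lookup-++ʳ y₁ y₂ b))) (h (r ↑ʳ b) (FinP.toℕ<n (r ↑ʳ b)))))
    (λ z m → let p , q = meet-⊆ (common r y₁) y₂ z m in by-parts
      (λ b _ → trans (cong (λ w → dot w z) (lookup-++ˡ y₁ y₂ b)) (p b (FinP.toℕ<n b)))
      (λ b _ → trans (cong (λ w → dot w z) (lookup-++ʳ y₁ y₂ b)) (q b)))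

  cond-cong : ∀ {l l′ k} A B η p {y : Vector (V k) l} {y′ : Vector (V k) l′} → All (λ c → card (common c y) ≡ card (common c y′)) p →
    Cond A B η p y → Cond A B η p y′
  cond-cong A B []      p       e        c       = tt
  cond-cong A B (h ∷ η) []      e        c       = tt
  cond-cong A B (h ∷ η) (r ∷ p) (e ∷ es) (q , c) = trans (cong (size ^ (A ℕ.+ r) ℕ.*_) (sym e)) q , cond-cong (A ℕ.+ r) (B ℕ.+ h) η p es c

  HS-≤ : ∀ {top η p} → HS top η p → All (_≤ top) p
  HS-≤ stop            = []
  HS-≤ (cons g f r H) = ℕP.m≤m+n r _ ∷ All.map (λ le → ℕP.≤-trans le (ℕP.m≤m+n r _)) (HS-≤ H)

  private
    cancel-pow : ∀ n {c b} → size ^ n ℕ.* c ≡ size ^ (n ℕ.+ b) → c ≡ size ^ b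
    cancel-pow n {c} {b} e = ℕP.*-cancelˡ-≡ c _ (size ^ n) {{ℕ.≢-nonZero (size^≢0 n)}} (trans e (ℕP.^-distribˡ-+-* size n b))

    expand-pow : ∀ n {c b} → c ≡ size ^ b → size ^ n ℕ.* c ≡ size ^ (n ℕ.+ b)
    expand-pow n refl = sym (ℕP.^-distribˡ-+-* size n _)

    reassoc : ∀ A s r f → A ℕ.+ s ℕ.+ (r ℕ.+ f) ≡ A ℕ.+ r ℕ.+ (s ℕ.+ f)
    reassoc = solve-∀

  -- For fixed first r rows, the number of choices of the remaining f + g depends only on the
  -- dimension s + f of the common kernel of the first r, so the count is a product. The equation s
  -- + `dsum H` = k says that the empty set of rows has the full space F^k as common kernel.
  count-rows : ∀ {k top η p} (H : HS top η p) s A → s ℕ.+ dsum H ≡ k →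
    + ∑[ Fun F top (𝕍 k) ] (λ y → χ ((card (common top y) ℕP.≟ size ^ s) ×-dec cond? A (A ℕ.+ s) η p y)) ≡ WL x s top η p
  count-rows {k} (stop {g}) s A sk = trans (cong +_ (∑-cong (FinSetoid.elements (Fun F g (𝕍 k))) (λ y →
      trans (χ-× (card (common g y) ℕP.≟ size ^ s) (yes tt)) (trans (ℕP.*-identityʳ _) (χ-cong (card (common g y) ℕP.≟ size ^ s) (card (meet full y) ℕP.≟ size ^ s)
        (trans (sym (c-m y))) (trans (c-m y)))))))
    (trans (cuts-value g 0 g 0 s refl (trans (cong (s ℕ.+_) refl) sk) full (trans (card-full k) (cong (size ^_) (sym sk)))) refl)
    where
    c-m : ∀ y → card (common g y) ≡ card (meet full y)
    c-m y = card-≅ (common g y) (meet full y) (λ z h → meet-⊇ full y z tt (λ b → h b (FinP.toℕ<n b))) (λ z m b _ → proj₂ (meet-⊆ full y z m) b)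
  count-rows {k} {η = _ ∷ η} {p = _ ∷ p} (cons g f r H) s A sk = begin
    + ∑[ Fun F (r ℕ.+ (f ℕ.+ g)) (𝕍 k) ] (λ y → χ (C y))
      ≡⟨ cong +_ (∑-++ᶠ (𝕍 k) r (λ y → χ (C y)) (λ {y} {y′} e → χ-cong (C y) (C y′) (C-cong e) (C-cong (λ b i → sym (e b i))))) ⟩
    + ∑[ Fun F r (𝕍 k) ] (λ y₁ → ∑[ Fun F (f ℕ.+ g) (𝕍 k) ] (λ y₂ → χ (C (y₁ ++ᶠ y₂))))
      ≡⟨ cong +_ (∑-cong E₁ (λ y₁ → trans (∑-cong E₂ (λ y₂ → trans (χ-cong (C (y₁ ++ᶠ y₂)) (C₁ y₁ ×-dec C₂ y₁ y₂) (split-C y₁ y₂) (unsplit-C y₁ y₂)) (χ-× (C₁ y₁) (C₂ y₁ y₂))))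
           (∑-*ˡ E₂ (χ (C₁ y₁)) _))) ⟩
    + ∑[ Fun F r (𝕍 k) ] (λ y₁ → χ (C₁ y₁) ℕ.* cuts (common r y₁) (f ℕ.+ g) s)
      ≡⟨ ∑-weighted E₁ C₁ (λ y₁ → cuts (common r y₁) (f ℕ.+ g) s) (Mval x (dsum H) s f g)
           (λ y₁ (c , _) → cuts-value (f ℕ.+ g) f g (dsum H) s refl (trans (trans (ℕP.+-comm (dsum H) _) (ℕP.+-assoc s f _)) sk) (common r y₁) c) ⟩
    + ∑[ Fun F r (𝕍 k) ] (λ y₁ → χ (C₁ y₁)) ℤ.* Mval x (dsum H) s f g
      ≡⟨ cong (ℤ._* Mval x (dsum H) s f g) (count-rows H (s ℕ.+ f) (A ℕ.+ r) (trans (ℕP.+-assoc s f _) sk)) ⟩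
    WL x (s ℕ.+ f) r η p ℤ.* Mval x (dsum H) s f g
      ≡⟨ sym (WL-cons x s g f r H) ⟩
    WL x s (r ℕ.+ (f ℕ.+ g)) (r ℕ.+ f ∷ η) (r ∷ p) ∎
    where
    open ≡-Reasoning
    E₁ = FinSetoid.elements (Fun F r (𝕍 k))
    E₂ = FinSetoid.elements (Fun F (f ℕ.+ g) (𝕍 k))
    top = r ℕ.+ (f ℕ.+ g)
    C : ∀ (y : Vector (V k) top) → Dec (card (common top y) ≡ size ^ s × Cond A (A ℕ.+ s) (r ℕ.+ f ∷ η) (r ∷ p) y)
    C y = (card (common top y) ℕP.≟ size ^ s) ×-dec cond? A (A ℕ.+ s) (r ℕ.+ f ∷ η) (r ∷ p) y
    C₁ : ∀ (y₁ : Vector (V k) r) → Dec (card (common r y₁) ≡ size ^ (s ℕ.+ f) × Cond (A ℕ.+ r) (A ℕ.+ r ℕ.+ (s ℕ.+ f)) η p y₁)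
    C₁ y₁ = (card (common r y₁) ℕP.≟ size ^ (s ℕ.+ f)) ×-dec cond? (A ℕ.+ r) (A ℕ.+ r ℕ.+ (s ℕ.+ f)) η p y₁
    C₂ : ∀ (y₁ : Vector (V k) r) (y₂ : Vector (V k) (f ℕ.+ g)) → Dec (card (meet (common r y₁) y₂) ≡ size ^ s)
    C₂ y₁ y₂ = card (meet (common r y₁) y₂) ℕP.≟ size ^ s
    common-≈ : ∀ c {y y′ : Vector (V k) top} → (∀ b → y b ≐ y′ b) → card (common c y) ≡ card (common c y′)
    common-≈ c {y} {y′} e = card-common-cong c c y y′ (λ z h b b< → trans (dot-cong (λ i → sym (e b i)) (λ _ → refl)) (h b b<))
      (λ z h b b< → trans (dot-cong (e b) (λ _ → refl)) (h b b<))
    C-cong : ∀ {y y′} → (∀ b → y b ≐ y′ b) → card (common top y) ≡ size ^ s × Cond A (A ℕ.+ s) (r ℕ.+ f ∷ η) (r ∷ p) y →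
      card (common top y′) ≡ size ^ s × Cond A (A ℕ.+ s) (r ℕ.+ f ∷ η) (r ∷ p) y′
    C-cong e (q , c) = trans (sym (common-≈ top e)) q , cond-cong A (A ℕ.+ s) (r ℕ.+ f ∷ η) (r ∷ p) (All.universal (λ c → common-≈ c e) _) c
    low : ∀ y₁ (y₂ : Vector (V k) (f ℕ.+ g)) → All (λ c → card (common c (y₁ ++ᶠ y₂)) ≡ card (common c y₁)) p
    low y₁ y₂ = All.map (λ {c} le → card-common-++ y₁ y₂ c le) (HS-≤ H)
    split-C : ∀ y₁ y₂ → card (common top (y₁ ++ᶠ y₂)) ≡ size ^ s × Cond A (A ℕ.+ s) (r ℕ.+ f ∷ η) (r ∷ p) (y₁ ++ᶠ y₂) →
      (card (common r y₁) ≡ size ^ (s ℕ.+ f) × Cond (A ℕ.+ r) (A ℕ.+ r ℕ.+ (s ℕ.+ f)) η p y₁) × card (meet (common r y₁) y₂) ≡ size ^ s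
    split-C y₁ y₂ (q , c , cs) =
      (cancel-pow (A ℕ.+ r) (trans (cong (size ^ (A ℕ.+ r) ℕ.*_) (sym (card-common-++ y₁ y₂ r ℕP.≤-refl))) (trans c (cong (size ^_) (reassoc A s r f)))) ,
       subst (λ B → Cond (A ℕ.+ r) B η p y₁) (reassoc A s r f) (cond-cong _ _ η p (low y₁ y₂) cs)) ,
      trans (sym (card-common-meet y₁ y₂)) q
    unsplit-C : ∀ y₁ y₂ → (card (common r y₁) ≡ size ^ (s ℕ.+ f) × Cond (A ℕ.+ r) (A ℕ.+ r ℕ.+ (s ℕ.+ f)) η p y₁) × card (meet (common r y₁) y₂) ≡ size ^ s →
      card (common top (y₁ ++ᶠ y₂)) ≡ size ^ s × Cond A (A ℕ.+ s) (r ℕ.+ f ∷ η) (r ∷ p) (y₁ ++ᶠ y₂)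
    unsplit-C y₁ y₂ ((c , cs) , q) = trans (card-common-meet y₁ y₂) q ,
      trans (cong (size ^ (A ℕ.+ r) ℕ.*_) (card-common-++ y₁ y₂ r ℕP.≤-refl)) (trans (expand-pow (A ℕ.+ r) c) (cong (size ^_) (sym (reassoc A s r f)))) ,
      cond-cong _ _ η p (All.map sym (low y₁ y₂)) (subst (λ B → Cond (A ℕ.+ r) B η p y₁) (sym (reassoc A s r f)) cs)

  card-common-drop : ∀ {l k} {r top} (y : Vector (V k) l) → r ≤ top → card (common r y) ≤ size ^ (top ∸ r) ℕ.* card (common top y)
  card-common-drop {l} {k} {r} {top} y r≤top = go (top ∸ r) (ℕP.m+[n∸m]≡n r≤top)
    where
    open ℕP.≤-Reasoning
    step : ∀ c → card (common c y) ≤ size ℕ.* card (common (suc c) y)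
    step c with c ℕP.<? l
    ... | no c≮l = ℕP.≤-trans (card-⊆ (common c y) (common (suc c) y) (λ z h b _ → h b (ℕP.<-≤-trans (FinP.toℕ<n b) (ℕP.≮⇒≥ c≮l))))
                     (ℕP.m≤n*m _ size {{ℕ.≢-nonZero size≢0}})
    ... | yes c<l = ℕP.≤-trans (card-∩-≥ (common c y) (dotF (y b₀))) (ℕP.*-monoʳ-≤ size (card-⊆ (common c y ∩ dotF (y b₀)) (common (suc c) y) sub))
      where
      b₀ = Fin.fromℕ< c<l
      sub : ∀ z → Mem (common c y ∩ dotF (y b₀)) z → Mem (common (suc c) y) z
      sub z (h , e) b b≤c with ℕP.m≤n⇒m<n∨m≡n (ℕP.≤-pred b≤c)
      ... | inj₁ b<c = h b b<c
      ... | inj₂ b≡c = subst (λ b → dot (y b) z ≡ 0#) (FinP.toℕ-injective (trans (FinP.toℕ-fromℕ< c<l) (sym b≡c))) e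
    go : ∀ a {top} → r ℕ.+ a ≡ top → card (common r y) ≤ size ^ a ℕ.* card (common top y)
    go zero    refl = ℕP.≤-reflexive (trans (cong (λ c → card (common c y)) (sym (ℕP.+-identityʳ r))) (sym (ℕP.*-identityˡ _)))
    go (suc a) refl = begin
      card (common r y)                                         ≤⟨ go a refl ⟩
      size ^ a ℕ.* card (common (r ℕ.+ a) y)                    ≤⟨ ℕP.*-monoʳ-≤ (size ^ a) (step (r ℕ.+ a)) ⟩
      size ^ a ℕ.* (size ℕ.* card (common (suc (r ℕ.+ a)) y))   ≡⟨ regroup (size ^ a) size _ ⟩
      size ^ suc a ℕ.* card (common (suc (r ℕ.+ a)) y)          ≡⟨ cong (λ c → size ^ suc a ℕ.* card (common c y)) (sym (ℕP.+-suc r a)) ⟩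
      size ^ suc a ℕ.* card (common (r ℕ.+ suc a) y)            ∎
      where
      regroup : ∀ a b c → a ℕ.* (b ℕ.* c) ≡ b ℕ.* a ℕ.* c
      regroup = solve-∀

  card-≤ : ∀ {k} (Z : Subspace k) → card Z ≤ size ^ k
  card-≤ {k} Z = ℕP.≤-trans (card-⊆ Z full (λ _ _ → tt)) (ℕP.≤-reflexive (card-full k))

  -- Fewer rows have a larger common kernel, which gives r ≤ h. The top - r further rows lower its
  -- dimension by at most top - r, which gives h ≤ top. These are the two interlacing inequalities;
  -- the bound by k is the dimension of the ambient space.
  cond⇒HS : ∀ {l k} (y : Vector (V k) l) top s A η p → length η ≡ length p → Desc top p → card (common top y) ≡ size ^ s →
    Cond A (A ℕ.+ s) η p y → Σ (HS top η p) λ H → s ℕ.+ dsum H ≤ k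
  cond⇒HS {k = k} y top s A []      []      _  _          c _        = stop , subst (_≤ k) (sym (ℕP.+-identityʳ s)) (size^-cancel-≤ {s} {k} (subst (_≤ size ^ k) c (card-≤ (common top y))))
  cond⇒HS {k = k} y top s A (h ∷ η) (r ∷ p) le (r≤top , ds) c (q , cs) = build (ℕP.m+[n∸m]≡n r≤h) (ℕP.m+[n∸m]≡n f≤)
    where
    open ℕP.≤-Reasoning
    c-r : size ^ s ≤ card (common r y)
    c-r = subst (_≤ card (common r y)) c (card-⊆ (common top y) (common r y) (λ z m b b< → m b (ℕP.<-≤-trans b< r≤top)))
    r≤h : r ≤ h
    r≤h = ℕP.+-cancelˡ-≤ (A ℕ.+ s) r h (size^-cancel-≤ (begin
      size ^ (A ℕ.+ s ℕ.+ r)                  ≡⟨ cong (size ^_) (swap A s r) ⟩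
      size ^ (A ℕ.+ r ℕ.+ s)                  ≡⟨ ℕP.^-distribˡ-+-* size (A ℕ.+ r) s ⟩
      size ^ (A ℕ.+ r) ℕ.* size ^ s           ≤⟨ ℕP.*-monoʳ-≤ (size ^ (A ℕ.+ r)) c-r ⟩
      size ^ (A ℕ.+ r) ℕ.* card (common r y)  ≡⟨ q ⟩
      size ^ (A ℕ.+ s ℕ.+ h)                  ∎))
      where
      swap : ∀ A s r → A ℕ.+ s ℕ.+ r ≡ A ℕ.+ r ℕ.+ s
      swap = solve-∀
    f = h ∸ r
    c′ : card (common r y) ≡ size ^ (s ℕ.+ f)
    c′ = cancel-pow (A ℕ.+ r) (trans q (cong (size ^_) (trans (cong (A ℕ.+ s ℕ.+_) (sym (ℕP.m+[n∸m]≡n r≤h))) (reassoc A s r f))))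
    f≤ : f ≤ top ∸ r
    f≤ = ℕP.+-cancelˡ-≤ s f (top ∸ r) (size^-cancel-≤ (begin
      size ^ (s ℕ.+ f)                             ≡⟨ sym c′ ⟩
      card (common r y)                            ≤⟨ card-common-drop y r≤top ⟩
      size ^ (top ∸ r) ℕ.* card (common top y)     ≡⟨ cong (size ^ (top ∸ r) ℕ.*_) c ⟩
      size ^ (top ∸ r) ℕ.* size ^ s                ≡⟨ trans (sym (ℕP.^-distribˡ-+-* size (top ∸ r) s)) (cong (size ^_) (ℕP.+-comm (top ∸ r) s)) ⟩
      size ^ (s ℕ.+ (top ∸ r))                     ∎))
    rest : Σ (HS r η p) λ H → s ℕ.+ f ℕ.+ dsum H ≤ k
    rest = cond⇒HS y r (s ℕ.+ f) (A ℕ.+ r) η p (ℕP.suc-injective le) ds c′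
      (subst (λ B → Cond (A ℕ.+ r) B η p y) (trans (cong (A ℕ.+ s ℕ.+_) (sym (ℕP.m+[n∸m]≡n r≤h))) (reassoc A s r f)) cs)
    build : r ℕ.+ f ≡ h → f ℕ.+ (top ∸ r ∸ f) ≡ top ∸ r → Σ (HS top (h ∷ η) (r ∷ p)) λ H → s ℕ.+ dsum H ≤ k
    build e₁ e₂ = subst₂ (λ t h → Σ (HS t (h ∷ η) (r ∷ p)) λ H → s ℕ.+ dsum H ≤ k)
      (trans (cong (r ℕ.+_) e₂) (ℕP.m+[n∸m]≡n r≤top)) e₁
      (cons (top ∸ r ∸ f) f r (proj₁ rest) , subst (_≤ k) (ℕP.+-assoc s f _) (proj₂ rest))

-- Horizontal strips and their enumeration.

module HorizontalStrips where

  open import Defs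
  open Counting
  open PartitionLists
  open Weights
  open import Data.Bool.Base using (Bool; true; false; _∧_; T)
  open import Data.Bool.ListAction using (all)
  open import Data.Nat.Base using (ℕ; zero; suc; _≤_; _<_; z≤n; s≤s; _∸_; _≤ᵇ_; _<ᵇ_; _≡ᵇ_; _+_; _*_)
  import Data.Nat.Properties as ℕP
  open import Data.Nat.Tactic.RingSolver using (solve-∀)
  open import Data.Nat.ListAction using (sum)
  open import Data.List.Base using (List; []; _∷_; map; length; filterᵇ; upTo; applyUpTo)
  open import Data.List.Properties using (≡-dec; ∷-injective; map-upTo)
  open import Data.List.Relation.Unary.All as All using (All; []; _∷_)
  import Data.List.Relation.Unary.All.Properties as AllP
  open import Data.List.Relation.Unary.Any using (here; there)
  open import Data.List.Membership.Propositional using (_∈_)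
  open import Data.Product.Base using (_×_; _,_)
  open import Data.Empty using (⊥-elim)
  open import Data.Unit.Base using (⊤; tt)
  open import Function.Base using (_∘_)
  open import Relation.Nullary using (Dec; yes; no)
  open import Relation.Nullary.Decidable using (_×-dec_)
  open import Relation.Binary.PropositionalEquality

  _≟ˡ_ : (ρ p : List ℕ) → Dec (ρ ≡ p)
  _≟ˡ_ = ≡-dec ℕP._≟_

  -- η / ρ is a horizontal strip of size k
  data Strip : ℕ → List ℕ → List ℕ → Set where
    empty : Strip 0 [] []
    cons  : ∀ {η ρ} f r (H : HS r η ρ) → Strip (f + dsum H) (r + f ∷ η) (r ∷ ρ)

  Decr : List ℕ → Set
  Decr []      = ⊤
  Decr (h ∷ η) = Desc h η

  data Sub : List ℕ → List ℕ → Set where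
    []  : Sub [] []
    _∷_ : ∀ {h r η ρ} → r ≤ h → Sub η ρ → Sub (h ∷ η) (r ∷ ρ)

  HS⇒Sub : ∀ {top η ρ} → HS top η ρ → Sub η ρ
  HS⇒Sub stop            = []
  HS⇒Sub (cons g f r H) = ℕP.m≤m+n r f ∷ HS⇒Sub H

  HS⇒Desc : ∀ {top η ρ} → HS top η ρ → Desc top ρ
  HS⇒Desc stop            = tt
  HS⇒Desc (cons g f r H) = ℕP.m≤m+n r _ , HS⇒Desc H

  Strip⇒Sub : ∀ {k η ρ} → Strip k η ρ → Sub η ρ
  Strip⇒Sub empty        = []
  Strip⇒Sub (cons f r H) = ℕP.m≤m+n r f ∷ HS⇒Sub H

  Strip⇒Decr : ∀ {k η ρ} → Strip k η ρ → Decr ρ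
  Strip⇒Decr empty        = tt
  Strip⇒Decr (cons f r H) = HS⇒Desc H

  Strip-length : ∀ {k η ρ} → Strip k η ρ → length η ≡ length ρ
  Strip-length empty        = refl
  Strip-length (cons f r H) = cong suc (HS-length H)

  Strip-sum : ∀ {k η ρ} → Strip k η ρ → sum η ≡ sum ρ + k
  Strip-sum empty                  = refl
  Strip-sum (cons {η} {ρ} f r H) = trans (cong (r + f +_) (sum-HS H)) (regroup r f (sum ρ) (dsum H))
    where
    regroup : ∀ r f p d → r + f + (p + d) ≡ r + p + (f + d)
    regroup = solve-∀

  ∑-∈-cong : ∀ {A : Set} (xs : List A) {φ ψ : A → ℕ} → (∀ x → x ∈ xs → φ x ≡ ψ x) → ∑ xs φ ≡ ∑ xs ψ
  ∑-∈-cong []       h = refl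
  ∑-∈-cong (x ∷ xs) h = cong₂ _+_ (h x (here refl)) (∑-∈-cong xs (λ y m → h y (there m)))

  ∑-applyUpTo : ∀ {A : Set} n (f : ℕ → A) (φ : A → ℕ) → ∑ (applyUpTo f n) φ ≡ ∑ (upTo n) (φ ∘ f)
  ∑-applyUpTo n f φ = trans (cong (λ l → ∑ l φ) (sym (map-upTo f n))) (∑-map f (upTo n) φ)

  upTo-once : ∀ n {p} → p < n → ∑ (upTo n) (λ i → χ (i ℕP.≟ p)) ≡ 1
  upTo-once (suc n) {zero} _ = cong suc (trans (∑-applyUpTo n suc _) (trans (∑-cong (upTo n) (λ i → χ-no (suc i ℕP.≟ 0) ℕP.1+n≢0)) (∑-0 (upTo n))))
  upTo-once (suc n) {suc p} (s≤s p<n) = trans (∑-applyUpTo n suc _)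
    (trans (∑-cong (upTo n) (λ i → χ-cong (suc i ℕP.≟ suc p) (i ℕP.≟ p) ℕP.suc-injective (cong suc))) (upTo-once n p<n))

  ∑-subLists : ∀ h η (φ : List ℕ → ℕ) → ∑ (subLists (h ∷ η)) φ ≡ ∑ (upTo (suc h)) (λ r → ∑ (subLists η) (λ ρ → φ (r ∷ ρ)))
  ∑-subLists h η φ = trans (∑-concatMap (λ r → map (r ∷_) (subLists η)) (upTo (suc h)) φ) (∑-cong (upTo (suc h)) (λ r → ∑-map (r ∷_) (subLists η) φ))

  subLists-once : ∀ {η p} → Sub η p → ∑ (subLists η) (λ ρ → χ (ρ ≟ˡ p)) ≡ 1
  subLists-once [] = refl
  subLists-once {h ∷ η} {r₀ ∷ p} (r≤h ∷ s) = trans (∑-subLists h η _) (trans (∑-cong (upTo (suc h)) (λ r →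
    trans (∑-cong (subLists η) (λ ρ → trans (χ-cong ((r ∷ ρ) ≟ˡ (r₀ ∷ p)) ((r ℕP.≟ r₀) ×-dec (ρ ≟ˡ p)) ∷-injective (λ (a , b) → cong₂ _∷_ a b))
      (χ-× (r ℕP.≟ r₀) (ρ ≟ˡ p))))
    (trans (∑-*ˡ (subLists η) (χ (r ℕP.≟ r₀)) _) (trans (cong (χ (r ℕP.≟ r₀) *_) (subLists-once s)) (ℕP.*-identityʳ _)))))
    (upTo-once (suc h) (s≤s r≤h)))

  subLists-Sub : ∀ η → All (Sub η) (subLists η)
  subLists-Sub []      = [] ∷ []
  subLists-Sub (h ∷ η) = AllP.concat⁺ (AllP.map⁺ (AllP.applyUpTo⁺₁ (λ i → i) (suc h)
    (λ {i} i<sh → AllP.map⁺ (All.map (λ s → ℕP.≤-pred i<sh ∷ s) (subLists-Sub η)))))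

  occupied : ℕ → ℕ → ℕ → ℕ
  occupied c h r = 𝟙 ((r <ᵇ suc c) ∧ (suc c ≤ᵇ h))

  -- The number of boxes of η / ρ in column c.
  col : ℕ → List ℕ → List ℕ → ℕ
  col c (h ∷ η) (r ∷ ρ) = occupied c h r + col c η ρ
  col c _       _       = 0

  col-count : ∀ c {η ρ} → Sub η ρ → length (filterᵇ (λ i → ((ρ ‼ i) <ᵇ suc c) ∧ (suc c ≤ᵇ (η ‼ i))) (upTo (length η))) ≡ col c η ρ
  col-count c {η} {ρ} s = trans (length-filterᵇ (λ i → ((ρ ‼ i) <ᵇ suc c) ∧ (suc c ≤ᵇ (η ‼ i))) (upTo (length η))) (go s)
    where
    go : ∀ {η ρ} → Sub η ρ → ∑ (upTo (length η)) (λ i → occupied c (η ‼ i) (ρ ‼ i)) ≡ col c η ρ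
    go []                    = refl
    go {h ∷ η} {r ∷ ρ} (_ ∷ s) = cong (occupied c h r +_) (trans (∑-applyUpTo (length η) suc _) (go s))

  T⇒≡ : ∀ {b} → T b → b ≡ true
  T⇒≡ {true} _ = refl

  ≡⇒T : ∀ {b} → b ≡ true → T b
  ≡⇒T refl = tt

  occupied-yes : ∀ {c h r} → r ≤ c → c < h → occupied c h r ≡ 1
  occupied-yes {c} {h} {r} r≤c c<h rewrite T⇒≡ (ℕP.<⇒<ᵇ (s≤s r≤c)) | T⇒≡ (ℕP.≤⇒≤ᵇ c<h) = refl

  occupied-≤1 : ∀ c h r → occupied c h r ≤ 1
  occupied-≤1 c h r with (r <ᵇ suc c) ∧ (suc c ≤ᵇ h)
  ... | true  = ℕP.≤-refl
  ... | false = z≤n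

  occupied-no₁ : ∀ {c h r} → c < r → occupied c h r ≡ 0
  occupied-no₁ {c} {h} {r} c<r with r <ᵇ suc c in eq
  ... | false = refl
  ... | true  = ⊥-elim (ℕP.<⇒≱ c<r (ℕP.≤-pred (ℕP.<ᵇ⇒< r (suc c) (≡⇒T eq))))

  occupied-no₂ : ∀ {c h r} → h ≤ c → occupied c h r ≡ 0
  occupied-no₂ {c} {h} {r} h≤c with suc c ≤ᵇ h in eq
  ... | true  = ⊥-elim (ℕP.<⇒≱ (ℕP.≤ᵇ⇒≤ (suc c) h (≡⇒T eq)) h≤c)
  ... | false with r <ᵇ suc c
  ...   | true  = refl
  ...   | false = refl

  col-HS-0 : ∀ {c top η ρ} → HS top η ρ → top ≤ c → col c η ρ ≡ 0
  col-HS-0 stop _ = refl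
  col-HS-0 {c} (cons g f r H) t≤c = cong₂ _+_ (occupied-no₂ {c} {r + f} {r} (ℕP.≤-trans (ℕP.+-monoʳ-≤ r (ℕP.m≤m+n f g)) t≤c))
    (col-HS-0 H (ℕP.≤-trans (ℕP.m≤m+n r _) t≤c))

  -- The first row of the strip occupies columns from r on, the rows below it only columns before r.
  col-HS-1 : ∀ {c top η ρ} → HS top η ρ → col c η ρ ≤ 1
  col-HS-1 stop = z≤n
  col-HS-1 {c} (cons {η} {ρ} g f r H) with r ℕP.≤? c
  ... | yes r≤c = subst (_≤ 1) (sym (trans (cong (occupied c (r + f) r +_) (col-HS-0 H r≤c)) (ℕP.+-identityʳ _))) (occupied-≤1 c (r + f) r)
  ... | no r≰c  = subst (_≤ 1) (sym (cong (_+ col c η ρ) (occupied-no₁ {c} {r + f} {r} (ℕP.≰⇒> r≰c)))) (col-HS-1 H)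

  col-Strip : ∀ {c k η ρ} → Strip k η ρ → col c η ρ ≤ 1
  col-Strip empty        = z≤n
  col-Strip {c} (cons f r H) = col-HS-1 {c} (cons 0 f r H)

  isDecr⁺ : ∀ {r} ρ → Desc r ρ → isDecr (r ∷ ρ) ≡ true
  isDecr⁺ []       d        = refl
  isDecr⁺ (r′ ∷ ρ) (le , d) = cong₂ _∧_ (T⇒≡ (ℕP.≤⇒≤ᵇ le)) (isDecr⁺ ρ d)

  isDecr⁻ : ∀ {r ρ} → isDecr (r ∷ ρ) ≡ true → Desc r ρ
  isDecr⁻ {r} {[]}     e = tt
  isDecr⁻ {r} {r′ ∷ ρ} e with r′ ≤ᵇ r in eq
  ... | true = ℕP.≤ᵇ⇒≤ r′ r (≡⇒T eq) , isDecr⁻ e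

  -- If the next row h′ were longer than r, column r would contain a box of the strip in both rows.
  -- So h′ ≤ r, and this is what `HS` records.
  interlacing : ∀ {h r η ρ} → Desc h η → Desc r ρ → Sub (h ∷ η) (r ∷ ρ) → (∀ c → c < h → col c (h ∷ η) (r ∷ ρ) ≤ 1) → HS r η ρ
  interlacing {η = []} {[]} dη dρ (_ ∷ []) cols = stop
  interlacing {h} {r} {h′ ∷ η} {r′ ∷ ρ} (h′≤h , dη) (r′≤r , dρ) (_ ∷ (r′≤h′ ∷ s)) cols =
    build (ℕP.m+[n∸m]≡n r′≤h′) (ℕP.m+[n∸m]≡n h′≤r) (interlacing dη dρ (r′≤h′ ∷ s) (λ c c<h′ → ℕP.≤-trans (ℕP.m≤n+m _ (occupied c h r)) (cols c (ℕP.<-≤-trans c<h′ h′≤h))))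
    where
    h′≤r : h′ ≤ r
    h′≤r = ℕP.≮⇒≥ (λ r<h′ → ℕP.<⇒≱ (s≤s (s≤s z≤n)) (subst (_≤ 1)
      (cong₂ (λ a b → a + (b + col r η ρ)) (occupied-yes ℕP.≤-refl (ℕP.<-≤-trans r<h′ h′≤h)) (occupied-yes r′≤r r<h′))
      (cols r (ℕP.<-≤-trans r<h′ h′≤h))))
    build : r′ + (h′ ∸ r′) ≡ h′ → h′ + (r ∸ h′) ≡ r → HS r′ η ρ → HS r (h′ ∷ η) (r′ ∷ ρ)
    build e₁ e₂ H = subst₂ (λ t h → HS t (h ∷ η) (r′ ∷ ρ)) (trans (sym (ℕP.+-assoc r′ _ _)) (trans (cong (_+ (r ∸ h′)) e₁) e₂)) e₁
      (cons (r ∸ h′) (h′ ∸ r′) r′ H)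

  all-upTo⁺ : ∀ {p : ℕ → Bool} n → (∀ i → i < n → p i ≡ true) → all p (upTo n) ≡ true
  all-upTo⁺ {p} n h = go n (λ i → i) (λ i i<n → h i i<n)
    where
    go : ∀ n (f : ℕ → ℕ) → (∀ i → i < n → p (f i) ≡ true) → all p (applyUpTo f n) ≡ true
    go zero    f h = refl
    go (suc n) f h rewrite h 0 (s≤s z≤n) = go n (f ∘ suc) (λ i i<n → h (suc i) (s≤s i<n))

  all-upTo⁻ : ∀ {p : ℕ → Bool} n → all p (upTo n) ≡ true → ∀ i → i < n → p i ≡ true
  all-upTo⁻ {p} n e = go n (λ i → i) e
    where
    go : ∀ n (f : ℕ → ℕ) → all p (applyUpTo f n) ≡ true → ∀ i → i < n → p (f i) ≡ true
    go (suc n) f e i i<n with p (f 0) in eq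
    go (suc n) f e zero    i<n       | true = eq
    go (suc n) f e (suc i) (s≤s i<n) | true = go n (f ∘ suc) e i i<n

  stripTest : List ℕ → ℕ → List ℕ → Bool
  stripTest η k ρ = isDecr ρ ∧ isHorizontalStrip η ρ ∧ ((sum η ∸ sum ρ) ≡ᵇ k)

  ∧⁻ : ∀ {a b} → a ∧ b ≡ true → a ≡ true × b ≡ true
  ∧⁻ {true} {true} h = refl , refl

  isHS⁺ : ∀ {k η ρ} → Strip k η ρ → isHorizontalStrip η ρ ≡ true
  isHS⁺ {k} {η} {ρ} S = all-upTo⁺ (η ‼ 0) (λ c _ → T⇒≡ (ℕP.≤⇒≤ᵇ (subst (_≤ 1) (sym (col-count c (Strip⇒Sub S))) (col-Strip S))))

  isHS⁻ : ∀ {η ρ} → Sub η ρ → isHorizontalStrip η ρ ≡ true → ∀ c → c < η ‼ 0 → col c η ρ ≤ 1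
  isHS⁻ {η} {ρ} s e c c< = subst (_≤ 1) (col-count c s) (ℕP.≤ᵇ⇒≤ _ 1 (≡⇒T (all-upTo⁻ (η ‼ 0) e c c<)))

  decr-top : ∀ {ρ} → Decr ρ → isDecr ρ ≡ true
  decr-top {[]}    d = refl
  decr-top {r ∷ ρ} d = isDecr⁺ ρ d

  strip⇒test : ∀ {k η ρ} → Strip k η ρ → stripTest η k ρ ≡ true
  strip⇒test {k} {η} {ρ} S = cong₂ _∧_ (decr-top {ρ} (Strip⇒Decr S)) (cong₂ _∧_ (isHS⁺ S)
    (T⇒≡ (ℕP.≡⇒≡ᵇ _ k (trans (cong (_∸ sum ρ) (Strip-sum S)) (ℕP.m+n∸m≡n (sum ρ) k)))))

  test⇒strip : ∀ {k η ρ} → Decr η → Sub η ρ → stripTest η k ρ ≡ true → Strip k η ρ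
  test⇒strip {k} {[]} {[]} d [] e = subst (λ k → Strip k [] []) (ℕP.≡ᵇ⇒≡ 0 k (≡⇒T e)) empty
  test⇒strip {k} {h ∷ η} {r ∷ ρ} d (r≤h ∷ s) e with ∧⁻ {isDecr (r ∷ ρ)} e
  ... | e₁ , e′ with ∧⁻ {isHorizontalStrip (h ∷ η) (r ∷ ρ)} e′
  ... | e₂ , e₃ = subst₂ (λ h k → Strip k (h ∷ η) (r ∷ ρ)) (ℕP.m+[n∸m]≡n r≤h) k≡ (cons (h ∸ r) r H)
    where
    H : HS r η ρ
    H = interlacing d (isDecr⁻ e₁) (r≤h ∷ s) (isHS⁻ (r≤h ∷ s) e₂)
    k≡ : h ∸ r + dsum H ≡ k
    k≡ = trans (sym (trans (cong (λ t → t + sum η ∸ (r + sum ρ)) (sym (ℕP.m+[n∸m]≡n r≤h)))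
      (trans (cong (_∸ (r + sum ρ)) (Strip-sum (cons (h ∸ r) r H))) (ℕP.m+n∸m≡n (r + sum ρ) _)))) (ℕP.≡ᵇ⇒≡ _ k (≡⇒T e₃))

  All-filterᵇ : ∀ {A : Set} {P : A → Set} (p : A → Bool) xs → (∀ x → x ∈ xs → p x ≡ true → P x) → All P (filterᵇ p xs)
  All-filterᵇ p []       h = []
  All-filterᵇ p (x ∷ xs) h with p x in eq
  ... | true  = h x (here refl) eq ∷ All-filterᵇ p xs (λ y m → h y (there m))
  ... | false = All-filterᵇ p xs (λ y m → h y (there m))

  strips-All : ∀ η k → Decr η → All (Strip k η) (strips η k)
  strips-All η k d = All-filterᵇ (stripTest η k) (subLists η) (λ ρ m e → test⇒strip d (All.lookup (subLists-Sub η) m) e)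

  strips-once : ∀ {k η p} → Strip k η p → ∑ (strips η k) (λ ρ → χ (ρ ≟ˡ p)) ≡ 1
  strips-once {k} {η} {p} S = trans (∑-filterᵇ (stripTest η k) (subLists η) _) (trans (∑-cong (subLists η) absorb) (subLists-once (Strip⇒Sub S)))
    where
    absorb : ∀ ρ → 𝟙 (stripTest η k ρ) * χ (ρ ≟ˡ p) ≡ χ (ρ ≟ˡ p)
    absorb ρ with ρ ≟ˡ p
    ... | no _     = ℕP.*-zeroʳ (𝟙 (stripTest η k ρ))
    ... | yes refl = cong (λ b → 𝟙 b * 1) (strip⇒test S)

  ∑≢0⇒∈ : ∀ (xs : List (List ℕ)) p → ∑ xs (λ ρ → χ (ρ ≟ˡ p)) ≢ 0 → p ∈ xs
  ∑≢0⇒∈ []       p h = ⊥-elim (h refl)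
  ∑≢0⇒∈ (ρ ∷ xs) p h with ρ ≟ˡ p
  ... | yes refl = here refl
  ... | no _     = there (∑≢0⇒∈ xs p h)

  strips-∈ : ∀ {k η p} → Strip k η p → p ∈ strips η k
  strips-∈ {k} {η} {p} S = ∑≢0⇒∈ (strips η k) p (λ z → ℕP.1+n≢0 (trans (sym (strips-once S)) z))

  desc-conjL : ∀ L o f → (∀ i → f (suc i) ≤ f i) → f 0 ≤ o → Desc o (applyUpTo f L)
  desc-conjL zero    o f h le = tt
  desc-conjL (suc L) o f h le = le , desc-conjL L (f 0) (f ∘ suc) (h ∘ suc) (h 0)

  cnt-antitone : ∀ i ρ → cnt (suc i) ρ ≤ cnt i ρ
  cnt-antitone i []      = z≤n
  cnt-antitone i (a ∷ ρ) = subst₂ _≤_ (sym (cnt-∷ (suc i) a ρ)) (sym (cnt-∷ i a ρ)) (ℕP.+-mono-≤ (gt-antitone a) (cnt-antitone i ρ))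
    where
    gt-antitone : ∀ a → gt (suc i) a ≤ gt i a
    gt-antitone a with suc i ℕP.<? a
    ... | yes p = ℕP.≤-reflexive (trans (gt-yes p) (sym (gt-yes (ℕP.<-trans (ℕP.n<1+n i) p))))
    ... | no ¬p = subst (_≤ gt i a) (sym (gt-no (ℕP.≮⇒≥ ¬p))) z≤n

  conjL-Desc : ∀ L ρ → Desc (cnt 0 ρ) (conjL L ρ)
  conjL-Desc L ρ = subst (Desc (cnt 0 ρ)) (sym (map-upTo (λ j → cnt j ρ) L)) (desc-conjL L (cnt 0 ρ) _ (λ i → cnt-antitone i ρ) ℕP.≤-refl)

  Desc⇒Decr : ∀ {top η} → Desc top η → Decr η
  Desc⇒Decr {η = []}    d       = tt
  Desc⇒Decr {η = h ∷ η} (_ , d) = d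

  ‼-conjL : ∀ L ρ i → i < L → conjL L ρ ‼ i ≡ cnt i ρ
  ‼-conjL L ρ i i<L = trans (cong (_‼ i) (map-upTo (λ j → cnt j ρ) L)) (go L (λ j → cnt j ρ) i i<L)
    where
    go : ∀ L f i → i < L → applyUpTo f L ‼ i ≡ f i
    go (suc L) f zero    _         = refl
    go (suc L) f (suc i) (s≤s i<L) = go L (f ∘ suc) i i<L

  length≡cnt : ∀ {ρ} → All (0 <_) ρ → length ρ ≡ cnt 0 ρ
  length≡cnt []                = refl
  length≡cnt {a ∷ ρ} (p ∷ pos) = trans (cong suc (length≡cnt pos)) (sym (trans (cnt-∷ 0 a ρ) (cong (_+ cnt 0 ρ) (gt-yes p))))

-- Integer sums over chains of strips.

module WeightedChains where

  open import Defs
  open Counting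
  open PartitionLists
  open Weights
  open HorizontalStrips
  open import Data.Bool.Base using (if_then_else_)
  open import Data.Nat.Base as ℕ using (ℕ; suc; _≡ᵇ_)
  import Data.Nat.Properties as ℕP
  open import Data.Nat.ListAction using (sum)
  open import Data.Integer.Base using (ℤ; +_; 0ℤ; 1ℤ; _+_; _*_)
  import Data.Integer.Properties as ℤP
  open import Data.Integer.Tactic.RingSolver using (solve-∀)
  open import Data.List.Base using (List; []; _∷_; length)
  open import Data.List.Relation.Unary.Any using (here; there)
  open import Data.List.Membership.Propositional using (_∈_)
  open import Relation.Nullary using (yes; no)
  open import Relation.Binary.PropositionalEquality

  ∑ℤ : {A : Set} → List A → (A → ℤ) → ℤ
  ∑ℤ []       φ = 0ℤ
  ∑ℤ (x ∷ xs) φ = φ x + ∑ℤ xs φ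

  module _ {A : Set} where

    ∑ℤ-cong : (xs : List A) {φ ψ : A → ℤ} → (∀ x → x ∈ xs → φ x ≡ ψ x) → ∑ℤ xs φ ≡ ∑ℤ xs ψ
    ∑ℤ-cong []       h = refl
    ∑ℤ-cong (x ∷ xs) h = cong₂ _+_ (h x (here refl)) (∑ℤ-cong xs (λ y m → h y (there m)))

    ∑ℤ-0 : (xs : List A) → ∑ℤ xs (λ _ → 0ℤ) ≡ 0ℤ
    ∑ℤ-0 []       = refl
    ∑ℤ-0 (x ∷ xs) = trans (ℤP.+-identityˡ _) (∑ℤ-0 xs)

    ∑ℤ-+ : (xs : List A) (φ ψ : A → ℤ) → ∑ℤ xs (λ x → φ x + ψ x) ≡ ∑ℤ xs φ + ∑ℤ xs ψ
    ∑ℤ-+ []       φ ψ = refl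
    ∑ℤ-+ (x ∷ xs) φ ψ = trans (cong (λ t → φ x + ψ x + t) (∑ℤ-+ xs φ ψ)) (regroup (φ x) (ψ x) _ _)
      where
      regroup : ∀ a b c d → a + b + (c + d) ≡ a + c + (b + d)
      regroup = solve-∀

    ∑ℤ-*ˡ : (xs : List A) (c : ℤ) (φ : A → ℤ) → ∑ℤ xs (λ x → c * φ x) ≡ c * ∑ℤ xs φ
    ∑ℤ-*ˡ []       c φ = sym (ℤP.*-zeroʳ c)
    ∑ℤ-*ˡ (x ∷ xs) c φ = trans (cong (λ t → c * φ x + t) (∑ℤ-*ˡ xs c φ)) (sym (ℤP.*-distribˡ-+ c (φ x) _))

    +-∑ : (xs : List A) (φ : A → ℕ) → + ∑ xs φ ≡ ∑ℤ xs (λ x → + φ x)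
    +-∑ []       φ = refl
    +-∑ (x ∷ xs) φ = trans (ℤP.pos-+ (φ x) _) (cong (λ t → + φ x + t) (+-∑ xs φ))

  ∑ℤ-swap : {A B : Set} (xs : List A) (ys : List B) (φ : A → B → ℤ) →
            ∑ℤ xs (λ x → ∑ℤ ys (φ x)) ≡ ∑ℤ ys (λ y → ∑ℤ xs (λ x → φ x y))
  ∑ℤ-swap []       ys φ = sym (∑ℤ-0 ys)
  ∑ℤ-swap (x ∷ xs) ys φ = trans (cong (λ t → ∑ℤ ys (φ x) + t) (∑ℤ-swap xs ys φ)) (sym (∑ℤ-+ ys (φ x) _))

  ∑ℤ-single : (xs : List (List ℕ)) (p : List ℕ) (φ : List ℕ → ℤ) → ∑ xs (λ ρ → χ (ρ ≟ˡ p)) ≡ 1 →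
              (∀ ρ → ρ ∈ xs → ρ ≢ p → φ ρ ≡ 0ℤ) → ∑ℤ xs φ ≡ φ p
  ∑ℤ-single xs p φ once h = trans (go xs h) (trans (cong (λ n → + n * φ p) once) (ℤP.*-identityˡ _))
    where
    go : ∀ xs → (∀ ρ → ρ ∈ xs → ρ ≢ p → φ ρ ≡ 0ℤ) → ∑ℤ xs φ ≡ + ∑ xs (λ ρ → χ (ρ ≟ˡ p)) * φ p
    go []       h = sym (ℤP.*-zeroˡ (φ p))
    go (ρ ∷ xs) h with ρ ≟ˡ p
    ... | yes refl = trans (cong (λ t → φ p + t) (go xs (λ ρ m → h ρ (there m)))) (factor (φ p) (+ ∑ xs (λ ρ → χ (ρ ≟ˡ p))))
      where
      factor : ∀ a b → a + b * a ≡ (1ℤ + b) * a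
      factor = solve-∀
    ... | no ne    = trans (cong₂ _+_ (h ρ (here refl) ne) (go xs (λ ρ m → h ρ (there m)))) (ℤP.+-identityˡ _)

  -- bChain with the weights Wt in place of theta
  B : ℤ → List ℕ → List ℕ → ℤ
  B x η []       = if sum η ≡ᵇ 0 then 1ℤ else 0ℤ
  B x η (k ∷ ks) = ∑ℤ (strips η k) (λ ρ → Wt x η ρ * B x ρ ks)

  psum-injective : ∀ {p p′} → length p ≡ length p′ → (∀ i → i ℕ.< length p → psum (suc i) p ≡ psum (suc i) p′) → p ≡ p′
  psum-injective {[]}    {[]}     _ _ = refl
  psum-injective {a ∷ p} {b ∷ p′} l h = cong₂ _∷_ a≡b (psum-injective (ℕP.suc-injective l)
    (λ i i< → ℕP.+-cancelˡ-≡ a _ _ (trans (h (suc i) (ℕ.s≤s i<)) (cong (ℕ._+ psum (suc i) p′) (sym a≡b)))))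
    where
    a≡b : a ≡ b
    a≡b = trans (sym (ℕP.+-identityʳ a)) (trans (h 0 (ℕ.s≤s ℕ.z≤n)) (ℕP.+-identityʳ b))

-- The recursion on the last block.

module FlagRecursion (F : FiniteField) where

  open import Defs hiding (FiniteField)
  open Counting
  open LinearAlgebra F
  open JordanExistence F
  open JordanKernels F
  open PartitionLists
  open KernelTypes F
  open CornerMatrices F
  open RowCounting F
  open Weights
  open HorizontalStrips
  open WeightedChains
  open import Data.Nat.Base as ℕ using (ℕ; zero; suc; _≤_; _<_; z≤n; s≤s; _∸_; _^_)
  import Data.Nat.Properties as ℕP
  open import Data.Nat.ListAction using (sum)
  open import Data.Nat.ListAction.Properties using (sum-++)
  open import Data.Integer.Base as ℤ using (ℤ; +_)
  import Data.Integer.Properties as ℤP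
  open import Data.Fin.Base as Fin using (Fin; toℕ)
  import Data.Fin.Properties as FinP
  open import Data.List.Base using (List; []; _∷_; _∷ʳ_; length; reverse)
  open import Data.List.Properties using (unfold-reverse)
  open import Data.List.Relation.Unary.All as All using (All; []; _∷_)
  open import Data.List.Membership.Propositional using (_∈_)
  open import Data.Product.Base using (Σ; ∃; _×_; _,_; proj₁; proj₂)
  open import Data.Empty using (⊥-elim)
  open import Data.Unit.Base using (tt)
  open import Data.Vec.Functional using (Vector)
  open import Relation.Nullary using (Dec; yes; no; ¬_)
  open import Relation.Nullary.Decidable using (_×-dec_)
  open import Relation.Binary.PropositionalEquality hiding (J; resp)

  open Subspace using (card)

  -- The unrolled form of `Cond`. For A = B = 0 and p the column lengths of ρ it is `RowType`, since
  -- partial sums of columns are `minsum`.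
  Rows : ∀ {l k} (A B : ℕ) (η p : List ℕ) → Vector (V k) l → Set
  Rows A B η p y = ∀ i → i < length η → size ^ (A ℕ.+ psum (suc i) p) ℕ.* card (common (p ‼ i) y) ≡ size ^ (B ℕ.+ psum (suc i) η)

  module _ {l k : ℕ} (y : Vector (V k) l) where

    private
      shift-sum : ∀ A r {t} → A ℕ.+ (r ℕ.+ t) ≡ A ℕ.+ r ℕ.+ t
      shift-sum A r = sym (ℕP.+-assoc A r _)

    rows⇒cond : ∀ A B η p → length η ≡ length p → Rows A B η p y → Cond A B η p y
    rows⇒cond A B []      []      _ h = tt
    rows⇒cond A B (a ∷ η) (r ∷ p) e h =
      subst₂ (λ u v → size ^ (A ℕ.+ u) ℕ.* card (common r y) ≡ size ^ (B ℕ.+ v)) (ℕP.+-identityʳ r) (ℕP.+-identityʳ a) (h 0 (s≤s z≤n)) ,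
      rows⇒cond (A ℕ.+ r) (B ℕ.+ a) η p (ℕP.suc-injective e)
        (λ i i< → subst₂ (λ u v → size ^ u ℕ.* card (common (p ‼ i) y) ≡ size ^ v) (shift-sum A r) (shift-sum B a) (h (suc i) (s≤s i<)))

    cond⇒rows : ∀ A B η p → length η ≡ length p → Cond A B η p y → Rows A B η p y
    cond⇒rows A B (a ∷ η) (r ∷ p) e (q , c) zero    _ =
      subst₂ (λ u v → size ^ (A ℕ.+ u) ℕ.* card (common r y) ≡ size ^ (B ℕ.+ v)) (sym (ℕP.+-identityʳ r)) (sym (ℕP.+-identityʳ a)) q
    cond⇒rows A B (a ∷ η) (r ∷ p) e (q , c) (suc i) (s≤s i<) =
      subst₂ (λ u v → size ^ u ℕ.* card (common (p ‼ i) y) ≡ size ^ v) (sym (shift-sum A r)) (sym (shift-sum B a))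
        (cond⇒rows (A ℕ.+ r) (B ℕ.+ a) η p (ℕP.suc-injective e) c i i<)

    private
      at : ∀ (η ρ : List ℕ) {i} → i < length η →
           (size ^ minsum (suc i) ρ ℕ.* card (common (cnt i ρ) y) ≡ size ^ psum (suc i) η)
           ≡ (size ^ psum (suc i) (conjL (length η) ρ) ℕ.* card (common (conjL (length η) ρ ‼ i) y) ≡ size ^ psum (suc i) η)
      at η ρ {i} i< = cong₂ (λ u v → size ^ u ℕ.* card (common v y) ≡ size ^ psum (suc i) η)
        (sym (psum-conjL (length η) ρ (suc i) i<)) (sym (‼-conjL (length η) ρ i i<))

    rowType⇒cond : ∀ η ρ → RowType η ρ y → Cond 0 0 η (conjL (length η) ρ) y
    rowType⇒cond η ρ h = rows⇒cond 0 0 η _ (sym (length-conjL (length η) ρ)) (λ i i< → subst (λ P → P) (at η ρ i<)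
      (subst (λ j → size ^ minsum (suc j) ρ ℕ.* card (common (cnt j ρ) y) ≡ size ^ psum (suc j) η) (FinP.toℕ-fromℕ< i<) (h (Fin.fromℕ< i<))))

    cond⇒rowType : ∀ η ρ → Cond 0 0 η (conjL (length η) ρ) y → RowType η ρ y
    cond⇒rowType η ρ c i = subst (λ P → P) (sym (at η ρ (FinP.toℕ<n i)))
      (cond⇒rows 0 0 η _ (sym (length-conjL (length η) ρ)) c (toℕ i) (FinP.toℕ<n i))

  type-injective : ∀ {n} (X : Sq n) {p p′} → length p ≡ length p′ → Type X p → Type X p′ → p ≡ p′
  type-injective X {p} {p′} e t t′ = psum-injective e (λ i i< → size^-injective (trans (sym (at p t i i<)) (at p′ t′ i (subst (i <_) e i<))))
    where
    at : ∀ p → Type X p → ∀ i → i < length p → ker X (suc i) ≡ size ^ psum (suc i) p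
    at p t i i< = subst (λ j → ker X (suc j) ≡ size ^ psum (suc j) p) (FinP.toℕ-fromℕ< i<) (t (Fin.fromℕ< i<))

  defect+length : ∀ {ρ} → All (0 <_) ρ → defect ρ ℕ.+ length ρ ≡ sum ρ
  defect+length []                        = refl
  defect+length {suc a ∷ ρ} (s≤s _ ∷ pos) = trans (ℕP.+-assoc a _ _) (trans (cong (a ℕ.+_) (ℕP.+-suc (defect ρ) _))
    (trans (ℕP.+-suc a _) (cong (λ t → suc (a ℕ.+ t)) (defect+length pos))))

  module _ {m k : ℕ} {X : Sq m} (τ : JordanType X) (η : List ℕ) (sum-η : sum η ≡ m ℕ.+ k) (η≢[] : 0 < length η) where
    open JordanType τ

    -- The type of X at the length of η, the only candidate for the smaller partition of a strip.
    -- Columns beyond that length are cut off for the moment.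
    p₀ : List ℕ
    p₀ = conjL (length η) ρ

    type-p₀ : Type X p₀
    type-p₀ i = trans (ker-type τ (suc (toℕ i))) (cong (size ^_) (sym (psum-conjL (length η) ρ (suc (toℕ i))
      (subst (toℕ i <_) (length-conjL (length η) ρ) (FinP.toℕ<n i)))))

    private
      sum-p₀ : sum p₀ ≡ minsum (length η) ρ
      sum-p₀ = trans (cong sum (sym (take-all p₀))) (trans (cong (λ n → psum n p₀) (length-conjL (length η) ρ)) (psum-conjL (length η) ρ (length η) ℕP.≤-refl))
        where
        open import Data.List.Base using (take)
        take-all : ∀ (p : List ℕ) → take (length p) p ≡ p
        take-all []      = refl
        take-all (a ∷ p) = cong (a ∷_) (take-all p)

      sum-p₀≤m : sum p₀ ≤ m
      sum-p₀≤m = subst (sum p₀ ≤_) total (subst (_≤ sum ρ) (sym sum-p₀) (minsum-≤ (length η) ρ))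

      desc : Desc (length ρ) p₀
      desc = subst (λ t → Desc t p₀) (sym (length≡cnt pos)) (conjL-Desc (length η) ρ)

      nonempty : ∀ {η p : List ℕ} → 0 < length η → length η ≡ length p → ∃ λ h → ∃ λ η′ → ∃ λ r → ∃ λ p′ → η ≡ h ∷ η′ × p ≡ r ∷ p′
      nonempty {h ∷ η} {r ∷ p} _ _ = h , η , r , p , refl , refl

    head-p₀ : p₀ ‼ 0 ≡ length ρ
    head-p₀ = trans (‼-conjL (length η) ρ 0 η≢[]) (sym (length≡cnt pos))

    -- the kernel dimensions of [[X, Y], [0, 0]] and of X differ by a horizontal strip
    cond⇒strip : ∀ (y : Vector (V k) (length ρ)) → Cond 0 0 η p₀ y → Strip k η p₀
    cond⇒strip y c with nonempty {η} {p₀} η≢[] (sym (length-conjL (length η) ρ))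
    ... | h , η′ , r , p′ , e , e′ = build η p₀ e e′ head-p₀ desc sum-p₀≤m sum-η (sym (length-conjL (length η) ρ)) c
      where
      build : ∀ η p → η ≡ h ∷ η′ → p ≡ r ∷ p′ → p ‼ 0 ≡ length ρ → Desc (length ρ) p → sum p ≤ m → sum η ≡ m ℕ.+ k → length η ≡ length p → Cond 0 0 η p y → Strip k η p
      build _ _ refl refl refl (_ , d) p≤m sη len (q , cs) = subst₂ (λ h k → Strip k (h ∷ η′) (r ∷ p′)) (ℕP.m+[n∸m]≡n r≤h) f+d≡k (cons f r H)
        where
        open ℕP.≤-Reasoning
        r≤h : r ≤ h
        r≤h = size^-cancel-≤ (begin
          size ^ r                            ≤⟨ ℕP.m≤m*n (size ^ r) _ {{ℕ.>-nonZero (card>0 (common r y))}} ⟩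
          size ^ r ℕ.* card (common r y)      ≡⟨ q ⟩
          size ^ h                            ∎)
        f = h ∸ r
        c-r : card (common r y) ≡ size ^ f
        c-r = ℕP.*-cancelˡ-≡ _ _ (size ^ r) {{ℕ.≢-nonZero (size^≢0 r)}} (trans q (trans (cong (size ^_) (sym (ℕP.m+[n∸m]≡n r≤h))) (ℕP.^-distribˡ-+-* size r f)))
        HΣ : Σ (HS r η′ p′) λ H → f ℕ.+ dsum H ≤ k
        HΣ = cond⇒HS y r f r η′ p′ (ℕP.suc-injective len) d c-r (subst (λ B → Cond r B η′ p′ y) (sym (ℕP.m+[n∸m]≡n r≤h)) cs)
        H = proj₁ HΣ
        -- The dimension of F^k gives one inequality. The other follows from |η| = m + k and |p₀| ≤
        -- m; in the case of equality the truncation in p₀ has lost nothing.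
        f+d≡k : f ℕ.+ dsum H ≡ k
        f+d≡k = ℕP.≤-antisym (proj₂ HΣ) (ℕP.+-cancelˡ-≤ m k _ (begin
          m ℕ.+ k                                ≡⟨ sym sη ⟩
          h ℕ.+ sum η′                           ≡⟨ cong (ℕ._+ sum η′) (sym (ℕP.m+[n∸m]≡n r≤h)) ⟩
          r ℕ.+ f ℕ.+ sum η′                     ≡⟨ Strip-sum (cons f r H) ⟩
          r ℕ.+ sum p′ ℕ.+ (f ℕ.+ dsum H)        ≤⟨ ℕP.+-monoˡ-≤ _ p≤m ⟩
          m ℕ.+ (f ℕ.+ dsum H)                   ∎))

    extensions : ℕ
    extensions = ∑[ Fun F m (𝕍 k) ] (λ Y → χ (type? (corner X Y) η))

    extensions-0 : ¬ Strip k η p₀ → extensions ≡ 0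
    extensions-0 ¬S = trans (count-extensions τ η) (trans (cong ((size ^ k) ^ defect ρ ℕ.*_)
      (trans (∑-cong (FinSetoid.elements (Fun F (length ρ) (𝕍 k))) (λ y → χ-no (rowType? η ρ y) (λ h → ¬S (cond⇒strip y (rowType⇒cond y η ρ h)))))
        (∑-0 (FinSetoid.elements (Fun F (length ρ) (𝕍 k)))))) (ℕP.*-zeroʳ ((size ^ k) ^ defect ρ)))

    extensions-Wt : Strip k η p₀ → + extensions ≡ Wt x η p₀
    extensions-Wt S = begin
      + extensions
        ≡⟨ cong +_ (trans (count-extensions τ η) (cong ((size ^ k) ^ defect ρ ℕ.*_) (∑-cong (FinSetoid.elements (Fun F (length ρ) (𝕍 k)))
             (λ y → χ-cong (rowType? η ρ y) (cond? 0 0 η p₀ y) (rowType⇒cond y η ρ) (cond⇒rowType y η ρ))))) ⟩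
      + ((size ^ k) ^ defect ρ ℕ.* ∑[ Fun F (length ρ) (𝕍 k) ] (λ y → χ (cond? 0 0 η p₀ y)))
        ≡⟨ trans (ℤP.pos-* ((size ^ k) ^ defect ρ) _) (cong (λ t → t ℤ.* + ∑[ Fun F (length ρ) (𝕍 k) ] (λ y → χ (cond? 0 0 η p₀ y)))
             (trans (cong +_ (ℕP.^-*-assoc size k (defect ρ))) (+-^ size (k ℕ.* defect ρ)))) ⟩
      x ℤ.^ (k ℕ.* defect ρ) ℤ.* + ∑[ Fun F (length ρ) (𝕍 k) ] (λ y → χ (cond? 0 0 η p₀ y))
        ≡⟨ finish S head-p₀ (trans (sym sum-η) (Strip-sum S)) (trans (defect+length pos) total) η≢[] ⟩
      Wt x η p₀ ∎
      where
      open ≡-Reasoning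
      finish : ∀ {η p} → Strip k η p → p ‼ 0 ≡ length ρ → m ℕ.+ k ≡ sum p ℕ.+ k → defect ρ ℕ.+ length ρ ≡ m → 0 < length η →
        x ℤ.^ (k ℕ.* defect ρ) ℤ.* + ∑[ Fun F (length ρ) (𝕍 k) ] (λ y → χ (cond? 0 0 η p y)) ≡ Wt x η p
      finish {_ ∷ η′} {_ ∷ p′} S′@(cons f r H) r≡ℓ sums def _ = cong₂ (ℤ._*_)
        (cong (x ℤ.^_) (cong₂ ℕ._*_ (sym (trans (cong (_∸ (r ℕ.+ sum p′)) (Strip-sum S′)) (ℕP.m+n∸m≡n (r ℕ.+ sum p′) _))) defect≡))
        (trans (rows (length ρ) (sym r≡ℓ)) (cong (λ t → WL x t r η′ p′) (sym (ℕP.m+n∸m≡n r f))))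
        where
        -- The rows of Y away from the block ends number |ρ| - ℓ(ρ), the sum of all columns of ρ but
        -- the first.
        defect≡ : defect ρ ≡ sum p′
        defect≡ = ℕP.+-cancelʳ-≡ (length ρ) _ _ (trans def (trans (ℕP.+-cancelʳ-≡ (f ℕ.+ dsum H) _ _ sums) (trans (ℕP.+-comm r _) (cong (sum p′ ℕ.+_) r≡ℓ))))
        rows : ∀ l → l ≡ r → + ∑[ Fun F l (𝕍 (f ℕ.+ dsum H)) ] (λ y → χ (cond? 0 0 (r ℕ.+ f ∷ η′) (r ∷ p′) y)) ≡ WL x f r η′ p′
        rows _ refl = trans (cong +_ (∑-cong (FinSetoid.elements (Fun F r (𝕍 (f ℕ.+ dsum H)))) (λ y →
            χ-cong (cond? 0 0 (r ℕ.+ f ∷ η′) (r ∷ p′) y) ((card (common r y) ℕP.≟ size ^ f) ×-dec cond? r (r ℕ.+ f) η′ p′ y)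
              (λ (q , c) → ℕP.*-cancelˡ-≡ _ _ (size ^ r) {{ℕ.≢-nonZero (size^≢0 r)}} (trans q (ℕP.^-distribˡ-+-* size r f)) , c)
              (λ (q , c) → trans (cong (size ^ r ℕ.*_) q) (sym (ℕP.^-distribˡ-+-* size r f)) , c))))
          (count-rows H f r refl)

    -- At most one term is nonzero, because X has only one type of a given length. In this form the
    -- Jordan form of X is no longer mentioned, so the sum over X can be exchanged with the sum over
    -- strips.
    extensions-strips : Decr η → + extensions ≡ ∑ℤ (strips η k) (λ p → + χ (type? X p) ℤ.* Wt x η p)
    extensions-strips dη with Strip? 
      where
      open import Data.List.Relation.Unary.Any using (any?)
      Strip? : Dec (Strip k η p₀)
      Strip? with any? (p₀ ≟ˡ_) (strips η k)
      ... | yes m = yes (All.lookup (strips-All η k dη) m)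
      ... | no ¬m = no (λ S → ¬m (strips-∈ S))
    ... | yes S = trans (extensions-Wt S) (sym (trans (∑ℤ-single (strips η k) p₀ _ (strips-once S)
            (λ p p∈ ne → trans (cong (λ t → + t ℤ.* Wt x η p) (χ-no (type? X p) (λ t → ne (unique p p∈ t)))) (ℤP.*-zeroˡ (Wt x η p))))
          (trans (cong (λ t → + t ℤ.* Wt x η p₀) (χ-yes (type? X p₀) type-p₀)) (ℤP.*-identityˡ _))))
      where
      unique : ∀ p → p ∈ strips η k → Type X p → p ≡ p₀
      unique p p∈ t = type-injective X (trans (sym (Strip-length (All.lookup (strips-All η k dη) p∈))) (sym (length-conjL (length η) ρ))) t type-p₀
    ... | no ¬S = trans (cong +_ (extensions-0 ¬S)) (sym (trans (∑ℤ-cong (strips η k) (λ p p∈ →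
            trans (cong (λ t → + t ℤ.* Wt x η p) (χ-no (type? X p) (λ t → ¬S (subst (Strip k η)
              (type-injective X (trans (sym (Strip-length (All.lookup (strips-All η k dη) p∈))) (sym (length-conjL (length η) ρ))) t type-p₀)
              (All.lookup (strips-All η k dη) p∈))))) (ℤP.*-zeroˡ (Wt x η p)))) (∑ℤ-0 (strips η k))))

  FT-recursion : ∀ Λ k η → 0 < k → Decr η → sum η ≡ sum Λ ℕ.+ k →
    + FT (sum Λ ℕ.+ k) η (Λ ∷ʳ k) ≡ ∑ℤ (strips η k) (λ p → Wt x η p ℤ.* + FT (sum Λ) p Λ)
  FT-recursion Λ k η k>0 dη sη = begin
    + FT (m ℕ.+ k) η (Λ ∷ʳ k)
      ≡⟨ trans (cong +_ (FT-snoc Λ k η)) (+-∑ E _) ⟩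
    ∑ℤ E (λ X → + (χ (nil? Λ X) ℕ.* ∑[ Fun F m (𝕍 k) ] (λ Y → χ (type? (corner X Y) η))))
      ≡⟨ ∑ℤ-cong E (λ X _ → per-matrix X) ⟩
    ∑ℤ E (λ X → ∑ℤ S (λ p → Wt x η p ℤ.* + χ (nil? Λ X ×-dec type? X p)))
      ≡⟨ ∑ℤ-swap E S _ ⟩
    ∑ℤ S (λ p → ∑ℤ E (λ X → Wt x η p ℤ.* + χ (nil? Λ X ×-dec type? X p)))
      ≡⟨ ∑ℤ-cong S (λ p _ → trans (∑ℤ-*ˡ E (Wt x η p) _) (cong (Wt x η p ℤ.*_) (sym (+-∑ E _)))) ⟩
    ∑ℤ S (λ p → Wt x η p ℤ.* + FT m p Λ) ∎
    where
    open ≡-Reasoning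
    m = sum Λ
    E = FinSetoid.elements (𝕄 m)
    S = strips η k
    η≢[] : 0 < length η
    η≢[] = go η (λ e → ℕP.n≮0 (ℕP.<-≤-trans k>0 (ℕP.≤-trans (ℕP.m≤n+m k m) (ℕP.≤-reflexive (trans (sym sη) e)))))
      where
      go : ∀ η → sum η ≢ 0 → 0 < length η
      go []      h = ⊥-elim (h refl)
      go (_ ∷ _) h = s≤s z≤n
    per-matrix : ∀ X → + (χ (nil? Λ X) ℕ.* ∑[ Fun F m (𝕍 k) ] (λ Y → χ (type? (corner X Y) η)))
      ≡ ∑ℤ S (λ p → Wt x η p ℤ.* + χ (nil? Λ X ×-dec type? X p))
    per-matrix X with nil? Λ X
    ... | no _ = sym (trans (∑ℤ-cong S (λ p _ → ℤP.*-zeroʳ (Wt x η p))) (∑ℤ-0 S))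
    ... | yes X∈ = trans (cong +_ (ℕP.*-identityˡ _)) (trans (extensions-strips (jordan-type Λ X X∈) η sη η≢[] dη)
        (∑ℤ-cong S (λ p _ → trans (ℤP.*-comm (+ χ (type? X p)) _) (cong (λ t → Wt x η p ℤ.* + t)
          (trans (sym (ℕP.*-identityˡ _)) (sym (χ-× (yes X∈) (type? X p))))))))

  sum-snoc : ∀ Λ k → sum (Λ ∷ʳ k) ≡ sum Λ ℕ.+ k
  sum-snoc Λ k = trans (sum-++ Λ (k ∷ [])) (cong (sum Λ ℕ.+_) (ℕP.+-identityʳ k))

  -- The composition is read backwards: the head of `ks` is the last block, the one which
  -- `FT-recursion` removes.
  FT≡B : ∀ ks η → All (0 <_) ks → Decr η → sum η ≡ sum (reverse ks) → + FT (sum (reverse ks)) η (reverse ks) ≡ B x η ks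
  FT≡B [] η _ dη sη rewrite sη = cong +_ (∑-cong (allMats F 0) (λ X → χ-yes (nil? [] X ×-dec type? X η) ((λ ()) , λ i → trivial X (toℕ i))))
    where
    zero-psum : ∀ i η → sum η ≡ 0 → psum i η ≡ 0
    zero-psum zero    η       e = refl
    zero-psum (suc i) []      e = refl
    zero-psum (suc i) (a ∷ η) e = cong₂ ℕ._+_ (ℕP.m+n≡0⇒m≡0 a e) (zero-psum i η (ℕP.m+n≡0⇒n≡0 a e))
    trivial : ∀ (X : Sq 0) i → ker X (suc i) ≡ size ^ psum (suc i) η
    trivial X i = trans (∑-cong (FinSetoid.elements (𝕍 0)) (λ v → χ-yes (0ᵥ? (pw X (suc i) v)) (λ ()))) (cong (size ^_) (sym (zero-psum (suc i) η sη)))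
  FT≡B (k ∷ ks) η (k>0 ∷ pos) dη sη = step (reverse (k ∷ ks)) (unfold-reverse k ks) sη
    where
    open ≡-Reasoning
    Λ = reverse ks
    step : ∀ Λ′ → Λ′ ≡ Λ ∷ʳ k → sum η ≡ sum Λ′ → + FT (sum Λ′) η Λ′ ≡ B x η (k ∷ ks)
    step _ refl sη = begin
      + FT (sum (Λ ∷ʳ k)) η (Λ ∷ʳ k)        ≡⟨ cong (λ n → + FT n η (Λ ∷ʳ k)) (sum-snoc Λ k) ⟩
      + FT (sum Λ ℕ.+ k) η (Λ ∷ʳ k)         ≡⟨ FT-recursion Λ k η k>0 dη (trans sη (sum-snoc Λ k)) ⟩
      ∑ℤ (strips η k) (λ p → Wt x η p ℤ.* + FT (sum Λ) p Λ)
        ≡⟨ ∑ℤ-cong (strips η k) (λ p p∈ → let S = All.lookup (strips-All η k dη) p∈ in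
             cong (Wt x η p ℤ.*_) (FT≡B ks p pos (Strip⇒Decr S)
               (ℕP.+-cancelʳ-≡ k _ _ (trans (sym (Strip-sum S)) (trans sη (sum-snoc Λ k)))))) ⟩
      B x η (k ∷ ks) ∎

-- Symmetry under reordering of the blocks.

module Symmetry (F : FiniteField) where

  open import Defs hiding (FiniteField)
  open Counting
  open LinearAlgebra F
  open JordanExistence F
  open JordanKernels F
  open PartitionLists
  open KernelTypes F
  open CornerMatrices F
  open RowCounting F using (x)
  open Weights
  open HorizontalStrips
  open WeightedChains
  open FlagRecursion F
  open import Data.Nat.Base as ℕ using (ℕ; zero; suc; _<_; z≤n; s≤s; _∸_)
  import Data.Nat.Properties as ℕP
  open import Data.Nat.Tactic.RingSolver using (solve-∀)
  open import Data.Nat.ListAction using (sum)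
  open import Data.Nat.ListAction.Properties using (sum-↭)
  open import Data.Integer.Base as ℤ using (ℤ; +_)
  import Data.Integer.Properties as ℤP
  open import Data.Fin.Base as Fin using (Fin; toℕ; opposite; inject₁; fromℕ)
  import Data.Fin.Properties as FinP
  open import Data.List.Base using (List; []; _∷_; _∷ʳ_; length; reverse)
  open import Data.List.Properties using (unfold-reverse; length-reverse; reverse-involutive; reverse-++)
  open import Data.List.Relation.Unary.All as All using (All; []; _∷_)
  open import Data.List.Relation.Binary.Permutation.Propositional using (_↭_; refl; prep; swap; trans; ↭-sym; ↭-trans)
  open import Data.List.Relation.Binary.Permutation.Propositional.Properties using (↭-reverse; All-resp-↭)
  open import Data.Product.Base using (_×_; _,_; proj₁; proj₂)
  open import Data.Sum.Base using (inj₂)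
  open import Function.Base using (_∘_)
  open import Relation.Nullary.Decidable using (_×-dec_)
  open import Relation.Binary.PropositionalEquality as ≡ using (_≡_; cong; cong₂; sym; subst; module ≡-Reasoning)

  Σᶠ-snoc : ∀ {n} (f : V (suc n)) → Σᶠ f ≡ Σᶠ (f ∘ inject₁) +ᶠ f (fromℕ n)
  Σᶠ-snoc {zero}  f = 𝕂.+-comm _ _
  Σᶠ-snoc {suc n} f = ≡.trans (cong (f Fin.zero +ᶠ_) (Σᶠ-snoc (f ∘ Fin.suc))) (sym (𝕂.+-assoc _ _ _))

  Σᶠ-opposite : ∀ {n} (f : V n) → Σᶠ (f ∘ opposite) ≡ Σᶠ f
  Σᶠ-opposite {zero}  f = ≡.refl
  Σᶠ-opposite {suc n} f = ≡.trans (cong (f (fromℕ n) +ᶠ_) (Σᶠ-opposite (f ∘ inject₁))) (≡.trans (𝕂.+-comm _ _) (sym (Σᶠ-snoc f)))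

  _ᵀ : ∀ {n} → Sq n → Sq n
  (X ᵀ) i j = X j i

  -- reflection in the antidiagonal
  _ᴬ : ∀ {n} → Sq n → Sq n
  (X ᴬ) i j = X (opposite j) (opposite i)

  ker-transpose : ∀ {n} (X : Sq n) i → ker X i ≡ ker (X ᵀ) i
  ker-transpose X i = card-ker-adjoint (pw X i) (pw (X ᵀ) i) (λ u v → adjoint i u v)
    where
    adjoint₁ : ∀ u w → dot u (X ▷ w) ≡ dot (X ᵀ ▷ u) w
    adjoint₁ u w = ≡.trans (dot-▷ u X w) (dot-cong {v = w} (λ k → dot-comm u _) (λ _ → ≡.refl))
    adjoint : ∀ i u v → dot u (pw X i v) ≡ dot v (pw (X ᵀ) i u)
    adjoint zero    u v = dot-comm u v
    adjoint (suc i) u v = ≡.trans (adjoint₁ u (pw X i v)) (≡.trans (adjoint i (X ᵀ ▷ u) v)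
      (dot-cong {u = v} (λ _ → ≡.refl) (≐-sym (pw-suc (X ᵀ) i u))))

  -- The antidiagonal reflection is the transpose conjugated by the permutation that reverses the
  -- coordinates. What remains is the comparison with the transpose, where kernels of adjoint maps
  -- enter.
  reflection-similar : ∀ {n} (X : Sq n) → Similar (X ᴬ) (X ᵀ)
  reflection-similar {n} X = record
    { g = P ; h = P ; gh = PP ; hg = PP
    ; intertwine = λ v i → ≡.trans (▷-congʳ (X ᴬ) (P▷ v) i) (≡.trans (Σᶠ-opposite (λ j → X j (opposite i) *ᶠ v j)) (sym (P▷ (X ᵀ ▷ v) i)))
    }
    where
    P : Sq n
    P i = δ (opposite i)
    P▷ : ∀ v → P ▷ v ≐ v ∘ opposite
    P▷ v i = dot-δˡ (opposite i) v
    PP : ∀ v → P ▷ P ▷ v ≐ v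
    PP v i = ≡.trans (P▷ (P ▷ v) i) (≡.trans (P▷ v (opposite i)) (cong v (FinP.opposite-involutive i)))

  ker-reflection : ∀ {n} (X : Sq n) i → ker (X ᴬ) i ≡ ker X i
  ker-reflection X i = ≡.trans (ker-similar (reflection-similar X) i) (sym (ker-transpose X i))

  sum-reverse : ∀ Λ → sum (reverse Λ) ≡ sum Λ
  sum-reverse Λ = sum-↭ (↭-reverse Λ)

  blk-reverse : ∀ Λ i i′ → i ℕ.+ suc i′ ≡ sum Λ → suc (blk F (reverse Λ) i′ ℕ.+ blk F Λ i) ≡ length Λ
  blk-reverse [] i i′ e = ⊥-elim (ℕP.1+n≢0 (≡.trans (sym (ℕP.+-suc i i′)) e))
    where open import Data.Empty using (⊥-elim)
  blk-reverse (a ∷ Λ) i i′ e = ≡.trans (cong (λ L → suc (blk F L i′ ℕ.+ blk F (a ∷ Λ) i)) (unfold-reverse a Λ)) (go (split a i) e)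
    where
    go : ∀ {i} → Split a i → i ℕ.+ suc i′ ≡ a ℕ.+ sum Λ → suc (blk F (reverse Λ ∷ʳ a) i′ ℕ.+ blk F (a ∷ Λ) i) ≡ suc (length Λ)
    go (lower {i} i<a) e = cong suc (≡.trans (cong₂ ℕ._+_ high (blk-< Λ i<a)) (≡.trans (ℕP.+-identityʳ _) (length-reverse Λ)))
      where
      l = a ∸ suc i
      i′≡ : i′ ≡ sum (reverse Λ) ℕ.+ l
      i′≡ = ℕP.+-cancelˡ-≡ (suc i) _ _ (≡.trans (sym (ℕP.+-suc i i′)) (≡.trans e (≡.trans (cong (ℕ._+ sum Λ) (sym (ℕP.m+[n∸m]≡n i<a)))
        (≡.trans (regroup (suc i) l (sum Λ)) (cong (λ t → suc i ℕ.+ (t ℕ.+ l)) (sym (sum-reverse Λ)))))))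
        where
        regroup : ∀ a b c → a ℕ.+ b ℕ.+ c ≡ a ℕ.+ (c ℕ.+ b)
        regroup = solve-∀
      high : blk F (reverse Λ ∷ʳ a) i′ ≡ length (reverse Λ)
      high = ≡.trans (cong (blk F (reverse Λ ∷ʳ a)) i′≡) (blk-snoc-≥ (reverse Λ) a (ℕP.∸-monoʳ-< {a} {suc i} {0} (s≤s z≤n) i<a))
    go (upper i) e = ≡.trans (cong₂ (λ s t → suc (s ℕ.+ t)) (blk-snoc-< (reverse Λ) a i′<) (blk-+ a i Λ))
      (≡.trans (cong suc (ℕP.+-suc _ _)) (cong suc (blk-reverse Λ i i′ e′)))
      where
      e′ : i ℕ.+ suc i′ ≡ sum Λ
      e′ = ℕP.+-cancelˡ-≡ a _ _ (≡.trans (sym (ℕP.+-assoc a i _)) e)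
      i′< : i′ < sum (reverse Λ)
      i′< = subst (i′ <_) (≡.trans e′ (sym (sum-reverse Λ))) (ℕP.m≤n+m (suc i′) i)

  opposite-sum : ∀ {n} (i : Fin n) → toℕ (opposite i) ℕ.+ suc (toℕ i) ≡ n
  opposite-sum {n} i = ≡.trans (cong (ℕ._+ suc (toℕ i)) (FinP.opposite-prop i)) (ℕP.m∸n+n≡m (FinP.toℕ<n i))

  nil-reverse : ∀ {n} Λ → sum Λ ≡ n → {X : Sq n} → Nil Λ X → Nil (reverse Λ) (X ᴬ)
  nil-reverse Λ total {X} nil i j le = nil (opposite j) (opposite i) (ℕP.+-cancelˡ-≤ (blk F (reverse Λ) (toℕ j)) _ _
    (ℕP.≤-trans (ℕP.+-monoˡ-≤ _ le) (ℕP.≤-reflexive (ℕP.suc-injective (≡.trans (rev i) (sym (rev j)))))))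
    where
    rev : ∀ i → suc (blk F (reverse Λ) (toℕ i) ℕ.+ blk F Λ (toℕ (opposite i))) ≡ length Λ
    rev i = blk-reverse Λ _ _ (≡.trans (opposite-sum i) (sym total))

  FT-reverse : ∀ n η Λ → sum Λ ≡ n → FT n η (reverse Λ) ≡ FT n η Λ
  FT-reverse n η Λ total = ≡.trans (sym (∑-reindex (𝕄 n) (𝕄 n) _ᴬ _ᴬ φ
      (λ e i j → e (opposite j) (opposite i)) (λ e i j → e (opposite j) (opposite i)) AA (λ X → inj₂ (AA X))
      (λ {X} {Y} e → χ-cong (nil? (reverse Λ) X ×-dec type? X η) (nil? (reverse Λ) Y ×-dec type? Y η) (transfer e) (transfer (λ i j → sym (e i j))))))
    (∑-cong (FinSetoid.elements (𝕄 n)) (λ X → χ-cong (nil? (reverse Λ) (X ᴬ) ×-dec type? (X ᴬ) η) (nil? Λ X ×-dec type? X η)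
      (λ (nil , ty) → (λ i j le → ≡.trans (sym (AA X i j)) (subst (λ L → Nil L ((X ᴬ) ᴬ)) (reverse-involutive Λ)
          (nil-reverse (reverse Λ) (≡.trans (sum-reverse Λ) total) {X ᴬ} nil) i j le)) ,
        type-ext (X ᴬ) X (λ i → ker-reflection X (suc i)) η ty)
      (λ (nil , ty) → nil-reverse Λ total {X} nil , type-ext X (X ᴬ) (λ i → sym (ker-reflection X (suc i))) η ty)))
    where
    φ : Sq n → ℕ
    φ X = χ (nil? (reverse Λ) X ×-dec type? X η)
    AA : ∀ (X : Sq n) i j → ((X ᴬ) ᴬ) i j ≡ X i j
    AA X i j = cong₂ X (FinP.opposite-involutive i) (FinP.opposite-involutive j)
    transfer : ∀ {X Y : Sq n} → (∀ i → X i ≐ Y i) → Nil (reverse Λ) X × Type X η → Nil (reverse Λ) Y × Type Y η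
    transfer {X} {Y} e (nil , ty) = (λ i j le → ≡.trans (sym (e i j)) (nil i j le)) , type-ext X Y (λ i → sq-ker-cong e (suc i)) η ty

  All-reverse : ∀ {Λ} → All (0 <_) Λ → All (0 <_) (reverse Λ)
  All-reverse {Λ} = All-resp-↭ (↭-sym (↭-reverse Λ))

  Fits : List ℕ → List ℕ → Set
  Fits ks η = All (0 <_) ks × Decr η × sum η ≡ sum ks

  FT≡B′ : ∀ n Λ η → Fits Λ η → sum Λ ≡ n → + FT n η Λ ≡ B x η (reverse Λ)
  FT≡B′ n Λ η (pos , dη , sη) total = go (reverse (reverse Λ)) (reverse-involutive Λ)
      (FT≡B (reverse Λ) η (All-reverse pos) dη (≡.trans sη (sym (≡.trans (sum-reverse (reverse Λ)) (sum-reverse Λ)))))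
    where
    go : ∀ L → L ≡ Λ → + FT (sum L) η L ≡ B x η (reverse Λ) → + FT n η Λ ≡ B x η (reverse Λ)
    go _ ≡.refl e = ≡.trans (cong (λ n → + FT n η Λ) (sym total)) e

  -- Invisible in the recursive formula: both sides count the same matrices up to reflection. This
  -- is where x has to be the size of a field.
  B-reverse : ∀ ks η → Fits ks η → B x η (reverse ks) ≡ B x η ks
  B-reverse ks η f@(pos , dη , sη) = ≡.trans (sym (FT≡B′ (sum ks) ks η f ≡.refl)) (≡.trans (cong +_ (sym (FT-reverse (sum ks) η ks ≡.refl)))
    (≡.trans (cong (λ n → + FT n η (reverse ks)) (sym (sum-reverse ks))) (FT≡B ks η pos dη (≡.trans sη (sym (sum-reverse ks))))))

  B-tail : ∀ k ks ks′ η → All (0 <_) ks → Decr η → sum η ≡ k ℕ.+ sum ks →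
    (∀ ρ → Fits ks ρ → B x ρ ks ≡ B x ρ ks′) → B x η (k ∷ ks) ≡ B x η (k ∷ ks′)
  B-tail k ks ks′ η pos dη sη h = ∑ℤ-cong (strips η k) (λ ρ ρ∈ → let S = All.lookup (strips-All η k dη) ρ∈ in
    cong (Wt x η ρ ℤ.*_) (h ρ (pos , Strip⇒Decr S ,
      ℕP.+-cancelʳ-≡ k _ _ (≡.trans (sym (Strip-sum S)) (≡.trans sη (ℕP.+-comm k _))))))

  snoc-Fits : ∀ k ks → All (0 <_) (k ∷ ks) → All (0 <_) (ks ∷ʳ k) × sum (ks ∷ʳ k) ≡ k ℕ.+ sum ks
  snoc-Fits k ks (p ∷ ps) = AllP.∷ʳ⁺ ps p , ≡.trans (sum-snoc ks k) (ℕP.+-comm _ k)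
    where import Data.List.Relation.Unary.All.Properties as AllP

  -- Rotating (k, l, ks) by reversals of the whole list and of its tail exchanges the first two entries.
  B-swap : ∀ k l ks η → Fits (k ∷ l ∷ ks) η → B x η (k ∷ l ∷ ks) ≡ B x η (l ∷ k ∷ ks)
  B-swap k l ks η (pk ∷ pl ∷ ps , dη , sη) = begin
    B x η (k ∷ l ∷ ks)
      ≡⟨ B-tail k (l ∷ ks) (reverse (l ∷ ks)) η (pl ∷ ps) dη sη (λ ρ f → sym (B-reverse (l ∷ ks) ρ f)) ⟩
    B x η (k ∷ reverse (l ∷ ks))
      ≡⟨ sym (B-reverse (k ∷ reverse (l ∷ ks)) η (pk ∷ All-reverse (pl ∷ ps) , dη , ≡.trans sη (cong (k ℕ.+_) (sym (sum-reverse (l ∷ ks)))))) ⟩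
    B x η (reverse (k ∷ reverse (l ∷ ks)))
      ≡⟨ cong (B x η) (≡.trans (unfold-reverse k (reverse (l ∷ ks))) (cong (_∷ʳ k) (reverse-involutive (l ∷ ks)))) ⟩
    B x η (l ∷ (ks ∷ʳ k))
      ≡⟨ B-tail l (ks ∷ʳ k) (reverse (ks ∷ʳ k)) η (proj₁ snoc) dη (≡.trans sη (≡.trans (regroup k l (sum ks)) (cong (l ℕ.+_) (sym (proj₂ snoc)))))
           (λ ρ f → sym (B-reverse (ks ∷ʳ k) ρ f)) ⟩
    B x η (l ∷ reverse (ks ∷ʳ k))
      ≡⟨ cong (λ L → B x η (l ∷ L)) (reverse-++ ks (k ∷ [])) ⟩
    B x η (l ∷ k ∷ reverse ks)
      ≡⟨ B-tail l (k ∷ reverse ks) (k ∷ ks) η (pk ∷ All-reverse ps) dη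
           (≡.trans sη (≡.trans (regroup k l (sum ks)) (cong (λ t → l ℕ.+ (k ℕ.+ t)) (sym (sum-reverse ks)))))
           (λ ρ (_ , dρ , sρ) → B-tail k (reverse ks) ks ρ (All-reverse ps) dρ sρ (λ κ (_ , dκ , sκ) → B-reverse ks κ (ps , dκ , ≡.trans sκ (sum-reverse ks)))) ⟩
    B x η (l ∷ k ∷ ks) ∎
    where
    open ≡-Reasoning
    snoc = snoc-Fits k ks (pk ∷ ps)
    regroup : ∀ k l s → k ℕ.+ (l ℕ.+ s) ≡ l ℕ.+ (k ℕ.+ s)
    regroup = solve-∀

  B-↭ : ∀ {ks ks′} → ks ↭ ks′ → ∀ η → Fits ks η → B x η ks ≡ B x η ks′
  B-↭ refl η f = ≡.refl
  B-↭ (prep {xs} {ys} k p) η (_ ∷ ps , dη , sη) = B-tail k xs ys η ps dη sη (B-↭ p)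
  B-↭ (swap {xs} {ys} k l p) η f@(pk ∷ pl ∷ ps , dη , sη) = ≡.trans (B-swap k l xs η f)
    (B-tail l (k ∷ xs) (k ∷ ys) η (pk ∷ ps) dη (≡.trans sη (regroup k l (sum xs)))
      (λ ρ (_ , dρ , sρ) → B-tail k xs ys ρ ps dρ sρ (B-↭ p)))
    where
    regroup : ∀ k l s → k ℕ.+ (l ℕ.+ s) ≡ l ℕ.+ (k ℕ.+ s)
    regroup = solve-∀
  B-↭ (trans p q) η f@(pos , dη , sη) = ≡.trans (B-↭ p η f) (B-↭ q η (All-resp-↭ p pos , dη , ≡.trans sη (sum-↭ p)))

  FT-↭ : ∀ {Λ Λ′} n η → Λ ↭ Λ′ → Fits Λ η → sum Λ ≡ n → FT n η Λ ≡ FT n η Λ′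
  FT-↭ {Λ} {Λ′} n η p f@(pos , dη , sη) total = ℤP.+-injective (≡.trans (FT≡B′ n Λ η f total) (≡.trans
    (B-↭ (↭-trans (↭-reverse Λ) (↭-trans p (↭-sym (↭-reverse Λ′)))) η (All-reverse pos , dη , ≡.trans sη (sym (sum-reverse Λ))))
    (sym (FT≡B′ n Λ′ η (All-resp-↭ p pos , dη , ≡.trans sη (sum-↭ p)) (≡.trans (sym (sum-↭ p)) total)))))

-- Degrees and leading coefficients.

module LeadingTerms where

  open import Defs
  open Counting
  open Weights
  open HorizontalStrips
  open WeightedChains
  open import Data.Bool.Base using (if_then_else_)
  open import Data.Nat.Base as ℕ using (ℕ; zero; suc; _<_; s≤s; _∸_; _≡ᵇ_)
  import Data.Nat.Properties as ℕP
  open import Data.Nat.ListAction using (sum)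
  import Data.Nat.Tactic.RingSolver as ℕS
  open import Data.Integer.Base as ℤ using (ℤ; +_; 0ℤ; 1ℤ; _+_; _*_; _-_; _^_)
  import Data.Integer.Properties as ℤP
  open import Data.Integer.Tactic.RingSolver using (solve-∀)
  open import Data.List.Base using (List; []; _∷_; _∷ʳ_; length)
  open import Data.List.Relation.Unary.All using (All; []; _∷_)
  open import Data.Product.Base using (Σ; ∃; _×_; _,_)
  open import Relation.Binary.PropositionalEquality

  -- φ is a polynomial function of formal degree d with coefficient c in degree d
  data Lead : ℕ → ℤ → (ℤ → ℤ) → Set where
    const : ∀ {c φ} → (∀ x → φ x ≡ c) → Lead 0 c φ
    step  : ∀ {d c φ ψ} a → Lead d c ψ → (∀ x → φ x ≡ a + x * ψ x) → Lead (suc d) c φ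

  lead-ext : ∀ {d c φ ψ} → (∀ x → φ x ≡ ψ x) → Lead d c φ → Lead d c ψ
  lead-ext e (const h)    = const (λ x → trans (sym (e x)) (h x))
  lead-ext e (step a l h) = step a l (λ x → trans (sym (e x)) (h x))

  lead-deg : ∀ {d d′ c φ} → d ≡ d′ → Lead d c φ → Lead d′ c φ
  lead-deg refl l = l

  lead-coeff : ∀ {d c c′ φ} → c ≡ c′ → Lead d c φ → Lead d c′ φ
  lead-coeff refl l = l

  lead-+ : ∀ {d c c′ φ ψ} → Lead d c φ → Lead d c′ ψ → Lead d (c + c′) (λ x → φ x + ψ x)
  lead-+ (const h)    (const h′)     = const (λ x → cong₂ _+_ (h x) (h′ x))
  lead-+ (step a l h) (step a′ l′ h′) = step (a + a′) (lead-+ l l′) (λ x → trans (cong₂ _+_ (h x) (h′ x)) (collect a a′ x _ _))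
    where
    collect : ∀ a a′ x u v → a + x * u + (a′ + x * v) ≡ a + a′ + x * (u + v)
    collect = solve-∀

  lead-low : ∀ {d e c c′ φ ψ} → e < d → Lead d c φ → Lead e c′ ψ → Lead d c (λ x → φ x + ψ x)
  lead-low (s≤s _) (step a l h) (const {c = c′} h′) = step (a + c′) l (λ x → trans (cong₂ _+_ (h x) (h′ x)) (collect a c′ x _))
    where
    collect : ∀ a c x u → a + x * u + c ≡ a + c + x * u
    collect = solve-∀
  lead-low (s≤s p) (step a l h) (step a′ l′ h′) = step (a + a′) (lead-low p l l′) (λ x → trans (cong₂ _+_ (h x) (h′ x)) (collect a a′ x _ _))
    where
    collect : ∀ a a′ x u v → a + x * u + (a′ + x * v) ≡ a + a′ + x * (u + v)
    collect = solve-∀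

  lead-scale : ∀ {d c φ} b → Lead d c φ → Lead d (b * c) (λ x → b * φ x)
  lead-scale b (const h)    = const (λ x → cong (b *_) (h x))
  lead-scale b (step a l h) = step (b * a) (lead-scale b l) (λ x → trans (cong (b *_) (h x)) (collect a b x _))
    where
    collect : ∀ a b x u → b * (a + x * u) ≡ b * a + x * (b * u)
    collect = solve-∀

  lead-shift : ∀ {d c φ} → Lead d c φ → Lead (suc d) c (λ x → x * φ x)
  lead-shift l = step 0ℤ l (λ x → sym (ℤP.+-identityˡ _))

  lead-* : ∀ {d d′ c c′ φ ψ} → Lead d c φ → Lead d′ c′ ψ → Lead (d ℕ.+ d′) (c * c′) (λ x → φ x * ψ x)
  lead-* {ψ = ψ} (const {c} h) l′ = lead-ext (λ x → cong (_* ψ x) (sym (h x))) (lead-scale c l′)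
  lead-* {ψ = ψ} (step {d = d} a l h) l′ = lead-ext (λ x → trans (collect a x _ (ψ x)) (cong (_* ψ x) (sym (h x))))
    (lead-low (s≤s (ℕP.m≤n+m _ d)) (lead-shift (lead-* l l′)) (lead-scale a l′))
    where
    collect : ∀ a x u v → x * (u * v) + a * v ≡ (a + x * u) * v
    collect = solve-∀

  lead-one : Lead 0 1ℤ (λ _ → 1ℤ)
  lead-one = const (λ _ → refl)

  lead-x : Lead 1 1ℤ (λ x → x)
  lead-x = step 0ℤ lead-one (λ x → unit x)
    where
    unit : ∀ x → x ≡ 0ℤ + x * 1ℤ
    unit = solve-∀

  lead-x-1 : Lead 1 1ℤ (λ x → x - 1ℤ)
  lead-x-1 = step (ℤ.- 1ℤ) lead-one (λ x → unit x)
    where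
    unit : ∀ x → x - 1ℤ ≡ ℤ.- 1ℤ + x * 1ℤ
    unit = solve-∀

  lead-^ : ∀ {φ} n → Lead 1 1ℤ φ → Lead n 1ℤ (λ x → φ x ^ n)
  lead-^ zero    l = lead-one
  lead-^ (suc n) l = lead-* l (lead-^ n l)

  lead-list : ∀ {d c φ} → Lead d c φ → Σ (List ℤ) λ cs → length cs ≡ d × (∀ x → φ x ≡ evalZ (cs ∷ʳ c) x)
  lead-list (const {c} h) = [] , refl , λ x → trans (h x) (sym (trans (cong (λ t → c + t) (ℤP.*-zeroʳ x)) (ℤP.+-identityʳ c)))
  lead-list (step a l h) with lead-list l
  ... | cs , len , e = a ∷ cs , cong suc len , λ x → trans (h x) (cong (λ t → a + x * t) (e x))

  lead-∑ : ∀ {A : Set} {d} (xs : List A) {P : A → Set} {c : A → ℕ} {φ : A → ℤ → ℤ} → All P xs → (∀ y → P y → Lead d (+ c y) (φ y)) →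
    Lead d (+ ∑ xs c) (λ x → ∑ℤ xs (λ y → φ y x))
  lead-∑ {d = d} [] [] h = zeros d
    where
    zeros : ∀ d → Lead d 0ℤ (λ x → 0ℤ)
    zeros zero    = const (λ _ → refl)
    zeros (suc d) = step 0ℤ (zeros d) (λ x → sym (trans (ℤP.+-identityˡ _) (ℤP.*-zeroʳ x)))
  lead-∑ (y ∷ xs) {c = c} (p ∷ ps) h = lead-coeff (sym (ℤP.pos-+ (c y) _)) (lead-+ (h y p) (lead-∑ xs ps h))

  lead-qi : ∀ m → Lead m 1ℤ (λ x → qi x (suc m))
  lead-qi zero    = const (λ x → trans (cong (λ t → 1ℤ + t) (ℤP.*-zeroʳ x)) refl)
  lead-qi (suc m) = step 1ℤ (lead-qi m) (λ x → refl)

  lead-ff : ∀ s e → Lead (e ℕ.* s ℕ.+ tri e) 1ℤ (λ x → ff x s e)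
  lead-ff s zero    = lead-one
  lead-ff s (suc e) = lead-deg (degree s e (tri e)) (lead-* (lead-ext (λ x → cong (qi x) (sym (ℕP.+-suc s e))) (lead-qi (s ℕ.+ e))) (lead-ff s e))
    where
    degree : ∀ s e t → s ℕ.+ e ℕ.+ (e ℕ.* s ℕ.+ t) ≡ s ℕ.+ e ℕ.* s ℕ.+ (e ℕ.+ t)
    degree = ℕS.solve-∀

  -- In the q-Pascal rule the term carrying the power of x has strictly larger degree and is monic.
  lead-G : ∀ e g → Lead (e ℕ.* g) 1ℤ (λ x → G x e g)
  lead-G zero    g       = lead-one
  lead-G (suc e) zero    = lead-deg (sym (ℕP.*-zeroʳ e)) lead-one
  lead-G (suc e) (suc g) = lead-ext (λ x → ℤP.+-comm (x ^ suc g * G x e (suc g)) (G x (suc e) g)) (lead-low lower (lead-* (lead-^ (suc g) lead-x) (lead-G e (suc g))) (lead-G (suc e) g))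
    where
    lower : suc e ℕ.* g < suc g ℕ.+ e ℕ.* suc g
    lower = ℕP.*-monoʳ-< (suc e) (ℕP.n<1+n g)

  degM : ℕ → ℕ → ℕ → ℕ → ℕ
  degM d s e g = d ℕ.* (e ℕ.+ g) ℕ.+ e ℕ.+ tri e ℕ.+ (e ℕ.* s ℕ.+ tri e) ℕ.+ e ℕ.* g

  lead-Mval : ∀ d s e g → Lead (degM d s e g) 1ℤ (λ x → Mval x d s e g)
  lead-Mval d s e g = lead-* (lead-* (lead-* (lead-* (lead-^ (d ℕ.* (e ℕ.+ g)) lead-x) (lead-^ e lead-x-1)) (lead-^ (tri e) lead-x)) (lead-ff s e)) (lead-G e g)

  tri-square : ∀ e → e ℕ.+ tri e ℕ.+ tri e ≡ e ℕ.* e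
  tri-square zero    = refl
  tri-square (suc e) = trans (expand e (tri e)) (trans (cong (λ t → suc (e ℕ.+ e ℕ.+ t)) (tri-square e)) (collect e))
    where
    expand : ∀ e t → suc e ℕ.+ (e ℕ.+ t) ℕ.+ (e ℕ.+ t) ≡ suc (e ℕ.+ e ℕ.+ (e ℕ.+ t ℕ.+ t))
    expand = ℕS.solve-∀
    collect : ∀ e → suc (e ℕ.+ e ℕ.+ e ℕ.* e) ≡ suc e ℕ.* suc e
    collect = ℕS.solve-∀

  -- the sum of all products of two entries
  D : List ℕ → ℕ
  D []      = 0
  D (a ∷ η) = a ℕ.* sum η ℕ.+ D η

  degH : ∀ {top η ρ} → HS top η ρ → ℕ → ℕ
  degH stop           s = 0
  degH (cons g f r H) s = degH H (s ℕ.+ f) ℕ.+ degM (dsum H) s f g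

  lead-WL : ∀ {top η ρ} (H : HS top η ρ) s → Lead (degH H s) 1ℤ (λ x → WL x s top η ρ)
  lead-WL stop           s = lead-one
  lead-WL (cons g f r H) s = lead-ext (λ x → sym (WL-cons x s g f r H)) (lead-* (lead-WL H (s ℕ.+ f)) (lead-Mval (dsum H) s f g))

  -- The degrees of the single rows depend on the strip, but this combination does not. In `lead-Wt`
  -- it makes the degree of every weight D η - D ρ, so all chains reach the same top degree and no
  -- leading term is lost.
  degH-identity : ∀ {top η ρ} (H : HS top η ρ) s → degH H s ℕ.+ dsum H ℕ.* sum ρ ℕ.+ D ρ ≡ (top ℕ.+ s) ℕ.* dsum H ℕ.+ D η
  degH-identity {top} stop s = sym (trans (ℕP.+-identityʳ _) (ℕP.*-zeroʳ (top ℕ.+ s)))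
  degH-identity (cons {η} {ρ} g f r H) s = begin
    degH H (s ℕ.+ f) ℕ.+ (d ℕ.* (f ℕ.+ g) ℕ.+ f ℕ.+ tri f ℕ.+ (f ℕ.* s ℕ.+ tri f) ℕ.+ f ℕ.* g) ℕ.+ (f ℕ.+ d) ℕ.* (r ℕ.+ P) ℕ.+ (r ℕ.* P ℕ.+ D ρ)
      ≡⟨ collect (degH H (s ℕ.+ f)) d f g (tri f) s r P (D ρ) ⟩
    (degH H (s ℕ.+ f) ℕ.+ d ℕ.* P ℕ.+ D ρ) ℕ.+ ((f ℕ.+ tri f ℕ.+ tri f) ℕ.+ (d ℕ.* f ℕ.+ d ℕ.* g ℕ.+ f ℕ.* s ℕ.+ f ℕ.* g ℕ.+ f ℕ.* r ℕ.+ f ℕ.* P ℕ.+ d ℕ.* r ℕ.+ r ℕ.* P))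
      ≡⟨ cong₂ (λ u v → u ℕ.+ (v ℕ.+ (d ℕ.* f ℕ.+ d ℕ.* g ℕ.+ f ℕ.* s ℕ.+ f ℕ.* g ℕ.+ f ℕ.* r ℕ.+ f ℕ.* P ℕ.+ d ℕ.* r ℕ.+ r ℕ.* P)))
           (degH-identity H (s ℕ.+ f)) (tri-square f) ⟩
    ((r ℕ.+ (s ℕ.+ f)) ℕ.* d ℕ.+ D η) ℕ.+ (f ℕ.* f ℕ.+ (d ℕ.* f ℕ.+ d ℕ.* g ℕ.+ f ℕ.* s ℕ.+ f ℕ.* g ℕ.+ f ℕ.* r ℕ.+ f ℕ.* P ℕ.+ d ℕ.* r ℕ.+ r ℕ.* P))
      ≡⟨ expand d f g s r P (D η) ⟩
    (r ℕ.+ (f ℕ.+ g) ℕ.+ s) ℕ.* (f ℕ.+ d) ℕ.+ ((r ℕ.+ f) ℕ.* (P ℕ.+ d) ℕ.+ D η)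
      ≡⟨ cong (λ t → (r ℕ.+ (f ℕ.+ g) ℕ.+ s) ℕ.* (f ℕ.+ d) ℕ.+ ((r ℕ.+ f) ℕ.* t ℕ.+ D η)) (sym (sum-HS H)) ⟩
    (r ℕ.+ (f ℕ.+ g) ℕ.+ s) ℕ.* (f ℕ.+ d) ℕ.+ ((r ℕ.+ f) ℕ.* sum η ℕ.+ D η) ∎
    where
    open ≡-Reasoning
    d = dsum H
    P = sum ρ
    collect : ∀ δ d f g t s r P D → δ ℕ.+ (d ℕ.* (f ℕ.+ g) ℕ.+ f ℕ.+ t ℕ.+ (f ℕ.* s ℕ.+ t) ℕ.+ f ℕ.* g) ℕ.+ (f ℕ.+ d) ℕ.* (r ℕ.+ P) ℕ.+ (r ℕ.* P ℕ.+ D)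
      ≡ (δ ℕ.+ d ℕ.* P ℕ.+ D) ℕ.+ ((f ℕ.+ t ℕ.+ t) ℕ.+ (d ℕ.* f ℕ.+ d ℕ.* g ℕ.+ f ℕ.* s ℕ.+ f ℕ.* g ℕ.+ f ℕ.* r ℕ.+ f ℕ.* P ℕ.+ d ℕ.* r ℕ.+ r ℕ.* P))
    collect = ℕS.solve-∀
    expand : ∀ d f g s r P D → ((r ℕ.+ (s ℕ.+ f)) ℕ.* d ℕ.+ D) ℕ.+ (f ℕ.* f ℕ.+ (d ℕ.* f ℕ.+ d ℕ.* g ℕ.+ f ℕ.* s ℕ.+ f ℕ.* g ℕ.+ f ℕ.* r ℕ.+ f ℕ.* P ℕ.+ d ℕ.* r ℕ.+ r ℕ.* P))
      ≡ (r ℕ.+ (f ℕ.+ g) ℕ.+ s) ℕ.* (f ℕ.+ d) ℕ.+ ((r ℕ.+ f) ℕ.* (P ℕ.+ d) ℕ.+ D)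
    expand = ℕS.solve-∀

  Wt-cons : ∀ {η ρ} x f r (H : HS r η ρ) → Wt x (r ℕ.+ f ∷ η) (r ∷ ρ) ≡ x ^ ((f ℕ.+ dsum H) ℕ.* sum ρ) * WL x f r η ρ
  Wt-cons {η} {ρ} x f r H = cong₂ (λ k s → x ^ (k ℕ.* sum ρ) * WL x s r η ρ)
    (trans (cong (_∸ (r ℕ.+ sum ρ)) (Strip-sum (cons f r H))) (ℕP.m+n∸m≡n (r ℕ.+ sum ρ) _)) (ℕP.m+n∸m≡n r f)

  lead-Wt : ∀ {k η ρ} → Strip k η ρ → ∃ λ v → Lead v 1ℤ (λ x → Wt x η ρ) × v ℕ.+ D ρ ≡ D η
  lead-Wt empty = 0 , lead-one , refl
  lead-Wt (cons {η} {ρ} f r H) = (f ℕ.+ d) ℕ.* P ℕ.+ degH H f ,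
    lead-ext (λ x → sym (Wt-cons x f r H)) (lead-* (lead-^ ((f ℕ.+ d) ℕ.* P) lead-x) (lead-WL H f)) , (begin
      (f ℕ.+ d) ℕ.* P ℕ.+ degH H f ℕ.+ (r ℕ.* P ℕ.+ D ρ)    ≡⟨ collect f d P (degH H f) r (D ρ) ⟩
      f ℕ.* P ℕ.+ r ℕ.* P ℕ.+ (degH H f ℕ.+ d ℕ.* P ℕ.+ D ρ) ≡⟨ cong (f ℕ.* P ℕ.+ r ℕ.* P ℕ.+_) (degH-identity H f) ⟩
      f ℕ.* P ℕ.+ r ℕ.* P ℕ.+ ((r ℕ.+ f) ℕ.* d ℕ.+ D η)     ≡⟨ expand f P r d (D η) ⟩
      (r ℕ.+ f) ℕ.* (P ℕ.+ d) ℕ.+ D η                       ≡⟨ cong (λ t → (r ℕ.+ f) ℕ.* t ℕ.+ D η) (sym (sum-HS H)) ⟩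
      (r ℕ.+ f) ℕ.* sum η ℕ.+ D η                           ∎)
    where
    open ≡-Reasoning
    d = dsum H
    P = sum ρ
    collect : ∀ f d P δ r D → (f ℕ.+ d) ℕ.* P ℕ.+ δ ℕ.+ (r ℕ.* P ℕ.+ D) ≡ f ℕ.* P ℕ.+ r ℕ.* P ℕ.+ (δ ℕ.+ d ℕ.* P ℕ.+ D)
    collect = ℕS.solve-∀
    expand : ∀ f P r d D → f ℕ.* P ℕ.+ r ℕ.* P ℕ.+ ((r ℕ.+ f) ℕ.* d ℕ.+ D) ≡ (r ℕ.+ f) ℕ.* (P ℕ.+ d) ℕ.+ D
    expand = ℕS.solve-∀

  -- The recursion of `B` with all weights replaced by their leading coefficient 1.
  chains : List ℕ → List ℕ → ℕ
  chains η []       = if sum η ≡ᵇ 0 then 1 else 0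
  chains η (k ∷ ks) = ∑ (strips η k) (λ ρ → chains ρ ks)

  D-zero : ∀ η → sum η ≡ 0 → D η ≡ 0
  D-zero []      e = refl
  D-zero (a ∷ η) e = cong₂ ℕ._+_ (cong (ℕ._* sum η) (ℕP.m+n≡0⇒m≡0 a e)) (D-zero η (ℕP.m+n≡0⇒n≡0 a e))

  lead-B : ∀ ks η → Decr η → sum η ≡ sum ks → Lead (D η) (+ chains η ks) (λ x → B x η ks)
  lead-B [] η dη sη = lead-deg (sym (D-zero η sη)) (subst (λ n → Lead 0 (+ (if n ≡ᵇ 0 then 1 else 0)) (λ x → if n ≡ᵇ 0 then 1ℤ else 0ℤ)) (sym sη) lead-one)
  lead-B (k ∷ ks) η dη sη = lead-∑ (strips η k) (strips-All η k dη) term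
    where
    term : ∀ ρ → Strip k η ρ → Lead (D η) (+ chains ρ ks) (λ x → Wt x η ρ * B x ρ ks)
    term ρ S with lead-Wt S
    ... | v , l , e = lead-deg e (lead-coeff (ℤP.*-identityˡ _) (lead-* l (lead-B ks ρ (Strip⇒Decr S)
      (ℕP.+-cancelʳ-≡ k _ _ (trans (sym (Strip-sum S)) (trans sη (ℕP.+-comm k _)))))))

-- Extracting the powers of x and x - 1.

module Factorisation where

  open import Defs
  open Counting
  open Weights
  open HorizontalStrips
  open WeightedChains
  open LeadingTerms
  open import Data.Bool.Base using (if_then_else_)
  open import Data.Nat.Base as ℕ using (ℕ; zero; suc; _≤_; z≤n; _∸_; _≡ᵇ_)
  import Data.Nat.Properties as ℕP
  open import Data.Nat.ListAction using (sum)
  import Data.Nat.Tactic.RingSolver as ℕS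
  open import Data.Integer.Base using (ℤ; +_; 0ℤ; 1ℤ; _+_; _*_; _-_; _^_)
  import Data.Integer.Properties as ℤP
  open import Data.Integer.Tactic.RingSolver using (solve-∀)
  open import Data.List.Base using (List; []; _∷_; drop)
  open import Data.List.Relation.Unary.All as All using (All; []; _∷_)
  open import Data.List.Relation.Unary.Any using (here; there)
  open import Data.List.Membership.Propositional using (_∈_)
  open import Data.Product.Base using (Σ; _,_)
  open import Relation.Binary.PropositionalEquality

  tsum : List ℕ → ℕ
  tsum η = sum (drop 1 η)

  -- E η = Σ_{j ≥ i + 2} η_i η_j + Σ_{i ≥ 2} binom(η_i, 2)
  E′ : List ℕ → ℕ
  E′ []      = 0
  E′ (a ∷ η) = tri a ℕ.+ a ℕ.* tsum η ℕ.+ E′ η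

  E : List ℕ → ℕ
  E []      = 0
  E (a ∷ η) = a ℕ.* tsum η ℕ.+ E′ η

  -- the excess Σ_j f_j (η_{j+1} − Σ_{i>j} f_i), where f = η − ρ
  exc : List ℕ → List ℕ → ℕ
  exc (h ∷ η) (r ∷ ρ) = (h ∸ r) ℕ.* ((η ‼ 0) ∸ (sum η ∸ sum ρ)) ℕ.+ exc η ρ
  exc _       _       = 0

  -- The exponent of x in `WL`, as it comes out of `WL-factor`.
  vH : ∀ {top η ρ} → HS top η ρ → ℕ
  vH stop           = 0
  vH (cons g f r H) = vH H ℕ.+ (dsum H ℕ.* (f ℕ.+ g) ℕ.+ tri f)

  tri-+ : ∀ a b → tri (a ℕ.+ b) ≡ tri a ℕ.+ tri b ℕ.+ a ℕ.* b
  tri-+ zero    b = sym (ℕP.+-identityʳ _)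
  tri-+ (suc a) b = trans (cong (a ℕ.+ b ℕ.+_) (tri-+ a b)) (regroup a b (tri a) (tri b))
    where
    regroup : ∀ a b t u → a ℕ.+ b ℕ.+ (t ℕ.+ u ℕ.+ a ℕ.* b) ≡ a ℕ.+ t ℕ.+ u ℕ.+ (b ℕ.+ a ℕ.* b)
    regroup = ℕS.solve-∀

  dsum-≤ : ∀ {top η ρ} (H : HS top η ρ) → dsum H ≤ η ‼ 0
  dsum-≤ stop           = z≤n
  dsum-≤ (cons g f r H) = ℕP.≤-trans (ℕP.≤-reflexive (ℕP.+-comm f _)) (ℕP.+-monoˡ-≤ f (ℕP.≤-trans (dsum-≤ H) (head-≤ H)))
    where
    head-≤ : ∀ {top η ρ} → HS top η ρ → η ‼ 0 ≤ top
    head-≤ stop           = z≤n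
    head-≤ (cons g f r H) = ℕP.+-monoʳ-≤ r (ℕP.m≤m+n f g)

  -- The first row split off: f boxes of the strip lie in it, d lie below it, and ρ₁ = d + z. The
  -- number z is also the factor in the excess of the row above. Replacing differences by these sums
  -- leaves identities without subtraction.
  record Shape {top η ρ} (H : HS top η ρ) : Set where
    field
      f d z : ℕ
      dsum≡ : dsum H ≡ f ℕ.+ d
      sum≡  : sum ρ ≡ d ℕ.+ z ℕ.+ tsum ρ
      tsum≡ : tsum η ≡ tsum ρ ℕ.+ d
      z≡    : (η ‼ 0) ∸ (sum η ∸ sum ρ) ≡ z

  shape : ∀ {top η ρ} (H : HS top η ρ) → Shape H
  shape stop = record { f = 0 ; d = 0 ; z = 0 ; dsum≡ = refl ; sum≡ = refl ; tsum≡ = refl ; z≡ = refl }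
  shape (cons {η} {ρ} g f r H) = record
    { f = f ; d = dsum H ; z = r ∸ dsum H ; dsum≡ = refl
    ; sum≡ = cong (ℕ._+ sum ρ) (sym (ℕP.m+[n∸m]≡n d≤r))
    ; tsum≡ = sum-HS H
    ; z≡ = trans (cong (r ℕ.+ f ∸_) (sum-∸ (cons g f r H))) (trans (cong (_∸ (f ℕ.+ dsum H)) (ℕP.+-comm r f)) (ℕP.[m+n]∸[m+o]≡n∸o f r (dsum H)))
    }
    where
    d≤r : dsum H ≤ r
    d≤r = ℕP.+-cancelˡ-≤ f _ _ (ℕP.≤-trans (dsum-≤ (cons g f r H)) (ℕP.≤-reflexive (ℕP.+-comm r f)))

  -- The inductive form of `vS-identity`. The terms with `top` account for the row above, whose
  -- length in ρ is `top`.
  vH-identity : ∀ {top η ρ} (H : HS top η ρ) →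
    dsum H ℕ.* sum ρ ℕ.+ vH H ℕ.+ E′ ρ ℕ.+ top ℕ.* Shape.f (shape H) ≡ top ℕ.* dsum H ℕ.+ E′ η ℕ.+ exc η ρ
  vH-identity {top} stop = sym (trans (ℕP.+-identityʳ _) (ℕP.+-identityʳ _))
  vH-identity (cons {η} {ρ} g f r H) = begin
    (f ℕ.+ dsum H) ℕ.* (r ℕ.+ sum ρ) ℕ.+ (vH H ℕ.+ (dsum H ℕ.* (f ℕ.+ g) ℕ.+ tri f)) ℕ.+ (tri r ℕ.+ r ℕ.* T ℕ.+ E′ ρ) ℕ.+ (r ℕ.+ (f ℕ.+ g)) ℕ.* f
      ≡⟨ cong₂ (λ d P → (f ℕ.+ d) ℕ.* (r ℕ.+ P) ℕ.+ (vH H ℕ.+ (d ℕ.* (f ℕ.+ g) ℕ.+ tri f)) ℕ.+ (tri r ℕ.+ r ℕ.* T ℕ.+ E′ ρ) ℕ.+ (r ℕ.+ (f ℕ.+ g)) ℕ.* f) S.dsum≡ S.sum≡ ⟩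
    (f ℕ.+ (S.f ℕ.+ S.d)) ℕ.* (r ℕ.+ (S.d ℕ.+ S.z ℕ.+ T)) ℕ.+ (vH H ℕ.+ ((S.f ℕ.+ S.d) ℕ.* (f ℕ.+ g) ℕ.+ tri f)) ℕ.+ (tri r ℕ.+ r ℕ.* T ℕ.+ E′ ρ) ℕ.+ (r ℕ.+ (f ℕ.+ g)) ℕ.* f
      ≡⟨ collect f g r S.f S.d S.z T (vH H) (tri f) (tri r) (E′ ρ) ⟩
    common-part ℕ.+ ((S.f ℕ.+ S.d) ℕ.* (S.d ℕ.+ S.z ℕ.+ T) ℕ.+ vH H ℕ.+ E′ ρ ℕ.+ r ℕ.* S.f)
      ≡⟨ cong (common-part ℕ.+_) (trans (cong₂ (λ d P → d ℕ.* P ℕ.+ vH H ℕ.+ E′ ρ ℕ.+ r ℕ.* S.f) (sym S.dsum≡) (sym S.sum≡))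
           (trans (vH-identity H) (cong (λ d → r ℕ.* d ℕ.+ E′ η ℕ.+ exc η ρ) S.dsum≡))) ⟩
    common-part ℕ.+ (r ℕ.* (S.f ℕ.+ S.d) ℕ.+ E′ η ℕ.+ exc η ρ)
      ≡⟨ expand f g r S.f S.d S.z T (tri f) (tri r) (E′ η) (exc η ρ) ⟩
    (r ℕ.+ (f ℕ.+ g)) ℕ.* (f ℕ.+ (S.f ℕ.+ S.d)) ℕ.+ (tri r ℕ.+ tri f ℕ.+ r ℕ.* f ℕ.+ (r ℕ.+ f) ℕ.* (T ℕ.+ S.d) ℕ.+ E′ η) ℕ.+ (f ℕ.* S.z ℕ.+ exc η ρ)
      ≡⟨ cong₂ (λ u v → (r ℕ.+ (f ℕ.+ g)) ℕ.* (f ℕ.+ u) ℕ.+ (v ℕ.+ (r ℕ.+ f) ℕ.* (T ℕ.+ S.d) ℕ.+ E′ η) ℕ.+ (f ℕ.* S.z ℕ.+ exc η ρ)) (sym S.dsum≡) (sym (tri-+ r f)) ⟩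
    (r ℕ.+ (f ℕ.+ g)) ℕ.* (f ℕ.+ dsum H) ℕ.+ (tri (r ℕ.+ f) ℕ.+ (r ℕ.+ f) ℕ.* (T ℕ.+ S.d) ℕ.+ E′ η) ℕ.+ (f ℕ.* S.z ℕ.+ exc η ρ)
      ≡⟨ cong₂ (λ u v → (r ℕ.+ (f ℕ.+ g)) ℕ.* (f ℕ.+ dsum H) ℕ.+ (tri (r ℕ.+ f) ℕ.+ (r ℕ.+ f) ℕ.* u ℕ.+ E′ η) ℕ.+ (v ℕ.+ exc η ρ)) (sym S.tsum≡)
           (cong₂ ℕ._*_ (sym (ℕP.m+n∸m≡n r f)) (sym S.z≡)) ⟩
    (r ℕ.+ (f ℕ.+ g)) ℕ.* (f ℕ.+ dsum H) ℕ.+ E′ (r ℕ.+ f ∷ η) ℕ.+ exc (r ℕ.+ f ∷ η) (r ∷ ρ) ∎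
    where
    open ≡-Reasoning
    module S = Shape (shape H)
    T = tsum ρ
    common-part = f ℕ.* r ℕ.+ f ℕ.* (S.d ℕ.+ S.z ℕ.+ T) ℕ.+ (S.f ℕ.+ S.d) ℕ.* f ℕ.+ (S.f ℕ.+ S.d) ℕ.* g ℕ.+ r ℕ.* S.d ℕ.+ tri f ℕ.+ tri r ℕ.+ r ℕ.* T ℕ.+ (r ℕ.+ (f ℕ.+ g)) ℕ.* f
    collect : ∀ f g r f′ d z T v t u e → (f ℕ.+ (f′ ℕ.+ d)) ℕ.* (r ℕ.+ (d ℕ.+ z ℕ.+ T)) ℕ.+ (v ℕ.+ ((f′ ℕ.+ d) ℕ.* (f ℕ.+ g) ℕ.+ t)) ℕ.+ (u ℕ.+ r ℕ.* T ℕ.+ e) ℕ.+ (r ℕ.+ (f ℕ.+ g)) ℕ.* f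
      ≡ (f ℕ.* r ℕ.+ f ℕ.* (d ℕ.+ z ℕ.+ T) ℕ.+ (f′ ℕ.+ d) ℕ.* f ℕ.+ (f′ ℕ.+ d) ℕ.* g ℕ.+ r ℕ.* d ℕ.+ t ℕ.+ u ℕ.+ r ℕ.* T ℕ.+ (r ℕ.+ (f ℕ.+ g)) ℕ.* f)
        ℕ.+ ((f′ ℕ.+ d) ℕ.* (d ℕ.+ z ℕ.+ T) ℕ.+ v ℕ.+ e ℕ.+ r ℕ.* f′)
    collect = ℕS.solve-∀
    expand : ∀ f g r f′ d z T t u e x → (f ℕ.* r ℕ.+ f ℕ.* (d ℕ.+ z ℕ.+ T) ℕ.+ (f′ ℕ.+ d) ℕ.* f ℕ.+ (f′ ℕ.+ d) ℕ.* g ℕ.+ r ℕ.* d ℕ.+ t ℕ.+ u ℕ.+ r ℕ.* T ℕ.+ (r ℕ.+ (f ℕ.+ g)) ℕ.* f)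
        ℕ.+ (r ℕ.* (f′ ℕ.+ d) ℕ.+ e ℕ.+ x)
      ≡ (r ℕ.+ (f ℕ.+ g)) ℕ.* (f ℕ.+ (f′ ℕ.+ d)) ℕ.+ (u ℕ.+ t ℕ.+ r ℕ.* f ℕ.+ (r ℕ.+ f) ℕ.* (T ℕ.+ d) ℕ.+ e) ℕ.+ (f ℕ.* z ℕ.+ x)
    expand = ℕS.solve-∀

  -- the exponent of x in Wt x η ρ
  vS : ∀ {k η ρ} → Strip k η ρ → ℕ
  vS empty                = 0
  vS (cons {ρ = ρ} f r H) = (f ℕ.+ dsum H) ℕ.* sum ρ ℕ.+ vH H

  -- Along a chain the values of `E` telescope, so the total power of x is E η plus the sum of the
  -- excesses.
  vS-identity : ∀ {k η ρ} (S : Strip k η ρ) → vS S ℕ.+ E ρ ≡ exc η ρ ℕ.+ E η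
  vS-identity empty = refl
  vS-identity (cons {η} {ρ} f r H) = begin
    (f ℕ.+ dsum H) ℕ.* sum ρ ℕ.+ vH H ℕ.+ (r ℕ.* T ℕ.+ E′ ρ)
      ≡⟨ cong₂ (λ d P → (f ℕ.+ d) ℕ.* P ℕ.+ vH H ℕ.+ (r ℕ.* T ℕ.+ E′ ρ)) S.dsum≡ S.sum≡ ⟩
    (f ℕ.+ (S.f ℕ.+ S.d)) ℕ.* (S.d ℕ.+ S.z ℕ.+ T) ℕ.+ vH H ℕ.+ (r ℕ.* T ℕ.+ E′ ρ)
      ≡⟨ ℕP.+-cancelʳ-≡ (r ℕ.* S.f) _ _ (begin
          (f ℕ.+ (S.f ℕ.+ S.d)) ℕ.* (S.d ℕ.+ S.z ℕ.+ T) ℕ.+ vH H ℕ.+ (r ℕ.* T ℕ.+ E′ ρ) ℕ.+ r ℕ.* S.f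
            ≡⟨ collect f S.f S.d S.z T (vH H) r (E′ ρ) ⟩
          (f ℕ.* (S.d ℕ.+ S.z ℕ.+ T) ℕ.+ r ℕ.* T) ℕ.+ ((S.f ℕ.+ S.d) ℕ.* (S.d ℕ.+ S.z ℕ.+ T) ℕ.+ vH H ℕ.+ E′ ρ ℕ.+ r ℕ.* S.f)
            ≡⟨ cong ((f ℕ.* (S.d ℕ.+ S.z ℕ.+ T) ℕ.+ r ℕ.* T) ℕ.+_) (trans (cong₂ (λ d P → d ℕ.* P ℕ.+ vH H ℕ.+ E′ ρ ℕ.+ r ℕ.* S.f) (sym S.dsum≡) (sym S.sum≡))
                 (trans (vH-identity H) (cong (λ d → r ℕ.* d ℕ.+ E′ η ℕ.+ exc η ρ) S.dsum≡))) ⟩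
          (f ℕ.* (S.d ℕ.+ S.z ℕ.+ T) ℕ.+ r ℕ.* T) ℕ.+ (r ℕ.* (S.f ℕ.+ S.d) ℕ.+ E′ η ℕ.+ exc η ρ)
            ≡⟨ expand f S.f S.d S.z T r (E′ η) (exc η ρ) ⟩
          f ℕ.* S.z ℕ.+ exc η ρ ℕ.+ ((r ℕ.+ f) ℕ.* (T ℕ.+ S.d) ℕ.+ E′ η) ℕ.+ r ℕ.* S.f ∎) ⟩
    f ℕ.* S.z ℕ.+ exc η ρ ℕ.+ ((r ℕ.+ f) ℕ.* (T ℕ.+ S.d) ℕ.+ E′ η)
      ≡⟨ cong₂ (λ u v → u ℕ.+ exc η ρ ℕ.+ ((r ℕ.+ f) ℕ.* v ℕ.+ E′ η)) (cong₂ ℕ._*_ (sym (ℕP.m+n∸m≡n r f)) (sym S.z≡)) (sym S.tsum≡) ⟩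
    exc (r ℕ.+ f ∷ η) (r ∷ ρ) ℕ.+ E (r ℕ.+ f ∷ η) ∎
    where
    open ≡-Reasoning
    module S = Shape (shape H)
    T = tsum ρ
    collect : ∀ f f′ d z T v r e → (f ℕ.+ (f′ ℕ.+ d)) ℕ.* (d ℕ.+ z ℕ.+ T) ℕ.+ v ℕ.+ (r ℕ.* T ℕ.+ e) ℕ.+ r ℕ.* f′
      ≡ (f ℕ.* (d ℕ.+ z ℕ.+ T) ℕ.+ r ℕ.* T) ℕ.+ ((f′ ℕ.+ d) ℕ.* (d ℕ.+ z ℕ.+ T) ℕ.+ v ℕ.+ e ℕ.+ r ℕ.* f′)
    collect = ℕS.solve-∀
    expand : ∀ f f′ d z T r e x → (f ℕ.* (d ℕ.+ z ℕ.+ T) ℕ.+ r ℕ.* T) ℕ.+ (r ℕ.* (f′ ℕ.+ d) ℕ.+ e ℕ.+ x)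
      ≡ f ℕ.* z ℕ.+ x ℕ.+ ((r ℕ.+ f) ℕ.* (T ℕ.+ d) ℕ.+ e) ℕ.+ r ℕ.* f′
    expand = ℕS.solve-∀

  ωL : ℤ → ℕ → ℕ → List ℕ → List ℕ → ℤ
  ωL x s top (h ∷ η) (r ∷ ρ) = ωL x (s ℕ.+ (h ∸ r)) r η ρ * (ff x s (h ∸ r) * G x (h ∸ r) (top ∸ h))
  ωL x s top _       _       = 1ℤ

  -- Wt without its powers of x and x − 1
  ω : ℤ → List ℕ → List ℕ → ℤ
  ω x (h ∷ η) (r ∷ ρ) = ωL x (h ∸ r) r η ρ
  ω x _       _       = 1ℤ

  ωL-cons : ∀ {η ρ} x s g f r → HS r η ρ → ωL x s (r ℕ.+ (f ℕ.+ g)) (r ℕ.+ f ∷ η) (r ∷ ρ) ≡ ωL x (s ℕ.+ f) r η ρ * (ff x s f * G x f g)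
  ωL-cons x s g f r H rewrite ℕP.m+n∸m≡n r f | ℕP.[m+n]∸[m+o]≡n∸o r (f ℕ.+ g) f | ℕP.m+n∸m≡n f g = refl

  WL-factor : ∀ {top η ρ} x s (H : HS top η ρ) → WL x s top η ρ ≡ (x - 1ℤ) ^ dsum H * x ^ vH H * ωL x s top η ρ
  WL-factor x s stop = refl
  WL-factor x s (cons {η} {ρ} g f r H) = begin
    WL x s (r ℕ.+ (f ℕ.+ g)) (r ℕ.+ f ∷ η) (r ∷ ρ)
      ≡⟨ WL-cons x s g f r H ⟩
    WL x (s ℕ.+ f) r η ρ * Mval x (dsum H) s f g
      ≡⟨ cong (_* Mval x (dsum H) s f g) (WL-factor x (s ℕ.+ f) H) ⟩
    y ^ dsum H * x ^ vH H * ωL x (s ℕ.+ f) r η ρ * (x ^ (dsum H ℕ.* (f ℕ.+ g)) * y ^ f * x ^ tri f * ff x s f * G x f g)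
      ≡⟨ regroup (y ^ dsum H) (x ^ vH H) (ωL x (s ℕ.+ f) r η ρ) (x ^ (dsum H ℕ.* (f ℕ.+ g))) (y ^ f) (x ^ tri f) (ff x s f) (G x f g) ⟩
    y ^ f * y ^ dsum H * (x ^ vH H * (x ^ (dsum H ℕ.* (f ℕ.+ g)) * x ^ tri f)) * (ωL x (s ℕ.+ f) r η ρ * (ff x s f * G x f g))
      ≡⟨ cong₂ _*_ (cong₂ _*_ (sym (^-+ y f (dsum H))) (trans (cong (x ^ vH H *_) (sym (^-+ x (dsum H ℕ.* (f ℕ.+ g)) (tri f)))) (sym (^-+ x (vH H) (dsum H ℕ.* (f ℕ.+ g) ℕ.+ tri f))))) (sym (ωL-cons x s g f r H)) ⟩
    y ^ (f ℕ.+ dsum H) * x ^ vH (cons g f r H) * ωL x s (r ℕ.+ (f ℕ.+ g)) (r ℕ.+ f ∷ η) (r ∷ ρ) ∎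
    where
    open ≡-Reasoning
    y = x - 1ℤ
    regroup : ∀ a b w c d e f g → a * b * w * (c * d * e * f * g) ≡ d * a * (b * (c * e)) * (w * (f * g))
    regroup = solve-∀

  -- the exponent of x − 1 in Wt x η ρ
  yS : ∀ {k η ρ} → Strip k η ρ → ℕ
  yS empty        = 0
  yS (cons f r H) = dsum H

  Wt-factor : ∀ {k η ρ} x (S : Strip k η ρ) → Wt x η ρ ≡ (x - 1ℤ) ^ yS S * x ^ vS S * ω x η ρ
  Wt-factor x empty = refl
  Wt-factor x (cons {η} {ρ} f r H) = begin
    Wt x (r ℕ.+ f ∷ η) (r ∷ ρ)
      ≡⟨ trans (Wt-cons x f r H) (cong (x ^ K *_) (WL-factor x f H)) ⟩
    x ^ K * ((x - 1ℤ) ^ dsum H * x ^ vH H * ωL x f r η ρ)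
      ≡⟨ regroup (x ^ K) ((x - 1ℤ) ^ dsum H) (x ^ vH H) (ωL x f r η ρ) ⟩
    (x - 1ℤ) ^ dsum H * (x ^ K * x ^ vH H) * ωL x f r η ρ
      ≡⟨ cong₂ (λ a b → (x - 1ℤ) ^ dsum H * a * ωL x b r η ρ) (sym (^-+ x K (vH H))) (sym (ℕP.m+n∸m≡n r f)) ⟩
    (x - 1ℤ) ^ dsum H * x ^ (K ℕ.+ vH H) * ω x (r ℕ.+ f ∷ η) (r ∷ ρ) ∎
    where
    open ≡-Reasoning
    K = (f ℕ.+ dsum H) ℕ.* sum ρ
    regroup : ∀ a b c w → a * (b * c * w) ≡ b * (a * c) * w
    regroup = solve-∀

  yS-identity : ∀ {k η ρ} (S : Strip k η ρ) → yS S ℕ.+ tsum ρ ≡ tsum η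
  yS-identity empty                = refl
  yS-identity (cons {ρ = ρ} f r H) = trans (ℕP.+-comm (dsum H) (sum ρ)) (sym (sum-HS H))

  -- The cofactor of `B` once the common powers of x and x - 1 are removed. Of the powers of x only
  -- the excess is left.
  Rf : ℤ → List ℕ → List ℕ → ℤ
  Rf x η []       = if sum η ≡ᵇ 0 then 1ℤ else 0ℤ
  Rf x η (k ∷ ks) = ∑ℤ (strips η k) (λ ρ → x ^ exc η ρ * ω x η ρ * Rf x ρ ks)

  E-zero : ∀ η → sum η ≡ 0 → E η ≡ 0
  E-zero []      e = refl
  E-zero (a ∷ η) e = cong₂ ℕ._+_ (cong (ℕ._* tsum η) (ℕP.m+n≡0⇒m≡0 a e)) (E′-zero η (ℕP.m+n≡0⇒n≡0 a e))
    where
    E′-zero : ∀ η → sum η ≡ 0 → E′ η ≡ 0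
    E′-zero []      e = refl
    E′-zero (a ∷ η) e = cong₂ ℕ._+_ (cong₂ ℕ._+_ (cong tri (ℕP.m+n≡0⇒m≡0 a e)) (cong (ℕ._* tsum η) (ℕP.m+n≡0⇒m≡0 a e))) (E′-zero η (ℕP.m+n≡0⇒n≡0 a e))

  tsum-zero : ∀ η → sum η ≡ 0 → tsum η ≡ 0
  tsum-zero []      e = refl
  tsum-zero (a ∷ η) e = ℕP.m+n≡0⇒n≡0 a e

  B-factor : ∀ x ks η → Decr η → sum η ≡ sum ks → B x η ks ≡ (x - 1ℤ) ^ tsum η * x ^ E η * Rf x η ks
  B-factor x [] η dη sη rewrite tsum-zero η sη | E-zero η sη = sym (ℤP.*-identityˡ _)
  B-factor x (k ∷ ks) η dη sη = trans (∑ℤ-cong (strips η k) term) (∑ℤ-*ˡ (strips η k) ((x - 1ℤ) ^ tsum η * x ^ E η) _)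
    where
    open ≡-Reasoning
    y = x - 1ℤ
    term : ∀ ρ → ρ ∈ strips η k → Wt x η ρ * B x ρ ks ≡ y ^ tsum η * x ^ E η * (x ^ exc η ρ * ω x η ρ * Rf x ρ ks)
    term ρ ρ∈ = begin
      Wt x η ρ * B x ρ ks
        ≡⟨ cong₂ _*_ (Wt-factor x S) (B-factor x ks ρ (Strip⇒Decr S) (ℕP.+-cancelʳ-≡ k _ _ (trans (sym (Strip-sum S)) (trans sη (ℕP.+-comm k _))))) ⟩
      y ^ yS S * x ^ vS S * ω x η ρ * (y ^ tsum ρ * x ^ E ρ * Rf x ρ ks)
        ≡⟨ regroup (y ^ yS S) (x ^ vS S) (ω x η ρ) (y ^ tsum ρ) (x ^ E ρ) (Rf x ρ ks) ⟩
      y ^ yS S * y ^ tsum ρ * (x ^ vS S * x ^ E ρ) * (ω x η ρ * Rf x ρ ks)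
        ≡⟨ cong₂ (λ a b → a * b * (ω x η ρ * Rf x ρ ks)) (trans (sym (^-+ y (yS S) _)) (cong (y ^_) (yS-identity S)))
             (trans (sym (^-+ x (vS S) _)) (trans (cong (x ^_) (vS-identity S)) (^-+ x (exc η ρ) _))) ⟩
      y ^ tsum η * (x ^ exc η ρ * x ^ E η) * (ω x η ρ * Rf x ρ ks)
        ≡⟨ reorder (y ^ tsum η) (x ^ exc η ρ) (x ^ E η) (ω x η ρ) (Rf x ρ ks) ⟩
      y ^ tsum η * x ^ E η * (x ^ exc η ρ * ω x η ρ * Rf x ρ ks) ∎
      where
      S = All.lookup (strips-All η k dη) ρ∈
      regroup : ∀ a b w c d R → a * b * w * (c * d * R) ≡ a * c * (b * d) * (w * R)
      regroup = solve-∀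
      reorder : ∀ a b c w R → a * (b * c) * (w * R) ≡ a * c * (b * w * R)
      reorder = solve-∀

  -- Polynomial functions without control of the degree, which is all that the cofactor in (3)
  -- requires.
  data Poly : (ℤ → ℤ) → Set where
    zero : ∀ {φ} → (∀ x → φ x ≡ 0ℤ) → Poly φ
    step : ∀ {φ ψ} a → Poly ψ → (∀ x → φ x ≡ a + x * ψ x) → Poly φ

  poly-list : ∀ {φ} → Poly φ → Σ (List ℤ) λ R → ∀ x → evalZ R x ≡ φ x
  poly-list (zero h) = [] , λ x → sym (h x)
  poly-list (step a p h) with poly-list p
  ... | R , e = a ∷ R , λ x → trans (cong (λ t → a + x * t) (e x)) (sym (h x))

  poly-ext : ∀ {φ ψ} → (∀ x → φ x ≡ ψ x) → Poly φ → Poly ψ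
  poly-ext e (zero h)     = zero (λ x → trans (sym (e x)) (h x))
  poly-ext e (step a p h) = step a p (λ x → trans (sym (e x)) (h x))

  poly-const : ∀ c → Poly (λ _ → c)
  poly-const c = step c (zero {φ = λ _ → 0ℤ} (λ _ → refl)) (λ x → sym (trans (cong (λ t → c + t) (ℤP.*-zeroʳ x)) (ℤP.+-identityʳ c)))

  poly-+ : ∀ {φ ψ} → Poly φ → Poly ψ → Poly (λ x → φ x + ψ x)
  poly-+ {ψ = ψ} (zero h) q = poly-ext (λ x → sym (trans (cong (_+ ψ x) (h x)) (ℤP.+-identityˡ _))) q
  poly-+ {φ} p@(step _ _ _) (zero h′) = poly-ext (λ x → sym (trans (cong (λ t → φ x + t) (h′ x)) (ℤP.+-identityʳ _))) p
  poly-+ (step a p h) (step b q h′) = step (a + b) (poly-+ p q) (λ x → trans (cong₂ _+_ (h x) (h′ x)) (collect a b x _ _))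
    where
    collect : ∀ a b x u v → a + x * u + (b + x * v) ≡ a + b + x * (u + v)
    collect = solve-∀

  poly-scale : ∀ {φ} b → Poly φ → Poly (λ x → b * φ x)
  poly-scale b (zero h)     = zero (λ x → trans (cong (b *_) (h x)) (ℤP.*-zeroʳ b))
  poly-scale b (step a p h) = step (b * a) (poly-scale b p) (λ x → trans (cong (b *_) (h x)) (collect a b x _))
    where
    collect : ∀ a b x u → b * (a + x * u) ≡ b * a + x * (b * u)
    collect = solve-∀

  poly-* : ∀ {φ ψ} → Poly φ → Poly ψ → Poly (λ x → φ x * ψ x)
  poly-* {ψ = ψ} (zero h) q = zero (λ x → trans (cong (_* ψ x) (h x)) (ℤP.*-zeroˡ (ψ x)))
  poly-* {ψ = ψ} (step {ψ = φ′} a p h) q = poly-ext (λ x → trans (collect a x (φ′ x) (ψ x)) (cong (_* ψ x) (sym (h x))))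
    (poly-+ (poly-scale a q) (step {ψ = λ x → φ′ x * ψ x} 0ℤ (poly-* p q) (λ x → sym (ℤP.+-identityˡ (x * (φ′ x * ψ x))))))
    where
    collect : ∀ a x u v → a * v + x * (u * v) ≡ (a + x * u) * v
    collect = solve-∀

  lead⇒poly : ∀ {d c φ} → Lead d c φ → Poly φ
  lead⇒poly (const {c} h) = poly-ext (λ x → sym (h x)) (poly-const c)
  lead⇒poly (step a l h)  = step a (lead⇒poly l) h

  poly-ω : ∀ {k η ρ} → Strip k η ρ → Poly (λ x → ω x η ρ)
  poly-ω empty = poly-const 1ℤ
  poly-ω (cons {η} {ρ} f r H) = poly-ext (λ x → cong (λ s → ωL x s r η ρ) (sym (ℕP.m+n∸m≡n r f))) (go f H)
    where
    go : ∀ {top η ρ} s → HS top η ρ → Poly (λ x → ωL x s top η ρ)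
    go s stop           = poly-const 1ℤ
    go s (cons g f r H) = poly-ext (λ x → sym (ωL-cons x s g f r H)) (poly-* (go (s ℕ.+ f) H) (poly-* (lead⇒poly (lead-ff s f)) (lead⇒poly (lead-G f g))))

  poly-∑ : ∀ {A : Set} (xs : List A) {φ : A → ℤ → ℤ} → (∀ y → y ∈ xs → Poly (φ y)) → Poly (λ x → ∑ℤ xs (λ y → φ y x))
  poly-∑ []       h = poly-const 0ℤ
  poly-∑ (y ∷ xs) h = poly-+ (h y (here refl)) (poly-∑ xs (λ z m → h z (there m)))

  poly-Rf : ∀ ks η → Decr η → Poly (λ x → Rf x η ks)
  poly-Rf []       η dη = poly-const _
  poly-Rf (k ∷ ks) η dη = poly-∑ (strips η k) (λ ρ ρ∈ → let S = All.lookup (strips-All η k dη) ρ∈ in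
    poly-* (poly-* (lead⇒poly (lead-^ (exc η ρ) lead-x)) (poly-ω S)) (poly-Rf ks ρ (Strip⇒Decr S)))

-- Strips of excess zero, positivity and dominance.

module LeastStrips where

  open import Defs
  open Counting
  open PartitionLists
  open Weights
  open HorizontalStrips
  open WeightedChains
  open LeadingTerms
  open Factorisation
  open import Data.Bool.Base using (true; false)
  open import Data.Nat.Base as ℕ using (ℕ; zero; suc; _≤_; _<_; z≤n; s≤s; _∸_; _≡ᵇ_)
  import Data.Nat.Properties as ℕP
  open import Data.Nat.ListAction using (sum)
  import Data.Nat.Tactic.RingSolver as ℕS
  open import Data.Integer.Base using (ℤ; +_; 0ℤ; 1ℤ; _+_; _*_; _^_)
  import Data.Integer.Properties as ℤP
  open import Data.List.Base using (List; []; _∷_; _∷ʳ_; length; reverse)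
  open import Data.List.Properties using (unfold-reverse; length-reverse)
  open import Data.List.Relation.Unary.All as All using (All; []; _∷_)
  open import Data.List.Relation.Unary.AllPairs using (AllPairs; []; _∷_)
  open import Data.List.Relation.Unary.Any using (here; there)
  open import Data.List.Membership.Propositional using (_∈_)
  open import Data.List.Relation.Binary.Permutation.Propositional using (↭-sym)
  open import Data.List.Relation.Binary.Permutation.Propositional.Properties using (↭-reverse; All-resp-↭)
  open import Data.Nat.ListAction.Properties using (sum-↭)
  open import Data.Product.Base using (Σ; ∃; _×_; _,_; proj₁; proj₂)
  open import Data.Sum.Base using (_⊎_; inj₁; inj₂; [_,_]′)
  open import Data.Empty using (⊥-elim)
  open import Relation.Nullary using (yes; no; ¬_)
  open import Relation.Binary.PropositionalEquality

  module AtZero where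

    qi-0 : ∀ m → qi 0ℤ (suc m) ≡ 1ℤ
    qi-0 m = trans (cong (λ t → 1ℤ + t) (ℤP.*-zeroˡ (qi 0ℤ m))) refl

    ff-0 : ∀ s e → ff 0ℤ s e ≡ 1ℤ
    ff-0 s zero    = refl
    ff-0 s (suc e) = cong₂ _*_ (trans (cong (qi 0ℤ) (ℕP.+-suc s e)) (qi-0 (s ℕ.+ e))) (ff-0 s e)

    G-0 : ∀ e g → G 0ℤ e g ≡ 1ℤ
    G-0 zero    g       = refl
    G-0 (suc e) zero    = refl
    G-0 (suc e) (suc g) = trans (cong₂ (λ u v → u + v * G 0ℤ e (suc g)) (G-0 (suc e) g) (ℤP.*-zeroˡ (0ℤ ^ g))) (cong (λ t → 1ℤ + t) (ℤP.*-zeroˡ (G 0ℤ e (suc g))))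

    ωL-0 : ∀ s top η ρ → ωL 0ℤ s top η ρ ≡ 1ℤ
    ωL-0 s top []      []      = refl
    ωL-0 s top []      (_ ∷ _) = refl
    ωL-0 s top (_ ∷ _) []      = refl
    ωL-0 s top (h ∷ η) (r ∷ ρ) = cong₂ _*_ (ωL-0 (s ℕ.+ (h ∸ r)) r η ρ) (cong₂ _*_ (ff-0 s (h ∸ r)) (G-0 (h ∸ r) (top ∸ h)))

    ω-0 : ∀ η ρ → ω 0ℤ η ρ ≡ 1ℤ
    ω-0 []      []      = refl
    ω-0 []      (_ ∷ _) = refl
    ω-0 (_ ∷ _) []      = refl
    ω-0 (h ∷ η) (r ∷ ρ) = ωL-0 (h ∸ r) r η ρ

  open AtZero using (ω-0)

  Pos : ℤ → Set
  Pos a = ∃ λ n → a ≡ + suc n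

  pos-* : ∀ {a b} → Pos a → Pos b → Pos (a * b)
  pos-* (m , refl) (n , refl) = n ℕ.+ m ℕ.* suc n , refl

  pos-+ : ∀ {a b} → Pos a → (∃ λ n → b ≡ + n) → Pos (a + b)
  pos-+ (m , refl) (n , refl) = m ℕ.+ n , refl

  pos⇒nonneg : ∀ {a} → Pos a → ∃ λ n → a ≡ + n
  pos⇒nonneg (n , e) = suc n , e

  pos-^ : ∀ {a} n → Pos a → Pos (a ^ n)
  pos-^ zero    p = 0 , refl
  pos-^ (suc n) p = pos-* p (pos-^ n p)

  module _ {x : ℤ} (x>0 : Pos x) where

    qi-nonneg : ∀ m → ∃ λ n → qi x m ≡ + n
    qi-pos : ∀ m → Pos (qi x (suc m))
    qi-nonneg zero    = 0 , refl
    qi-nonneg (suc m) = pos⇒nonneg (qi-pos m)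
    qi-pos m = let n , e = qi-nonneg m ; a , e₀ = x>0 in
      suc a ℕ.* n , trans (cong₂ (λ u v → 1ℤ + u * v) e₀ e) (cong (λ t → 1ℤ + t) (sym (ℤP.pos-* (suc a) n)))

    ff-pos : ∀ s e → Pos (ff x s e)
    ff-pos s zero    = 0 , refl
    ff-pos s (suc e) = pos-* (subst (λ m → Pos (qi x m)) (sym (ℕP.+-suc s e)) (qi-pos (s ℕ.+ e))) (ff-pos s e)

    G-pos : ∀ e g → Pos (G x e g)
    G-pos zero    g       = 0 , refl
    G-pos (suc e) zero    = 0 , refl
    G-pos (suc e) (suc g) = pos-+ (G-pos (suc e) g) (pos⇒nonneg (pos-* (pos-^ (suc g) x>0) (G-pos e (suc g))))

    ωL-pos : ∀ s top η ρ → Pos (ωL x s top η ρ)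
    ωL-pos s top []      []      = 0 , refl
    ωL-pos s top []      (_ ∷ _) = 0 , refl
    ωL-pos s top (_ ∷ _) []      = 0 , refl
    ωL-pos s top (h ∷ η) (r ∷ ρ) = pos-* (ωL-pos (s ℕ.+ (h ∸ r)) r η ρ) (pos-* (ff-pos s (h ∸ r)) (G-pos (h ∸ r) (top ∸ h)))

    ω-pos : ∀ η ρ → Pos (ω x η ρ)
    ω-pos []      []      = 0 , refl
    ω-pos []      (_ ∷ _) = 0 , refl
    ω-pos (_ ∷ _) []      = 0 , refl
    ω-pos (h ∷ η) (r ∷ ρ) = ωL-pos (h ∸ r) r η ρ

    ∑ℤ-pos : ∀ {A : Set} (xs : List A) (c : A → ℕ) (φ : A → ℤ) → (∀ y → ∃ λ n → φ y ≡ + n × (c y ≢ 0 → n ≢ 0)) →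
             ∃ λ n → ∑ℤ xs φ ≡ + n × (∑ xs c ≢ 0 → n ≢ 0)
    ∑ℤ-pos []       c φ h = 0 , refl , λ ne → ne
    ∑ℤ-pos (y ∷ xs) c φ h with h y | ∑ℤ-pos xs c φ h
    ... | m , e , p | n , e′ , q = m ℕ.+ n , trans (cong₂ _+_ e e′) (sym (ℤP.pos-+ m n)) , nonzero
      where
      nonzero : c y ℕ.+ ∑ xs c ≢ 0 → m ℕ.+ n ≢ 0
      nonzero ne z with c y
      ... | suc _ = p (λ ()) (ℕP.m+n≡0⇒m≡0 m z)
      ... | zero  = q ne (ℕP.m+n≡0⇒n≡0 m z)

    -- For positive x every chain contributes a positive number, so the sum can vanish only if there
    -- is no chain. It serves at x = q for nonvanishing and at x = 1 for the value of the cofactor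
    -- in (3).
    Rf-pos : ∀ ks η → ∃ λ n → Rf x η ks ≡ + n × (chains η ks ≢ 0 → n ≢ 0)
    Rf-pos [] η with sum η ≡ᵇ 0
    ... | true  = 1 , refl , λ _ ()
    ... | false = 0 , refl , λ ne → ne
    Rf-pos (k ∷ ks) η = ∑ℤ-pos (strips η k) (λ ρ → chains ρ ks) _ term
      where
      term : ∀ ρ → ∃ λ n → x ^ exc η ρ * ω x η ρ * Rf x ρ ks ≡ + n × (chains ρ ks ≢ 0 → n ≢ 0)
      term ρ with pos-* (pos-^ (exc η ρ) x>0) (ω-pos η ρ) | Rf-pos ks ρ
      ... | m , e | n , e′ , q = suc m ℕ.* n , trans (cong₂ _*_ e e′) (sym (ℤP.pos-* (suc m) n)) ,
        λ ne z → q ne (case ℕP.m*n≡0⇒m≡0∨n≡0 (suc m) z of λ { (inj₂ n≡0) → n≡0 })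
        where open import Function.Base using (case_of_)

  -- The rows above the merged pair stay, those below move up by one, and a zero row is appended to
  -- keep the length. A missing next row counts as empty.
  mergeFrom : ℕ → ℕ → List ℕ → List ℕ
  mergeFrom k h []       = (h ∸ k) ∷ []
  mergeFrom k h (h′ ∷ η) with k ℕP.≤? h′
  ... | yes _ = h ∷ mergeFrom k h′ η
  ... | no _  = (h ℕ.+ h′ ∸ k) ∷ (η ∷ʳ 0)

  -- the strip of size k of least excess: row j and row j + 1 are merged, where η_{j+1} < k ≤ η_j
  merge : ℕ → List ℕ → List ℕ
  merge k []      = []
  merge k (h ∷ η) = mergeFrom k h η

  merge-yes : ∀ {k h h′ η} → k ≤ h′ → merge k (h ∷ h′ ∷ η) ≡ h ∷ merge k (h′ ∷ η)
  merge-yes {k} {h} {h′} k≤ with k ℕP.≤? h′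
  ... | yes _ = refl
  ... | no k≰ = ⊥-elim (k≰ k≤)

  merge-no : ∀ {k h h′ η} → ¬ k ≤ h′ → merge k (h ∷ h′ ∷ η) ≡ (h ℕ.+ h′ ∸ k) ∷ (η ∷ʳ 0)
  merge-no {k} {h} {h′} k≰ with k ℕP.≤? h′
  ... | yes k≤ = ⊥-elim (k≰ k≤)
  ... | no _   = refl

  -- Moving all rows up by one removes a horizontal strip as large as the first row. No strip is
  -- larger, and the boxes below any row fill the length of the next row, so the excess is zero.
  record Shift (top h : ℕ) (η : List ℕ) : Set where
    field
      strip : HS top (h ∷ η) (η ∷ʳ 0)
      size  : dsum strip ≡ h
      least : exc (h ∷ η) (η ∷ʳ 0) ≡ 0

  shift-HS : ∀ g h η → Desc h η → Shift (h ℕ.+ g) h η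
  shift-HS g h [] d = record { strip = cons g h 0 stop ; size = ℕP.+-identityʳ h ; least = trans (ℕP.+-identityʳ _) (ℕP.*-zeroʳ h) }
  shift-HS g h (h′ ∷ η) (h′≤h , d) = subst (λ t → Shift (t ℕ.+ g) t (h′ ∷ η)) (ℕP.m+[n∸m]≡n h′≤h) (build (h ∸ h′) (subst (λ t → Shift t h′ η) (ℕP.+-identityʳ h′) (shift-HS 0 h′ η d)))
    where
    build : ∀ f → Shift h′ h′ η → Shift (h′ ℕ.+ f ℕ.+ g) (h′ ℕ.+ f) (h′ ∷ η)
    build f S = record
      { strip = subst (λ t → HS t (h′ ℕ.+ f ∷ h′ ∷ η) (h′ ∷ (η ∷ʳ 0))) (sym (ℕP.+-assoc h′ f g)) (cons g f h′ S.strip)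
      ; size = trans (dsum-subst (sym (ℕP.+-assoc h′ f g)) (cons g f h′ S.strip)) (trans (cong (f ℕ.+_) S.size) (ℕP.+-comm f h′))
      ; least = cong₂ ℕ._+_ (trans (cong (λ t → (h′ ℕ.+ f ∸ h′) ℕ.* (h′ ∸ t)) (trans (sum-∸ S.strip) S.size))
                  (trans (cong ((h′ ℕ.+ f ∸ h′) ℕ.*_) (ℕP.n∸n≡0 h′)) (ℕP.*-zeroʳ (h′ ℕ.+ f ∸ h′)))) S.least
      }
      where
      module S = Shift S
      dsum-subst : ∀ {t t′ η ρ} (e : t ≡ t′) (H : HS t η ρ) → dsum (subst (λ t → HS t η ρ) e H) ≡ dsum H
      dsum-subst refl H = refl

  strip⇒HS : ∀ {k top h η ρ} → Strip k (h ∷ η) ρ → h ≤ top → Σ (HS top (h ∷ η) ρ) λ H → dsum H ≡ k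
  strip⇒HS {top = top} (cons f r H) h≤top = subst (λ t → Σ (HS t _ _) λ H′ → dsum H′ ≡ f ℕ.+ dsum H)
    (trans (sym (ℕP.+-assoc r f _)) (ℕP.m+[n∸m]≡n h≤top)) (cons (top ∸ (r ℕ.+ f)) f r H , refl)

  -- Rows above the merged pair lose no boxes. From the upper row of the pair on, the boxes below a
  -- row number exactly the length of the next row, so each factor η_{j+1} - Σ_{i>j} f_i is zero.
  merge-strip : ∀ k h η → k ≤ h → Desc h η → Strip k (h ∷ η) (merge k (h ∷ η)) × exc (h ∷ η) (merge k (h ∷ η)) ≡ 0
  merge-strip k h [] k≤h d = subst (λ t → Strip k (t ∷ []) ((h ∸ k) ∷ [])) (ℕP.m∸n+n≡m k≤h) (subst (λ k′ → Strip k′ (h ∸ k ℕ.+ k ∷ []) ((h ∸ k) ∷ [])) (ℕP.+-identityʳ k) (cons k (h ∸ k) stop)) ,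
    trans (ℕP.+-identityʳ _) (ℕP.*-zeroʳ (h ∸ (h ∸ k)))
  merge-strip k h (h′ ∷ η) k≤h (h′≤h , d) with k ℕP.≤? h′
  ... | yes k≤h′ = keep (merge-strip k h′ η k≤h′ d)
    where
    keep : Strip k (h′ ∷ η) (merge k (h′ ∷ η)) × exc (h′ ∷ η) (merge k (h′ ∷ η)) ≡ 0 →
           Strip k (h ∷ h′ ∷ η) (h ∷ merge k (h′ ∷ η)) × exc (h ∷ h′ ∷ η) (h ∷ merge k (h′ ∷ η)) ≡ 0
    keep (S , e) with strip⇒HS S h′≤h
    ... | H , d≡k = subst₂ (λ t k′ → Strip k′ (t ∷ h′ ∷ η) (h ∷ merge k (h′ ∷ η))) (ℕP.+-identityʳ h) d≡k (cons 0 h H) ,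
      cong₂ ℕ._+_ (cong (λ t → t ℕ.* (h′ ∸ (sum (h′ ∷ η) ∸ sum (merge k (h′ ∷ η))))) (ℕP.n∸n≡0 h)) e
  ... | no k≰h′ = join (ℕP.m+[n∸m]≡n h′≤r)
    where
    h′<k = ℕP.≰⇒> k≰h′
    r = h ℕ.+ h′ ∸ k
    r≡ : r ≡ h′ ℕ.+ (h ∸ k)
    r≡ = trans (cong (_∸ k) (ℕP.+-comm h h′)) (ℕP.+-∸-assoc h′ k≤h)
    h′≤r : h′ ≤ r
    h′≤r = subst (h′ ≤_) (sym r≡) (ℕP.m≤m+n h′ _)
    join : h′ ℕ.+ (r ∸ h′) ≡ r → Strip k (h ∷ h′ ∷ η) (r ∷ (η ∷ʳ 0)) × exc (h ∷ h′ ∷ η) (r ∷ (η ∷ʳ 0)) ≡ 0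
    join e with subst (λ t → Shift t h′ η) e (shift-HS (r ∸ h′) h′ η d)
    ... | S = subst₂ (λ k h → Strip k (h ∷ h′ ∷ η) (r ∷ (η ∷ʳ 0))) k≡ h≡ (cons (k ∸ h′) r S.strip) ,
      cong₂ ℕ._+_ (trans (cong (λ t → (h ∸ r) ℕ.* (h′ ∸ t)) (trans (sum-∸ S.strip) S.size)) (trans (cong ((h ∸ r) ℕ.*_) (ℕP.n∸n≡0 h′)) (ℕP.*-zeroʳ (h ∸ r)))) S.least
      where
      module S = Shift S
      k≡ : k ∸ h′ ℕ.+ dsum S.strip ≡ k
      k≡ = trans (cong (k ∸ h′ ℕ.+_) S.size) (ℕP.m∸n+n≡m (ℕP.<⇒≤ h′<k))
      h≡ : r ℕ.+ (k ∸ h′) ≡ h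
      h≡ = ℕP.+-cancelʳ-≡ h′ _ _ (trans (ℕP.+-assoc r _ _) (trans (cong (r ℕ.+_) (ℕP.m∸n+n≡m (ℕP.<⇒≤ h′<k)))
        (ℕP.m∸n+n≡m (ℕP.≤-trans k≤h (ℕP.m≤m+n h h′)))))

  HS-head-≤ : ∀ {top h η ρ} → HS top (h ∷ η) ρ → h ≤ top
  HS-head-≤ (cons g f r H) = ℕP.+-monoʳ-≤ r (ℕP.m≤m+n f g)

  -- The size of a strip is bounded by the first row, with equality only if every row of ρ is the
  -- next row of η.
  shift-unique : ∀ {top h η ρ} (H : HS top (h ∷ η) ρ) → dsum H ≡ h → ρ ≡ η ∷ʳ 0
  shift-unique (cons {[]} {[]} g f r stop) e = cong (_∷ []) (sym (ℕP.+-cancelˡ-≡ f 0 r (trans e (ℕP.+-comm r f))))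
  shift-unique (cons {h′ ∷ η} g f r H) e = cong₂ _∷_ r≡h′ (shift-unique H (trans dsum≡r r≡h′))
    where
    dsum≡r : dsum H ≡ r
    dsum≡r = ℕP.+-cancelˡ-≡ f _ _ (trans e (ℕP.+-comm r f))
    r≡h′ : r ≡ h′
    r≡h′ = ℕP.≤-antisym (subst (_≤ h′) dsum≡r (dsum-≤ H)) (HS-head-≤ H)

  -- Excess zero makes every product f_j (η_{j+1} - Σ_{i>j} f_i) vanish. At the first row with f_j >
  -- 0 the boxes below number η_{j+1}, so `shift-unique` determines the rows below, and k = f_j +
  -- η_{j+1} > η_{j+1} shows that `merge` acts at the same row.
  merge-unique : ∀ {k η ρ} → Strip k η ρ → 0 < k → exc η ρ ≡ 0 → ρ ≡ merge k η
  merge-unique (cons f r stop) k>0 e = cong (_∷ []) (sym (trans (cong (r ℕ.+ f ∸_) (ℕP.+-identityʳ f)) (ℕP.m+n∸n≡m r f)))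
  merge-unique (cons {h′ ∷ η} zero r H@(cons {ρ = ρ} g f′ r′ H′)) k>0 e = trans
    (cong₂ _∷_ (sym (ℕP.+-identityʳ r)) (merge-unique (cons f′ r′ H′) k>0 (ℕP.m+n≡0⇒n≡0 ((r ℕ.+ 0 ∸ r) ℕ.* (h′ ∸ (sum (h′ ∷ η) ∸ sum (r′ ∷ ρ)))) e)))
    (sym (merge-yes {h = r ℕ.+ 0} {η = η} (dsum-≤ H)))
  merge-unique (cons {h′ ∷ η} (suc f) r H@(cons {ρ = ρ} g f′ r′ H′)) k>0 e = trans
    (cong₂ _∷_ (sym r≡) (shift-unique H d≡h′))
    (sym (merge-no {h = r ℕ.+ suc f} {η = η} (λ k≤ → ℕP.<⇒≱ k≤ (subst (λ t → h′ ≤ f ℕ.+ t) (sym d≡h′) (ℕP.m≤n+m h′ f)))))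
    where
    excess-zero : suc f ≡ 0 ⊎ h′ ∸ (sum (h′ ∷ η) ∸ sum (r′ ∷ ρ)) ≡ 0 → h′ ∸ dsum H ≡ 0
    excess-zero (inj₂ z) = trans (cong (h′ ∸_) (sym (sum-∸ H))) z
    d≡h′ : dsum H ≡ h′
    d≡h′ = ℕP.≤-antisym (dsum-≤ H) (ℕP.m∸n≡0⇒m≤n (excess-zero (ℕP.m*n≡0⇒m≡0∨n≡0 (suc f)
      (trans (cong (ℕ._* (h′ ∸ (sum (h′ ∷ η) ∸ sum (r′ ∷ ρ)))) (sym (ℕP.m+n∸m≡n r (suc f)))) (ℕP.m+n≡0⇒m≡0 _ e)))))
    r≡ : r ℕ.+ suc f ℕ.+ h′ ∸ (suc f ℕ.+ dsum H) ≡ r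
    r≡ = trans (cong₂ _∸_ (ℕP.+-assoc r (suc f) h′) (cong (suc f ℕ.+_) d≡h′)) (ℕP.m+n∸n≡m r (suc f ℕ.+ h′))

  psum-[] : ∀ i → psum i [] ≡ 0
  psum-[] zero    = refl
  psum-[] (suc i) = refl

  psum-snoc-0 : ∀ i η → psum i (η ∷ʳ 0) ≡ psum i η
  psum-snoc-0 zero    η             = refl
  psum-snoc-0 (suc i) []            = cong (0 ℕ.+_) (psum-[] i)
  psum-snoc-0 (suc i) (a ∷ η)       = cong (a ℕ.+_) (psum-snoc-0 i η)

  -- Before the merged pair nothing changes; after it, i rows of the result are i + 1 rows of η less
  -- k boxes.
  psum-merge : ∀ k h η → k ≤ h → ∀ i → psum i (merge k (h ∷ η)) ≡ psum i (h ∷ η) ⊎ psum i (merge k (h ∷ η)) ℕ.+ k ≡ psum (suc i) (h ∷ η)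
  psum-merge k h η        k≤h zero = inj₁ refl
  psum-merge k h [] k≤h (suc i) = inj₂ (trans (cong (λ t → h ∸ k ℕ.+ t ℕ.+ k) (psum-[] i)) (trans (cong (ℕ._+ k) (ℕP.+-identityʳ (h ∸ k)))
    (trans (ℕP.m∸n+n≡m k≤h) (sym (trans (cong (h ℕ.+_) (psum-[] (suc i))) (ℕP.+-identityʳ h))))))
  psum-merge k h (h′ ∷ η) k≤h (suc i) with k ℕP.≤? h′
  ... | yes k≤h′ with psum-merge k h′ η k≤h′ i
  ...   | inj₁ e = inj₁ (cong (h ℕ.+_) e)
  ...   | inj₂ e = inj₂ (trans (ℕP.+-assoc h _ k) (cong (h ℕ.+_) e))
  psum-merge k h (h′ ∷ η) k≤h (suc i) | no _ = inj₂ (begin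
    h ℕ.+ h′ ∸ k ℕ.+ psum i (η ∷ʳ 0) ℕ.+ k   ≡⟨ swap (h ℕ.+ h′ ∸ k) _ k ⟩
    h ℕ.+ h′ ∸ k ℕ.+ k ℕ.+ psum i (η ∷ʳ 0)   ≡⟨ cong₂ ℕ._+_ (ℕP.m∸n+n≡m (ℕP.≤-trans k≤h (ℕP.m≤m+n h h′))) (psum-snoc-0 i η) ⟩
    h ℕ.+ h′ ℕ.+ psum i η                    ≡⟨ ℕP.+-assoc h h′ _ ⟩
    h ℕ.+ (h′ ℕ.+ psum i η)                  ∎)
    where
    open ≡-Reasoning
    swap : ∀ a b c → a ℕ.+ b ℕ.+ c ≡ a ℕ.+ c ℕ.+ b
    swap = ℕS.solve-∀

  psum-mono : ∀ {i j} η → i ≤ j → psum i η ≤ psum j η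
  psum-mono η       z≤n       = z≤n
  psum-mono []      (s≤s i≤j) = z≤n
  psum-mono (a ∷ η) (s≤s i≤j) = ℕP.+-monoʳ-≤ a (psum-mono η i≤j)

  psum-all : ∀ {i} η → length η ≤ i → psum i η ≡ sum η
  psum-all {zero}  []      _         = refl
  psum-all {suc i} []      _         = refl
  psum-all         (a ∷ η) (s≤s l≤i) = cong (a ℕ.+_) (psum-all η l≤i)

  psum-≤-sum : ∀ i η → psum i η ≤ sum η
  psum-≤-sum zero    η       = z≤n
  psum-≤-sum (suc i) []      = z≤n
  psum-≤-sum (suc i) (a ∷ η) = ℕP.+-monoʳ-≤ a (psum-≤-sum i η)

  psum-snoc-≤ : ∀ i la k → i ≤ length la → psum i (la ∷ʳ k) ≡ psum i la
  psum-snoc-≤ zero    la       k _         = refl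
  psum-snoc-≤ (suc i) (a ∷ la) k (s≤s i≤) = cong (a ℕ.+_) (psum-snoc-≤ i la k i≤)

  -- The entry after the first i ones is at least k, whether it belongs to la or is the appended k.
  psum-snoc-+ : ∀ i la k → i ≤ length la → All (k ≤_) la → psum i la ℕ.+ k ≤ psum (suc i) (la ∷ʳ k)
  psum-snoc-+ zero    []       k _         _        = ℕP.≤-reflexive (sym (ℕP.+-identityʳ k))
  psum-snoc-+ zero    (a ∷ la) k _         (p ∷ _)  = ℕP.≤-trans p (ℕP.m≤m+n a _)
  psum-snoc-+ (suc i) (a ∷ la) k (s≤s i≤)  (_ ∷ ps) = ℕP.≤-trans (ℕP.≤-reflexive (ℕP.+-assoc a _ k)) (ℕP.+-monoʳ-≤ a (psum-snoc-+ i la k i≤ ps))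

  -- In the first case of `psum-merge` the partial sums of η are still available. In the second,
  -- dominance is used with one more part, and that part is at least k because k is the least.
  merge-dominates : ∀ k la h η → k ≤ h → All (k ≤_) la → (la ∷ʳ k) ⊴ (h ∷ η) → la ⊴ merge k (h ∷ η)
  merge-dominates k la h η k≤h k≤la dom i = [ low i , high ]′ (ℕP.≤-total i (length la))
    where
    low : ∀ i → i ≤ length la → psum i la ≤ psum i (merge k (h ∷ η))
    low i i≤ with psum-merge k h η k≤h i
    ... | inj₁ e = ℕP.≤-trans (ℕP.≤-reflexive (sym (psum-snoc-≤ i la k i≤))) (ℕP.≤-trans (dom i) (ℕP.≤-reflexive (sym e)))
    ... | inj₂ e = ℕP.+-cancelʳ-≤ k _ _ (ℕP.≤-trans (psum-snoc-+ i la k i≤ k≤la) (ℕP.≤-trans (dom (suc i)) (ℕP.≤-reflexive (sym e))))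
    high : length la ≤ i → psum i la ≤ psum i (merge k (h ∷ η))
    high l≤i = ℕP.≤-trans (ℕP.≤-reflexive (trans (psum-all la l≤i) (sym (psum-all la ℕP.≤-refl))))
      (ℕP.≤-trans (low (length la) ℕP.≤-refl) (psum-mono (merge k (h ∷ η)) l≤i))

  ∑-∈-≢0 : ∀ {A : Set} {xs : List A} {y} (c : A → ℕ) → y ∈ xs → c y ≢ 0 → ∑ xs c ≢ 0
  ∑-∈-≢0 c (here refl) ne z = ne (ℕP.m+n≡0⇒m≡0 _ z)
  ∑-∈-≢0 {xs = x ∷ _} c (there m) ne z = ∑-∈-≢0 c m ne (ℕP.m+n≡0⇒n≡0 (c x) z)

  ∑-≢0-∈ : ∀ {A : Set} (xs : List A) (c : A → ℕ) → ∑ xs c ≢ 0 → ∃ λ y → y ∈ xs × c y ≢ 0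
  ∑-≢0-∈ []       c ne = ⊥-elim (ne refl)
  ∑-≢0-∈ (x ∷ xs) c ne with c x ℕP.≟ 0
  ... | no nz = x , here refl , nz
  ... | yes z with ∑-≢0-∈ xs c (λ z′ → ne (cong₂ ℕ._+_ z z′))
  ...   | y , m , nz = y , there m , nz

  Ascending : List ℕ → Set
  Ascending = AllPairs _≤_

  record Minimal (k : ℕ) (ks η : List ℕ) : Set where
    field
      strip : Strip k η (merge k η)
      least : exc η (merge k η) ≡ 0
      dom   : reverse ks ⊴ merge k η

  minimal : ∀ k ks η → 0 < k → All (k ≤_) ks → Decr η → reverse (k ∷ ks) ⊴ η → Minimal k ks η
  minimal k ks η k>0 k≤ks dη dom = go η dη (subst (_⊴ η) (unfold-reverse k ks) dom)
    where
    la = reverse ks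
    k≤la : All (k ≤_) la
    k≤la = All-resp-↭ (↭-sym (↭-reverse ks)) k≤ks
    go : ∀ η → Decr η → (la ∷ʳ k) ⊴ η → Minimal k ks η
    go [] dη dom = ⊥-elim (ℕP.<⇒≱ k>0 (ℕP.≤-trans (psum-snoc-+ 0 la k z≤n k≤la) (dom 1)))
    go (h ∷ η) dη dom = record { strip = proj₁ M ; least = proj₂ M ; dom = merge-dominates k la h η k≤h k≤la dom }
      where
      k≤h : k ≤ h
      k≤h = ℕP.≤-trans (psum-snoc-+ 0 la k z≤n k≤la) (ℕP.≤-trans (dom 1) (ℕP.≤-reflexive (ℕP.+-identityʳ h)))
      M = merge-strip k h η k≤h dη

  chains-base : ∀ η → sum η ≡ 0 → chains η [] ≡ 1
  chains-base η e rewrite e = refl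

  dominance⇒chains : ∀ ks η → All (0 <_) ks → Ascending ks → Decr η → sum η ≡ sum ks → reverse ks ⊴ η → chains η ks ≢ 0
  dominance⇒chains [] η _ _ dη sη dom z = ℕP.1+n≢0 (trans (sym (chains-base η sη)) z)
  dominance⇒chains (k ∷ ks) η (k>0 ∷ pos) (k≤ ∷ asc) dη sη dom = ∑-∈-≢0 (λ ρ → chains ρ ks) (strips-∈ M.strip)
    (dominance⇒chains ks (merge k η) pos asc (Strip⇒Decr M.strip) (ℕP.+-cancelʳ-≡ k _ _ (trans (sym (Strip-sum M.strip)) (trans sη (ℕP.+-comm k _)))) M.dom)
    where module M = Minimal (minimal k ks η k>0 k≤ dη dom)

  -- At x = 0 the power x^exc leaves a single strip at every level, and all q-integers of positive
  -- index become 1. One chain survives and contributes 1.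
  Rf-0 : ∀ ks η → All (0 <_) ks → Ascending ks → Decr η → sum η ≡ sum ks → reverse ks ⊴ η → Rf 0ℤ η ks ≡ 1ℤ
  Rf-0 [] η _ _ dη sη dom rewrite sη = refl
  Rf-0 (k ∷ ks) η (k>0 ∷ pos) (k≤ ∷ asc) dη sη dom = trans
    (∑ℤ-single (strips η k) (merge k η) _ (strips-once M.strip) other)
    (trans (cong₂ (λ n w → 0ℤ ^ n * w * Rf 0ℤ (merge k η) ks) M.least (ω-0 η (merge k η)))
      (trans (ℤP.*-identityˡ _) (Rf-0 ks (merge k η) pos asc (Strip⇒Decr M.strip) (ℕP.+-cancelʳ-≡ k _ _ (trans (sym (Strip-sum M.strip)) (trans sη (ℕP.+-comm k _)))) M.dom)))
    where
    module M = Minimal (minimal k ks η k>0 k≤ dη dom)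
    other : ∀ ρ → ρ ∈ strips η k → ρ ≢ merge k η → 0ℤ ^ exc η ρ * ω 0ℤ η ρ * Rf 0ℤ ρ ks ≡ 0ℤ
    other ρ ρ∈ ne with exc η ρ in eq
    ... | zero  = ⊥-elim (ne (merge-unique (All.lookup (strips-All η k dη) ρ∈) k>0 eq))
    ... | suc n = cong (λ t → t * Rf 0ℤ ρ ks) (cong (_* ω 0ℤ η ρ) (ℤP.*-zeroˡ (0ℤ ^ n)))

  -- the rows below row i + 1 of η lie inside the rows below row i of ρ
  strip-rows : ∀ {k η ρ} → Strip k η ρ → ∀ i → sum η ℕ.+ psum i ρ ≤ psum (suc i) η ℕ.+ sum ρ
  strip-rows empty        zero    = z≤n
  strip-rows empty        (suc i) = z≤n
  strip-rows (cons f r H) i = HS-rows H i (r ℕ.+ f)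
    where
    HS-rows : ∀ {top η ρ} → HS top η ρ → ∀ i h → h ℕ.+ sum η ℕ.+ psum i (top ∷ ρ) ≤ h ℕ.+ psum i η ℕ.+ (top ℕ.+ sum ρ)
    HS-rows {top} {η} {ρ} H zero h = ℕP.≤-trans (ℕP.≤-reflexive (ℕP.+-identityʳ _)) (ℕP.≤-trans (ℕP.+-monoʳ-≤ h (bound H)) (ℕP.≤-reflexive (cong (ℕ._+ (top ℕ.+ sum ρ)) (sym (ℕP.+-identityʳ h)))))
      where
      bound : ∀ {top η ρ} → HS top η ρ → sum η ≤ top ℕ.+ sum ρ
      bound stop = z≤n
      bound (cons g f r H) = ℕP.≤-trans (ℕP.+-monoʳ-≤ (r ℕ.+ f) (bound H)) (ℕP.+-monoˡ-≤ _ (ℕP.+-monoʳ-≤ r (ℕP.m≤m+n f g)))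
    HS-rows stop (suc zero) h = ℕP.≤-refl
    HS-rows stop (suc (suc i)) h = ℕP.≤-refl
    HS-rows {top} (cons {η} {ρ} g f r H) (suc i) h = ℕP.≤-trans (ℕP.≤-reflexive (collect h (r ℕ.+ f) (sum η) top _))
      (ℕP.≤-trans (ℕP.+-monoʳ-≤ top (HS-rows H i (h ℕ.+ (r ℕ.+ f)))) (ℕP.≤-reflexive (expand h (r ℕ.+ f) (psum i η) top (r ℕ.+ sum ρ))))
      where
      collect : ∀ h a s t p → h ℕ.+ (a ℕ.+ s) ℕ.+ (t ℕ.+ p) ≡ t ℕ.+ (h ℕ.+ a ℕ.+ s ℕ.+ p)
      collect = ℕS.solve-∀
      expand : ∀ h a p t s → t ℕ.+ (h ℕ.+ a ℕ.+ p ℕ.+ s) ≡ h ℕ.+ (a ℕ.+ p) ℕ.+ (t ℕ.+ s)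
      expand = ℕS.solve-∀

  Sub-psum : ∀ {η ρ} → Sub η ρ → ∀ i → psum i ρ ≤ psum i η
  Sub-psum s        zero    = z≤n
  Sub-psum []       (suc i) = z≤n
  Sub-psum (le ∷ s) (suc i) = ℕP.+-mono-≤ le (Sub-psum s i)

  -- The first component says that η has no boxes beyond as many rows as there are steps. It is
  -- carried along to settle the partial sum at which the parts are exhausted.
  chains⇒dominance : ∀ ks η → Decr η → sum η ≡ sum ks → chains η ks ≢ 0 → psum (length ks) η ≡ sum η × reverse ks ⊴ η
  chains⇒dominance [] η dη sη ne = sym sη , λ { zero → z≤n ; (suc i) → z≤n }
  chains⇒dominance (k ∷ ks) η dη sη ne with ∑-≢0-∈ (strips η k) (λ ρ → chains ρ ks) ne
  ... | ρ , ρ∈ , ne′ = rows , subst (_⊴ η) (sym (unfold-reverse k ks)) dom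
    where
    S = All.lookup (strips-All η k dη) ρ∈
    sρ : sum ρ ≡ sum ks
    sρ = ℕP.+-cancelʳ-≡ k _ _ (trans (sym (Strip-sum S)) (trans sη (ℕP.+-comm k _)))
    IH = chains⇒dominance ks ρ (Strip⇒Decr S) sρ ne′
    la = reverse ks
    rows : psum (suc (length ks)) η ≡ sum η
    rows = ℕP.≤-antisym (psum-≤-sum (suc (length ks)) η) (ℕP.+-cancelʳ-≤ (sum ρ) _ _ (ℕP.≤-trans (ℕP.≤-reflexive (cong (sum η ℕ.+_) (sym (proj₁ IH)))) (strip-rows S (length ks))))
    sum-la : sum (la ∷ʳ k) ≡ sum η
    sum-la = trans (cong sum (sym (unfold-reverse k ks))) (trans (sum-↭ (↭-reverse (k ∷ ks))) (sym sη))
    dom : (la ∷ʳ k) ⊴ η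
    dom i with i ℕP.≤? length la
    ... | yes i≤ = ℕP.≤-trans (ℕP.≤-reflexive (psum-snoc-≤ i la k i≤)) (ℕP.≤-trans (proj₂ IH i) (Sub-psum (Strip⇒Sub S) i))
    ... | no i≰  = ℕP.≤-trans (psum-≤-sum i (la ∷ʳ k)) (ℕP.≤-trans (ℕP.≤-reflexive (trans sum-la (sym rows)))
                     (psum-mono η (subst (λ n → suc n ≤ i) (length-reverse ks) (ℕP.≰⇒> i≰))))

-- Comparison with θ and b at 1/q.

module ReciprocalFormula where

  open import Defs
  open Counting hiding (_⊗_)
  open Weights
  open HorizontalStrips
  open WeightedChains
  open LeadingTerms
  open Factorisation
  open LeastStrips
  open import Data.Maybe.Base using (nothing)
  open import Data.Nat.Base as ℕ using (ℕ; zero; suc; _≤_; z≤n; _∸_)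
  import Data.Nat.Properties as ℕP
  open import Data.Nat.ListAction using (sum)
  import Data.Nat.Tactic.RingSolver as ℕS
  open import Data.Integer.Base as ℤ using (ℤ; +_; 0ℤ; 1ℤ)
  import Data.Integer.Properties as ℤP
  import Data.Integer.Tactic.RingSolver as ℤS
  open import Data.Rational.Base using (ℚ; 0ℚ; 1ℚ; _+_; _*_; _-_; 1/_; _/_; toℚᵘ; ≢-nonZero)
  import Data.Rational.Properties as ℚP
  open import Data.Rational.Unnormalised.Base as ℚᵘ using (mkℚᵘ; *≡*)
  import Data.Rational.Unnormalised.Properties as ℚᵘP
  open import Data.List.Base using (List; []; _∷_; map; length; applyUpTo)
  open import Data.List.Properties using (map-upTo; map-applyUpTo)
  open import Data.List.Relation.Unary.All as All using (All; []; _∷_)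
  open import Data.List.Relation.Unary.Any using (here; there)
  open import Data.List.Membership.Propositional using (_∈_)
  open import Data.Product.Base using (_,_)
  open import Data.Empty using (⊥-elim)
  open import Function.Base using (_∘_)
  open import Relation.Nullary using (yes; no)
  open import Relation.Binary.PropositionalEquality
  import Tactic.RingSolver.NonReflective as NR
  open import Tactic.RingSolver.Core.AlmostCommutativeRing using (fromCommutativeRing)

  module ℚS = NR (fromCommutativeRing ℚP.+-*-commutativeRing (λ _ → nothing))

  ι : ℤ → ℚ
  ι i = i / 1

  private
    toℚᵘ-ι : ∀ i → toℚᵘ (ι i) ℚᵘ.≃ mkℚᵘ i 0
    toℚᵘ-ι i = ℚP.toℚᵘ-fromℚᵘ (mkℚᵘ i 0)

  ι-+ : ∀ a b → ι (a ℤ.+ b) ≡ ι a + ι b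
  ι-+ a b = ℚP.toℚᵘ-injective (ℚᵘP.≃-trans (toℚᵘ-ι (a ℤ.+ b)) (ℚᵘP.≃-trans (*≡* (eq a b))
    (ℚᵘP.≃-trans (ℚᵘP.+-cong (ℚᵘP.≃-sym (toℚᵘ-ι a)) (ℚᵘP.≃-sym (toℚᵘ-ι b))) (ℚᵘP.≃-sym (ℚP.toℚᵘ-homo-+ (ι a) (ι b))))))
    where
    eq : ∀ a b → (a ℤ.+ b) ℤ.* 1ℤ ≡ (a ℤ.* 1ℤ ℤ.+ b ℤ.* 1ℤ) ℤ.* 1ℤ
    eq = ℤS.solve-∀

  ι-* : ∀ a b → ι (a ℤ.* b) ≡ ι a * ι b
  ι-* a b = ℚP.toℚᵘ-injective (ℚᵘP.≃-trans (toℚᵘ-ι (a ℤ.* b)) (ℚᵘP.≃-trans (*≡* refl)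
    (ℚᵘP.≃-trans (ℚᵘP.*-cong (ℚᵘP.≃-sym (toℚᵘ-ι a)) (ℚᵘP.≃-sym (toℚᵘ-ι b))) (ℚᵘP.≃-sym (ℚP.toℚᵘ-homo-* (ι a) (ι b))))))

  ι-injective : ∀ {a b} → ι a ≡ ι b → a ≡ b
  ι-injective {a} {b} e = trans (sym (ℤP.*-identityʳ a)) (trans (drop (ℚᵘP.≃-trans (ℚᵘP.≃-sym (toℚᵘ-ι a)) (ℚᵘP.≃-trans (ℚᵘP.≃-reflexive (cong toℚᵘ e)) (toℚᵘ-ι b)))) (ℤP.*-identityʳ b))
    where
    drop : mkℚᵘ a 0 ℚᵘ.≃ mkℚᵘ b 0 → a ℤ.* 1ℤ ≡ b ℤ.* 1ℤ
    drop (*≡* e) = e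

  ι-^ : ∀ a n → ι (a ℤ.^ n) ≡ powQ (ι a) n
  ι-^ a zero    = refl
  ι-^ a (suc n) = trans (ι-* a (a ℤ.^ n)) (cong (ι a *_) (ι-^ a n))

  powQ-+ : ∀ a m n → powQ a (m ℕ.+ n) ≡ powQ a m * powQ a n
  powQ-+ a zero    n = sym (ℚP.*-identityˡ _)
  powQ-+ a (suc m) n = trans (cong (a *_) (powQ-+ a m n)) (sym (ℚP.*-assoc a _ _))

  cancel-* : ∀ {a b r} → r ≢ 0ℚ → a * r ≡ b * r → a ≡ b
  cancel-* {a} {b} {r} r≢0 e = trans (undo a) (trans (cong (_* inv) e) (sym (undo b)))
    where
    inv : ℚ
    inv = 1/_ r {{≢-nonZero r≢0}}
    undo : ∀ c → c ≡ c * r * inv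
    undo c = sym (trans (ℚP.*-assoc c r inv) (trans (cong (c *_) (ℚP.*-inverseʳ r {{≢-nonZero r≢0}})) (ℚP.*-identityʳ c)))

  divQ-* : ∀ p {r} → r ≢ 0ℚ → divQ p r * r ≡ p
  divQ-* p {r} r≢0 with r ℚP.≟ 0ℚ
  ... | yes z = ⊥-elim (r≢0 z)
  ... | no ne = trans (ℚP.*-assoc p _ r) (trans (cong (p *_) (ℚP.*-inverseˡ r {{≢-nonZero ne}})) (ℚP.*-identityʳ p))

  qi-snoc : ∀ x m → qi x (suc m) ≡ x ℤ.^ m ℤ.+ qi x m
  qi-snoc x zero    = trans (cong (λ t → 1ℤ ℤ.+ t) (ℤP.*-zeroʳ x)) refl
  qi-snoc x (suc m) = trans (cong (λ t → 1ℤ ℤ.+ x ℤ.* t) (qi-snoc x m)) (regroup x (x ℤ.^ m) (qi x m))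
    where
    regroup : ∀ x a b → 1ℤ ℤ.+ x ℤ.* (a ℤ.+ b) ≡ x ℤ.* a ℤ.+ (1ℤ ℤ.+ x ℤ.* b)
    regroup = ℤS.solve-∀

  qi-+ : ∀ x m n → qi x (m ℕ.+ n) ≡ qi x m ℤ.+ x ℤ.^ m ℤ.* qi x n
  qi-+ x zero    n = sym (trans (ℤP.+-identityˡ _) (ℤP.*-identityˡ _))
  qi-+ x (suc m) n = trans (cong (λ t → 1ℤ ℤ.+ x ℤ.* t) (qi-+ x m n)) (regroup x (qi x m) (x ℤ.^ m) (qi x n))
    where
    regroup : ∀ x a b c → 1ℤ ℤ.+ x ℤ.* (a ℤ.+ b ℤ.* c) ≡ 1ℤ ℤ.+ x ℤ.* a ℤ.+ x ℤ.* b ℤ.* c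
    regroup = ℤS.solve-∀

  qf : ℤ → ℕ → ℤ
  qf x zero    = 1ℤ
  qf x (suc m) = qi x (suc m) ℤ.* qf x m

  ff-qf : ∀ x s e → ff x s e ℤ.* qf x s ≡ qf x (s ℕ.+ e)
  ff-qf x s zero    = trans (ℤP.*-identityˡ _) (cong (qf x) (sym (ℕP.+-identityʳ s)))
  ff-qf x s (suc e) = trans (ℤP.*-assoc (qi x (s ℕ.+ suc e)) _ _) (trans (cong₂ ℤ._*_ (cong (qi x) (ℕP.+-suc s e)) (ff-qf x s e)) (cong (qf x) (sym (ℕP.+-suc s e))))

  -- Connects the recursive Gaussian binomial with the quotient of factorials, cleared of
  -- denominators. The step rests on [e+g+2] = [g+1] + x^(g+1) [e+1].
  G-qf : ∀ x e g → G x e g ℤ.* (qf x e ℤ.* qf x g) ≡ qf x (e ℕ.+ g)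
  G-qf x zero    g       = trans (ℤP.*-identityˡ _) (ℤP.*-identityˡ _)
  G-qf x (suc e) zero    = trans (ℤP.*-identityˡ _) (trans (ℤP.*-identityʳ _) (cong (qf x) (sym (ℕP.+-identityʳ (suc e)))))
  G-qf x (suc e) (suc g) = begin
    (G x (suc e) g ℤ.+ X ℤ.* G x e (suc g)) ℤ.* (a ℤ.* qf x e ℤ.* (b ℤ.* qf x g))
      ≡⟨ regroup (G x (suc e) g) X (G x e (suc g)) a (qf x e) b (qf x g) ⟩
    b ℤ.* (G x (suc e) g ℤ.* (a ℤ.* qf x e ℤ.* qf x g)) ℤ.+ X ℤ.* a ℤ.* (G x e (suc g) ℤ.* (qf x e ℤ.* (b ℤ.* qf x g)))
      ≡⟨ cong₂ (λ u v → b ℤ.* u ℤ.+ X ℤ.* a ℤ.* v) (G-qf x (suc e) g) (trans (G-qf x e (suc g)) (cong (qf x) (ℕP.+-suc e g))) ⟩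
    b ℤ.* qf x (suc e ℕ.+ g) ℤ.+ X ℤ.* a ℤ.* qf x (suc e ℕ.+ g)
      ≡⟨ collect b X a (qf x (suc e ℕ.+ g)) ⟩
    (b ℤ.+ X ℤ.* a) ℤ.* qf x (suc e ℕ.+ g)
      ≡⟨ cong (ℤ._* qf x (suc e ℕ.+ g)) (trans (sym (qi-+ x (suc g) (suc e))) (cong (qi x) (ℕP.+-comm (suc g) (suc e)))) ⟩
    qi x (suc e ℕ.+ suc g) ℤ.* qf x (suc e ℕ.+ g)
      ≡⟨ cong (λ v → qi x (suc e ℕ.+ suc g) ℤ.* qf x v) (sym (ℕP.+-suc e g)) ⟩
    qf x (suc e ℕ.+ suc g) ∎
    where
    open ≡-Reasoning
    X = x ℤ.^ suc g
    a = qi x (suc e)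
    b = qi x (suc g)
    regroup : ∀ G₁ X G₂ a p b q → (G₁ ℤ.+ X ℤ.* G₂) ℤ.* (a ℤ.* p ℤ.* (b ℤ.* q)) ≡ b ℤ.* (G₁ ℤ.* (a ℤ.* p ℤ.* q)) ℤ.+ X ℤ.* a ℤ.* (G₂ ℤ.* (p ℤ.* (b ℤ.* q)))
    regroup = ℤS.solve-∀
    collect : ∀ b X a q → b ℤ.* q ℤ.+ X ℤ.* a ℤ.* q ≡ (b ℤ.+ X ℤ.* a) ℤ.* q
    collect = ℤS.solve-∀

  GL : ∀ {top η ρ} → ℤ → HS top η ρ → ℤ
  GL x stop           = 1ℤ
  GL x (cons g f r H) = G x f g ℤ.* GL x H

  fg : ∀ {top η ρ} → HS top η ρ → ℕ
  fg stop           = 0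
  fg (cons g f r H) = f ℕ.* g ℕ.+ fg H

  -- The factors `ff` telescope from row to row. This is the origin of the quotient of two
  -- factorials in front of θ.
  ωL-qf : ∀ {top η ρ} x s (H : HS top η ρ) → ωL x s top η ρ ℤ.* qf x s ≡ qf x (s ℕ.+ dsum H) ℤ.* GL x H
  ωL-qf x s stop = trans (ℤP.*-identityˡ _) (trans (cong (qf x) (sym (ℕP.+-identityʳ s))) (sym (ℤP.*-identityʳ _)))
  ωL-qf x s (cons {η} {ρ} g f r H) = begin
    ωL x s (r ℕ.+ (f ℕ.+ g)) (r ℕ.+ f ∷ η) (r ∷ ρ) ℤ.* qf x s
      ≡⟨ cong (ℤ._* qf x s) (ωL-cons x s g f r H) ⟩
    ωL x (s ℕ.+ f) r η ρ ℤ.* (ff x s f ℤ.* G x f g) ℤ.* qf x s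
      ≡⟨ regroup (ωL x (s ℕ.+ f) r η ρ) (ff x s f) (G x f g) (qf x s) ⟩
    ωL x (s ℕ.+ f) r η ρ ℤ.* (ff x s f ℤ.* qf x s) ℤ.* G x f g
      ≡⟨ cong (λ t → ωL x (s ℕ.+ f) r η ρ ℤ.* t ℤ.* G x f g) (ff-qf x s f) ⟩
    ωL x (s ℕ.+ f) r η ρ ℤ.* qf x (s ℕ.+ f) ℤ.* G x f g
      ≡⟨ cong (ℤ._* G x f g) (ωL-qf x (s ℕ.+ f) H) ⟩
    qf x (s ℕ.+ f ℕ.+ dsum H) ℤ.* GL x H ℤ.* G x f g
      ≡⟨ trans (cong (λ n → qf x n ℤ.* GL x H ℤ.* G x f g) (ℕP.+-assoc s f (dsum H))) (reorder (qf x (s ℕ.+ (f ℕ.+ dsum H))) (GL x H) (G x f g)) ⟩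
    qf x (s ℕ.+ (f ℕ.+ dsum H)) ℤ.* (G x f g ℤ.* GL x H) ∎
    where
    open ≡-Reasoning
    regroup : ∀ w a b q → w ℤ.* (a ℤ.* b) ℤ.* q ≡ w ℤ.* (a ℤ.* q) ℤ.* b
    regroup = ℤS.solve-∀
    reorder : ∀ a b c → a ℤ.* b ℤ.* c ≡ a ℤ.* (c ℤ.* b)
    reorder = ℤS.solve-∀

  degω : ∀ {top η ρ} → HS top η ρ → ℕ → ℕ
  degω stop           s = 0
  degω (cons g f r H) s = degω H (s ℕ.+ f) ℕ.+ (f ℕ.* s ℕ.+ tri f) ℕ.+ f ℕ.* g

  degω-tri : ∀ {top η ρ} (H : HS top η ρ) s → degω H s ℕ.+ tri s ≡ tri (s ℕ.+ dsum H) ℕ.+ fg H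
  degω-tri stop s = trans (cong tri (sym (ℕP.+-identityʳ s))) (sym (ℕP.+-identityʳ _))
  degω-tri (cons g f r H) s = begin
    degω H (s ℕ.+ f) ℕ.+ (f ℕ.* s ℕ.+ tri f) ℕ.+ f ℕ.* g ℕ.+ tri s
      ≡⟨ regroup (degω H (s ℕ.+ f)) f s (tri f) g (tri s) ⟩
    degω H (s ℕ.+ f) ℕ.+ (tri s ℕ.+ tri f ℕ.+ s ℕ.* f) ℕ.+ f ℕ.* g
      ≡⟨ cong (λ t → degω H (s ℕ.+ f) ℕ.+ t ℕ.+ f ℕ.* g) (sym (tri-+ s f)) ⟩
    degω H (s ℕ.+ f) ℕ.+ tri (s ℕ.+ f) ℕ.+ f ℕ.* g
      ≡⟨ cong (ℕ._+ f ℕ.* g) (degω-tri H (s ℕ.+ f)) ⟩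
    tri (s ℕ.+ f ℕ.+ dsum H) ℕ.+ fg H ℕ.+ f ℕ.* g
      ≡⟨ trans (cong (λ t → tri t ℕ.+ fg H ℕ.+ f ℕ.* g) (ℕP.+-assoc s f (dsum H))) (reorder _ (fg H) (f ℕ.* g)) ⟩
    tri (s ℕ.+ (f ℕ.+ dsum H)) ℕ.+ (f ℕ.* g ℕ.+ fg H) ∎
    where
    open ≡-Reasoning
    regroup : ∀ δ f s t g u → δ ℕ.+ (f ℕ.* s ℕ.+ t) ℕ.+ f ℕ.* g ℕ.+ u ≡ δ ℕ.+ (u ℕ.+ t ℕ.+ s ℕ.* f) ℕ.+ f ℕ.* g
    regroup = ℕS.solve-∀
    reorder : ∀ a b c → a ℕ.+ b ℕ.+ c ≡ a ℕ.+ (c ℕ.+ b)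
    reorder = ℕS.solve-∀

  degH-split : ∀ {top η ρ} (H : HS top η ρ) s → degH H s ≡ dsum H ℕ.+ vH H ℕ.+ degω H s
  degH-split stop           s = refl
  degH-split (cons g f r H) s = trans (cong (ℕ._+ degM (dsum H) s f g) (degH-split H (s ℕ.+ f)))
    (regroup (dsum H) (vH H) (degω H (s ℕ.+ f)) (dsum H ℕ.* (f ℕ.+ g)) f (tri f) (f ℕ.* s) (f ℕ.* g))
    where
    regroup : ∀ d v w a f t b c → d ℕ.+ v ℕ.+ w ℕ.+ (a ℕ.+ f ℕ.+ t ℕ.+ (b ℕ.+ t) ℕ.+ c) ≡ f ℕ.+ d ℕ.+ (v ℕ.+ (a ℕ.+ t)) ℕ.+ (w ℕ.+ (b ℕ.+ t) ℕ.+ c)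
    regroup = ℕS.solve-∀

  -- Every box below the first row forms a pair with a box of the first row, unless η is empty. The
  -- inequality makes the truncated subtraction in the exponent of (1) a true one.
  tsum≤D : ∀ η → Decr η → tsum η ≤ D η
  tsum≤D []          _ = z≤n
  tsum≤D (suc h ∷ η) d = ℕP.≤-trans (ℕP.m≤m+n (sum η) (h ℕ.* sum η)) (ℕP.m≤m+n _ _)
  tsum≤D (zero ∷ η)  d = ℕP.≤-trans (ℕP.≤-reflexive (zeros η d)) z≤n
    where
    zeros : ∀ η → Desc zero η → sum η ≡ 0
    zeros []         _       = refl
    zeros (zero ∷ η) (_ , d) = zeros η d

  sumQ-scale : ∀ c f m → sumQ (applyUpTo (λ i → c * f i) m) ≡ c * sumQ (applyUpTo f m)
  sumQ-scale c f zero    = sym (ℚP.*-zeroʳ c)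
  sumQ-scale c f (suc m) = trans (cong (λ u → c * f 0 + u) (sumQ-scale c (f ∘ suc) m)) (sym (ℚP.*-distribˡ-+ c _ _))

  qInt-suc : ∀ t m → qInt t (suc m) ≡ 1ℚ + t * qInt t m
  qInt-suc t m = cong (λ u → 1ℚ + u) (trans (cong sumQ (map-applyUpTo suc (powQ t) m))
    (trans (sumQ-scale t (powQ t) m) (cong (λ l → t * sumQ l) (sym (map-upTo (powQ t) m)))))

  prodQ-snoc : ∀ f m → prodQ (applyUpTo f (suc m)) ≡ prodQ (applyUpTo f m) * f m
  prodQ-snoc f zero    = trans (ℚP.*-identityʳ (f 0)) (sym (ℚP.*-identityˡ (f 0)))
  prodQ-snoc f (suc m) = trans (cong (f 0 *_) (prodQ-snoc (f ∘ suc) m)) (sym (ℚP.*-assoc (f 0) _ _))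

  qFact-suc : ∀ t m → qFact t (suc m) ≡ qFact t m * qInt t (suc m)
  qFact-suc t m = trans (cong prodQ (map-upTo (λ i → qInt t (suc i)) (suc m))) (trans (prodQ-snoc (λ i → qInt t (suc i)) m)
    (cong (λ l → prodQ l * qInt t (suc m)) (sym (map-upTo (λ i → qInt t (suc i)) m))))

  private
    swap-middle : ∀ a b c d → a * b * (c * d) ≡ a * c * (b * d)
    swap-middle = ℚS.solve 4 (λ a b c d → (a ⊗ b ⊗ (c ⊗ d)) ⊜ (a ⊗ c ⊗ (b ⊗ d))) refl
      where open ℚS using (_⊗_; _⊜_)

  module Reciprocal (x : ℤ) (x>0 : Pos x) (t : ℚ) (xt≡1 : ι x * t ≡ 1ℚ) where

    Q : ℚ
    Q = ι x

    pos⇒≢0 : ∀ {a} → Pos a → ι a ≢ 0ℚ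
    pos⇒≢0 (n , refl) e = case ι-injective {+ suc n} {0ℤ} e of λ ()
      where open import Function.Base using (case_of_)

    qf-pos : ∀ m → Pos (qf x m)
    qf-pos zero    = 0 , refl
    qf-pos (suc m) = pos-* (qi-pos x>0 m) (qf-pos m)

    -- The coefficients of a q-integer are all 1, so passing to 1/x only reverses their order. The
    -- powers of x in the lemmas below are degrees for the same reason.
    qInt-ι : ∀ m → powQ Q m * qInt t (suc m) ≡ ι (qi x (suc m))
    qInt-ι zero    = trans (ℚP.*-identityˡ _) (trans (qInt-suc t 0) (trans (cong (λ u → 1ℚ + u) (ℚP.*-zeroʳ t))
      (sym (cong ι (trans (cong (λ u → 1ℤ ℤ.+ u) (ℤP.*-zeroʳ x)) refl)))))
    qInt-ι (suc m) = begin
      Q * powQ Q m * qInt t (suc (suc m))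
        ≡⟨ cong (Q * powQ Q m *_) (qInt-suc t (suc m)) ⟩
      Q * powQ Q m * (1ℚ + t * qInt t (suc m))
        ≡⟨ trans (ℚP.*-distribˡ-+ (Q * powQ Q m) 1ℚ (t * qInt t (suc m))) (cong₂ _+_ (ℚP.*-identityʳ (Q * powQ Q m)) (swap-middle Q (powQ Q m) t (qInt t (suc m)))) ⟩
      Q * powQ Q m + Q * t * (powQ Q m * qInt t (suc m))
        ≡⟨ cong₂ (λ a b → Q * powQ Q m + a * b) xt≡1 (qInt-ι m) ⟩
      Q * powQ Q m + 1ℚ * ι (qi x (suc m))
        ≡⟨ cong₂ _+_ (sym (ι-^ x (suc m))) (ℚP.*-identityˡ _) ⟩
      ι (x ℤ.^ suc m) + ι (qi x (suc m))
        ≡⟨ trans (sym (ι-+ (x ℤ.^ suc m) _)) (cong ι (sym (qi-snoc x (suc m)))) ⟩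
      ι (qi x (suc (suc m))) ∎
      where open ≡-Reasoning

    qFact-ι : ∀ m → powQ Q (tri m) * qFact t m ≡ ι (qf x m)
    qFact-ι zero    = refl
    qFact-ι (suc m) = begin
      powQ Q (m ℕ.+ tri m) * qFact t (suc m)
        ≡⟨ cong₂ _*_ (powQ-+ Q m (tri m)) (trans (qFact-suc t m) (ℚP.*-comm (qFact t m) (qInt t (suc m)))) ⟩
      powQ Q m * powQ Q (tri m) * (qInt t (suc m) * qFact t m)
        ≡⟨ swap-middle (powQ Q m) _ _ _ ⟩
      powQ Q m * qInt t (suc m) * (powQ Q (tri m) * qFact t m)
        ≡⟨ cong₂ _*_ (qInt-ι m) (qFact-ι m) ⟩
      ι (qi x (suc m)) * ι (qf x m)
        ≡⟨ sym (ι-* (qi x (suc m)) _) ⟩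
      ι (qf x (suc m)) ∎
      where open ≡-Reasoning

    qFact≢0 : ∀ m → qFact t m ≢ 0ℚ
    qFact≢0 m e = pos⇒≢0 (qf-pos m) (trans (sym (qFact-ι m)) (trans (cong (powQ Q (tri m) *_) e) (ℚP.*-zeroʳ (powQ Q (tri m)))))

    *-≢0 : ∀ {a b} → a ≢ 0ℚ → b ≢ 0ℚ → a * b ≢ 0ℚ
    *-≢0 {a} {b} a≢0 b≢0 e = a≢0 (cancel-* b≢0 (trans e (sym (ℚP.*-zeroˡ b))))

    qBinom-ι : ∀ f g → powQ Q (f ℕ.* g) * qBinom t (f ℕ.+ g) f ≡ ι (G x f g)
    qBinom-ι f g = trans (cong (powQ Q (f ℕ.* g) *_) unfold) (cancel-* (pos⇒≢0 (pos-* (qf-pos f) (qf-pos g))) (begin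
      powQ Q (f ℕ.* g) * divQ (qFact t (f ℕ.+ g)) R * ι (qf x f ℤ.* qf x g)
        ≡⟨ cong (powQ Q (f ℕ.* g) * divQ (qFact t (f ℕ.+ g)) R *_) (trans (ι-* (qf x f) (qf x g)) (trans (cong₂ _*_ (sym (qFact-ι f)) (sym (qFact-ι g))) (swap-middle (powQ Q (tri f)) _ _ _))) ⟩
      powQ Q (f ℕ.* g) * divQ (qFact t (f ℕ.+ g)) R * (powQ Q (tri f) * powQ Q (tri g) * R)
        ≡⟨ swap-middle (powQ Q (f ℕ.* g)) _ _ R ⟩
      powQ Q (f ℕ.* g) * (powQ Q (tri f) * powQ Q (tri g)) * (divQ (qFact t (f ℕ.+ g)) R * R)
        ≡⟨ cong₂ _*_ (trans (cong (powQ Q (f ℕ.* g) *_) (sym (powQ-+ Q (tri f) (tri g)))) (trans (sym (powQ-+ Q (f ℕ.* g) _))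
             (cong (powQ Q) (trans (ℕP.+-comm (f ℕ.* g) _) (sym (tri-+ f g)))))) (divQ-* (qFact t (f ℕ.+ g)) (*-≢0 (qFact≢0 f) (qFact≢0 g))) ⟩
      powQ Q (tri (f ℕ.+ g)) * qFact t (f ℕ.+ g)
        ≡⟨ trans (qFact-ι (f ℕ.+ g)) (cong ι (sym (G-qf x f g))) ⟩
      ι (G x f g ℤ.* (qf x f ℤ.* qf x g))
        ≡⟨ ι-* (G x f g) _ ⟩
      ι (G x f g) * ι (qf x f ℤ.* qf x g) ∎))
      where
      open ≡-Reasoning
      R = qFact t f * qFact t g
      unfold : qBinom t (f ℕ.+ g) f ≡ divQ (qFact t (f ℕ.+ g)) R
      unfold rewrite T⇒≡ (ℕP.≤⇒≤ᵇ (ℕP.m≤m+n f g)) | ℕP.m+n∸m≡n f g = refl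

    binoms : List ℕ → List ℕ → ℕ → ℚ
    binoms η ρ i = qBinom t ((ρ ‼ i) ∸ (ρ ‼ suc i)) ((η ‼ suc i) ∸ (ρ ‼ suc i))

    binoms-ι : ∀ {r η ρ} h (H : HS r η ρ) → powQ Q (fg H) * prodQ (applyUpTo (binoms (h ∷ η) (r ∷ ρ)) (suc (length η))) ≡ ι (GL x H)
    -- At the last index θ compares with a missing row, read as 0; this contributes the binomial of
    -- r over 0.
    binoms-ι {r} h stop = trans (cong (1ℚ *_) (ℚP.*-identityʳ (qBinom t r 0))) (qBinom-ι 0 r)
    binoms-ι h (cons {η} {ρ} g f r H) = begin
      powQ Q (f ℕ.* g ℕ.+ fg H) * (qBinom t (r ℕ.+ (f ℕ.+ g) ∸ r) (r ℕ.+ f ∸ r) * rest)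
        ≡⟨ cong₂ (λ a b → a * (b * rest)) (powQ-+ Q (f ℕ.* g) (fg H)) (cong₂ (qBinom t) (ℕP.m+n∸m≡n r (f ℕ.+ g)) (ℕP.m+n∸m≡n r f)) ⟩
      powQ Q (f ℕ.* g) * powQ Q (fg H) * (qBinom t (f ℕ.+ g) f * rest)
        ≡⟨ swap-middle (powQ Q (f ℕ.* g)) _ _ _ ⟩
      powQ Q (f ℕ.* g) * qBinom t (f ℕ.+ g) f * (powQ Q (fg H) * rest)
        ≡⟨ cong₂ _*_ (qBinom-ι f g) (binoms-ι (r ℕ.+ f) H) ⟩
      ι (G x f g) * ι (GL x H)
        ≡⟨ sym (ι-* (G x f g) _) ⟩
      ι (G x f g ℤ.* GL x H) ∎
      where
      open ≡-Reasoning
      rest = prodQ (applyUpTo (binoms (r ℕ.+ f ∷ η) (r ∷ ρ)) (suc (length η)))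

    degS : ∀ {k η ρ} → Strip k η ρ → ℕ
    degS empty        = 0
    degS (cons f r H) = degω H f

    -- Both sides are the same product of q-integers and binomials, taken at x and at 1/x, and
    -- `degS` is its degree. Multiplying by the factorial of f clears the quotient in θ.
    theta-ι : ∀ {k η ρ} (S : Strip k η ρ) → ι (ω x η ρ) ≡ powQ Q (degS S) * theta t η ρ
    theta-ι empty = refl
    theta-ι (cons {η} {ρ} f r H) = cancel-* (pos⇒≢0 (qf-pos f)) (begin
      ι (ωL x (r ℕ.+ f ∸ r) r η ρ) * ι (qf x f)
        ≡⟨ trans (sym (ι-* (ωL x (r ℕ.+ f ∸ r) r η ρ) (qf x f))) (cong ι (trans (cong (λ s → ωL x s r η ρ ℤ.* qf x f) (ℕP.m+n∸m≡n r f)) (ωL-qf x f H))) ⟩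
      ι (qf x (f ℕ.+ dsum H) ℤ.* GL x H)
        ≡⟨ trans (ι-* (qf x (f ℕ.+ dsum H)) (GL x H)) (cong₂ _*_ (sym (qFact-ι (f ℕ.+ dsum H))) (sym (binoms-ι (r ℕ.+ f) H))) ⟩
      powQ Q (tri (f ℕ.+ dsum H)) * qFact t (f ℕ.+ dsum H) * (powQ Q (fg H) * Π)
        ≡⟨ swap-middle (powQ Q (tri (f ℕ.+ dsum H))) _ _ _ ⟩
      powQ Q (tri (f ℕ.+ dsum H)) * powQ Q (fg H) * (qFact t (f ℕ.+ dsum H) * Π)
        ≡⟨ cong₂ _*_ (trans (sym (powQ-+ Q (tri (f ℕ.+ dsum H)) (fg H))) (trans (cong (powQ Q) (sym (degω-tri H f))) (powQ-+ Q (degω H f) (tri f))))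
             (cong (_* Π) (sym (divQ-* (qFact t (f ℕ.+ dsum H)) (qFact≢0 f)))) ⟩
      powQ Q (degω H f) * powQ Q (tri f) * (divQ (qFact t (f ℕ.+ dsum H)) (qFact t f) * qFact t f * Π)
        ≡⟨ rearrange (powQ Q (degω H f)) (powQ Q (tri f)) (divQ (qFact t (f ℕ.+ dsum H)) (qFact t f)) (qFact t f) Π ⟩
      powQ Q (degω H f) * (divQ (qFact t (f ℕ.+ dsum H)) (qFact t f) * Π) * (powQ Q (tri f) * qFact t f)
        ≡⟨ cong₂ (λ a b → powQ Q (degω H f) * a * b) theta≡ (qFact-ι f) ⟩
      powQ Q (degω H f) * theta t (r ℕ.+ f ∷ η) (r ∷ ρ) * ι (qf x f) ∎)
      where
      open ≡-Reasoning
      Π = prodQ (applyUpTo (binoms (r ℕ.+ f ∷ η) (r ∷ ρ)) (suc (length η)))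
      rearrange : ∀ a b c d e → a * b * (c * d * e) ≡ a * (c * e) * (b * d)
      rearrange = ℚS.solve 5 (λ a b c d e → (a ⊗ b ⊗ (c ⊗ d ⊗ e)) ⊜ (a ⊗ (c ⊗ e) ⊗ (b ⊗ d))) refl
        where open ℚS using (_⊗_; _⊜_)
      theta≡ : divQ (qFact t (f ℕ.+ dsum H)) (qFact t f) * Π ≡ theta t (r ℕ.+ f ∷ η) (r ∷ ρ)
      theta≡ = cong₂ _*_ (cong₂ (λ a b → divQ (qFact t a) (qFact t b))
          (sym (trans (cong (_∸ (r ℕ.+ sum ρ)) (Strip-sum (cons f r H))) (ℕP.m+n∸m≡n (r ℕ.+ sum ρ) _))) (sym (ℕP.m+n∸m≡n r f)))
        (cong prodQ (sym (map-upTo (binoms (r ℕ.+ f ∷ η) (r ∷ ρ)) (suc (length η)))))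

    -- The weight has degree D η - D ρ, split here into its powers of x - 1 and x and the degree of
    -- `ω`.
    degrees : ∀ {k η ρ} (S : Strip k η ρ) → yS S ℕ.+ vS S ℕ.+ degS S ℕ.+ D ρ ≡ D η
    degrees empty = refl
    degrees (cons {η} {ρ} f r H) = begin
      dsum H ℕ.+ (K ℕ.+ vH H) ℕ.+ degω H f ℕ.+ (r ℕ.* P ℕ.+ D ρ)
        ≡⟨ regroup (dsum H) f P (vH H) (degω H f) r (D ρ) ⟩
      f ℕ.* P ℕ.+ r ℕ.* P ℕ.+ (dsum H ℕ.+ vH H ℕ.+ degω H f ℕ.+ dsum H ℕ.* P ℕ.+ D ρ)
        ≡⟨ cong (λ u → f ℕ.* P ℕ.+ r ℕ.* P ℕ.+ u) (trans (cong (λ u → u ℕ.+ dsum H ℕ.* P ℕ.+ D ρ) (sym (degH-split H f))) (degH-identity H f)) ⟩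
      f ℕ.* P ℕ.+ r ℕ.* P ℕ.+ ((r ℕ.+ f) ℕ.* dsum H ℕ.+ D η)
        ≡⟨ expand f P r (dsum H) (D η) ⟩
      (r ℕ.+ f) ℕ.* (P ℕ.+ dsum H) ℕ.+ D η
        ≡⟨ cong (λ u → (r ℕ.+ f) ℕ.* u ℕ.+ D η) (sym (sum-HS H)) ⟩
      (r ℕ.+ f) ℕ.* sum η ℕ.+ D η ∎
      where
      open ≡-Reasoning
      P = sum ρ
      K = (f ℕ.+ dsum H) ℕ.* P
      regroup : ∀ d f P v w r D → d ℕ.+ ((f ℕ.+ d) ℕ.* P ℕ.+ v) ℕ.+ w ℕ.+ (r ℕ.* P ℕ.+ D) ≡ f ℕ.* P ℕ.+ r ℕ.* P ℕ.+ (d ℕ.+ v ℕ.+ w ℕ.+ d ℕ.* P ℕ.+ D)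
      regroup = ℕS.solve-∀
      expand : ∀ f P r d D → f ℕ.* P ℕ.+ r ℕ.* P ℕ.+ ((r ℕ.+ f) ℕ.* d ℕ.+ D) ≡ (r ℕ.+ f) ℕ.* (P ℕ.+ d) ℕ.+ D
      expand = ℕS.solve-∀

    ι-∑ : ∀ {A : Set} (xs : List A) (φ : A → ℤ) (ψ : A → ℚ) c → (∀ y → y ∈ xs → ι (φ y) ≡ c * ψ y) → ι (∑ℤ xs φ) ≡ c * sumQ (map ψ xs)
    ι-∑ []       φ ψ c h = sym (ℚP.*-zeroʳ c)
    ι-∑ (y ∷ xs) φ ψ c h = trans (ι-+ (φ y) _) (trans (cong₂ _+_ (h y (here refl)) (ι-∑ xs φ ψ c (λ z m → h z (there m)))) (sym (ℚP.*-distribˡ-+ c _ _)))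

    -- The exponent e of x is introduced by an equation instead of a difference, so that the
    -- contributions of the steps add up by `degrees`.
    bChain-ι : ∀ ks η e → Decr η → sum η ≡ sum ks → e ℕ.+ tsum η ≡ D η →
      ι (B x η ks) ≡ powQ (ι (x ℤ.- 1ℤ)) (tsum η) * powQ Q e * bChain t η ks
    bChain-ι [] η e dη sη ee rewrite tsum-zero η sη | sη | ℕP.m+n≡0⇒m≡0 e (trans ee (D-zero η sη)) = refl
    bChain-ι (k ∷ ks) η e dη sη ee = ι-∑ (strips η k) _ _ (powQ Y (tsum η) * powQ Q e) term
      where
      open ≡-Reasoning
      Y = ι (x ℤ.- 1ℤ)
      term : ∀ ρ → ρ ∈ strips η k → ι (Wt x η ρ ℤ.* B x ρ ks) ≡ powQ Y (tsum η) * powQ Q e * (theta t η ρ * bChain t ρ ks)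
      term ρ ρ∈ = begin
        ι (Wt x η ρ ℤ.* B x ρ ks)
          ≡⟨ trans (cong (λ w → ι (w ℤ.* B x ρ ks)) (Wt-factor x S)) (trans (ι-* (YS ℤ.* XS ℤ.* ω x η ρ) (B x ρ ks)) (cong₂ _*_
               (trans (ι-* (YS ℤ.* XS) (ω x η ρ)) (cong₂ _*_ (trans (ι-* YS XS) (cong₂ _*_ (ι-^ (x ℤ.- 1ℤ) (yS S)) (ι-^ x (vS S)))) (theta-ι S)))
               (bChain-ι ks ρ e′ (Strip⇒Decr S) (ℕP.+-cancelʳ-≡ k _ _ (trans (sym (Strip-sum S)) (trans sη (ℕP.+-comm k _)))) e′+))) ⟩
        powQ Y (yS S) * powQ Q (vS S) * (powQ Q (degS S) * theta t η ρ) * (powQ Y (tsum ρ) * powQ Q e′ * bChain t ρ ks)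
          ≡⟨ rearrange (powQ Y (yS S)) (powQ Q (vS S)) (powQ Q (degS S)) (theta t η ρ) (powQ Y (tsum ρ)) (powQ Q e′) (bChain t ρ ks) ⟩
        powQ Y (yS S) * powQ Y (tsum ρ) * (powQ Q (vS S) * (powQ Q (degS S) * powQ Q e′)) * (theta t η ρ * bChain t ρ ks)
          ≡⟨ cong₂ (λ a b → a * b * (theta t η ρ * bChain t ρ ks)) (trans (sym (powQ-+ Y (yS S) _)) (cong (powQ Y) (yS-identity S)))
               (trans (cong (powQ Q (vS S) *_) (sym (powQ-+ Q (degS S) e′))) (trans (sym (powQ-+ Q (vS S) _)) (cong (powQ Q) exponent))) ⟩
        powQ Y (tsum η) * powQ Q e * (theta t η ρ * bChain t ρ ks) ∎
        where
        S = All.lookup (strips-All η k dη) ρ∈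
        YS = (x ℤ.- 1ℤ) ℤ.^ yS S
        XS = x ℤ.^ vS S
        e′ = D ρ ∸ tsum ρ
        e′+ : e′ ℕ.+ tsum ρ ≡ D ρ
        e′+ = ℕP.m∸n+n≡m (tsum≤D ρ (Strip⇒Decr S))
        exponent : vS S ℕ.+ (degS S ℕ.+ e′) ≡ e
        exponent = ℕP.+-cancelʳ-≡ (tsum η) _ _ (trans (cong (λ u → vS S ℕ.+ (degS S ℕ.+ e′) ℕ.+ u) (sym (yS-identity S)))
          (trans (collect (vS S) (degS S) e′ (yS S) (tsum ρ)) (trans (cong (λ u → yS S ℕ.+ vS S ℕ.+ degS S ℕ.+ u) e′+) (trans (degrees S) (sym ee)))))
          where
          collect : ∀ v w e y s → v ℕ.+ (w ℕ.+ e) ℕ.+ (y ℕ.+ s) ≡ y ℕ.+ v ℕ.+ w ℕ.+ (e ℕ.+ s)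
          collect = ℕS.solve-∀
        rearrange : ∀ a b c d e f g → a * b * (c * d) * (e * f * g) ≡ a * e * (b * (c * f)) * (d * g)
        rearrange = ℚS.solve 7 (λ a b c d e f g → (a ⊗ b ⊗ (c ⊗ d) ⊗ (e ⊗ f ⊗ g)) ⊜ (a ⊗ e ⊗ (b ⊗ (c ⊗ f)) ⊗ (d ⊗ g))) refl
          where open ℚS using (_⊗_; _⊜_)

-- Chains of strips as semistandard tableaux.

module Tableaux where

  open import Defs
  open Counting
  open Weights
  open HorizontalStrips
  open LeadingTerms
  open import Data.Bool.Base using (Bool; true; false; _∧_; if_then_else_)
  open import Data.Bool.ListAction using (all)
  open import Data.Bool.Properties using (∧-assoc; ∧-comm)
  open import Data.Nat.Base using (ℕ; zero; suc; _≤_; _<_; z≤n; s≤s; _∸_; _≤ᵇ_; _<ᵇ_; _≡ᵇ_; _+_; _*_)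
  import Data.Nat.Properties as ℕP
  open import Data.Nat.ListAction using (sum)
  open import Data.Nat.Tactic.RingSolver using (solve-∀)
  open import Data.List.Base using (List; []; _∷_; [_]; map; length; filterᵇ; upTo; concat; replicate; _++_; _∷ʳ_; reverse)
  open import Data.List.Properties using (map-++; applyUpTo-∷ʳ; length-++; unfold-reverse)
  open import Data.List.Relation.Unary.All as All using (All; []; _∷_)
  import Data.List.Relation.Unary.All.Properties as AllP
  open import Data.List.Membership.Propositional using (_∈_)
  open import Data.Product.Base using (_×_; _,_)
  open import Data.Sum.Base using (inj₁; inj₂)
  open import Data.Empty using (⊥-elim)
  open import Function.Base using (_∘_; case_of_)
  open import Relation.Nullary using (Dec; yes; no)
  open import Relation.Binary.PropositionalEquality hiding ([_])

  𝟙-∧ : ∀ a b → 𝟙 (a ∧ b) ≡ 𝟙 a * 𝟙 b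
  𝟙-∧ true  b = sym (ℕP.*-identityˡ _)
  𝟙-∧ false b = refl

  vals : ℕ → List ℕ
  vals s = map suc (upTo s)

  vals-suc : ∀ s → vals (suc s) ≡ vals s ++ [ suc s ]
  vals-suc s = trans (cong (map suc) (sym (applyUpTo-∷ʳ (λ i → i) s))) (map-++ suc (upTo s) [ s ])

  ∑-listsOfLen : ∀ r vs (φ : List ℕ → ℕ) → ∑ (listsOfLen (suc r) vs) φ ≡ ∑ vs (λ v → ∑ (listsOfLen r vs) (λ l → φ (v ∷ l)))
  ∑-listsOfLen r vs φ = trans (∑-concatMap (λ v → map (v ∷_) (listsOfLen r vs)) vs φ) (∑-cong vs (λ v → ∑-map (v ∷_) (listsOfLen r vs) φ))

  ∑-fillings : ∀ r η s (φ : List (List ℕ) → ℕ) → ∑ (fillings (r ∷ η) s) φ ≡ ∑ (listsOfLen r (vals s)) (λ row → ∑ (fillings η s) (λ T → φ (row ∷ T)))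
  ∑-fillings r η s φ = trans (∑-concatMap (λ row → map (row ∷_) (fillings η s)) (listsOfLen r (vals s)) φ)
    (∑-cong (listsOfLen r (vals s)) (λ row → ∑-map (row ∷_) (fillings η s) φ))

  headOK : ℕ → List ℕ → Bool
  headOK v []      = true
  headOK v (y ∷ l) = v ≤ᵇ y

  weaklyIncr-∷ : ∀ v l → 𝟙 (weaklyIncr (v ∷ l)) ≡ 𝟙 (weaklyIncr l) * 𝟙 (headOK v l)
  weaklyIncr-∷ v []      = refl
  weaklyIncr-∷ v (y ∷ l) = trans (𝟙-∧ (v ≤ᵇ y) _) (ℕP.*-comm (𝟙 (v ≤ᵇ y)) _)

  listsOfLen-bound : ∀ r s → All (λ l → length l ≡ r × All (_≤ s) l) (listsOfLen r (vals s))
  listsOfLen-bound zero    s = (refl , []) ∷ []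
  listsOfLen-bound (suc r) s = AllP.concat⁺ (AllP.map⁺ (AllP.map⁺ (AllP.applyUpTo⁺₁ (λ i → i) s
    (λ {i} i<s → AllP.map⁺ (All.map (λ (e , b) → cong suc e , i<s ∷ b) (listsOfLen-bound r s))))))

  -- A weakly increasing row with entries in 1, …, s + 1 is one with entries in 1, …, s followed by copies of s + 1.
  ∑-rows : ∀ s h (ψ : List ℕ → ℕ) →
    ∑ (listsOfLen h (vals (suc s))) (λ l → 𝟙 (weaklyIncr l) * ψ l) ≡
    ∑ (upTo (suc h)) (λ r → ∑ (listsOfLen r (vals s)) (λ l → 𝟙 (weaklyIncr l) * ψ (l ++ replicate (h ∸ r) (suc s))))
  ∑-rows s zero ψ = sym (ℕP.+-identityʳ _)
  ∑-rows s (suc h) ψ = begin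
    ∑ (listsOfLen (suc h) (vals (suc s))) (λ l → 𝟙 (weaklyIncr l) * ψ l)
      ≡⟨ ∑-listsOfLen h (vals (suc s)) _ ⟩
    ∑ (vals (suc s)) (λ v → ∑ (listsOfLen h (vals (suc s))) (λ l → 𝟙 (weaklyIncr (v ∷ l)) * ψ (v ∷ l)))
      ≡⟨ ∑-cong (vals (suc s)) (λ v → trans (∑-cong (listsOfLen h (vals (suc s))) (λ l → trans (cong (_* ψ (v ∷ l)) (weaklyIncr-∷ v l)) (ℕP.*-assoc (𝟙 (weaklyIncr l)) _ _)))
           (∑-rows s h (λ l → 𝟙 (headOK v l) * ψ (v ∷ l)))) ⟩
    ∑ (vals (suc s)) inner
      ≡⟨ trans (cong (λ vs → ∑ vs inner) (vals-suc s)) (∑-++ (vals s) [ suc s ] inner) ⟩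
    ∑ (vals s) inner + (inner (suc s) + 0)
      ≡⟨ cong₂ _+_ small (trans (ℕP.+-identityʳ _) large) ⟩
    ∑ (upTo (suc h)) (λ r → row (suc r)) + row 0
      ≡⟨ ℕP.+-comm _ (row 0) ⟩
    row 0 + ∑ (upTo (suc h)) (λ r → row (suc r))
      ≡⟨ cong (row 0 +_) (sym (∑-applyUpTo (suc h) suc row)) ⟩
    ∑ (upTo (suc (suc h))) row ∎
    where
    open ≡-Reasoning
    c = suc s
    row : ℕ → ℕ
    row r = ∑ (listsOfLen r (vals s)) (λ l → 𝟙 (weaklyIncr l) * ψ (l ++ replicate (suc h ∸ r) c))
    ext : ℕ → List ℕ → List ℕ
    ext r l = l ++ replicate (h ∸ r) c
    inner : ℕ → ℕ
    inner v = ∑ (upTo (suc h)) (λ r → ∑ (listsOfLen r (vals s)) (λ l → 𝟙 (weaklyIncr l) * (𝟙 (headOK v (ext r l)) * ψ (v ∷ ext r l))))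
    headOK-ext : ∀ {v} r l → v ≤ c → headOK v (ext r l) ≡ headOK v l
    headOK-ext {v} r (y ∷ l) v≤ = refl
    headOK-ext {v} r [] v≤ with h ∸ r
    ... | zero  = refl
    ... | suc _ = T⇒≡ (ℕP.≤⇒≤ᵇ v≤)
    small : ∑ (vals s) inner ≡ ∑ (upTo (suc h)) (λ r → row (suc r))
    small = trans (∑-∈-cong (vals s) (λ v v∈ → ∑-cong (upTo (suc h)) (λ r → ∑-cong (listsOfLen r (vals s)) (λ l → begin
        𝟙 (weaklyIncr l) * (𝟙 (headOK v (ext r l)) * ψ (v ∷ ext r l))
          ≡⟨ cong (λ b → 𝟙 (weaklyIncr l) * (𝟙 b * ψ (v ∷ ext r l))) (headOK-ext r l (ℕP.≤-trans (All.lookup vals-≤ v∈) (ℕP.n≤1+n s))) ⟩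
        𝟙 (weaklyIncr l) * (𝟙 (headOK v l) * ψ (v ∷ ext r l))
          ≡⟨ trans (sym (ℕP.*-assoc (𝟙 (weaklyIncr l)) _ _)) (cong (_* ψ (v ∷ ext r l)) (sym (weaklyIncr-∷ v l))) ⟩
        𝟙 (weaklyIncr (v ∷ l)) * ψ (v ∷ ext r l) ∎))))
      (trans (∑-swap (vals s) (upTo (suc h)) _) (∑-cong (upTo (suc h)) (λ r → sym (∑-listsOfLen r (vals s) _))))
      where
      vals-≤ : All (_≤ s) (vals s)
      vals-≤ = AllP.map⁺ (AllP.applyUpTo⁺₁ (λ i → i) s (λ i<s → i<s))
    tail-0 : ∀ r → ∑ (listsOfLen (suc r) (vals s)) (λ l → 𝟙 (weaklyIncr l) * (𝟙 (headOK c (ext (suc r) l)) * ψ (c ∷ ext (suc r) l))) ≡ 0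
    tail-0 r = trans (∑-∈-cong (listsOfLen (suc r) (vals s)) vanish) (∑-0 (listsOfLen (suc r) (vals s)))
      where
      vanish : ∀ l → l ∈ listsOfLen (suc r) (vals s) → 𝟙 (weaklyIncr l) * (𝟙 (headOK c (ext (suc r) l)) * ψ (c ∷ ext (suc r) l)) ≡ 0
      vanish l l∈ with l | All.lookup (listsOfLen-bound (suc r) s) l∈
      ... | y ∷ l′ | _ , y≤s ∷ _ with c ≤ᵇ y in eq
      ...   | false = ℕP.*-zeroʳ (𝟙 (weaklyIncr (y ∷ l′)))
      ...   | true  = ⊥-elim (ℕP.<⇒≱ (ℕP.≤ᵇ⇒≤ c y (≡⇒T eq)) y≤s)
    large : inner c ≡ row 0
    large = trans (cong₂ _+_ head (trans (∑-applyUpTo h suc _) (trans (∑-cong (upTo h) tail-0) (∑-0 (upTo h))))) (ℕP.+-identityʳ _)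
      where
      headOK-rep : ∀ m → headOK c (replicate m c) ≡ true
      headOK-rep zero    = refl
      headOK-rep (suc m) = T⇒≡ (ℕP.≤⇒≤ᵇ (ℕP.≤-refl {c}))
      head : 1 * (𝟙 (headOK c (replicate h c)) * ψ (c ∷ replicate h c)) + 0 ≡ 1 * ψ (c ∷ replicate h c) + 0
      head = cong (λ t → 1 * t + 0) (trans (cong (λ b → 𝟙 b * ψ (c ∷ replicate h c)) (headOK-rep h)) (ℕP.*-identityˡ _))

  -- The filling T of shape ρ enlarged to shape η, with every new box filled by c.
  extend : ℕ → List ℕ → List ℕ → List (List ℕ) → List (List ℕ)
  extend c (h ∷ η) (r ∷ ρ) (l ∷ T) = (l ++ replicate (h ∸ r) c) ∷ extend c η ρ T
  extend c _       _       _       = []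

  -- An application of `∑-rows` to each row; ρ records how much of the row is taken by entries up to
  -- s. No condition relates different rows yet, so ρ runs over all of `subLists η`.
  ∑-fillings-suc : ∀ s η (φ : List (List ℕ) → ℕ) →
    ∑ (fillings η (suc s)) (λ T → 𝟙 (all weaklyIncr T) * φ T) ≡
    ∑ (subLists η) (λ ρ → ∑ (fillings ρ s) (λ T → 𝟙 (all weaklyIncr T) * φ (extend (suc s) η ρ T)))
  ∑-fillings-suc s []      φ = sym (ℕP.+-identityʳ _)
  ∑-fillings-suc s (h ∷ η) φ = begin
    ∑ (fillings (h ∷ η) (suc s)) (λ T → 𝟙 (all weaklyIncr T) * φ T)
      ≡⟨ ∑-fillings h η (suc s) _ ⟩
    ∑ (listsOfLen h (vals (suc s))) (λ l → ∑ (fillings η (suc s)) (λ T → 𝟙 (all weaklyIncr (l ∷ T)) * φ (l ∷ T)))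
      ≡⟨ ∑-cong (listsOfLen h (vals (suc s))) (λ l → trans (∑-cong (fillings η (suc s)) (λ T → split-𝟙 l T (φ (l ∷ T)))) (∑-*ˡ (fillings η (suc s)) (𝟙 (weaklyIncr l)) _)) ⟩
    ∑ (listsOfLen h (vals (suc s))) (λ l → 𝟙 (weaklyIncr l) * ∑ (fillings η (suc s)) (λ T → 𝟙 (all weaklyIncr T) * φ (l ∷ T)))
      ≡⟨ ∑-cong (listsOfLen h (vals (suc s))) (λ l → cong (𝟙 (weaklyIncr l) *_) (∑-fillings-suc s η (λ T → φ (l ∷ T)))) ⟩
    ∑ (listsOfLen h (vals (suc s))) (λ l → 𝟙 (weaklyIncr l) * rest l)
      ≡⟨ ∑-rows s h rest ⟩
    ∑ (upTo (suc h)) (λ r → ∑ (listsOfLen r (vals s)) (λ l → 𝟙 (weaklyIncr l) * rest (l ++ replicate (h ∸ r) (suc s))))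
      ≡⟨ ∑-cong (upTo (suc h)) (λ r → trans (∑-cong (listsOfLen r (vals s)) (λ l → sym (∑-*ˡ (subLists η) (𝟙 (weaklyIncr l)) _)))
           (trans (∑-swap (listsOfLen r (vals s)) (subLists η) _) (∑-cong (subLists η) (λ ρ → trans
             (∑-cong (listsOfLen r (vals s)) (λ l → trans (sym (∑-*ˡ (fillings ρ s) (𝟙 (weaklyIncr l)) _))
               (∑-cong (fillings ρ s) (λ T → sym (split-𝟙 l T (φ ((l ++ replicate (h ∸ r) (suc s)) ∷ extend (suc s) η ρ T)))))))
             (sym (∑-fillings r ρ s _)))))) ⟩
    ∑ (upTo (suc h)) (λ r → ∑ (subLists η) (λ ρ → ∑ (fillings (r ∷ ρ) s) (λ T → 𝟙 (all weaklyIncr T) * φ (extend (suc s) (h ∷ η) (r ∷ ρ) T))))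
      ≡⟨ sym (∑-subLists h η _) ⟩
    ∑ (subLists (h ∷ η)) (λ ρ → ∑ (fillings ρ s) (λ T → 𝟙 (all weaklyIncr T) * φ (extend (suc s) (h ∷ η) ρ T))) ∎
    where
    open ≡-Reasoning
    rest : List ℕ → ℕ
    rest l = ∑ (subLists η) (λ ρ → ∑ (fillings ρ s) (λ T → 𝟙 (all weaklyIncr T) * φ (l ∷ extend (suc s) η ρ T)))
    split-𝟙 : ∀ l T n → 𝟙 (all weaklyIncr (l ∷ T)) * n ≡ 𝟙 (weaklyIncr l) * (𝟙 (all weaklyIncr T) * n)
    split-𝟙 l T n = trans (cong (_* n) (𝟙-∧ (weaklyIncr l) _)) (ℕP.*-assoc (𝟙 (weaklyIncr l)) _ n)

  data Fill (s : ℕ) : List ℕ → List (List ℕ) → Set where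
    []  : Fill s [] []
    _∷_ : ∀ {r l ρ T} → length l ≡ r × All (_≤ s) l → Fill s ρ T → Fill s (r ∷ ρ) (l ∷ T)

  fillings-Fill : ∀ ρ s → All (Fill s ρ) (fillings ρ s)
  fillings-Fill []      s = [] ∷ []
  fillings-Fill (r ∷ ρ) s = AllP.concat⁺ (AllP.map⁺ (All.map (λ b → AllP.map⁺ (All.map (b ∷_) (fillings-Fill ρ s))) (listsOfLen-bound r s)))

  ‼-++ˡ : ∀ l l′ {j} → j < length l → (l ++ l′) ‼ j ≡ l ‼ j
  ‼-++ˡ (x ∷ l) l′ {zero}  _       = refl
  ‼-++ˡ (x ∷ l) l′ {suc j} (s≤s p) = ‼-++ˡ l l′ p

  ‼-++-replicate : ∀ l m c {j} → length l ≤ j → j < length l + m → (l ++ replicate m c) ‼ j ≡ c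
  ‼-++-replicate []      (suc m) c {zero}  _       _       = refl
  ‼-++-replicate []      (suc m) c {suc j} _       (s≤s p) = ‼-++-replicate [] m c z≤n p
  ‼-++-replicate (x ∷ l) m       c {suc j} (s≤s q) (s≤s p) = ‼-++-replicate l m c q p

  ‼-bound : ∀ {s l} → All (_≤ s) l → ∀ j → l ‼ j ≤ s
  ‼-bound []       j       = z≤n
  ‼-bound (p ∷ ps) zero    = p
  ‼-bound (p ∷ ps) (suc j) = ‼-bound ps j

  below : List ℕ → List ℕ → Bool
  below u l = all (λ j → (u ‼ j) <ᵇ (l ‼ j)) (upTo (length l))

  module _ {s h r h′ r′ : ℕ} {u l : List ℕ} (r≤h : r ≤ h) (r′≤h′ : r′ ≤ h′) (h′≤h : h′ ≤ h)
           (lu : length u ≡ r) (bu : All (_≤ s) u) (ll : length l ≡ r′) (bl : All (_≤ s) l) where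
    private
      c = suc s
      u⁺ = u ++ replicate (h ∸ r) c
      l⁺ = l ++ replicate (h′ ∸ r′) c

      length-rep : ∀ m → length (replicate m c) ≡ m
      length-rep zero    = refl
      length-rep (suc m) = cong suc (length-rep m)

      length-l⁺ : length l⁺ ≡ h′
      length-l⁺ = trans (length-++ l) (trans (cong₂ _+_ ll (length-rep (h′ ∸ r′))) (ℕP.m+[n∸m]≡n r′≤h′))

      u⁺-low : ∀ {j} → j < r → u⁺ ‼ j ≡ u ‼ j
      u⁺-low j<r = ‼-++ˡ u _ (subst (_ <_) (sym lu) j<r)
      u⁺-high : ∀ {j} → r ≤ j → j < h → u⁺ ‼ j ≡ c
      u⁺-high r≤j j<h = ‼-++-replicate u (h ∸ r) c (subst (_≤ _) (sym lu) r≤j) (subst (_ <_) (sym (trans (cong (_+ (h ∸ r)) lu) (ℕP.m+[n∸m]≡n r≤h))) j<h)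
      l⁺-low : ∀ {j} → j < r′ → l⁺ ‼ j ≡ l ‼ j
      l⁺-low j<r = ‼-++ˡ l _ (subst (_ <_) (sym ll) j<r)
      l⁺-high : ∀ {j} → r′ ≤ j → j < h′ → l⁺ ‼ j ≡ c
      l⁺-high r≤j j<h = ‼-++-replicate l (h′ ∸ r′) c (subst (_≤ _) (sym ll) r≤j) (subst (_ <_) (sym (trans (cong (_+ (h′ ∸ r′)) ll) (ℕP.m+[n∸m]≡n r′≤h′))) j<h)

      l⁺-≤ : ∀ {j} → j < h′ → l⁺ ‼ j ≤ c
      l⁺-≤ {j} j<h′ with j ℕP.<? r′
      ... | yes p = ℕP.≤-trans (ℕP.≤-reflexive (l⁺-low p)) (ℕP.≤-trans (‼-bound bl j) (ℕP.n≤1+n s))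
      ... | no ¬p = ℕP.≤-reflexive (l⁺-high (ℕP.≮⇒≥ ¬p) j<h′)

    -- The new entry is the largest one, so nothing can lie strictly below it. Hence the lower row
    -- ends before the new boxes of the upper row begin.
    below-extend⁻ : below u⁺ l⁺ ≡ true → below u l ≡ true × h′ ≤ r
    below-extend⁻ e = all-upTo⁺ (length l) (λ j j<l → T⇒≡ (ℕP.<⇒<ᵇ (strict j (subst (j <_) ll j<l)))) , h′≤r
      where
      lt : ∀ j → j < h′ → u⁺ ‼ j < l⁺ ‼ j
      lt j j<h′ = ℕP.<ᵇ⇒< _ _ (≡⇒T (all-upTo⁻ (length l⁺) e j (subst (j <_) (sym length-l⁺) j<h′)))
      h′≤r : h′ ≤ r
      h′≤r = ℕP.≮⇒≥ (λ r<h′ → ℕP.<⇒≱ (lt r r<h′) (ℕP.≤-trans (l⁺-≤ r<h′) (ℕP.≤-reflexive (sym (u⁺-high ℕP.≤-refl (ℕP.<-≤-trans r<h′ h′≤h))))))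
      strict : ∀ j → j < r′ → u ‼ j < l ‼ j
      strict j j<r′ = subst₂ _<_ (u⁺-low (ℕP.<-≤-trans j<r′ (ℕP.≤-trans r′≤h′ h′≤r))) (l⁺-low j<r′) (lt j (ℕP.<-≤-trans j<r′ r′≤h′))

    below-extend⁺ : below u l ≡ true → h′ ≤ r → below u⁺ l⁺ ≡ true
    below-extend⁺ e h′≤r = all-upTo⁺ (length l⁺) (λ j j<l → T⇒≡ (ℕP.<⇒<ᵇ (strict j (subst (j <_) length-l⁺ j<l))))
      where
      strict : ∀ j → j < h′ → u⁺ ‼ j < l⁺ ‼ j
      strict j j<h′ with j ℕP.<? r′
      ... | yes p = subst₂ _<_ (sym (u⁺-low (ℕP.<-≤-trans j<h′ h′≤r))) (sym (l⁺-low p)) (ℕP.<ᵇ⇒< _ _ (≡⇒T (all-upTo⁻ (length l) e j (subst (j <_) (sym ll) p))))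
      ... | no ¬p = subst₂ _<_ (sym (u⁺-low (ℕP.<-≤-trans j<h′ h′≤r))) (sym (l⁺-high (ℕP.≮⇒≥ ¬p) j<h′)) (s≤s (‼-bound bu j))

  HS-cons : ∀ {r h′ r′ η ρ} → r′ ≤ h′ → h′ ≤ r → HS r′ η ρ → HS r (h′ ∷ η) (r′ ∷ ρ)
  HS-cons {r} {h′} {r′} r′≤h′ h′≤r H = subst₂ (λ t h → HS t (h ∷ _) (r′ ∷ _))
    (trans (sym (ℕP.+-assoc r′ _ _)) (trans (cong (_+ (r ∸ h′)) (ℕP.m+[n∸m]≡n r′≤h′)) (ℕP.m+[n∸m]≡n h′≤r))) (ℕP.m+[n∸m]≡n r′≤h′)
    (cons (r ∸ h′) (h′ ∸ r′) r′ H)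

  HS-top : ∀ {r h′ r′ η ρ} → HS r (h′ ∷ η) (r′ ∷ ρ) → h′ ≤ r × HS r′ η ρ
  HS-top (cons g f r H) = ℕP.+-monoʳ-≤ r (ℕP.m≤m+n f g) , H

  colsStrict-extend⁻ : ∀ {s h r η ρ l T} → Desc h η → Sub (h ∷ η) (r ∷ ρ) → Fill s (r ∷ ρ) (l ∷ T) →
    colsStrict (extend (suc s) (h ∷ η) (r ∷ ρ) (l ∷ T)) ≡ true → colsStrict (l ∷ T) ≡ true × HS r η ρ
  colsStrict-extend⁻ {η = []} {[]} d (_ ∷ []) (_ ∷ []) e = refl , stop
  colsStrict-extend⁻ {s} {h} {r} {h′ ∷ η} {r′ ∷ ρ} {u} {l ∷ T} (h′≤h , d) (r≤h ∷ r′≤h′ ∷ sub) ((lu , bu) ∷ (ll , bl) ∷ fill) e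
    with ∧⁻ {below (u ++ replicate (h ∸ r) (suc s)) (l ++ replicate (h′ ∸ r′) (suc s))} e
  ... | e₁ , e₂ with below-extend⁻ r≤h r′≤h′ h′≤h lu bu ll bl e₁ | colsStrict-extend⁻ d (r′≤h′ ∷ sub) ((ll , bl) ∷ fill) e₂
  ...   | b , h′≤r | c , H = cong₂ _∧_ b c , HS-cons r′≤h′ h′≤r H

  colsStrict-extend⁺ : ∀ {s h r η ρ l T} → Desc h η → Sub (h ∷ η) (r ∷ ρ) → Fill s (r ∷ ρ) (l ∷ T) →
    colsStrict (l ∷ T) ≡ true → HS r η ρ → colsStrict (extend (suc s) (h ∷ η) (r ∷ ρ) (l ∷ T)) ≡ true
  colsStrict-extend⁺ {η = []} {[]} d (_ ∷ []) (_ ∷ []) e H = refl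
  colsStrict-extend⁺ {s} {h} {r} {h′ ∷ η} {r′ ∷ ρ} {u} {l ∷ T} (h′≤h , d) (r≤h ∷ r′≤h′ ∷ sub) ((lu , bu) ∷ (ll , bl) ∷ fill) e H
    with ∧⁻ {below u l} e | HS-top H
  ... | e₁ , e₂ | h′≤r , H′ = cong₂ _∧_ (below-extend⁺ r≤h r′≤h′ h′≤h lu bu ll bl e₁ h′≤r) (colsStrict-extend⁺ d (r′≤h′ ∷ sub) ((ll , bl) ∷ fill) e₂ H′)

  bool-ext : ∀ {a b} → (a ≡ true → b ≡ true) → (b ≡ true → a ≡ true) → a ≡ b
  bool-ext {true}  {true}  f g = refl
  bool-ext {false} {false} f g = refl
  bool-ext {true}  {false} f g = sym (f refl)
  bool-ext {false} {true}  f g = g refl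

  -- Boxes with the largest entry cannot lie above one another, so they form a horizontal strip;
  -- conversely, above each box of a horizontal strip stands an entry of T, which is smaller. The
  -- test of the size is included on both sides because `stripTest` contains it.
  colsStrict-extend : ∀ {s η ρ T} k → Decr η → Sub η ρ → Fill s ρ T →
    colsStrict (extend (suc s) η ρ T) ∧ ((sum η ∸ sum ρ) ≡ᵇ k) ≡ stripTest η k ρ ∧ colsStrict T
  colsStrict-extend {η = []} zero    d [] [] = refl
  colsStrict-extend {η = []} (suc k) d [] [] = refl
  colsStrict-extend {s} {h ∷ η} {r ∷ ρ} {l ∷ T} k d (r≤h ∷ sub) (b ∷ fill) = bool-ext to from
    where
    to : colsStrict (extend (suc s) (h ∷ η) (r ∷ ρ) (l ∷ T)) ∧ ((h + sum η ∸ (r + sum ρ)) ≡ᵇ k) ≡ true → stripTest (h ∷ η) k (r ∷ ρ) ∧ colsStrict (l ∷ T) ≡ true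
    to e with ∧⁻ {colsStrict (extend (suc s) (h ∷ η) (r ∷ ρ) (l ∷ T))} e
    ... | e₁ , e₂ with colsStrict-extend⁻ d (r≤h ∷ sub) (b ∷ fill) e₁
    ...   | c , H = cong₂ _∧_ (strip⇒test (subst₂ (λ h k → Strip k (h ∷ η) (r ∷ ρ)) (ℕP.m+[n∸m]≡n r≤h) k≡ (cons (h ∸ r) r H))) c
      where
      k≡ : h ∸ r + dsum H ≡ k
      k≡ = trans (sym (trans (cong (λ t → t + sum η ∸ (r + sum ρ)) (sym (ℕP.m+[n∸m]≡n r≤h)))
        (trans (cong (_∸ (r + sum ρ)) (Strip-sum (cons (h ∸ r) r H))) (ℕP.m+n∸m≡n (r + sum ρ) _)))) (ℕP.≡ᵇ⇒≡ _ k (≡⇒T e₂))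
    from : stripTest (h ∷ η) k (r ∷ ρ) ∧ colsStrict (l ∷ T) ≡ true → colsStrict (extend (suc s) (h ∷ η) (r ∷ ρ) (l ∷ T)) ∧ ((h + sum η ∸ (r + sum ρ)) ≡ᵇ k) ≡ true
    from e with ∧⁻ {stripTest (h ∷ η) k (r ∷ ρ)} e
    ... | e₁ , c = cong₂ _∧_ (colsStrict-extend⁺ d (r≤h ∷ sub) (b ∷ fill) c (strip-HS (test⇒strip d (r≤h ∷ sub) e₁)))
        (T⇒≡ (ℕP.≡⇒≡ᵇ _ k (trans (cong (_∸ (r + sum ρ)) (Strip-sum (test⇒strip {k} d (r≤h ∷ sub) e₁))) (ℕP.m+n∸m≡n (r + sum ρ) k))))
      where
      strip-HS : ∀ {k h η r ρ} → Strip k (h ∷ η) (r ∷ ρ) → HS r η ρ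
      strip-HS (cons f r H) = H

  count : ℕ → List ℕ → ℕ
  count v xs = length (filterᵇ (λ e → e ≡ᵇ v) xs)

  count-++ : ∀ v xs ys → count v (xs ++ ys) ≡ count v xs + count v ys
  count-++ v []       ys = refl
  count-++ v (x ∷ xs) ys with x ≡ᵇ v
  ... | true  = cong suc (count-++ v xs ys)
  ... | false = count-++ v xs ys

  ≢⇒false : ∀ {m n} → m ≢ n → (m ≡ᵇ n) ≡ false
  ≢⇒false {m} {n} ne with m ≡ᵇ n in eq
  ... | false = refl
  ... | true  = ⊥-elim (ne (ℕP.≡ᵇ⇒≡ m n (≡⇒T eq)))

  count-replicate : ∀ m c → count c (replicate m c) ≡ m
  count-replicate zero    c = refl
  count-replicate (suc m) c rewrite T⇒≡ (ℕP.≡⇒≡ᵇ c c refl) = cong suc (count-replicate m c)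

  count-absent : ∀ {v xs} → All (_≢ v) xs → count v xs ≡ 0
  count-absent []                   = refl
  count-absent {v} {x ∷ xs} (p ∷ ps) rewrite ≢⇒false {x} {v} p = count-absent ps

  count-replicate-other : ∀ {v} m c → c ≢ v → count v (replicate m c) ≡ 0
  count-replicate-other m c ne = count-absent (AllP.replicate⁺ m ne)

  count-extend-old : ∀ {s η ρ T} v → v ≤ s → Sub η ρ → Fill s ρ T → count v (concat (extend (suc s) η ρ T)) ≡ count v (concat T)
  count-extend-old v v≤ [] [] = refl
  count-extend-old {s} {h ∷ η} {r ∷ ρ} {l ∷ T} v v≤ (_ ∷ sub) (_ ∷ fill) = trans (count-++ v (l ++ replicate (h ∸ r) (suc s)) _)
    (trans (cong₂ _+_ (trans (count-++ v l _) (trans (cong (count v l +_) (count-replicate-other (h ∸ r) (suc s) (λ e → ℕP.<⇒≢ (s≤s v≤) (sym e)))) (ℕP.+-identityʳ _)))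
      (count-extend-old v v≤ sub fill)) (sym (count-++ v l (concat T))))

  count-extend-new : ∀ {s η ρ T} → Sub η ρ → Fill s ρ T → count (suc s) (concat (extend (suc s) η ρ T)) ≡ sum η ∸ sum ρ
  count-extend-new {ρ = ρ} sub fill = trans (sym (ℕP.m+n∸m≡n (sum ρ) _)) (cong (_∸ sum ρ) (go sub fill))
    where
    go : ∀ {s η ρ T} → Sub η ρ → Fill s ρ T → sum ρ + count (suc s) (concat (extend (suc s) η ρ T)) ≡ sum η
    go [] [] = refl
    go {s} {h ∷ η} {r ∷ ρ} {l ∷ T} (r≤h ∷ sub) ((_ , bl) ∷ fill) = begin
      r + sum ρ + count c ((l ++ replicate (h ∸ r) c) ++ concat (extend c η ρ T))
        ≡⟨ cong (r + sum ρ +_) (trans (count-++ c (l ++ replicate (h ∸ r) c) _) (cong (_+ rest) (trans (count-++ c l _)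
             (cong₂ _+_ (count-absent (All.map (λ x≤s e → ℕP.<⇒≢ (s≤s x≤s) e) bl)) (count-replicate (h ∸ r) c))))) ⟩
      r + sum ρ + (h ∸ r + rest)
        ≡⟨ regroup r (sum ρ) (h ∸ r) rest ⟩
      r + (h ∸ r) + (sum ρ + rest)
        ≡⟨ cong₂ _+_ (ℕP.m+[n∸m]≡n r≤h) (go sub fill) ⟩
      h + sum η ∎
      where
      open ≡-Reasoning
      c = suc s
      rest = count c (concat (extend c η ρ T))
      regroup : ∀ a b c d → a + b + (c + d) ≡ a + c + (b + d)
      regroup = solve-∀

  content : List ℕ → List (List ℕ) → Bool
  content la T = all (λ k → count (suc k) (concat T) ≡ᵇ (la ‼ k)) (upTo (length la))

  all-cong : ∀ n {p p′ : ℕ → Bool} → (∀ i → i < n → p i ≡ p′ i) → all p (upTo n) ≡ all p′ (upTo n)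
  all-cong n {p} {p′} h = bool-ext (λ e → all-upTo⁺ n (λ i i<n → trans (sym (h i i<n)) (all-upTo⁻ n e i i<n)))
    (λ e → all-upTo⁺ n (λ i i<n → trans (h i i<n) (all-upTo⁻ n e i i<n)))

  all-suc : ∀ n (p : ℕ → Bool) → all p (upTo (suc n)) ≡ all p (upTo n) ∧ p n
  all-suc n p = bool-ext
    (λ e → cong₂ _∧_ (all-upTo⁺ n (λ i i<n → all-upTo⁻ (suc n) e i (ℕP.<-trans i<n (ℕP.n<1+n n)))) (all-upTo⁻ (suc n) e n (ℕP.n<1+n n)))
    (λ e → let e₁ , e₂ = ∧⁻ {all p (upTo n)} e in all-upTo⁺ (suc n) (λ i i<sn → case ℕP.m≤n⇒m<n∨m≡n (ℕP.≤-pred i<sn) of λ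
      { (inj₁ i<n) → all-upTo⁻ n e₁ i i<n ; (inj₂ refl) → e₂ }))

  ‼-snoc : ∀ la k → (la ∷ʳ k) ‼ length la ≡ k
  ‼-snoc []       k = refl
  ‼-snoc (a ∷ la) k = ‼-snoc la k

  length-snoc : ∀ (la : List ℕ) k → length (la ∷ʳ k) ≡ suc (length la)
  length-snoc la k = trans (length-++ la) (ℕP.+-comm (length la) 1)

  content-extend : ∀ la k {η ρ T} → Sub η ρ → Fill (length la) ρ T →
    content (la ∷ʳ k) (extend (suc (length la)) η ρ T) ≡ content la T ∧ ((sum η ∸ sum ρ) ≡ᵇ k)
  content-extend la k {η} {ρ} {T} sub fill = trans (cong (λ n → all p (upTo n)) (length-snoc la k)) (trans (all-suc s p) (cong₂ _∧_
    (all-cong s (λ i i<s → cong₂ _≡ᵇ_ (count-extend-old (suc i) i<s sub fill) (‼-++ˡ la (k ∷ []) i<s)))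
    (cong₂ _≡ᵇ_ (count-extend-new sub fill) (‼-snoc la k))))
    where
    s = length la
    p : ℕ → Bool
    p j = count (suc j) (concat (extend (suc s) η ρ T)) ≡ᵇ ((la ∷ʳ k) ‼ j)

  -- Deleting the boxes with the largest entry from a tableau leaves a tableau whose shape differs
  -- from η by a horizontal strip of size k.
  kostka-snoc : ∀ η la k → Decr η → kostka η (la ∷ʳ k) ≡ ∑ (strips η k) (λ ρ → kostka ρ la)
  kostka-snoc η la k dη = begin
    kostka η (la ∷ʳ k)
      ≡⟨ trans (length-filterᵇ (isSSYT (la ∷ʳ k)) (fillings η (length (la ∷ʳ k)))) (cong (λ n → ∑ (fillings η n) (𝟙 ∘ isSSYT (la ∷ʳ k))) (length-snoc la k)) ⟩
    ∑ (fillings η (suc s)) (𝟙 ∘ isSSYT (la ∷ʳ k))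
      ≡⟨ ∑-cong (fillings η (suc s)) (λ T → 𝟙-∧ (all weaklyIncr T) _) ⟩
    ∑ (fillings η (suc s)) (λ T → 𝟙 (all weaklyIncr T) * 𝟙 (colsStrict T ∧ content (la ∷ʳ k) T))
      ≡⟨ ∑-fillings-suc s η _ ⟩
    ∑ (subLists η) (λ ρ → ∑ (fillings ρ s) (λ T → 𝟙 (all weaklyIncr T) * 𝟙 (colsStrict (extend (suc s) η ρ T) ∧ content (la ∷ʳ k) (extend (suc s) η ρ T))))
      ≡⟨ ∑-∈-cong (subLists η) (λ ρ ρ∈ → trans (∑-∈-cong (fillings ρ s) (λ T T∈ → per-filling ρ T (All.lookup (subLists-Sub η) ρ∈) (All.lookup (fillings-Fill ρ s) T∈)))
           (trans (∑-*ˡ (fillings ρ s) (𝟙 (stripTest η k ρ)) _) (cong (𝟙 (stripTest η k ρ) *_) (sym (length-filterᵇ (isSSYT la) (fillings ρ s)))))) ⟩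
    ∑ (subLists η) (λ ρ → 𝟙 (stripTest η k ρ) * kostka ρ la)
      ≡⟨ sym (∑-filterᵇ (stripTest η k) (subLists η) _) ⟩
    ∑ (strips η k) (λ ρ → kostka ρ la) ∎
    where
    open ≡-Reasoning
    s = length la
    per-filling : ∀ ρ T → Sub η ρ → Fill s ρ T →
      𝟙 (all weaklyIncr T) * 𝟙 (colsStrict (extend (suc s) η ρ T) ∧ content (la ∷ʳ k) (extend (suc s) η ρ T)) ≡ 𝟙 (stripTest η k ρ) * 𝟙 (isSSYT la T)
    per-filling ρ T sub fill = begin
      𝟙 W * 𝟙 (C⁺ ∧ content (la ∷ʳ k) (extend (suc s) η ρ T))
        ≡⟨ cong (λ b → 𝟙 W * 𝟙 (C⁺ ∧ b)) (trans (content-extend la k sub fill) (∧-comm (content la T) _)) ⟩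
      𝟙 W * 𝟙 (C⁺ ∧ (size ∧ content la T))
        ≡⟨ cong (λ b → 𝟙 W * 𝟙 b) (trans (sym (∧-assoc C⁺ size _)) (trans (cong (_∧ content la T) (colsStrict-extend k dη sub fill)) (∧-assoc (stripTest η k ρ) (colsStrict T) _))) ⟩
      𝟙 W * 𝟙 (stripTest η k ρ ∧ (colsStrict T ∧ content la T))
        ≡⟨ cong (𝟙 W *_) (𝟙-∧ (stripTest η k ρ) _) ⟩
      𝟙 W * (𝟙 (stripTest η k ρ) * 𝟙 (colsStrict T ∧ content la T))
        ≡⟨ regroup (𝟙 W) (𝟙 (stripTest η k ρ)) _ ⟩
      𝟙 (stripTest η k ρ) * (𝟙 W * 𝟙 (colsStrict T ∧ content la T))
        ≡⟨ cong (𝟙 (stripTest η k ρ) *_) (sym (𝟙-∧ W _)) ⟩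
      𝟙 (stripTest η k ρ) * 𝟙 (isSSYT la T) ∎
      where
      W = all weaklyIncr T
      C⁺ = colsStrict (extend (suc s) η ρ T)
      size = (sum η ∸ sum ρ) ≡ᵇ k
      regroup : ∀ a b c → a * (b * c) ≡ b * (a * c)
      regroup = solve-∀

  -- The chain may end at a list of zeros instead of the empty list, so the empty tableau has empty
  -- rows.
  blank : List ℕ → List (List ℕ)
  blank = map (λ _ → [])

  fillings-zero : ∀ η → sum η ≡ 0 → fillings η 0 ≡ [ blank η ]
  fillings-zero []         e = refl
  fillings-zero (zero ∷ η) e = cong (λ Ts → map ([] ∷_) Ts ++ []) (fillings-zero η e)

  fillings-nonzero : ∀ η → sum η ≢ 0 → fillings η 0 ≡ []
  fillings-nonzero []          ne = ⊥-elim (ne refl)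
  fillings-nonzero (zero ∷ η)  ne = cong (λ Ts → map ([] ∷_) Ts ++ []) (fillings-nonzero η ne)
  fillings-nonzero (suc r ∷ η) ne = refl

  isSSYT-blank : ∀ η → isSSYT [] (blank η) ≡ true
  isSSYT-blank η = cong₂ _∧_ (rows η) (cong₂ _∧_ (columns η) refl)
    where
    rows : ∀ η → all weaklyIncr (blank η) ≡ true
    rows []      = refl
    rows (_ ∷ η) = rows η
    columns : ∀ η → colsStrict (blank η) ≡ true
    columns []          = refl
    columns (_ ∷ [])    = refl
    columns (_ ∷ b ∷ η) = columns (b ∷ η)

  kostka-[] : ∀ η → kostka η [] ≡ chains η []
  kostka-[] η = trans (length-filterᵇ (isSSYT []) (fillings η 0)) (go (sum η ℕP.≟ 0))
    where
    go : Dec (sum η ≡ 0) → ∑ (fillings η 0) (𝟙 ∘ isSSYT []) ≡ chains η []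
    go (yes e) = trans (cong (λ Ts → ∑ Ts (𝟙 ∘ isSSYT [])) (fillings-zero η e))
      (trans (cong (λ b → 𝟙 b + 0) (isSSYT-blank η)) (cong (λ n → if n ≡ᵇ 0 then 1 else 0) (sym e)))
    go (no ne) = trans (cong (λ Ts → ∑ Ts (𝟙 ∘ isSSYT [])) (fillings-nonzero η ne))
      (cong (λ b → if b then 1 else 0) (sym (≢⇒false {sum η} {0} ne)))

  kostka≡chains : ∀ ks η → Decr η → kostka η (reverse ks) ≡ chains η ks
  kostka≡chains []       η dη = kostka-[] η
  kostka≡chains (k ∷ ks) η dη = trans (cong (kostka η) (unfold-reverse k ks)) (trans (kostka-snoc η (reverse ks) k dη)
    (∑-∈-cong (strips η k) (λ ρ ρ∈ → kostka≡chains ks ρ (Strip⇒Decr (All.lookup (strips-All η k dη) ρ∈)))))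

-- Identification of the exponents and assembly of the theorem.

open import Defs
open Counting using (∑; ∑-cong; ∑-+; ∑-map)
open LinearAlgebra using (pred-size; size≡suc; pred-size≢0)
open KernelTypes using (Fcount≡FT)
open PartitionLists
open Weights
open HorizontalStrips
open WeightedChains
open Symmetry using (FT-↭; FT≡B′)
open LeadingTerms
open Factorisation
open LeastStrips
open ReciprocalFormula
open Tableaux
open import Data.Bool.Base using (true; false)
open import Data.Nat.Base as ℕ using (ℕ; zero; suc; _∸_; _≤_; z≤n; s≤s; _≤ᵇ_)
import Data.Nat.Properties as ℕP
open import Data.Nat.ListAction using (sum)
open import Data.Nat.ListAction.Properties using (sum-↭)
import Data.Nat.Tactic.RingSolver as ℕS
open import Data.Nat.Combinatorics using (_C_; nCk+nC[k+1]≡[n+1]C[k+1]; nC1≡n)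
open import Data.List.Base using (List; []; _∷_; length; _∷ʳ_; map; upTo; applyUpTo; zipWith; reverse)
open import Data.List.Properties using (unfold-reverse; reverse-involutive)
open import Data.List.Relation.Unary.All as All using (All; []; _∷_)
open import Data.List.Relation.Unary.AllPairs using ([]; _∷_)
import Data.List.Relation.Unary.AllPairs.Properties as AllPairsP
open import Data.List.Membership.Propositional using (_∈_)
open import Data.List.Relation.Unary.Any using (here; there)
open import Data.List.Relation.Binary.Permutation.Propositional using (_↭_; prep; ↭-sym; ↭-trans; ↭-refl)
import Data.List.Relation.Binary.Permutation.Propositional as Perm
open import Data.List.Relation.Binary.Permutation.Propositional.Properties using (↭-reverse; All-resp-↭)
open import Data.Product.Base using (Σ; _×_; _,_; proj₂)
open import Data.Empty using (⊥-elim)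
open import Function.Base using (_∘_; case_of_)
open import Function.Bundles using (_⇔_; mk⇔)
open import Relation.Nullary using (yes; no)
open import Relation.Binary.PropositionalEquality
open import Data.Integer.Base as ℤ using (ℤ; +_; 0ℤ; 1ℤ; _<_; _-_; _^_; _*_)
import Data.Integer.Properties as ℤP
import Data.Rational.Base as ℚ
import Data.Rational.Properties as ℚP

insertDesc-↭ : ∀ x l → insertDesc x l ↭ x ∷ l
insertDesc-↭ x []      = ↭-refl
insertDesc-↭ x (y ∷ l) with y ≤ᵇ x
... | true  = ↭-refl
... | false = ↭-trans (prep y (insertDesc-↭ x l)) (Perm.swap y x ↭-refl)

sortDesc-↭ : ∀ l → sortDesc l ↭ l
sortDesc-↭ []      = ↭-refl
sortDesc-↭ (x ∷ l) = ↭-trans (insertDesc-↭ x (sortDesc l)) (prep x (sortDesc-↭ l))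

insertDesc-sorted : ∀ x l → Sorted l → Sorted (insertDesc x l)
insertDesc-sorted x []      s       = [] ∷ []
insertDesc-sorted x (y ∷ l) (p ∷ s) with y ≤ᵇ x in eq
... | true  = (y≤x ∷ All.map (λ le → ℕP.≤-trans le y≤x) p) ∷ p ∷ s
  where y≤x = ℕP.≤ᵇ⇒≤ y x (≡⇒T eq)
... | false = All-resp-↭ (↭-sym (insertDesc-↭ x l)) (x≤y ∷ p) ∷ insertDesc-sorted x l s
  where x≤y = ℕP.<⇒≤ (ℕP.≰⇒> (λ y≤x → case trans (sym eq) (T⇒≡ (ℕP.≤⇒≤ᵇ y≤x)) of λ ()))

sortDesc-sorted : ∀ l → Sorted (sortDesc l)
sortDesc-sorted []      = []
sortDesc-sorted (x ∷ l) = insertDesc-sorted x (sortDesc l) (sortDesc-sorted l)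

reverse-ascending : ∀ {l} → Sorted l → Ascending (reverse l)
reverse-ascending []                = []
reverse-ascending {a ∷ l} (p ∷ s) = subst Ascending (sym (unfold-reverse a l))
  (AllPairsP.++⁺ (reverse-ascending s) ([] ∷ []) (All.map (λ le → le ∷ []) (All-resp-↭ (↭-sym (↭-reverse l)) p)))

nC2≡tri : ∀ n → n C 2 ≡ tri n
nC2≡tri zero    = refl
nC2≡tri (suc n) = trans (sym (nCk+nC[k+1]≡[n+1]C[k+1] n 1)) (cong₂ ℕ._+_ (nC1≡n n) (nC2≡tri n))

zipWith-suc : ∀ f μ → sum (zipWith ℕ._*_ (applyUpTo (suc ∘ f) (length μ)) μ) ≡ sum μ ℕ.+ sum (zipWith ℕ._*_ (applyUpTo f (length μ)) μ)
zipWith-suc f []      = refl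
zipWith-suc f (a ∷ μ) = trans (cong (suc (f 0) ℕ.* a ℕ.+_) (zipWith-suc (f ∘ suc) μ)) (regroup a (f 0 ℕ.* a) (sum μ) _)
  where
  regroup : ∀ a b s t → a ℕ.+ b ℕ.+ (s ℕ.+ t) ≡ a ℕ.+ s ℕ.+ (b ℕ.+ t)
  regroup = ℕS.solve-∀

nstat-∷ : ∀ a μ → nstat (a ∷ μ) ≡ sum μ ℕ.+ nstat μ
nstat-∷ a μ = zipWith-suc (λ i → i) μ

sum-map : ∀ (f : ℕ → ℕ) xs → sum (map f xs) ≡ ∑ xs f
sum-map f []       = refl
sum-map f (x ∷ xs) = cong (f x ℕ.+_) (sum-map f xs)

sum-conjL : ∀ L μ → ∑ (upTo L) (λ c → cnt c μ) ≡ minsum L μ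
sum-conjL L μ = trans (sym (sum-map (λ c → cnt c μ) (upTo L))) (trans (sym (psum-all (conjL L μ) (ℕP.≤-reflexive (length-conjL L μ)))) (psum-conjL L μ L ℕP.≤-refl))

-- n(μ) is the sum of binom(c, 2) over the column lengths c. A longest row placed on top lengthens
-- every nonempty column by one, and binom(c + 1, 2) - binom(c, 2) = c; summed over the columns this
-- is |μ|.
nstat-conj : ∀ L μ → Sorted μ → All (_≤ L) μ → nstat μ ≡ ∑ (upTo L) (λ c → tri (cnt c μ))
nstat-conj L []      s       b       = sym (zeros (upTo L))
  where
  zeros : ∀ xs → ∑ xs (λ _ → 0) ≡ 0
  zeros []       = refl
  zeros (x ∷ xs) = zeros xs
nstat-conj L (a ∷ μ) (p ∷ s) (_ ∷ b) = begin
  nstat (a ∷ μ)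
    ≡⟨ nstat-∷ a μ ⟩
  sum μ ℕ.+ nstat μ
    ≡⟨ cong₂ ℕ._+_ (sym (trans (sum-conjL L μ) (minsum-bounded b))) (nstat-conj L μ s b) ⟩
  ∑ (upTo L) (λ c → cnt c μ) ℕ.+ ∑ (upTo L) (λ c → tri (cnt c μ))
    ≡⟨ sym (∑-+ (upTo L) _ _) ⟩
  ∑ (upTo L) (λ c → cnt c μ ℕ.+ tri (cnt c μ))
    ≡⟨ ∑-cong (upTo L) (λ c → sym (trans (cong tri (cnt-∷ c a μ)) (add c))) ⟩
  ∑ (upTo L) (λ c → tri (cnt c (a ∷ μ))) ∎
  where
  open ≡-Reasoning
  add : ∀ c → tri (gt c a ℕ.+ cnt c μ) ≡ cnt c μ ℕ.+ tri (cnt c μ)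
  add c with c ℕP.<? a
  ... | yes c<a = cong (λ g → tri (g ℕ.+ cnt c μ)) (gt-yes c<a)
  ... | no c≮a  = trans (cong₂ (λ g m → tri (g ℕ.+ m)) (gt-no (ℕP.≮⇒≥ c≮a)) none) (cong (λ m → m ℕ.+ tri m) (sym none))
    where
    none : cnt c μ ≡ 0
    none = cnt-bounded (All.map (λ le → ℕP.≤-trans le (ℕP.≮⇒≥ c≮a)) p)

-- Two boxes lie in one row or in different rows. With `nstat-conj` this identifies D η as binom(n,
-- 2) - n(μ).
tri-sum : ∀ η → tri (sum η) ≡ sum (map tri η) ℕ.+ D η
tri-sum []      = refl
tri-sum (a ∷ η) = trans (tri-+ a (sum η)) (trans (cong (λ t → tri a ℕ.+ t ℕ.+ a ℕ.* sum η) (tri-sum η)) (regroup (tri a) (sum (map tri η)) (D η) (a ℕ.* sum η)))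
  where
  regroup : ∀ t s d m → t ℕ.+ (s ℕ.+ d) ℕ.+ m ≡ t ℕ.+ s ℕ.+ (m ℕ.+ d)
  regroup = ℕS.solve-∀

sum-head-tail : ∀ η → sum η ≡ (η ‼ 0) ℕ.+ tsum η
sum-head-tail []      = refl
sum-head-tail (a ∷ η) = refl

adjProdSum-∷ : ∀ a η → adjProdSum (a ∷ η) ≡ a ℕ.* (η ‼ 0) ℕ.+ adjProdSum η
adjProdSum-∷ a []      = sym (trans (ℕP.+-identityʳ _) (ℕP.*-zeroʳ a))
adjProdSum-∷ a (b ∷ η) = refl

-- Pairs of boxes in adjacent rows give `adjProdSum`; pairs in one row or in rows further apart give
-- `E′`.
tri-E′ : ∀ η → tri (sum η) ≡ adjProdSum η ℕ.+ E′ η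
tri-E′ []      = refl
tri-E′ (a ∷ η) = begin
  tri (a ℕ.+ sum η)
    ≡⟨ tri-+ a (sum η) ⟩
  tri a ℕ.+ tri (sum η) ℕ.+ a ℕ.* sum η
    ≡⟨ cong₂ (λ t s → tri a ℕ.+ t ℕ.+ a ℕ.* s) (tri-E′ η) (sum-head-tail η) ⟩
  tri a ℕ.+ (adjProdSum η ℕ.+ E′ η) ℕ.+ a ℕ.* ((η ‼ 0) ℕ.+ tsum η)
    ≡⟨ regroup (tri a) (adjProdSum η) (E′ η) a (η ‼ 0) (tsum η) ⟩
  a ℕ.* (η ‼ 0) ℕ.+ adjProdSum η ℕ.+ (tri a ℕ.+ a ℕ.* tsum η ℕ.+ E′ η)
    ≡⟨ cong (ℕ._+ E′ (a ∷ η)) (sym (adjProdSum-∷ a η)) ⟩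
  adjProdSum (a ∷ η) ℕ.+ E′ (a ∷ η) ∎
  where
  open ≡-Reasoning
  regroup : ∀ t p e a h s → t ℕ.+ (p ℕ.+ e) ℕ.+ a ℕ.* (h ℕ.+ s) ≡ a ℕ.* h ℕ.+ p ℕ.+ (t ℕ.+ a ℕ.* s ℕ.+ e)
  regroup = ℕS.solve-∀

-- The pairs inside the first row are split off as well. As η₁ = ℓ(μ), they account for binom(ℓ(μ),
-- 2) in the exponent of (3).
tri-E : ∀ η → tri (sum η) ≡ tri (η ‼ 0) ℕ.+ (adjProdSum η ℕ.+ E η)
tri-E []      = refl
tri-E (a ∷ η) = trans (tri-E′ (a ∷ η)) (regroup (adjProdSum (a ∷ η)) (tri a) (a ℕ.* tsum η) (E′ η))
  where
  regroup : ∀ p t m e → p ℕ.+ (t ℕ.+ m ℕ.+ e) ≡ t ℕ.+ (p ℕ.+ (m ℕ.+ e))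
  regroup = ℕS.solve-∀

B≢0⇒chains≢0 : ∀ x ks η → B x η ks ≢ 0ℤ → chains η ks ≢ 0
B≢0⇒chains≢0 x ks η ne z = ne (vanish ks η z)
  where
  vanish : ∀ ks η → chains η ks ≡ 0 → B x η ks ≡ 0ℤ
  vanish []       η z with sum η ℕ.≡ᵇ 0
  ... | false = refl
  vanish (k ∷ ks) η z = trans (∑ℤ-cong (strips η k) (λ ρ ρ∈ → trans (cong (Wt x η ρ *_) (vanish ks ρ (zero-at (strips η k) ρ∈ z))) (ℤP.*-zeroʳ (Wt x η ρ)))) (∑ℤ-0 (strips η k))
    where
    zero-at : ∀ xs {ρ} → ρ ∈ xs → ∑ xs (λ ρ → chains ρ ks) ≡ 0 → chains ρ ks ≡ 0
    zero-at (ρ ∷ xs) (here refl) z = ℕP.m+n≡0⇒m≡0 _ z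
    zero-at (ρ ∷ xs) (there m)   z = zero-at xs m (ℕP.m+n≡0⇒n≡0 (chains ρ ks) z)

size-1-Pos : ∀ F → Pos (+ FiniteField.size F - 1ℤ)
size-1-Pos F = go (FiniteField.size F) (pred-size F) (size≡suc F) (pred-size≢0 F)
  where
  go : ∀ q p → q ≡ suc p → p ≢ 0 → Pos (+ q - 1ℤ)
  go _ zero    refl ne = ⊥-elim (ne refl)
  go _ (suc p) refl ne = p , refl

size-Pos : ∀ F → Pos (+ FiniteField.size F)
size-Pos F = pred-size F , cong +_ (size≡suc F)

theorem1p12 : (n : ℕ) (Λ μ : List ℕ) → IsComposition n Λ → IsPartition n μ →
    let la = sortDesc Λ
        μ′ = conj μ
        ℓ = length μ
    in ((F : FiniteField) → (Fcount F n μ Λ ≢ 0 ⇔ la ⊴ μ′))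
       × (la ⊴ μ′ →
           ((F : FiniteField) →
              (Fcount F n μ Λ ≡ Fcount F n μ la)
              × (ℕtoℚ (Fcount F n μ la)
                 ≡ (powQ (ℕtoℚ (FiniteField.size F) ℚ.- ℚ.1ℚ) (n ∸ ℓ)
                    ℚ.* powQ (ℕtoℚ (FiniteField.size F)) ((n C 2) ∸ nstat μ ∸ (n ∸ ℓ)))
                   ℚ.* bPoly μ′ la (divQ ℚ.1ℚ (ℕtoℚ (FiniteField.size F)))))
           × Σ (List ℤ) (λ cs →
               length cs ≡ (n C 2) ∸ nstat μ
               × kostka μ′ la ≢ 0
               × ((F : FiniteField) →
                    + Fcount F n μ la ≡ evalZ (cs ∷ʳ (+ kostka μ′ la)) (+ FiniteField.size F)))
           × Σ (List ℤ) (λ R →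
               evalZ R 0ℤ ≡ 1ℤ
               × 0ℤ < evalZ R 1ℤ
               × ((F : FiniteField) →
                    + Fcount F n μ la
                    ≡ ((+ FiniteField.size F - 1ℤ) ^ (n ∸ ℓ))
                      * ((+ FiniteField.size F) ^ ((n C 2) ∸ (ℓ C 2) ∸ adjProdSum μ′))
                      * evalZ R (+ FiniteField.size F))))
theorem1p12 n Λ μ (posΛ , sumΛ) part@(posμ , linked , sumμ) =
  (λ F → mk⇔ (nonzero⇒ F) (nonzero⇐ F)) ,
  (λ dom → (λ F → symmetric F , formula F) , leading dom , remainder dom)
  where
  la = sortDesc Λ
  -- The parts in the order of removal: last block first, hence increasing.
  ks = reverse la
  η = conj μ
  sorted = linked⇒sorted linked

  pos-la : All (0 ℕ.<_) la
  pos-la = All-resp-↭ (↭-sym (sortDesc-↭ Λ)) posΛ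
  sum-la : sum la ≡ n
  sum-la = trans (sum-↭ (sortDesc-↭ Λ)) sumΛ
  pos-ks : All (0 ℕ.<_) ks
  pos-ks = All-resp-↭ (↭-sym (↭-reverse la)) pos-la
  asc-ks : Ascending ks
  asc-ks = reverse-ascending (sortDesc-sorted Λ)
  sum-η : sum η ≡ n
  sum-η = trans (sym (psum-all η (ℕP.≤-reflexive (length-conj μ)))) (trans (psum-conj μ (μ ‼ 0) ℕP.≤-refl)
    (trans (minsum-bounded (sorted-bounded sorted)) sumμ))
  dη : Decr η
  dη = Desc⇒Decr (conjL-Desc (μ ‼ 0) μ)
  sη : sum η ≡ sum ks
  sη = trans sum-η (sym (trans (sum-↭ (↭-reverse la)) sum-la))

  head-η : η ‼ 0 ≡ length μ
  head-η = go μ posμ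
    where
    go : ∀ μ → All (0 ℕ.<_) μ → conj μ ‼ 0 ≡ length μ
    go []      _         = refl
    go (a ∷ μ) (p ∷ pos) = trans (‼-conjL a (a ∷ μ) 0 p) (sym (length≡cnt (p ∷ pos)))

  -- The first row of the conjugate partition is the number of parts of μ, so n - ℓ(μ) counts the
  -- boxes below it.
  tsum≡ : tsum η ≡ n ∸ length μ
  tsum≡ = sym (trans (cong₂ _∸_ (trans (sym sum-η) (sum-head-tail η)) (sym head-η)) (ℕP.m+n∸m≡n (η ‼ 0) (tsum η)))
  D≡ : D η ≡ (n C 2) ∸ nstat μ
  D≡ = sym (trans (cong₂ _∸_ (trans (nC2≡tri n) (trans (cong tri (sym sum-η)) (tri-sum η)))
         (trans (nstat-conj (μ ‼ 0) μ sorted (sorted-bounded sorted)) (trans (sym (∑-map (λ c → cnt c μ) (upTo (μ ‼ 0)) tri)) (sym (sum-map tri η)))))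
       (ℕP.m+n∸m≡n (sum (map tri η)) (D η)))
  E≡ : E η ≡ (n C 2) ∸ (length μ C 2) ∸ adjProdSum η
  E≡ = sym (trans (cong (_∸ adjProdSum η) (trans (cong₂ _∸_ (trans (nC2≡tri n) (trans (cong tri (sym sum-η)) (tri-E η)))
         (trans (nC2≡tri (length μ)) (cong tri (sym head-η)))) (ℕP.m+n∸m≡n (tri (η ‼ 0)) _))) (ℕP.m+n∸m≡n (adjProdSum η) (E η)))

  module _ (F : FiniteField) where
    x : ℤ
    x = + FiniteField.size F

    symmetric : Fcount F n μ Λ ≡ Fcount F n μ la
    symmetric = trans (Fcount≡FT F n μ Λ part) (trans (FT-↭ F n η (↭-sym (sortDesc-↭ Λ)) (posΛ , dη , trans sum-η (sym sumΛ)) sumΛ)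
      (sym (Fcount≡FT F n μ la part)))

    count≡B : + Fcount F n μ la ≡ B x η ks
    count≡B = trans (cong +_ (Fcount≡FT F n μ la part)) (FT≡B′ F n la η (pos-la , dη , trans sum-η (sym sum-la)) sum-la)

    -- A nonzero sum over chains has at least one chain, and a chain forces dominance.
    nonzero⇒ : Fcount F n μ Λ ≢ 0 → la ⊴ η
    nonzero⇒ ne = subst (_⊴ η) (reverse-involutive la) (proj₂ (chains⇒dominance ks η dη sη
      (B≢0⇒chains≢0 x ks η (λ z → ne (trans symmetric (ℤP.+-injective (trans count≡B z)))))))

    -- In `B-factor` at x = q all three factors are positive: q - 1 because a field has two
    -- elements, the cofactor because dominance provides a chain.
    nonzero⇐ : la ⊴ η → Fcount F n μ Λ ≢ 0
    nonzero⇐ dom z = case trans (sym (cong +_ (trans (sym symmetric) z))) (trans count≡B (trans (B-factor x ks η dη sη) (proj₂ positive))) of λ ()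
      where
      R>0 : Pos (Rf x η ks)
      R>0 with Rf-pos (size-Pos F) ks η
      ... | zero  , e , nz = ⊥-elim (nz (dominance⇒chains ks η pos-ks asc-ks dη sη (subst (_⊴ η) (sym (reverse-involutive la)) dom)) refl)
      ... | suc m , e , nz = m , e
      positive : Pos ((x - 1ℤ) ^ tsum η * x ^ E η * Rf x η ks)
      positive = pos-* (pos-* (pos-^ (tsum η) (size-1-Pos F)) (pos-^ (E η) (size-Pos F))) R>0

    formula : ℕtoℚ (Fcount F n μ la)
      ≡ (powQ (ℕtoℚ (FiniteField.size F) ℚ.- ℚ.1ℚ) (n ∸ length μ)
         ℚ.* powQ (ℕtoℚ (FiniteField.size F)) ((n C 2) ∸ nstat μ ∸ (n ∸ length μ)))
        ℚ.* bPoly η la (divQ ℚ.1ℚ (ℕtoℚ (FiniteField.size F)))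
    formula = trans (cong ι count≡B) (trans (Recip.bChain-ι ks η (D η ∸ tsum η) dη sη (ℕP.m∸n+n≡m (tsum≤D η dη)))
      (cong₂ (λ a b → a ℚ.* b ℚ.* bPoly η la t) (cong₂ powQ (ι-+ x (ℤ.- 1ℤ)) tsum≡) (cong (powQ (ι x)) (cong₂ _∸_ D≡ tsum≡))))
      where
      ιx≢0 : ι x ≢ ℚ.0ℚ
      ιx≢0 e = case trans (sym (proj₂ (size-Pos F))) (ι-injective {b = 0ℤ} e) of λ ()
      t : ℚ.ℚ
      t = divQ ℚ.1ℚ (ι x)
      module Recip = Reciprocal x (size-Pos F) t (trans (ℚP.*-comm (ι x) t) (divQ-* ℚ.1ℚ ιx≢0))

  module _ (dom : la ⊴ η) where
    dom-ks : reverse ks ⊴ η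
    dom-ks = subst (_⊴ η) (sym (reverse-involutive la)) dom

    chains≢0 : chains η ks ≢ 0
    chains≢0 = dominance⇒chains ks η pos-ks asc-ks dη sη dom-ks

    kostka≡ : kostka η la ≡ chains η ks
    kostka≡ = trans (cong (kostka η) (sym (reverse-involutive la))) (kostka≡chains ks η dη)

    leading : Σ (List ℤ) (λ cs → length cs ≡ (n C 2) ∸ nstat μ × kostka η la ≢ 0 ×
      ((F : FiniteField) → + Fcount F n μ la ≡ evalZ (cs ∷ʳ (+ kostka η la)) (+ FiniteField.size F)))
    leading with lead-list (lead-coeff (cong +_ (sym kostka≡)) (lead-B ks η dη sη))
    ... | cs , len , e = cs , trans len D≡ , (λ z → chains≢0 (trans (sym kostka≡) z)) , (λ F → trans (count≡B F) (e _))

    remainder : Σ (List ℤ) (λ R → evalZ R 0ℤ ≡ 1ℤ × 0ℤ < evalZ R 1ℤ ×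
      ((F : FiniteField) → + Fcount F n μ la ≡ ((+ FiniteField.size F - 1ℤ) ^ (n ∸ length μ))
        * ((+ FiniteField.size F) ^ ((n C 2) ∸ (length μ C 2) ∸ adjProdSum η)) * evalZ R (+ FiniteField.size F)))
    remainder with poly-list (poly-Rf ks η dη)
    ... | R , e = R , trans (e 0ℤ) (Rf-0 ks η pos-ks asc-ks dη sη dom-ks) , subst (0ℤ <_) (sym (e 1ℤ)) R1>0 ,
      (λ F → trans (count≡B F) (trans (B-factor _ ks η dη sη) (cong₂ _*_
        (cong₂ (λ a b → (+ FiniteField.size F - 1ℤ) ^ a * (+ FiniteField.size F) ^ b) tsum≡ E≡) (sym (e _)))))
      where
      R1>0 : 0ℤ < Rf 1ℤ η ks
      R1>0 with Rf-pos {1ℤ} (0 , refl) ks η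
      ... | zero  , e , nz = ⊥-elim (nz chains≢0 refl)
      ... | suc m , e , nz = subst (0ℤ <_) (sym e) (ℤ.+<+ (s≤s z≤n))
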